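{- Let $s\in\mathbb{C}_2$ with $|s|<4$ and $2s\notin\mathbb{Z}_2^\times$. Put $\kappa=\langle\cdot\rangle^{ -12s}$, $\nu=\nu(2s)$ and $r=\frac{3+\nu}{12}$. Let $G=q+\cdots\in\mathbb{C}_2[[q]]$ (zero constant term and $q$-coefficient $1$) be an overconvergent form of weight $\kappa$, i.e. $G\in M_\kappa[\rho]$ for some sufficiently small rational $\rho>0$. If $UG=0$, then $F:=h^sG\in M_0[\rho]$ does not extend to an element of $M_0[r]$; equivalently, $G\notin M_\kappa[r]$.
   Context: $\mathbb{C}_2$ is the completion of an algebraic closure of $\mathbb{Q}_2$, with $|2|=1/2$ and valuation $v$ with $v(2)=1$, $v(0)=+\infty$. For $x\in\mathbb{C}_2$ let $\beta(x)=\sup\{v(x-n):n\in\mathbb{Z}_2\}$ (with $\beta=+\infty$ if $x\in\mathbb{Z}_2$), and define $\nu(x)$ by: $\nu=\beta$ if $\beta\le0$; $\nu=\sum_{k=1}^n 2^{ -k}+(\beta-n)/2^{n+1}$ if $n\le\beta\le n+1$ for an integer $n\ge0$ (so $\nu=\beta/2$ for $0\le\beta\le1$); $\nu=1$ if $\beta=+\infty$. For $t\in\mathbb{C}_2$, $|t|<2$, $\langle\cdot\rangle^t:\mathbb{Z}_2^\times\to\mathbb{C}_2^\times$ is the continuous character with $-1\mapsto1$ and $5\mapsto\exp(t\log 5)$. For $r\in\mathbb{Q}$, $0<r<2/3$, $X[r]$ is the closed subdisc $|j|\ge2^{ -12r}$ of the $j$-line over $\mathbb{C}_2$, and $M_0[r]$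 is the space of rigid functions on $X[r]$, identified with their $q$-expansions at the cusp $\infty$. For $r'<r$, restriction gives $M_0[r]\subset M_0[r']$. Let $h=\prod_{n\ge1}\left(\frac{1-q^n}{1+q^n}\right)^{24}$ and $h^{1/8}=\prod_{n\ge1}\left(\frac{1-q^n}{1+q^n}\right)^3=1+2qg$ with $g\in\mathbb{Z}[[q]]$. For $|s|<8$, $h^s:=(1+2qg)^{8s}$ by the binomial expansion, a power series in $q$ over $\mathbb{C}_2$. Let $\mu(s)=\min\{v(s),0\}$. Let $\mathcal{X}$ be the set of pairs $(\kappa,r)$ with $r\in\mathbb{Q}$ and $\kappa=\langle\cdot\rangle^{ -12s}$ for some $s\in\mathbb{C}_2$ with $|s|<8$ and $0<r<1/2+\mu(s)/6$. For $(\kappa,r)\in\mathcal{X}$, $M_\kappa[r]$ is the space of $F\in\mathbb{C}_2[[q]]$ such that $Fh^s$ is the $q$-expansion of an element of $M_0[r]$. Under the hypotheses of the statement, $(\kappa,\frac{3+\nu}{12})\in\mathcal{X}$. $U(\sum a_nq^n)=\sum a_{2n}q^n$. -}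

module Defs where

open import Algebra.Bundles using (CommutativeRing; Semiring)
import Algebra.Definitions.RawSemiring as RawSemiringDefs
open import Data.Bool.Base using (if_then_else_)
open import Data.Fin.Base using (toℕ)
open import Data.Integer.Base using (ℤ; -[1+_]; ∣_∣) renaming (+_ to pos)
open import Data.List.Base using (filter; map; upTo)
import Data.Nat.ListAction as List
open import Data.Nat.Base as ℕ using (ℕ; zero; suc; _∸_; _!; _≡ᵇ_)
open import Data.Nat.Divisibility using (_∣?_)
open import Data.Product.Base using (∃; ∃-syntax; Σ-syntax; _×_; _,_; proj₁)
open import Data.Rational.Base as ℚ using (ℚ; 0ℚ; 1ℚ; ½; floor; _⊓_; _≤ᵇ_)
open import Data.Vec.Functional using (Vector)
open import Level using (_⊔_) renaming (suc to lsuc)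
open import Relation.Binary.PropositionalEquality.Core using (_≡_)
import Relation.Binary.Construct.Add.Supremum.NonStrict as NonStrict
import Relation.Binary.Construct.Add.Supremum.Strict as Strict
open import Relation.Nullary.Construct.Add.Supremum using (_⁺; ⊤⁺; [_])
open import Relation.Nullary.Negation.Core using (¬_)

open NonStrict ℚ._≤_ public using (_≤⁺_)
open Strict ℚ._<_ public using (_<⁺_)

ℚ∞ : Set
ℚ∞ = ℚ ⁺

infixl 6 _+⁺_

_+⁺_ : ℚ∞ → ℚ∞ → ℚ∞
[ a ] +⁺ [ b ] = [ a ℚ.+ b ]
[ _ ] +⁺ ⊤⁺    = ⊤⁺
⊤⁺    +⁺ _     = ⊤⁺

fromInt : ℤ → ℚ
fromInt n = n ℚ./ 1

fromNat : ℕ → ℚ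
fromNat n = fromInt (pos n)

½^ : ℕ → ℚ
½^ zero    = 1ℚ
½^ (suc n) = ½ ℚ.* ½^ n

Σ½^ : ℕ → ℚ
Σ½^ zero    = 0ℚ
Σ½^ (suc n) = Σ½^ n ℚ.+ ½^ (suc n)

-- ν as a function of β.  The pieces on [n , n+1] agree at the integers, so taking n = ⌊β⌋
-- loses nothing.
ν : ℚ∞ → ℚ
ν ⊤⁺    = 1ℚ
ν [ β ] = if β ≤ᵇ 0ℚ then β else Σ½^ n ℚ.+ (β ℚ.- fromNat n) ℚ.* ½^ (suc n)
  where n = ∣ floor β ∣

μ : ℚ∞ → ℚ
μ ⊤⁺    = 0ℚ
μ [ a ] = a ⊓ 0ℚ

module PowerSeries {c ℓ} (R : CommutativeRing c ℓ) where

  open CommutativeRing R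
  open RawSemiringDefs (Semiring.rawSemiring semiring) public
    using (_^_; sum) renaming (_×_ to infixr 8 _·_)

  Series : Set c
  Series = ℕ → Carrier

  infix  4 _≋_
  infixl 6 _-ˢ_ _+ˢ_
  infixl 7 _*ˢ_
  infixr 8 _^ˢ_

  _≋_ : Series → Series → Set ℓ
  f ≋ g = ∀ n → f n ≈ g n

  monomial : ℕ → Series
  monomial k n = if k ≡ᵇ n then 1# else 0#

  0ˢ 1ˢ : Series
  0ˢ _ = 0#
  1ˢ   = monomial 0

  _+ˢ_ _-ˢ_ _*ˢ_ : Series → Series → Series
  (f +ˢ g) n = f n + g n
  (f -ˢ g) n = f n - g n
  (f *ˢ g) n = sum {suc n} λ i → f (toℕ i) * g (n ∸ toℕ i)

  _^ˢ_ : Series → ℕ → Series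
  f ^ˢ zero  = 1ˢ
  f ^ˢ suc k = f *ˢ f ^ˢ k

  -- Σ_k a_k u^k, for u with zero constant term: u^k is then divisible by
  -- q^k, so the terms with k > n do not contribute to the coefficient of q^n.
  substitute : (ℕ → Carrier) → Series → Series
  substitute a u n = sum {suc n} λ k → a (toℕ k) * (u ^ˢ toℕ k) n

  -- 1/f = Σ_k (1 - f)^k, for f with constant term 1
  inverseˢ : Series → Series
  inverseˢ f = substitute (λ _ → 1#) (1ˢ -ˢ f)

  ∏< : ℕ → (ℕ → Series) → Series
  ∏< zero    f = 1ˢ
  ∏< (suc n) f = ∏< n f *ˢ f n

  -- ∏_{n ≥ 1} f_n, for f_n ≡ 1 mod q^n: the coefficient of q^n is that of
  -- f_1 ⋯ f_n.
  ∏₁ : (ℕ → Series) → Series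
  ∏₁ f n = ∏< n (λ k → f (suc k)) n

  σ₃ : ℕ → ℕ
  σ₃ n = List.sum (map (ℕ._^ 3) (filter (_∣? n) (map suc (upTo n))))

  E₄ : Series
  E₄ zero      = 1#
  E₄ n@(suc _) = (240 ℕ.* σ₃ n) · 1#

  Δ : Series
  Δ = monomial 1 *ˢ ∏₁ λ n → (1ˢ -ˢ monomial n) ^ˢ 24

  -- q-expansion of 1/j = Δ/E₄³ = q - 744q² + ⋯
  j⁻¹ : Series
  j⁻¹ = Δ *ˢ inverseˢ (E₄ ^ˢ 3)

  h^⅛ : Series
  h^⅛ = ∏₁ λ n → ((1ˢ -ˢ monomial n) *ˢ inverseˢ (1ˢ +ˢ monomial n)) ^ˢ 3

  U : Series → Series
  U f n = f (2 ℕ.* n)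

-- The absolute value is |x| = 2^{-v(x)}.  The value of _⁻¹ at 0 is immaterial.
record ValuedField c ℓ : Set (lsuc (c ⊔ ℓ)) where
  field
    commutativeRing : CommutativeRing c ℓ

  open CommutativeRing commutativeRing public
  open PowerSeries commutativeRing public

  field
    _⁻¹    : Carrier → Carrier
    ⁻¹-inv : ∀ x → ¬ x ≈ 0# → x * x ⁻¹ ≈ 1#
    v      : Carrier → ℚ∞
    v-cong : ∀ {x y} → x ≈ y → v x ≡ v y
    v-0    : v 0# ≡ ⊤⁺
    v-∞    : ∀ x → v x ≡ ⊤⁺ → x ≈ 0#
    v-*    : ∀ x y → v (x * y) ≡ v x +⁺ v y
    v-+    : ∀ {a} x y → a ≤⁺ v x → a ≤⁺ v y → a ≤⁺ v (x + y)
    v-2    : v (2 · 1#) ≡ [ 1ℚ ]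

  fromℤ : ℤ → Carrier
  fromℤ (pos n)  = n · 1#
  fromℤ -[1+ n ] = - (suc n · 1#)

  infix 4 _⟶_

  _⟶_ : (ℕ → Carrier) → Carrier → Set
  f ⟶ x = ∀ (N : ℚ) → ∃[ m ] ∀ n → m ℕ.≤ n → [ N ] ≤⁺ v (f n - x)

  Cauchy : (ℕ → Carrier) → Set
  Cauchy f = ∀ (N : ℚ) → ∃[ m ] ∀ k n → m ℕ.≤ k → m ℕ.≤ n → [ N ] ≤⁺ v (f k - f n)

  HasSum : (ℕ → Carrier) → Carrier → Set
  HasSum f x = (λ n → sum {n} λ i → f (toℕ i)) ⟶ x

  -- ℤ₂ is the closure of ℤ and ℚ₂ = ℤ₂[1/2]; these are the usual rings when
  -- the field is complete.
  ∈ℤ₂ : Carrier → Set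
  ∈ℤ₂ x = ∀ (N : ℚ) → ∃[ n ] [ N ] ≤⁺ v (x - fromℤ n)

  ∈ℚ₂ : Carrier → Set
  ∈ℚ₂ x = ∃[ k ] ∈ℤ₂ ((2 · 1#) ^ k * x)

  ∈ℤ₂ˣ : Carrier → Set (c ⊔ ℓ)
  ∈ℤ₂ˣ x = ∈ℤ₂ x × ∃[ y ] (∈ℤ₂ y × x * y ≈ 1#)

  -- x^n + c_{n-1} x^{n-1} + ⋯ + c_0
  monic : ∀ {n} → Vector Carrier n → Carrier → Carrier
  monic {n} cs x = x ^ n + sum λ i → cs i * x ^ toℕ i

  AlgebraicOverℚ₂ : Carrier → Set (c ⊔ ℓ)
  AlgebraicOverℚ₂ x =
    ∃[ n ] Σ[ cs ∈ Vector Carrier n ] ((∀ i → ∈ℚ₂ (cs i)) × monic cs x ≈ 0#)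

-- The completion of an algebraic closure of ℚ₂, up to isomorphism: the field
-- is complete and algebraically closed, and the elements algebraic over ℚ₂
-- (which form an algebraic closure of ℚ₂) are dense.  Its value group is ℚ,
-- so v needs no real values.
record ℂ₂ c ℓ : Set (lsuc (c ⊔ ℓ)) where
  field
    valuedField : ValuedField c ℓ

  open ValuedField valuedField public

  field
    complete            : ∀ f → Cauchy f → ∃[ x ] f ⟶ x
    algebraicallyClosed : ∀ n (cs : Vector Carrier (suc n)) → ∃[ x ] monic cs x ≈ 0#
    algebraicDense      : ∀ x (N : ℚ) → ∃[ y ] (AlgebraicOverℚ₂ y × [ N ] ≤⁺ v (x - y))

module OverconvergentForms {c ℓ} (C : ℂ₂ c ℓ) where

  open ℂ₂ C public

  -- b = sup {v(x - n) : n ∈ ℤ₂}.  ℤ₂ is compact, so the supremum is attained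
  -- and hence lies in ℚ ∪ {+∞}; it is +∞ exactly when x ∈ ℤ₂.
  Isβ : Carrier → ℚ∞ → Set c
  Isβ x b = (∀ n → ∈ℤ₂ n → v (x - n) ≤⁺ b)
          × (∀ u → (∀ n → ∈ℤ₂ n → v (x - n) ≤⁺ u) → b ≤⁺ u)

  ℤ₂ˣ : Set (c ⊔ ℓ)
  ℤ₂ˣ = ∃ ∈ℤ₂ˣ

  record Character : Set (c ⊔ ℓ) where
    field
      ⟦_⟧        : ℤ₂ˣ → Carrier
      nonzero    : ∀ x → ¬ ⟦ x ⟧ ≈ 0#
      homo       : ∀ x y z → proj₁ z ≈ proj₁ x * proj₁ y → ⟦ z ⟧ ≈ ⟦ x ⟧ * ⟦ y ⟧
      continuous : ∀ x (N : ℚ) → Σ[ M ∈ ℚ ] ∀ y →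
                   [ M ] ≤⁺ v (proj₁ x - proj₁ y) → [ N ] ≤⁺ v (⟦ x ⟧ - ⟦ y ⟧)

  -- y = exp x
  IsExp : Carrier → Carrier → Set
  IsExp x y = HasSum (λ n → x ^ n * ((n !) · 1#) ⁻¹) y

  -- y = log (1 + x)
  IsLog1+ : Carrier → Carrier → Set
  IsLog1+ x y = HasSum (λ n → (- 1#) ^ n * x ^ suc n * (suc n · 1#) ⁻¹) y

  -- κ = ⟨·⟩^t: -1 and 5 generate ℤ₂ˣ topologically, so these two values
  -- determine the continuous character.
  infix 4 _≐⟨·⟩^_

  _≐⟨·⟩^_ : Character → Carrier → Set (c ⊔ ℓ)
  κ ≐⟨·⟩^ t =
      (∀ x → proj₁ x ≈ - 1# → ⟦ x ⟧ ≈ 1#)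
    × (∃[ log5 ] (IsLog1+ (4 · 1#) log5
                × (∀ x → proj₁ x ≈ 5 · 1# → IsExp (t * log5) ⟦ x ⟧)))
    where open Character κ

  falling : Carrier → ℕ → Carrier
  falling a zero    = 1#
  falling a (suc k) = falling a k * (a - k · 1#)

  binomial : Carrier → ℕ → Carrier
  binomial a k = falling a k * ((k !) · 1#) ⁻¹

  -- h^s = (1 + 2qg)^{8s}
  h^ : Carrier → Series
  h^ s = substitute (binomial (8 · s)) (h^⅛ -ˢ 1ˢ)

  -- X[r] is the closed disc |1/j| ≤ 2^{12r}, so a rigid function on it is a
  -- series Σ a_n j^{-n} with |a_n| 2^{12rn} → 0.
  Rigid : ℚ → (ℕ → Carrier) → Set
  Rigid r a = ∀ (N : ℚ) → ∃[ m ] ∀ n → m ℕ.≤ n →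
              [ N ℚ.+ fromNat 12 ℚ.* r ℚ.* fromNat n ] ≤⁺ v (a n)

  M₀ : ℚ → Series → Set (c ⊔ ℓ)
  M₀ r F = ∃[ a ] (Rigid r a × F ≋ substitute a j⁻¹)

  -- κ = ⟨·⟩^{-12s} with |s| < 8.  Such an s is determined by κ, because
  -- |-12s log 5| < 1/2 and exp is injective on the disc |x| < 1/2.
  WeightParameter : Character → Carrier → Set (c ⊔ ℓ)
  WeightParameter κ s = [ fromInt -[1+ 2 ] ] <⁺ v s × κ ≐⟨·⟩^ (- (12 · s))

  𝒳 : Character → ℚ → Set (c ⊔ ℓ)
  𝒳 κ r = ∃[ s ] (WeightParameter κ s × 0ℚ ℚ.< r
                × r ℚ.< ½ ℚ.+ μ (v s) ℚ.* (pos 1 ℚ./ 6))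

  -- Meant for (κ , r) in 𝒳; the bounds on r are kept separate, so that
  -- F ∉ M κ r never holds merely because (κ , r) ∉ 𝒳.
  M : Character → ℚ → Series → Set (c ⊔ ℓ)
  M κ r F = ∃[ s ] (WeightParameter κ s × M₀ r (F *ˢ h^ s))

{-# OPTIONS --safe #-}
module Submission where

-- Let u = θ₃⁴/θ₄⁴ and w = u² - u.  Liouville's identities for Lambert series
-- give 16/j = w/(1+16w)³ and h(-q)^s = h(q)^s u^{6s}, and q ↦ -q sends u to
-- 1/u.  If UG = 0 then G is odd, so F = h^s G satisfies F(-q) = - u^{6s} F(q).
-- For F = Σ a_k j^{-k}, φ_k = a_k/16^k, t(w) = w/(1+16w)³ and u = 1 + X this is
--   φ(t(X + X²)) (1 + X)^{6s} = - φ(t((1 + X)^{-2} - (1 + X)^{-1})),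
-- and F extends to X[r] only if v(φ_k) + (1 - ν)k → ∞.
--
-- If β is finite, then 6s = m + ε with m ∈ ℕ and v(ε - i) = min(v(i), β) for all
-- i ∈ ℕ.  The weights v(binomial ε k) + (1 - ν)k are then nonnegative, equal to
-- 1 for large k = 2^a, and greater than 1 for all other large k.  If φ(t(X + X²))
-- (1 + X)^m has its minimal weight at index N, the left-hand side has at 2^a + N
-- a unique dominant term, which does not tend to ∞ with a.
--
-- If β = ∞, then 6s ∈ 2ℤ₂ and ν = 1, and φ may be scaled to be integral with
-- a unit coefficient.  Modulo v > 1, φ(t(u² - u)) is a polynomial e(u) with
-- e(1 - u) = e(u).  Integrating the indicator functions of balls in ℤ₂ against
-- both sides gives e(u) ≡ - u^c e(1/u) with c even.  These two symmetries
-- generate S₃ and force 2 e(u) ≡ 0, which fails where e(u), u and 1 - u are units.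
--
-- As exp is an isometry on v > 1 and v(log 5) = 2, κ determines s, so that
-- membership of G in M_κ[r] is that of F in M₀[r].

open import Defs
open import Algebra.Bundles using (CommutativeRing)
import Algebra.Properties.CommutativeMonoid.Mult as CMMult
import Algebra.Properties.Ring as RingProperties
import Algebra.Properties.Semiring.Exp as SemiringExp
import Algebra.Properties.Semiring.Mult as SemiringMult
import Algebra.Solver.Ring as Solver
open import Algebra.Solver.Ring.AlmostCommutativeRing using (fromCommutativeRing; _-Raw-AlmostCommutative⟶_)
open import Algebra.Structures using (IsCommutativeRing)
open import Data.Bool.Base as Bool using (if_then_else_; true; false)
open import Data.Empty using (⊥; ⊥-elim)
open import Data.Fin.Base as Fin using (Fin; toℕ)
import Data.Fin.Properties as Fin
open import Data.Integer.Base as ℤ using (ℤ; -[1+_]) renaming (+_ to pos)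
import Data.Integer.DivMod as ℤ
import Data.Integer.Properties as ℤ
open import Data.List.Base using (filter; map; applyUpTo)
open import Data.List.Properties using (filter-accept; filter-reject)
open import Data.Maybe.Base using (Maybe; just; nothing)
open import Data.Nat.Base as ℕ using (ℕ; zero; suc; _∸_; z≤n; s≤s; _!)
import Data.Nat.DivMod as ℕ
open import Data.Nat.Divisibility using (_∣_; _∣?_; ∣m∣n⇒∣m+n; ∣m+n∣m⇒∣n; ∣-refl; ∣⇒≤)
open import Data.Nat.Induction using (<-rec)
import Data.Nat.ListAction as List
import Data.Nat.Properties as ℕ
open import Data.Product.Base using (∃; ∃-syntax; _,_; _×_; proj₁; proj₂)
open import Data.Rational.Base as ℚ using (ℚ; 0ℚ; 1ℚ; ½; floor; _⊓_)
import Data.Rational.Properties as ℚ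
import Data.Rational.Unnormalised.Base as ℚᵘ
import Data.Rational.Unnormalised.Properties as ℚᵘ
open import Data.Sum.Base as Sum using (_⊎_; inj₁; inj₂)
open import Data.Unit.Base using (⊤; tt)
open import Data.Vec.Base as Vec using (Vec; lookup)
open import Data.Vec.N-ary using (N-ary; _$ⁿ_; Eq; Eqʰ; Eqʰ-to-Eq; curryⁿ; curryⁿ-cong; curryⁿ-cong⁻¹)
open import Function.Base using (_∘_; id)
open import Level using (0ℓ; _⊔_)
open import Relation.Binary.Definitions using (tri<; tri≈; tri>)
import Relation.Binary.Construct.Add.Supremum.NonStrict as NonStrict
import Relation.Binary.Construct.Add.Supremum.Strict as Strict
open import Relation.Binary.PropositionalEquality as ≡ using (_≡_)
open import Relation.Nullary.Construct.Add.Supremum using (⊤⁺; [_])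
open import Relation.Nullary.Decidable using (Dec; does; yes; no; dec-true; dec-false)
open import Relation.Nullary.Negation using (¬_; contradiction)

infix  9 :-_
infixr 9 _:×_ _:^_
infixl 8 _:*_
infixl 7 _:+_ _:-_
infix  4 _:=_

-- Used instead of the polynomials of Algebra.Solver.Ring because constructors
-- carry no module parameters, which keeps the many solver terms small.
data Expr (n : ℕ) : Set where
  con       : ℤ → Expr n
  var       : Fin n → Expr n
  _:+_ _:*_ : Expr n → Expr n → Expr n
  :-_       : Expr n → Expr n
  _:^_      : Expr n → ℕ → Expr n
  _:×_      : ℕ → Expr n → Expr n

pattern _:-_ p q = p :+ (:- q)
pattern _:=_ p q = p , q
pattern :1       = con (pos 1)
pattern # n      = con (pos n)

close : ∀ {a} {A : Set a} n → N-ary n (Expr n) A → A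
close n f = f $ⁿ Vec.map var (Vec.allFin n)

module IntegerSolver {c ℓ} (R : CommutativeRing c ℓ) where
  open CommutativeRing R
  open RingProperties ring
    using (-‿distribˡ-*; -‿distribʳ-*; -‿+-comm; -‿involutive; -0#≈0#)
  open SemiringExp semiring using (_^_; ^-congˡ)
  open SemiringMult semiring renaming (_×_ to infixr 8 _·_)
  open import Relation.Binary.Reasoning.Setoid setoid

  ⟦_⟧ℤ : ℤ → Carrier
  ⟦ pos n ⟧ℤ    = n · 1#
  ⟦ -[1+ n ] ⟧ℤ = - (suc n · 1#)

  private
    0≈x-x : ∀ x → 0# ≈ x - x
    0≈x-x x = sym (-‿inverseʳ x)

    cancel-suc : ∀ a x y → x - y ≈ (a + x) - (a + y)
    cancel-suc a x y = begin
      x - y                  ≈⟨ +-congˡ (+-identityˡ _) ⟨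
      x + (0# - y)           ≈⟨ +-congˡ (+-congʳ (-‿inverseʳ a)) ⟨
      x + (a - a - y)        ≈⟨ +-congˡ (+-assoc _ _ _) ⟩
      x + (a + (- a - y))    ≈⟨ +-assoc _ _ _ ⟨
      x + a + (- a - y)      ≈⟨ +-cong (+-comm _ _) (-‿+-comm _ _) ⟩
      (a + x) - (a + y)      ∎

    ⊖-homo : ∀ m n → ⟦ m ℤ.⊖ n ⟧ℤ ≈ m · 1# - n · 1#
    ⊖-homo zero zero = 0≈x-x 0#
    ⊖-homo zero (suc n) = sym (+-identityˡ _)
    ⊖-homo (suc m) zero = sym (trans (+-congˡ -0#≈0#) (+-identityʳ _))
    ⊖-homo (suc m) (suc n) = begin
      ⟦ suc m ℤ.⊖ suc n ⟧ℤ         ≈⟨ reflexive (≡.cong ⟦_⟧ℤ (ℤ.[1+m]⊖[1+n]≡m⊖n m n)) ⟩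
      ⟦ m ℤ.⊖ n ⟧ℤ                 ≈⟨ ⊖-homo m n ⟩
      m · 1# - n · 1#              ≈⟨ cancel-suc 1# _ _ ⟩
      suc m · 1# - suc n · 1#      ∎

    +-homo : ∀ a b → ⟦ a ℤ.+ b ⟧ℤ ≈ ⟦ a ⟧ℤ + ⟦ b ⟧ℤ
    +-homo (pos m) (pos n) = ×-homo-+ 1# m n
    +-homo (pos m) -[1+ n ] = ⊖-homo m (suc n)
    +-homo -[1+ m ] (pos n) = trans (⊖-homo n (suc m)) (+-comm _ _)
    +-homo -[1+ m ] -[1+ n ] = begin
      - (suc (suc (m ℕ.+ n)) · 1#)        ≈⟨ -‿cong (reflexive (≡.cong (_· 1#) (ℕ.+-suc (suc m) n))) ⟨
      - ((suc m ℕ.+ suc n) · 1#)          ≈⟨ -‿cong (×-homo-+ 1# (suc m) (suc n)) ⟩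
      - (suc m · 1# + suc n · 1#)         ≈⟨ -‿+-comm _ _ ⟨
      - (suc m · 1#) - suc n · 1#         ∎

    -‿homo : ∀ a → ⟦ ℤ.- a ⟧ℤ ≈ - ⟦ a ⟧ℤ
    -‿homo (pos zero)    = sym -0#≈0#
    -‿homo (pos (suc n)) = refl
    -‿homo -[1+ n ]      = sym (-‿involutive _)

    *-homo : ∀ a b → ⟦ a ℤ.* b ⟧ℤ ≈ ⟦ a ⟧ℤ * ⟦ b ⟧ℤ
    *-homo (pos m) (pos n) = begin
      ⟦ pos m ℤ.* pos n ⟧ℤ     ≈⟨ reflexive (≡.cong ⟦_⟧ℤ (≡.sym (ℤ.pos-* m n))) ⟩
      (m ℕ.* n) · 1#           ≈⟨ ×1-homo-* m n ⟩
      m · 1# * n · 1#          ∎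
    *-homo (pos m) -[1+ n ] = begin
      ⟦ pos m ℤ.* -[1+ n ] ⟧ℤ        ≈⟨ reflexive (≡.cong ⟦_⟧ℤ (≡.sym (ℤ.neg-distribʳ-* (pos m) (pos (suc n))))) ⟩
      ⟦ ℤ.- (pos m ℤ.* pos (suc n)) ⟧ℤ ≈⟨ -‿homo (pos m ℤ.* pos (suc n)) ⟩
      - ⟦ pos m ℤ.* pos (suc n) ⟧ℤ   ≈⟨ -‿cong (*-homo (pos m) (pos (suc n))) ⟩
      - (m · 1# * suc n · 1#)        ≈⟨ -‿distribʳ-* _ _ ⟩
      m · 1# * - (suc n · 1#)        ∎
    *-homo -[1+ m ] (pos n) = begin
      ⟦ -[1+ m ] ℤ.* pos n ⟧ℤ        ≈⟨ reflexive (≡.cong ⟦_⟧ℤ (≡.sym (ℤ.neg-distribˡ-* (pos (suc m)) (pos n)))) ⟩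
      ⟦ ℤ.- (pos (suc m) ℤ.* pos n) ⟧ℤ ≈⟨ -‿homo (pos (suc m) ℤ.* pos n) ⟩
      - ⟦ pos (suc m) ℤ.* pos n ⟧ℤ   ≈⟨ -‿cong (*-homo (pos (suc m)) (pos n)) ⟩
      - (suc m · 1# * n · 1#)        ≈⟨ -‿distribˡ-* _ _ ⟩
      - (suc m · 1#) * n · 1#        ∎
    *-homo -[1+ m ] -[1+ n ] = begin
      (suc m ℕ.* suc n) · 1#                  ≈⟨ ×1-homo-* (suc m) (suc n) ⟩
      suc m · 1# * suc n · 1#                 ≈⟨ -‿involutive _ ⟨
      - - (suc m · 1# * suc n · 1#)           ≈⟨ -‿cong (-‿distribʳ-* _ _) ⟩
      - (suc m · 1# * - (suc n · 1#))         ≈⟨ -‿distribˡ-* _ _ ⟩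
      - (suc m · 1#) * - (suc n · 1#)         ∎

    -- Interpreting the coefficient 1 as 1# itself, not as 1# + 0#, lets the
    -- solver see through occurrences of 1#.
    ⟦_⟧ : ℤ → Carrier
    ⟦ pos 1 ⟧ = 1#
    ⟦ a ⟧     = ⟦ a ⟧ℤ

    ⟦⟧≈⟦⟧ℤ : ∀ a → ⟦ a ⟧ ≈ ⟦ a ⟧ℤ
    ⟦⟧≈⟦⟧ℤ (pos 0)             = refl
    ⟦⟧≈⟦⟧ℤ (pos 1)             = sym (+-identityʳ 1#)
    ⟦⟧≈⟦⟧ℤ (pos (suc (suc _))) = refl
    ⟦⟧≈⟦⟧ℤ -[1+ _ ]            = refl

    morphism : ℤ.+-*-rawRing -Raw-AlmostCommutative⟶ fromCommutativeRing R
    morphism = record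
      { ⟦_⟧    = ⟦_⟧
      ; +-homo = λ a b → trans (⟦⟧≈⟦⟧ℤ (a ℤ.+ b))
                   (trans (+-homo a b) (sym (+-cong (⟦⟧≈⟦⟧ℤ a) (⟦⟧≈⟦⟧ℤ b))))
      ; *-homo = λ a b → trans (⟦⟧≈⟦⟧ℤ (a ℤ.* b))
                   (trans (*-homo a b) (sym (*-cong (⟦⟧≈⟦⟧ℤ a) (⟦⟧≈⟦⟧ℤ b))))
      ; -‿homo = λ a → trans (⟦⟧≈⟦⟧ℤ (ℤ.- a))
                   (trans (-‿homo a) (-‿cong (sym (⟦⟧≈⟦⟧ℤ a))))
      ; 0-homo = refl
      ; 1-homo = refl }

    _coeff≟_ : ∀ a b → Maybe (⟦ a ⟧ ≈ ⟦ b ⟧)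
    a coeff≟ b with a ℤ.≟ b
    ... | yes eq = just (reflexive (≡.cong ⟦_⟧ eq))
    ... | no  _  = nothing

  module Polynomials = Solver ℤ.+-*-rawRing (fromCommutativeRing R) morphism _coeff≟_

  constant : ℤ → Carrier
  constant = ⟦_⟧

  ⟦_⟧ₑ : ∀ {n} → Expr n → Vec Carrier n → Carrier
  ⟦ con c  ⟧ₑ ρ = constant c
  ⟦ var x  ⟧ₑ ρ = lookup ρ x
  ⟦ p :+ q ⟧ₑ ρ = ⟦ p ⟧ₑ ρ + ⟦ q ⟧ₑ ρ
  ⟦ p :* q ⟧ₑ ρ = ⟦ p ⟧ₑ ρ * ⟦ q ⟧ₑ ρ
  ⟦ :- p   ⟧ₑ ρ = - ⟦ p ⟧ₑ ρ
  ⟦ p :^ n ⟧ₑ ρ = ⟦ p ⟧ₑ ρ ^ n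
  ⟦ n :× p ⟧ₑ ρ = n · ⟦ p ⟧ₑ ρ

  polynomial : ∀ {n} → Expr n → Polynomials.Polynomial n
  polynomial (con c)  = Polynomials.con c
  polynomial (var x)  = Polynomials.var x
  polynomial (p :+ q) = polynomial p Polynomials.:+ polynomial q
  polynomial (p :* q) = polynomial p Polynomials.:* polynomial q
  polynomial (:- p)   = Polynomials.:- polynomial p
  polynomial (p :^ n) = polynomial p Polynomials.:^ n
  polynomial (n :× p) = Polynomials.con (pos n) Polynomials.:* polynomial p

  ⟦_⟧↓ : ∀ {n} → Expr n → Vec Carrier n → Carrier
  ⟦ p ⟧↓ = Polynomials.⟦ polynomial p ⟧↓

  correct : ∀ {n} (p : Expr n) ρ → ⟦ p ⟧↓ ρ ≈ ⟦ p ⟧ₑ ρ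
  correct p ρ = trans (Polynomials.correct (polynomial p) ρ) (agree p)
    where
    agree : ∀ p → Polynomials.⟦ polynomial p ⟧ ρ ≈ ⟦ p ⟧ₑ ρ
    agree (con c)  = refl
    agree (var x)  = refl
    agree (p :+ q) = +-cong (agree p) (agree q)
    agree (p :* q) = *-cong (agree p) (agree q)
    agree (:- p)   = -‿cong (agree p)
    agree (p :^ n) = ^-congˡ n (agree p)
    agree (n :× p) = begin
      constant (pos n) * Polynomials.⟦ polynomial p ⟧ ρ ≈⟨ *-cong (⟦⟧≈⟦⟧ℤ (pos n)) (agree p) ⟩
      n · 1# * ⟦ p ⟧ₑ ρ                                 ≈⟨ ×-assoc-* n 1# _ ⟩
      n · (1# * ⟦ p ⟧ₑ ρ)                               ≈⟨ ×-congʳ n (*-identityˡ _) ⟩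
      n · ⟦ p ⟧ₑ ρ                                      ∎

  solve : ∀ n (f : N-ary n (Expr n) (Expr n × Expr n)) →
          Eqʰ n _≈_ (curryⁿ ⟦ proj₁ (close n f) ⟧↓) (curryⁿ ⟦ proj₂ (close n f) ⟧↓) →
          Eq n _≈_ (curryⁿ ⟦ proj₁ (close n f) ⟧ₑ) (curryⁿ ⟦ proj₂ (close n f) ⟧ₑ)
  solve n f h = curryⁿ-cong _≈_ ⟦ p ⟧ₑ ⟦ q ⟧ₑ λ ρ → trans (sym (correct p ρ))
    (trans (curryⁿ-cong⁻¹ _≈_ ⟦ p ⟧↓ ⟦ q ⟧↓ (Eqʰ-to-Eq n _≈_ h) ρ) (correct q ρ))
    where
    p = proj₁ (close n f)
    q = proj₂ (close n f)

module Sums {c ℓ} (R : CommutativeRing c ℓ) where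
  open CommutativeRing R
  open RingProperties ring using (-1*x≈-x)
  open PowerSeries R using (sum)
  open IntegerSolver R using (solve)
  open import Relation.Binary.Reasoning.Setoid setoid

  -- Opaque, so that the summand can be inferred from the sum.
  opaque
    ∑ : ℕ → (ℕ → Carrier) → Carrier
    ∑ n f = sum {n} λ i → f (toℕ i)

    sum≡∑ : ∀ n f → sum {n} (λ i → f (toℕ i)) ≡ ∑ n f
    sum≡∑ n f = ≡.refl

    ∑-nil : ∀ {f} → ∑ 0 f ≈ 0#
    ∑-nil = refl

    ∑-cons : ∀ {n f} → ∑ (suc n) f ≈ f 0 + ∑ n (λ i → f (suc i))
    ∑-cons = refl

    ∑-cong : ∀ n {f g} → (∀ i → i ℕ.< n → f i ≈ g i) → ∑ n f ≈ ∑ n g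
    ∑-cong zero    h = refl
    ∑-cong (suc n) h = +-cong (h 0 (s≤s z≤n)) (∑-cong n λ i i<n → h (suc i) (s≤s i<n))

  ∑-cong′ : ∀ n {f g} → (∀ i → f i ≈ g i) → ∑ n f ≈ ∑ n g
  ∑-cong′ n h = ∑-cong n λ i _ → h i

  ∑-zero : ∀ n {f} → (∀ i → i ℕ.< n → f i ≈ 0#) → ∑ n f ≈ 0#
  ∑-zero zero    h = ∑-nil
  ∑-zero (suc n) h = trans ∑-cons
    (trans (+-cong (h 0 (s≤s z≤n)) (∑-zero n λ i i<n → h (suc i) (s≤s i<n))) (+-identityˡ 0#))

  ∑-snoc : ∀ n {f} → ∑ (suc n) f ≈ ∑ n f + f n
  ∑-snoc zero    = trans ∑-cons (trans (+-comm _ _) (+-congʳ (trans ∑-nil (sym ∑-nil))))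
  ∑-snoc (suc n) = trans ∑-cons (trans (+-congˡ (∑-snoc n)) (trans (sym (+-assoc _ _ _)) (+-congʳ (sym ∑-cons))))

  ∑-distrib-+ : ∀ n {f g} → ∑ n (λ i → f i + g i) ≈ ∑ n f + ∑ n g
  ∑-distrib-+ zero    = trans ∑-nil (sym (trans (+-cong ∑-nil ∑-nil) (+-identityˡ 0#)))
  ∑-distrib-+ (suc n) = trans ∑-cons (trans (+-congˡ (∑-distrib-+ n))
    (trans (solve 4 (λ a b c d → a :+ b :+ (c :+ d) := a :+ c :+ (b :+ d)) refl _ _ _ _)
           (sym (+-cong ∑-cons ∑-cons))))

  *-distribˡ-∑ : ∀ n x {f} → x * ∑ n f ≈ ∑ n (λ i → x * f i)
  *-distribˡ-∑ zero    x = trans (*-congˡ ∑-nil) (trans (zeroʳ x) (sym ∑-nil))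
  *-distribˡ-∑ (suc n) x = trans (*-congˡ ∑-cons)
    (trans (distribˡ x _ _) (trans (+-congˡ (*-distribˡ-∑ n x)) (sym ∑-cons)))

  *-distribʳ-∑ : ∀ n x {f} → ∑ n f * x ≈ ∑ n (λ i → f i * x)
  *-distribʳ-∑ n x = trans (*-comm _ x) (trans (*-distribˡ-∑ n x) (∑-cong′ n λ i → *-comm x _))

  ∑-distrib-neg : ∀ n {f} → ∑ n (λ i → - f i) ≈ - ∑ n f
  ∑-distrib-neg n = trans (∑-cong′ n λ i → sym (-1*x≈-x _)) (trans (sym (*-distribˡ-∑ n _)) (-1*x≈-x _))

  ∑-distrib-- : ∀ n {f g} → ∑ n (λ i → f i - g i) ≈ ∑ n f - ∑ n g
  ∑-distrib-- n = trans (∑-distrib-+ n) (+-congˡ (∑-distrib-neg n))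

  ∑-swap : ∀ m n {F : ℕ → ℕ → Carrier} →
           ∑ m (λ i → ∑ n (F i)) ≈ ∑ n (λ j → ∑ m (λ i → F i j))
  ∑-swap zero    n = trans ∑-nil (sym (∑-zero n λ _ _ → ∑-nil))
  ∑-swap (suc m) n = trans ∑-cons (trans (+-congˡ (∑-swap m n))
    (trans (sym (∑-distrib-+ n)) (∑-cong′ n λ i → sym ∑-cons)))

  ∑-reverse : ∀ n {f} → ∑ (suc n) f ≈ ∑ (suc n) (λ i → f (n ∸ i))
  ∑-reverse zero    = trans ∑-cons (trans (+-congˡ (trans ∑-nil (sym ∑-nil))) (sym ∑-cons))
  ∑-reverse (suc n) = trans (∑-snoc (suc n)) (trans (+-comm _ _) (trans (+-congˡ (∑-reverse n)) (sym ∑-cons)))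

  ∑-truncate : ∀ {m n f} → m ℕ.≤ n → (∀ i → m ℕ.≤ i → f i ≈ 0#) → ∑ n f ≈ ∑ m f
  ∑-truncate {n = n} z≤n       h = trans (∑-zero n λ i _ → h i z≤n) (sym ∑-nil)
  ∑-truncate         (s≤s m≤n) h = trans ∑-cons
    (trans (+-congˡ (∑-truncate m≤n λ i m≤i → h (suc i) (s≤s m≤i))) (sym ∑-cons))

  ∑-antidiagonal : ∀ n {F : ℕ → ℕ → Carrier} →
    ∑ n (λ k → ∑ (suc k) (λ i → F i (k ∸ i))) ≈ ∑ n (λ i → ∑ (n ∸ i) (F i))
  ∑-antidiagonal zero    = trans ∑-nil (sym ∑-nil)
  ∑-antidiagonal (suc n) {F} = begin
    ∑ (suc n) (λ k → ∑ (suc k) (λ i → F i (k ∸ i)))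
      ≈⟨ ∑-cong′ (suc n) (λ k → ∑-cons) ⟩
    ∑ (suc n) (λ k → F 0 k + ∑ k (λ i → F (suc i) (k ∸ suc i)))
      ≈⟨ ∑-distrib-+ (suc n) ⟩
    ∑ (suc n) (F 0) + ∑ (suc n) (λ k → ∑ k (λ i → F (suc i) (k ∸ suc i)))
      ≈⟨ +-congˡ (trans ∑-cons (trans (+-congʳ ∑-nil) (+-identityˡ _))) ⟩
    ∑ (suc n) (F 0) + ∑ n (λ k → ∑ (suc k) (λ i → F (suc i) (k ∸ i)))
      ≈⟨ +-congˡ (∑-antidiagonal n) ⟩
    ∑ (suc n) (F 0) + ∑ n (λ i → ∑ (n ∸ i) (F (suc i)))
      ≈⟨ ∑-cons ⟨
    ∑ (suc n) (λ i → ∑ (suc n ∸ i) (F i))  ∎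

module SeriesRing {c ℓ} (R : CommutativeRing c ℓ) where
  open CommutativeRing R
  open PowerSeries R
  open IntegerSolver R using (solve)
  open Sums R
  open import Relation.Binary.Reasoning.Setoid setoid

  tail : Series → Series
  tail f n = f (suc n)

  const : Carrier → Series
  const x zero    = x
  const x (suc n) = 0#

  scale : Carrier → Series → Series
  scale x f n = x * f n

  -ˢ_ : Series → Series
  (-ˢ f) n = - f n

  *ˢ-def : ∀ f g n → (f *ˢ g) n ≈ ∑ (suc n) (λ i → f i * g (n ∸ i))
  *ˢ-def f g n = reflexive (sum≡∑ (suc n) λ i → f i * g (n ∸ i))

  *ˢ-cong-at : ∀ {f f′ g g′} n → (∀ i → i ℕ.≤ n → f i ≈ f′ i) → (∀ i → i ℕ.≤ n → g i ≈ g′ i) →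
               (f *ˢ g) n ≈ (f′ *ˢ g′) n
  *ˢ-cong-at {f} {f′} {g} {g′} n h k = trans (*ˢ-def f g n) (trans
    (∑-cong (suc n) λ { i (s≤s i≤n) → *-cong (h i i≤n) (k (n ∸ i) (ℕ.m∸n≤m n i)) })
    (sym (*ˢ-def f′ g′ n)))

  *ˢ-cong : ∀ {f f′ g g′} → f ≋ f′ → g ≋ g′ → f *ˢ g ≋ f′ *ˢ g′
  *ˢ-cong {f} {f′} {g} {g′} h k n = *ˢ-cong-at {f} {f′} {g} {g′} n (λ i _ → h i) (λ i _ → k i)

  *ˢ-distribʳ : ∀ f g h → (g +ˢ h) *ˢ f ≋ g *ˢ f +ˢ h *ˢ f
  *ˢ-distribʳ f g h n = trans (*ˢ-def (g +ˢ h) f n) (trans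
    (trans (∑-cong′ (suc n) λ i → distribʳ (f (n ∸ i)) (g i) (h i)) (∑-distrib-+ (suc n)))
    (sym (+-cong (*ˢ-def g f n) (*ˢ-def h f n))))

  scale-*ˢ : ∀ x f g → scale x f *ˢ g ≋ scale x (f *ˢ g)
  scale-*ˢ x f g n = trans (*ˢ-def (scale x f) g n) (trans
    (∑-cong′ (suc n) λ i → *-assoc x (f i) (g (n ∸ i)))
    (sym (trans (*-congˡ (*ˢ-def f g n)) (*-distribˡ-∑ (suc n) x))))

  *ˢ-comm : ∀ f g → f *ˢ g ≋ g *ˢ f
  *ˢ-comm f g n = trans (*ˢ-def f g n) (trans (∑-reverse n)
    (trans (∑-cong (suc n) λ { i (s≤s i≤n) → trans (*-comm _ _)
       (*-congʳ (reflexive (≡.cong g (ℕ.m∸[m∸n]≡n i≤n)))) }) (sym (*ˢ-def g f n))))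

  *ˢ-assoc : ∀ f g h → (f *ˢ g) *ˢ h ≋ f *ˢ (g *ˢ h)
  *ˢ-assoc f g h zero = solve 3 (λ a b c → (a :* b :+ # 0) :* c :+ # 0 := a :* (b :* c :+ # 0) :+ # 0) refl (f 0) (g 0) (h 0)
  *ˢ-assoc f g h (suc n) = begin
    (f 0 * g 0 + 0#) * h (suc n) + ((scale (f 0) (tail g) +ˢ tail f *ˢ g) *ˢ h) n
      ≈⟨ +-cong (solve 3 (λ a b c → (a :* b :+ # 0) :* c := a :* (b :* c)) refl (f 0) (g 0) (h (suc n)))
                (*ˢ-distribʳ h (scale (f 0) (tail g)) (tail f *ˢ g) n) ⟩
    f 0 * (g 0 * h (suc n)) + ((scale (f 0) (tail g) *ˢ h) n + ((tail f *ˢ g) *ˢ h) n)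
      ≈⟨ +-congˡ (+-cong (scale-*ˢ (f 0) (tail g) h n) (*ˢ-assoc (tail f) g h n)) ⟩
    f 0 * (g 0 * h (suc n)) + (f 0 * (tail g *ˢ h) n + (tail f *ˢ (g *ˢ h)) n)
      ≈⟨ solve 4 (λ a b c d → a :* b :+ (a :* c :+ d) := a :* (b :+ c) :+ d) refl _ _ _ _ ⟩
    f 0 * (g *ˢ h) (suc n) + (tail f *ˢ (g *ˢ h)) n  ∎

  const-*ˢ : ∀ x f → const x *ˢ f ≋ scale x f
  const-*ˢ x f n = trans (*ˢ-def (const x) f n) (trans ∑-cons
    (trans (+-congˡ (∑-zero n λ i _ → zeroˡ (f (n ∸ suc i)))) (+-identityʳ _)))

  1ˢ≋const : 1ˢ ≋ const 1#
  1ˢ≋const zero    = refl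
  1ˢ≋const (suc n) = refl

  *ˢ-identityˡ : ∀ f → 1ˢ *ˢ f ≋ f
  *ˢ-identityˡ f n = trans (*ˢ-cong {g = f} 1ˢ≋const (λ _ → refl) n) (trans (const-*ˢ 1# f n) (*-identityˡ _))

  -- Opaque copies of the operations, and equality as a record, so that series
  -- can be inferred from the equations between them.
  infix  4 _≈ˢ_ _≈[_]_
  infixl 6 _⊕_
  infixl 7 _⊛_
  infix  8 ⊖_

  record _≈ˢ_ (f g : Series) : Set ℓ where
    constructor ⟪_⟫
    field at : f ≋ g
  open _≈ˢ_ public

  record _≈[_]_ (f : Series) (N : ℕ) (g : Series) : Set ℓ where
    constructor ⟪_⟫
    field at[_] : ∀ n → n ℕ.< N → f n ≈ g n
  open _≈[_]_ public

  opaque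
    _⊕_ _⊛_ : Series → Series → Series
    _⊕_ = _+ˢ_
    _⊛_ = _*ˢ_

    ⊖_ : Series → Series
    ⊖_ = -ˢ_

    𝟘 𝟙 : Series
    𝟘 = 0ˢ
    𝟙 = 1ˢ

    ⊛≡*ˢ : ∀ f g → f ⊛ g ≡ f *ˢ g
    ⊛≡*ˢ f g = ≡.refl

    𝟙≡1ˢ : 𝟙 ≡ 1ˢ
    𝟙≡1ˢ = ≡.refl

    coeff-+ : ∀ f g n → (f ⊕ g) n ≈ f n + g n
    coeff-+ f g n = refl

    coeff-neg : ∀ f n → (⊖ f) n ≈ - f n
    coeff-neg f n = refl

    coeff-0 : ∀ n → 𝟘 n ≈ 0#
    coeff-0 n = refl

    coeff-1-0 : 𝟙 0 ≈ 1#
    coeff-1-0 = refl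

    coeff-1-suc : ∀ n → 𝟙 (suc n) ≈ 0#
    coeff-1-suc n = refl

    coeff-* : ∀ f g n → (f ⊛ g) n ≈ ∑ (suc n) (λ i → f i * g (n ∸ i))
    coeff-* f g n = *ˢ-def f g n

    coeff-*-0 : ∀ f g → (f ⊛ g) 0 ≈ f 0 * g 0
    coeff-*-0 f g = +-identityʳ _

    coeff-*-suc : ∀ f g n → (f ⊛ g) (suc n) ≈ f 0 * g (suc n) + (tail f ⊛ g) n
    coeff-*-suc f g n = refl

    coeff-const-* : ∀ x f n → (const x ⊛ f) n ≈ x * f n
    coeff-const-* = const-*ˢ

    isCommutativeRing-mod :
      (P : ℕ → Set) (P-down : ∀ {i n} → i ℕ.≤ n → P n → P i) (_≃_ : Series → Series → Set ℓ) →
      (∀ {f g} → (∀ n → P n → f n ≈ g n) → f ≃ g) →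
      (∀ {f g} → f ≃ g → ∀ n → P n → f n ≈ g n) →
      IsCommutativeRing _≃_ _⊕_ _⊛_ ⊖_ 𝟘 𝟙
    isCommutativeRing-mod P P-down _≃_ to from = record
      { isRing = record
        { +-isAbelianGroup = record
          { isGroup = record
            { isMonoid = record
              { isSemigroup = record
                { isMagma = record
                  { isEquivalence = record
                    { refl = to λ _ _ → refl ; sym = λ h → to λ n p → sym (from h n p)
                    ; trans = λ h k → to λ n p → trans (from h n p) (from k n p) }
                  ; ∙-cong = λ h k → to λ n p → +-cong (from h n p) (from k n p) }
                ; assoc = λ _ _ _ → to λ _ _ → +-assoc _ _ _ }
              ; identity = (λ _ → to λ _ _ → +-identityˡ _) , (λ _ → to λ _ _ → +-identityʳ _) }
            ; inverse = (λ _ → to λ _ _ → -‿inverseˡ _) , (λ _ → to λ _ _ → -‿inverseʳ _)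
            ; ⁻¹-cong = λ h → to λ n p → -‿cong (from h n p) }
          ; comm = λ _ _ → to λ _ _ → +-comm _ _ }
        ; *-cong = λ {f} {f′} {g} {g′} h k → to λ n p → *ˢ-cong-at {f} {f′} {g} {g′} n
            (λ i i≤n → from h i (P-down i≤n p)) (λ i i≤n → from k i (P-down i≤n p))
        ; *-assoc = λ f g h → to λ n _ → *ˢ-assoc f g h n
        ; *-identity = (λ f → to λ n _ → *ˢ-identityˡ f n)
                     , (λ f → to λ n _ → trans (*ˢ-comm f 1ˢ n) (*ˢ-identityˡ f n))
        ; distrib = (λ f g h → to λ n _ → trans (*ˢ-comm f (g +ˢ h) n)
                       (trans (*ˢ-distribʳ f g h n) (+-cong (*ˢ-comm g f n) (*ˢ-comm h f n))))
                  , (λ f g h → to λ n _ → *ˢ-distribʳ f g h n) }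
      ; *-comm = λ f g → to λ n _ → *ˢ-comm f g n }

  𝕊 : CommutativeRing c ℓ
  𝕊 = record
    { _≈_ = _≈ˢ_ ; isCommutativeRing = isCommutativeRing-mod (λ _ → ⊤) (λ _ _ → tt) _≈ˢ_
        (λ h → ⟪ (λ n → h n tt) ⟫) (λ h n _ → at h n) }

  𝕊/q^ : ℕ → CommutativeRing c ℓ
  𝕊/q^ N = record
    { _≈_ = _≈[ N ]_ ; isCommutativeRing = isCommutativeRing-mod (ℕ._< N)
        (λ i≤n n<N → ℕ.≤-<-trans i≤n n<N) _≈[ N ]_ ⟪_⟫ at[_] }

-- For u_n = q^n/(1-q^n), the product u_m u_n is linear in the products
-- with u_{m+n}; hence u_n u_{n+k} telescopes in n.  The indices are shifted
-- by one: U i stands for u_{i+1}.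
module Liouville {c ℓ} (A : CommutativeRing c ℓ) (U : ℕ → CommutativeRing.Carrier A) where
  open CommutativeRing A
  open IntegerSolver A using (solve)
  open Sums A
  open PowerSeries A using (_·_)
  open import Relation.Binary.Reasoning.Setoid setoid

  ∑< : ℕ → (ℕ → ℕ → Carrier) → Carrier
  ∑< M F = ∑ M λ j → ∑ j λ i → F i j

  ∑<-cong : ∀ M {F G} → (∀ i k → F i (suc (i ℕ.+ k)) ≈ G i (suc (i ℕ.+ k))) → ∑< M F ≈ ∑< M G
  ∑<-cong M {F} {G} h = ∑-cong′ M λ j → ∑-cong j λ i i<j →
    ≡.subst (λ n → F i n ≈ G i n) (ℕ.m+[n∸m]≡n i<j) (h i (j ∸ suc i))

  ∑<-distrib-+ : ∀ M {F G} → ∑< M (λ i j → F i j + G i j) ≈ ∑< M F + ∑< M G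
  ∑<-distrib-+ M = trans (∑-cong′ M λ j → ∑-distrib-+ j) (∑-distrib-+ M)

  square-split : ∀ M {H : ℕ → ℕ → Carrier} →
    ∑ M (λ i → ∑ M (H i)) ≈ ∑ M (λ i → H i i) + ∑< M (λ i j → H i j + H j i)
  square-split zero = trans ∑-nil (sym (trans (+-cong ∑-nil ∑-nil) (+-identityˡ 0#)))
  square-split (suc M) {H} = begin
    ∑ (suc M) (λ i → ∑ (suc M) (H i))
      ≈⟨ ∑-snoc M ⟩
    ∑ M (λ i → ∑ (suc M) (H i)) + ∑ (suc M) (H M)
      ≈⟨ +-cong (trans (∑-cong′ M λ i → ∑-snoc M) (∑-distrib-+ M)) (∑-snoc M) ⟩
    ∑ M (λ i → ∑ M (H i)) + ∑ M (λ i → H i M) + (∑ M (H M) + H M M)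
      ≈⟨ +-congʳ (+-congʳ (square-split M)) ⟩
    ∑ M (λ i → H i i) + ∑< M (λ i j → H i j + H j i) + ∑ M (λ i → H i M) + (∑ M (H M) + H M M)
      ≈⟨ solve 5 (λ a b c d e → a :+ b :+ c :+ (d :+ e) := (a :+ e) :+ (b :+ (c :+ d))) refl _ _ _ _ _ ⟩
    ∑ M (λ i → H i i) + H M M + (∑< M (λ i j → H i j + H j i) + (∑ M (λ i → H i M) + ∑ M (H M)))
      ≈⟨ +-cong (sym (∑-snoc M)) (trans (+-congˡ (sym (∑-distrib-+ M))) (sym (∑-snoc M))) ⟩
    ∑ (suc M) (λ i → H i i) + ∑< (suc M) (λ i j → H i j + H j i)  ∎

  square-triangle : ∀ M {Φ : ℕ → ℕ → Carrier} → (∀ i k → M ℕ.≤ suc (i ℕ.+ k) → Φ i k ≈ 0#) →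
    ∑ M (λ i → ∑ M (Φ i)) ≈ ∑< M (λ i j → Φ i (j ∸ suc i))
  square-triangle zero h = trans ∑-nil (sym ∑-nil)
  square-triangle (suc M) {Φ} h = begin
    ∑ (suc M) (λ i → ∑ (suc M) (Φ i))
      ≈⟨ ∑-cong (suc M) (λ { i (s≤s i≤M) → ∑-truncate (ℕ.≤-trans (ℕ.m∸n≤m M i) (ℕ.n≤1+n M))
           λ k M∸i≤k → h i k (s≤s (ℕ.≤-trans (ℕ.≤-reflexive (≡.sym (ℕ.m+[n∸m]≡n i≤M))) (ℕ.+-monoʳ-≤ i M∸i≤k))) }) ⟩
    ∑ (suc M) (λ i → ∑ (M ∸ i) (Φ i))
      ≈⟨ trans (∑-snoc M) (trans (+-congˡ (trans (reflexive (≡.cong (λ n → ∑ n (Φ M)) (ℕ.n∸n≡0 M))) ∑-nil)) (+-identityʳ _)) ⟩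
    ∑ M (λ i → ∑ (M ∸ i) (Φ i))
      ≈⟨ ∑-antidiagonal M ⟨
    ∑ M (λ k → ∑ (suc k) (λ i → Φ i (k ∸ i)))
      ≈⟨ trans ∑-cons (trans (+-congʳ ∑-nil) (+-identityˡ _)) ⟨
    ∑< (suc M) (λ i j → Φ i (j ∸ suc i)) ∎

  ∑-reverse′ : ∀ j {f} → ∑ j (λ i → f (j ∸ suc i)) ≈ ∑ j f
  ∑-reverse′ zero    = trans ∑-nil (sym ∑-nil)
  ∑-reverse′ (suc j) = sym (∑-reverse j)

  by-parts : ∀ M {f g : ℕ → Carrier} →
    ∑ M f * ∑ M g ≈ ∑ M (λ j → f j * ∑ j g) + ∑ M (λ j → g j * ∑ j f) + ∑ M (λ j → f j * g j)
  by-parts zero = trans (*-cong ∑-nil ∑-nil) (trans (solve 0 (# 0 :* # 0 := # 0 :+ # 0 :+ # 0) refl) (sym (+-cong (+-cong ∑-nil ∑-nil) ∑-nil)))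
  by-parts (suc M) {f} {g} = begin
    ∑ (suc M) f * ∑ (suc M) g
      ≈⟨ *-cong (∑-snoc M) (∑-snoc M) ⟩
    (∑ M f + f M) * (∑ M g + g M)
      ≈⟨ solve 4 (λ p x q y → (p :+ x) :* (q :+ y) := p :* q :+ (x :* q :+ y :* p :+ x :* y)) refl _ _ _ _ ⟩
    ∑ M f * ∑ M g + (f M * ∑ M g + g M * ∑ M f + f M * g M)
      ≈⟨ +-congʳ (by-parts M) ⟩
    _ ≈⟨ solve 6 (λ a b c x y z → a :+ b :+ c :+ (x :+ y :+ z) := a :+ x :+ (b :+ y) :+ (c :+ z)) refl _ _ _ _ _ _ ⟩
    _ ≈⟨ +-cong (+-cong (∑-snoc M) (∑-snoc M)) (∑-snoc M) ⟨
    _ ∎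

  module _ (relation : ∀ i j → U (suc (i ℕ.+ j)) * (1# + U i + U j) ≈ U i * U j)
           (M : ℕ) (vanish : ∀ i j → M ℕ.≤ suc (i ℕ.+ j) → U i * U j ≈ 0#)
           (f : ℕ → Carrier) (G : ℕ → ℕ → Carrier)
           (G-sym : ∀ i j → G i j ≈ G j i)
           (G-diag : ∀ i → G i i + f (2 ℕ.+ (i ℕ.+ i)) ≈ f 0)
           (G-off : ∀ i k → G i (suc (i ℕ.+ k)) + f (2 ℕ.+ (i ℕ.+ suc (i ℕ.+ k))) ≈ f (suc k)) where

    private
      g : ℕ → Carrier
      g k = f (suc k) * U k

      F P Q : ℕ → Carrier
      F k = ∑ k (λ i → f (suc i))
      P k = ∑ k U
      Q k = ∑ k g

      sum-part : ∑ M (λ i → ∑ M λ j → f (2 ℕ.+ (i ℕ.+ j)) * (U i * U j)) ≈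
                 ∑ M (λ j → g j * (j · 1# + 2 · P j))
      sum-part = begin
        ∑ M (λ i → ∑ M λ j → f (2 ℕ.+ (i ℕ.+ j)) * (U i * U j))
          ≈⟨ square-triangle M (λ i k M≤ → trans (*-congˡ (vanish i k M≤)) (zeroʳ _)) ⟩
        ∑< M (λ i j → f (2 ℕ.+ (i ℕ.+ (j ∸ suc i))) * (U i * U (j ∸ suc i)))
          ≈⟨ ∑<-cong M (λ i k → ≡.subst (λ n → f (2 ℕ.+ (i ℕ.+ n)) * (U i * U n) ≈ f (2 ℕ.+ (i ℕ.+ k)) * U (suc (i ℕ.+ k)) * (1# + U i + U n))
               (≡.sym (ℕ.m+n∸m≡n i k)) (trans (*-congˡ (sym (relation i k))) (sym (*-assoc _ _ _)))) ⟩
        ∑< M (λ i j → g j * (1# + U i + U (j ∸ suc i)))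
          ≈⟨ ∑-cong′ M (λ j → trans (sym (*-distribˡ-∑ j _)) (*-congˡ (trans (∑-distrib-+ j) (trans (+-cong (trans (∑-distrib-+ j) (+-congʳ (∑-one j))) (∑-reverse′ j))
               (solve 2 (λ n p → n :+ p :+ p := n :+ 2 :× p) refl (j · 1#) (P j)))))) ⟩
        ∑ M (λ j → g j * (j · 1# + 2 · P j)) ∎
        where
        ∑-one : ∀ j → ∑ j (λ _ → 1#) ≈ j · 1#
        ∑-one zero    = ∑-nil
        ∑-one (suc j) = trans ∑-cons (+-congˡ (∑-one j))

      difference-part : ∑< M (λ i j → f (j ∸ i) * (U i * U j)) ≈
                        P M * Q M - ∑ M (λ j → U j * Q j) - ∑ M (λ j → U j * F j)
      difference-part = begin
        ∑< M (λ i j → f (j ∸ i) * (U i * U j))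
          ≈⟨ ∑<-cong M (λ i k → ≡.subst (λ n → f n * (U i * U (suc (i ℕ.+ k))) ≈ expand i (suc (i ℕ.+ k)))
               (≡.sym (≡.trans (≡.cong (_∸ i) (≡.sym (ℕ.+-suc i k))) (ℕ.m+n∸m≡n i (suc k)))) (≡.subst
                 (λ n → f (suc k) * (U i * U (suc (i ℕ.+ k))) ≈ U i * (f (suc n) * U n) + (- (f (suc n) * U n) * U (suc (i ℕ.+ k)) - f (suc n) * U (suc (i ℕ.+ k))))
                 (≡.sym (ℕ.m+n∸m≡n i k)) (telescope i k))) ⟩
        ∑< M expand
          ≈⟨ trans (∑<-distrib-+ M) (+-congˡ (∑<-distrib-+ M)) ⟩
        ∑< M (λ i j → U i * g (j ∸ suc i)) + (∑< M (λ i j → - g (j ∸ suc i) * U j) + ∑< M (λ i j → - (f (suc (j ∸ suc i)) * U j)))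
          ≈⟨ +-cong (trans (sym (square-triangle M λ i k M≤ → trans (solve 3 (λ a b c → a :* (b :* c) := b :* (a :* c)) refl _ _ _) (trans (*-congˡ (vanish i k M≤)) (zeroʳ _))))
                       (trans (∑-cong′ M λ i → sym (*-distribˡ-∑ M (U i))) (sym (*-distribʳ-∑ M (Q M)))))
                    (+-cong (∑-cong′ M λ j → trans (∑-reverse′ j {λ k → - g k * U j}) (trans (sym (*-distribʳ-∑ j (U j))) (trans (*-congʳ (∑-distrib-neg j)) (solve 2 (λ a b → :- a :* b := :- (b :* a)) refl _ _))))
                            (∑-cong′ M λ j → trans (∑-reverse′ j {λ k → - (f (suc k) * U j)}) (trans (∑-distrib-neg j) (-‿cong (trans (sym (*-distribʳ-∑ j (U j))) (*-comm _ _)))))) ⟩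
        P M * Q M + (∑ M (λ j → - (U j * Q j)) + ∑ M (λ j → - (U j * F j)))
          ≈⟨ +-congˡ (+-cong (∑-distrib-neg M) (∑-distrib-neg M)) ⟩
        P M * Q M + (- ∑ M (λ j → U j * Q j) - ∑ M (λ j → U j * F j))
          ≈⟨ +-assoc _ _ _ ⟨
        P M * Q M - ∑ M (λ j → U j * Q j) - ∑ M (λ j → U j * F j) ∎
        where
        expand : ℕ → ℕ → Carrier
        expand i j = U i * g (j ∸ suc i) + (- g (j ∸ suc i) * U j - f (suc (j ∸ suc i)) * U j)
        telescope : ∀ i k → f (suc k) * (U i * U (suc (i ℕ.+ k))) ≈
          U i * (f (suc k) * U k) + (- (f (suc k) * U k) * U (suc (i ℕ.+ k)) - f (suc k) * U (suc (i ℕ.+ k)))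
        telescope i k = begin
          f (suc k) * (U i * W)
            ≈⟨ solve 4 (λ f a b w → f :* (a :* w) := f :* (w :* (:1 :+ a :+ b)) :+ (:- (f :* b) :* w :- f :* w)) refl (f (suc k)) (U i) (U k) W ⟩
          f (suc k) * (W * (1# + U i + U k)) + (- (f (suc k) * U k) * W - f (suc k) * W)
            ≈⟨ +-congʳ (trans (*-congˡ (relation i k)) (solve 3 (λ f a b → f :* (a :* b) := a :* (f :* b)) refl _ _ _)) ⟩
          U i * (f (suc k) * U k) + (- (f (suc k) * U k) * W - f (suc k) * W) ∎
          where W = U (suc (i ℕ.+ k))

    liouville : ∑ M (λ i → ∑ M λ j → G i j * (U i * U j)) ≈
                ∑ M (λ k → f 0 * (U k * U k) + (2 · (f (suc k) * (U k * U k)) - k · 1# * (f (suc k) * U k) - 2 · (F k * U k)))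
    liouville = begin
      ∑ M (λ i → ∑ M λ j → G i j * (U i * U j))
        ≈⟨ solve 2 (λ x y → x := x :+ y :- y) refl _ (∑ M λ i → ∑ M λ j → f (2 ℕ.+ (i ℕ.+ j)) * (U i * U j)) ⟩
      ∑ M (λ i → ∑ M λ j → G i j * (U i * U j)) + ∑ M (λ i → ∑ M λ j → f (2 ℕ.+ (i ℕ.+ j)) * (U i * U j)) - ∑ M (λ i → ∑ M λ j → f (2 ℕ.+ (i ℕ.+ j)) * (U i * U j))
        ≈⟨ +-cong (trans (sym (∑-distrib-+ M)) (∑-cong′ M λ i → trans (sym (∑-distrib-+ M)) (∑-cong′ M λ j → sym (distribʳ _ _ _)))) (-‿cong sum-part) ⟩
      ∑ M (λ i → ∑ M λ j → H i j) - ∑ M (λ j → g j * (j · 1# + 2 · P j))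
        ≈⟨ +-congʳ (trans (square-split M) (+-cong (∑-cong′ M λ i → *-congʳ (G-diag i)) (∑<-cong M off))) ⟩
      ∑ M (λ i → f 0 * (U i * U i)) + ∑< M (λ i j → f (j ∸ i) * (U i * U j) + f (j ∸ i) * (U i * U j)) - ∑ M (λ j → g j * (j · 1# + 2 · P j))
        ≈⟨ +-congʳ (+-congˡ (trans (∑<-distrib-+ M) (trans (+-cong difference-part difference-part)
             (+-cong (+-congʳ (+-congʳ (by-parts M))) (+-congʳ (+-congʳ (by-parts M))))))) ⟩
      _ ≈⟨ +-congˡ (-‿cong (trans (∑-cong′ M λ j → solve 3 (λ g n p → g :* (n :+ 2 :× p) := n :* g :+ (g :* p :+ g :* p)) refl (g j) (j · 1#) (P j))
             (trans (∑-distrib-+ M) (+-congˡ (∑-distrib-+ M))))) ⟩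
      _ ≈⟨ solve 6 (λ a uq gp ug uf n → a :+ ((uq :+ gp :+ ug :- uq :- uf) :+ (uq :+ gp :+ ug :- uq :- uf)) :- (n :+ (gp :+ gp)) :=
                       a :+ ((ug :+ ug) :+ (:- n) :+ ((:- uf) :+ (:- uf)))) refl _ _ _ _ _ _ ⟩
      _ ≈⟨ +-congˡ (+-cong (+-cong (sym (∑-distrib-+ M)) (sym (∑-distrib-neg M))) (trans (+-cong (sym (∑-distrib-neg M)) (sym (∑-distrib-neg M))) (sym (∑-distrib-+ M)))) ⟩
      _ ≈⟨ trans (+-congˡ (trans (+-congʳ (sym (∑-distrib-+ M))) (sym (∑-distrib-+ M)))) (sym (∑-distrib-+ M)) ⟩
      _ ≈⟨ ∑-cong′ M (λ k → +-congˡ (solve 4 (λ f u n F → u :* (f :* u) :+ u :* (f :* u) :+ :- (n :* (f :* u)) :+ (:- (u :* F) :+ :- (u :* F)) :=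
                2 :× (f :* (u :* u)) :- n :* (f :* u) :- 2 :× (F :* u)) refl (f (suc k)) (U k) (k · 1#) (F k))) ⟩
      _ ∎
      where
      H : ℕ → ℕ → Carrier
      H i j = (G i j + f (2 ℕ.+ (i ℕ.+ j))) * (U i * U j)
      off : ∀ i k → H i (suc (i ℕ.+ k)) + H (suc (i ℕ.+ k)) i ≈
            f (suc (i ℕ.+ k) ∸ i) * (U i * U (suc (i ℕ.+ k))) + f (suc (i ℕ.+ k) ∸ i) * (U i * U (suc (i ℕ.+ k)))
      off i k = +-cong (*-congʳ e) (*-cong (trans (+-cong (G-sym _ _)
          (reflexive (≡.cong (λ n → f (2 ℕ.+ n)) (ℕ.+-comm (suc (i ℕ.+ k)) i)))) e) (*-comm _ _))
        where
        e = trans (G-off i k) (reflexive (≡.cong f (≡.sym (≡.trans (≡.cong (_∸ i) (≡.sym (ℕ.+-suc i k))) (ℕ.m+n∸m≡n i (suc k))))))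

module ModularForms {c ℓ} (R : CommutativeRing c ℓ)
  (torsion-free : ∀ n x → CommutativeRing._≈_ R (PowerSeries._·_ R (suc n) x) (CommutativeRing.0# R) →
                  CommutativeRing._≈_ R x (CommutativeRing.0# R)) where
  module K where
    open CommutativeRing R public
    open SemiringMult semiring public
    open IntegerSolver R public using (solve)
    open Sums R public
    open RingProperties ring public using (-0#≈0#; -‿distribʳ-*; -‿distribˡ-*; x+x≈x⇒x≈0)
    open CMMult +-commutativeMonoid public using (×-distrib-+)
  open PowerSeries R using (Series; monomial; 0ˢ; 1ˢ; _+ˢ_; _-ˢ_; _*ˢ_; _^ˢ_; substitute; inverseˢ; ∏<; ∏₁; σ₃; E₄; Δ; j⁻¹; h^⅛)
  open SeriesRing R public
    using (𝕊; 𝕊/q^; tail; const; _≈[_]_; at; at[_]; ⟪_⟫; coeff-+; coeff-neg; coeff-0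
          ; coeff-1-0; coeff-1-suc; coeff-*; coeff-*-0; coeff-*-suc; coeff-const-*)
  open CommutativeRing 𝕊 public hiding (zero)
  open SemiringMult semiring public using (×-homo-+; ×-congʳ; ×-assocˡ; ×1-homo-*) renaming (_×_ to infixr 8 _·_)
  open PowerSeries 𝕊 public using (_^_)
  open IntegerSolver 𝕊 public using (solve)
  open Sums 𝕊 public
  open import Relation.Binary.Reasoning.Setoid setoid

  module Mod (N : ℕ) = CommutativeRing (𝕊/q^ N)

  mod : ∀ {f g N} → f ≈ g → f ≈[ N ] g
  mod h = ⟪ (λ n _ → at h n) ⟫

  mod-≤ : ∀ {f g M N} → M ℕ.≤ N → f ≈[ N ] g → f ≈[ M ] g
  mod-≤ M≤N h = ⟪ (λ n n<M → at[ h ] n (ℕ.≤-trans n<M M≤N)) ⟫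

  unmod : ∀ {f g} → (∀ N → f ≈[ N ] g) → f ≈ g
  unmod h = ⟪ (λ n → at[ h (suc n) ] n ℕ.≤-refl) ⟫

  mod-suc : ∀ {f g n} → f ≈[ n ] g → f n K.≈ g n → f ≈[ suc n ] g
  mod-suc {f} {g} {n} h k = ⟪ aux ⟫
    where
    aux : ∀ m → m ℕ.< suc n → f m K.≈ g m
    aux m (s≤s m≤n) with ℕ.m≤n⇒m<n∨m≡n m≤n
    ... | inj₁ m<n = at[ h ] m m<n
    ... | inj₂ ≡.refl = k

  X : Series
  X = monomial 1

  tail-cong : ∀ {f g N} → f ≈[ suc N ] g → tail f ≈[ N ] tail g
  tail-cong h = ⟪ (λ n n<N → at[ h ] (suc n) (s≤s n<N)) ⟫

  tail-+ : ∀ f g → tail (f + g) ≈ tail f + tail g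
  tail-+ f g = ⟪ (λ n → K.trans (coeff-+ f g (suc n)) (K.sym (coeff-+ (tail f) (tail g) n))) ⟫

  tail-* : ∀ f g → tail (f * g) ≈ const (f 0) * tail g + tail f * g
  tail-* f g = ⟪ (λ n → K.trans (coeff-*-suc f g n) (K.sym (K.trans (coeff-+ (const (f 0) * tail g) _ n)
    (K.+-congʳ (coeff-const-* (f 0) (tail g) n))))) ⟫

  ≈0-const : ∀ {f N} → f 0 K.≈ K.0# → tail f ≈[ N ] 0# → f ≈[ suc N ] 0#
  ≈0-const {f} {N} f0 tf = ⟪ aux ⟫
    where
    aux : ∀ n → n ℕ.< suc N → f n K.≈ 0# n
    aux zero    _         = K.trans f0 (K.sym (coeff-0 0))
    aux (suc n) (s≤s n<N) = K.trans (at[ tf ] n n<N) (K.trans (coeff-0 n) (K.sym (coeff-0 (suc n))))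

  const-cong : ∀ {x y} → x K.≈ y → const x ≈ const y
  const-cong h = ⟪ (λ { zero → h ; (suc n) → K.refl }) ⟫

  const-0 : const K.0# ≈ 0#
  const-0 = ⟪ (λ { zero → K.sym (coeff-0 0) ; (suc n) → K.sym (coeff-0 (suc n)) }) ⟫

  const-1 : const K.1# ≈ 1#
  const-1 = ⟪ (λ { zero → K.sym coeff-1-0 ; (suc n) → K.sym (coeff-1-suc n) }) ⟫

  const-+ : ∀ x y → const (x K.+ y) ≈ const x + const y
  const-+ x y = ⟪ (λ { zero → K.sym (coeff-+ (const x) (const y) 0)
                     ; (suc n) → K.sym (K.trans (coeff-+ (const x) (const y) (suc n)) (K.+-identityˡ _)) }) ⟫

  const-neg : ∀ x → const (K.- x) ≈ - const x
  const-neg x = ⟪ (λ { zero → K.sym (coeff-neg (const x) 0)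
                     ; (suc n) → K.sym (K.trans (coeff-neg (const x) (suc n)) K.-0#≈0#) }) ⟫

  const-* : ∀ x y → const (x K.* y) ≈ const x * const y
  const-* x y = ⟪ (λ { zero → K.sym (coeff-const-* x (const y) 0)
                     ; (suc n) → K.sym (K.trans (coeff-const-* x (const y) (suc n)) (K.zeroʳ x)) }) ⟫

  const-· : ∀ n x → const (n K.× x) ≈ n · const x
  const-· zero    x = const-0
  const-· (suc n) x = trans (const-+ x _) (+-congˡ (const-· n x))

  tail-X : tail X ≈ 1#
  tail-X = ⟪ (λ { zero → K.sym coeff-1-0 ; (suc n) → K.sym (coeff-1-suc n) }) ⟫

  coeff-· : ∀ k f n → (k · f) n K.≈ k K.× f n
  coeff-· zero    f n = coeff-0 n
  coeff-· (suc k) f n = K.trans (coeff-+ f _ n) (K.+-congˡ (coeff-· k f n))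

  coeff-- : ∀ f g n → (f - g) n K.≈ f n K.- g n
  coeff-- f g n = K.trans (coeff-+ f _ n) (K.+-congˡ (coeff-neg g n))

  coeff-∑ : ∀ N F n → ∑ N F n K.≈ K.∑ N (λ i → F i n)
  coeff-∑ zero    F n = K.trans (at ∑-nil n) (K.trans (coeff-0 n) (K.sym K.∑-nil))
  coeff-∑ (suc N) F n = K.trans (at ∑-cons n) (K.trans (coeff-+ (F 0) _ n)
    (K.trans (K.+-congˡ (coeff-∑ N (F ∘ suc) n)) (K.sym K.∑-cons)))

  coeff-*-leading : ∀ g f n → f ≈[ n ] 0# → (g * f) n K.≈ g 0 K.* f n
  coeff-*-leading g f n h = K.trans (coeff-* g f n) (K.trans K.∑-cons
    (K.trans (K.+-congˡ (K.∑-zero n λ i i<n → K.trans (K.*-congˡ (f≈0 i i<n)) (K.zeroʳ _))) (K.+-identityʳ _)))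
    where
    f≈0 : ∀ i → i ℕ.< n → f (n ∸ suc i) K.≈ K.0#
    f≈0 i i<n = K.trans (at[ h ] (n ∸ suc i) (ℕ.∸-monoʳ-< {o = 0} (s≤s z≤n) i<n)) (coeff-0 _)

  split : ∀ f → f ≈ const (f 0) + X * tail f
  split f = ⟪ aux ⟫
    where
    aux : ∀ n → f n K.≈ (const (f 0) + X * tail f) n
    aux zero = K.sym (K.trans (coeff-+ (const (f 0)) _ 0) (K.trans (K.+-congˡ (coeff-*-0 X (tail f)))
      (K.trans (K.+-congˡ (K.zeroˡ _)) (K.+-identityʳ _))))
    aux (suc n) = K.sym (K.trans (coeff-+ (const (f 0)) _ (suc n)) (K.trans (K.+-identityˡ _)
      (K.trans (coeff-*-suc X (tail f) n) (K.trans (K.+-congʳ (K.zeroˡ _)) (K.trans (K.+-identityˡ _) tX)))))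
      where
      tX : (tail X * tail f) n K.≈ f (suc n)
      tX = K.trans (at (*-congʳ tail-X) n)
                   (at (*-identityˡ (tail f)) n)

  X-coeff : ∀ f n → (X * f) (suc n) K.≈ f n
  X-coeff f n = K.trans (coeff-*-suc X f n) (K.trans (K.+-congʳ (K.zeroˡ _)) (K.trans (K.+-identityˡ _)
    (K.trans (at (*-congʳ tail-X) n)
             (at (*-identityˡ f) n))))

  *-mod-suc : ∀ {u f g N} → u 0 K.≈ K.0# → f ≈[ N ] g → u * f ≈[ suc N ] u * g
  *-mod-suc {u} {f} {g} {N} u0 h = ⟪ aux ⟫
    where
    aux : ∀ n → n ℕ.< suc N → (u * f) n K.≈ (u * g) n
    aux zero _ = K.trans (coeff-*-0 u f) (K.trans (K.*-congʳ u0) (K.trans (K.zeroˡ _)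
      (K.sym (K.trans (coeff-*-0 u g) (K.trans (K.*-congʳ u0) (K.zeroˡ _))))))
    aux (suc n) (s≤s n<N) = K.trans (coeff-*-suc u f n) (K.trans
      (K.+-cong (K.trans (K.*-congʳ u0) (K.trans (K.zeroˡ _) (K.sym (K.trans (K.*-congʳ u0) (K.zeroˡ _)))))
                (at[ Mod.*-congˡ N {tail u} h ] n n<N)) (K.sym (coeff-*-suc u g n)))

  0-coeff : ∀ {f N} → f ≈[ suc N ] 0# → f 0 K.≈ K.0#
  0-coeff h = K.trans (at[ h ] 0 (s≤s z≤n)) (coeff-0 0)

  mod-zero : ∀ {f g} → f ≈[ 0 ] g
  mod-zero = ⟪ (λ _ ()) ⟫

  mod-1 : ∀ {f} → f 0 K.≈ K.0# → f ≈[ 1 ] 0#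
  mod-1 h = ≈0-const h mod-zero

  *-order : ∀ {u f N} → u 0 K.≈ K.0# → f ≈[ N ] 0# → u * f ≈[ suc N ] 0#
  *-order {u} u0 h = Mod.trans _ (*-mod-suc u0 h) (mod (zeroʳ u))

  ^-order : ∀ {u} k → u 0 K.≈ K.0# → u ^ k ≈[ k ] 0#
  ^-order zero    u0 = mod-zero
  ^-order (suc k) u0 = *-order u0 (^-order k u0)

  cancel-*ˡ-mod : ∀ {g f} N → (∀ x → g 0 K.* x K.≈ K.0# → x K.≈ K.0#) → g * f ≈[ N ] 0# → f ≈[ N ] 0#
  cancel-*ˡ-mod zero    g0 h = mod-zero
  cancel-*ˡ-mod {g} {f} (suc n) g0 h = mod-suc ih
      (K.trans (g0 (f n) (K.trans (K.sym (coeff-*-leading g f n ih)) (K.trans (at[ h ] n ℕ.≤-refl) (coeff-0 n))))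
               (K.sym (coeff-0 n)))
    where ih = cancel-*ˡ-mod n g0 (mod-≤ (ℕ.n≤1+n n) h)

  ≈1-cancel : ∀ {y} → y K.≈ K.1# → ∀ x → y K.* x K.≈ K.0# → x K.≈ K.0#
  ≈1-cancel y≈1 x h = K.trans (K.sym (K.trans (K.*-congʳ y≈1) (K.*-identityˡ x))) h

  x-y≈0⇒x≈y : ∀ {x y} → x - y ≈ 0# → x ≈ y
  x-y≈0⇒x≈y {x} {y} h = trans (solve 2 (λ a b → a := (a :- b) :+ b) refl x y) (trans (+-congʳ h) (+-identityˡ y))

  cancel-*ˡ : ∀ {g f f′} → (∀ x → g 0 K.* x K.≈ K.0# → x K.≈ K.0#) → g * f ≈ g * f′ → f ≈ f′
  cancel-*ˡ {g} {f} {f′} g0 h = x-y≈0⇒x≈y (unmod λ N → cancel-*ˡ-mod N g0 (mod (trans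
    (solve 3 (λ a b c → a :* (b :- c) := a :* b :- a :* c) refl g f f′)
    (trans (+-congʳ h) (-‿inverseʳ _)))))

  opaque
    subst : Series → Series → Series
    subst = PowerSeries.substitute R

    subst≡substitute : ∀ a u → subst a u ≡ PowerSeries.substitute R a u
    subst≡substitute a u = ≡.refl

    ^≈^ˢ : ∀ u k n → PowerSeries._^ˢ_ R u k n K.≈ (u ^ k) n
    ^≈^ˢ u zero    n = K.reflexive (≡.cong (λ f → f n) (≡.sym (SeriesRing.𝟙≡1ˢ R)))
    ^≈^ˢ u (suc k) n = K.trans (SeriesRing.*ˢ-cong R {u} {u} {PowerSeries._^ˢ_ R u k} {u ^ k} (λ _ → K.refl) (^≈^ˢ u k) n)
      (K.reflexive (≡.cong (λ f → f n) (≡.sym (SeriesRing.⊛≡*ˢ R u (u ^ k)))))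

    coeff-subst : ∀ a u n → subst a u n K.≈ K.∑ (suc n) (λ k → a k K.* (u ^ k) n)
    coeff-subst a u n = K.trans (K.reflexive (K.sum≡∑ (suc n) λ k → a k K.* PowerSeries._^ˢ_ R u k n))
      (K.∑-cong′ (suc n) λ k → K.*-congˡ (^≈^ˢ u k n))

  module _ {u : Series} (u0 : u 0 K.≈ K.0#) where

    subst-mod-poly : ∀ a N → subst a u ≈[ N ] ∑ N (λ k → const (a k) * u ^ k)
    subst-mod-poly a N = ⟪ (λ n n<N → K.trans (coeff-subst a u n) (K.trans
      (K.sym (K.∑-truncate n<N λ k n<k → K.trans (K.*-congˡ (K.trans (at[ ^-order k u0 ] n n<k) (coeff-0 n))) (K.zeroʳ _)))
      (K.trans (K.∑-cong′ N λ k → K.sym (coeff-const-* (a k) (u ^ k) n)) (K.sym (coeff-∑ N (λ k → const (a k) * u ^ k) n))))) ⟫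

    subst-unfold : ∀ a → subst a u ≈ const (a 0) + u * subst (tail a) u
    subst-unfold a = unmod λ N → mod-≤ (ℕ.n≤1+n N) (Mod.trans _ (subst-mod-poly a (suc N)) (Mod.trans _ (mod (step N))
        (Mod.+-congˡ _ (*-mod-suc u0 (Mod.sym _ (subst-mod-poly (tail a) N))))))
      where
      step : ∀ N → ∑ (suc N) (λ k → const (a k) * u ^ k) ≈ const (a 0) + u * ∑ N (λ k → const (tail a k) * u ^ k)
      step N = trans ∑-cons (+-cong (*-identityʳ _) (trans (∑-cong′ N λ k →
        solve 3 (λ x y z → x :* (y :* z) := y :* (x :* z)) refl (const (a (suc k))) u (u ^ k)) (sym (*-distribˡ-∑ N u))))

    private
      unfold-mod : ∀ {N a b} → const (a 0) + u * subst (tail a) u ≈[ N ] b → subst a u ≈[ N ] b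
      unfold-mod {N} {a} h = Mod.trans N (mod (subst-unfold a)) h

    -- In the inductive proofs below, u * φ is determined modulo q^(N+1) by
    -- φ modulo q^N.
    subst-cong-mod : ∀ N {a b} → a ≈[ N ] b → subst a u ≈[ N ] subst b u
    subst-cong-mod zero    h = mod-zero
    subst-cong-mod (suc N) {a} {b} h = unfold-mod (Mod.trans (suc N)
      (Mod.+-cong (suc N) (mod (const-cong (at[ h ] 0 (s≤s z≤n)))) (*-mod-suc u0 (subst-cong-mod N (tail-cong h))))
      (mod (sym (subst-unfold b))))

    subst-cong : ∀ {a b} → a ≈ b → subst a u ≈ subst b u
    subst-cong h = unmod λ N → subst-cong-mod N (mod h)

    subst-coeff-0 : ∀ a → subst a u 0 K.≈ a 0
    subst-coeff-0 a = K.trans (at (subst-unfold a) 0) (K.trans (coeff-+ _ _ 0)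
      (K.trans (K.+-congˡ (K.trans (coeff-*-0 u _) (K.trans (K.*-congʳ u0) (K.zeroˡ _)))) (K.+-identityʳ _)))

    subst-0 : subst 0# u ≈ 0#
    subst-0 = unmod go
      where
      go : ∀ N → subst 0# u ≈[ N ] 0#
      go zero    = mod-zero
      go (suc N) = unfold-mod (Mod.trans (suc N)
        (Mod.+-cong (suc N) (mod (trans (const-cong (coeff-0 0)) const-0))
          (*-order u0 (Mod.trans N (subst-cong-mod N ⟪ (λ n _ → K.trans (coeff-0 (suc n)) (K.sym (coeff-0 n))) ⟫) (go N))))
        (mod (+-identityˡ 0#)))

    subst-const : ∀ x → subst (const x) u ≈ const x
    subst-const x = trans (subst-unfold (const x)) (trans (+-congˡ (trans
      (*-congˡ (trans (subst-cong {tail (const x)} {0#} ⟪ (λ n → K.sym (coeff-0 n)) ⟫) subst-0)) (zeroʳ u))) (+-identityʳ _))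

    subst-1 : subst 1# u ≈ 1#
    subst-1 = trans (subst-cong (sym const-1)) (trans (subst-const K.1#) const-1)

    subst-+ : ∀ a b → subst (a + b) u ≈ subst a u + subst b u
    subst-+ a b = unmod λ N → go N a b
      where
      go : ∀ N a b → subst (a + b) u ≈[ N ] subst a u + subst b u
      go zero    a b = mod-zero
      go (suc N) a b = unfold-mod (Mod.trans (suc N)
        (Mod.+-cong (suc N) (mod (trans (const-cong (coeff-+ a b 0)) (const-+ _ _)))
          (*-mod-suc u0 (Mod.trans N (subst-cong-mod N (mod (tail-+ a b))) (go N (tail a) (tail b)))))
        (mod (trans (solve 5 (λ x y u s t → x :+ y :+ u :* (s :+ t) := (x :+ u :* s) :+ (y :+ u :* t)) refl _ _ u _ _)
                    (sym (+-cong (subst-unfold a) (subst-unfold b))))))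

    subst-* : ∀ a b → subst (a * b) u ≈ subst a u * subst b u
    subst-* a b = unmod λ N → go N a b
      where
      go : ∀ N a b → subst (a * b) u ≈[ N ] subst a u * subst b u
      go zero    a b = mod-zero
      go (suc N) a b = unfold-mod (Mod.trans (suc N)
        (Mod.+-cong (suc N) (mod (trans (const-cong (coeff-*-0 a b)) (const-* _ _)))
          (*-mod-suc u0 (Mod.trans N (mod (trans (subst-cong (tail-* a b)) (subst-+ _ _)))
            (Mod.+-cong N (Mod.trans N (go N (const (a 0)) (tail b)) (mod (*-congʳ (subst-const (a 0))))) (go N (tail a) b)))))
        (mod (begin
          const (a 0) * const (b 0) + u * (const (a 0) * subst (tail b) u + subst (tail a) u * subst b u)
            ≈⟨ +-congˡ (*-congˡ (+-congˡ (*-congˡ (subst-unfold b)))) ⟩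
          const (a 0) * const (b 0) + u * (const (a 0) * subst (tail b) u + subst (tail a) u * (const (b 0) + u * subst (tail b) u))
            ≈⟨ solve 5 (λ x y u s t → x :* y :+ u :* (x :* t :+ s :* (y :+ u :* t)) := (x :+ u :* s) :* (y :+ u :* t)) refl
                 (const (a 0)) (const (b 0)) u _ _ ⟩
          (const (a 0) + u * subst (tail a) u) * (const (b 0) + u * subst (tail b) u)
            ≈⟨ *-cong (subst-unfold a) (subst-unfold b) ⟨
          subst a u * subst b u ∎)))

    subst-neg : ∀ a → subst (- a) u ≈ - subst a u
    subst-neg a = begin
      subst (- a) u                       ≈⟨ subst-cong (-1*x≈-x a) ⟨
      subst (- 1# * a) u                  ≈⟨ subst-* (- 1#) a ⟩
      subst (- 1#) u * subst a u          ≈⟨ *-congʳ (trans (subst-cong (trans (-‿cong (sym const-1)) (sym (const-neg _)))) (subst-const _)) ⟩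
      const (K.- K.1#) * subst a u        ≈⟨ *-congʳ (trans (const-neg _) (-‿cong const-1)) ⟩
      - 1# * subst a u                    ≈⟨ -1*x≈-x _ ⟩
      - subst a u                         ∎
      where open RingProperties ring using (-1*x≈-x)

    subst-- : ∀ a b → subst (a - b) u ≈ subst a u - subst b u
    subst-- a b = trans (subst-+ a (- b)) (+-congˡ (subst-neg b))

    subst-· : ∀ k a → subst (k · a) u ≈ k · subst a u
    subst-· zero    a = subst-0
    subst-· (suc k) a = trans (subst-+ a _) (+-congˡ (subst-· k a))

    subst-^ : ∀ a k → subst (a ^ k) u ≈ subst a u ^ k
    subst-^ a zero    = subst-1
    subst-^ a (suc k) = trans (subst-* a _) (*-congˡ (subst-^ a k))

    subst-X : subst X u ≈ u
    subst-X = trans (subst-unfold X) (trans (+-cong const-0 (*-congˡ (trans (subst-cong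
      tail-X) subst-1)))
      (trans (+-identityˡ _) (*-identityʳ u)))

    subst-∑ : ∀ N F → subst (∑ N F) u ≈ ∑ N (λ i → subst (F i) u)
    subst-∑ zero    F = trans (subst-cong ∑-nil) (trans subst-0 (sym ∑-nil))
    subst-∑ (suc N) F = trans (subst-cong ∑-cons) (trans (subst-+ _ _) (trans (+-congˡ (subst-∑ N (F ∘ suc))) (sym ∑-cons)))

    subst-order : ∀ N {k a} → (∀ {M f} → f ≈[ M ] 0# → u * f ≈[ k ℕ.+ M ] 0#) →
                  a ≈[ N ] 0# → subst a u ≈[ N ℕ.* k ] 0#
    subst-order zero    {k} uk h = mod-zero
    subst-order (suc N) {k} uk h = unfold-mod (Mod.trans (suc N ℕ.* k)
      (Mod.+-cong (suc N ℕ.* k) (mod (trans (const-cong (0-coeff h)) const-0))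
        (uk (subst-order N uk (Mod.trans N (tail-cong h) ⟪ (λ n _ → K.trans (coeff-0 (suc n)) (K.sym (coeff-0 n))) ⟫))))
      (mod (+-identityˡ 0#)))

  module SubstHom {u : Series} (u0 : u 0 K.≈ K.0#) where
    cong       = λ {a b} → subst-cong {u} u0 {a} {b}
    cong-mod   = λ {N a b} → subst-cong-mod {u} u0 N {a} {b}
    homo-+     = subst-+ {u} u0
    homo-*     = subst-* {u} u0
    homo-neg   = subst-neg {u} u0
    homo--     = subst-- {u} u0
    homo-·     = subst-· {u} u0
    homo-^     = subst-^ {u} u0
    homo-0     = subst-0 {u} u0
    homo-1     = subst-1 {u} u0
    homo-const = subst-const {u} u0
    homo-∑     = subst-∑ {u} u0

  subst-congʳ : ∀ {u w} (u0 : u 0 K.≈ K.0#) → u ≈ w → ∀ a → subst a u ≈ subst a w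
  subst-congʳ {u} {w} u0 u≈w a = unmod λ N → go N a
    where
    w0 = K.trans (K.sym (at u≈w 0)) u0
    go : ∀ N a → subst a u ≈[ N ] subst a w
    go zero    a = mod-zero
    go (suc N) a = Mod.trans (suc N) (mod (subst-unfold u0 a)) (Mod.trans (suc N)
      (Mod.+-congˡ (suc N) (Mod.trans (suc N) (*-mod-suc u0 (go N (tail a))) (mod (*-congʳ u≈w)))) (mod (sym (subst-unfold w0 a))))

  subst-0-order : ∀ {t u} → t 0 K.≈ K.0# → u 0 K.≈ K.0# → subst t u 0 K.≈ K.0#
  subst-0-order {t} t0 u0 = K.trans (subst-coeff-0 u0 t) t0

  subst-assoc : ∀ {t u} → t 0 K.≈ K.0# → u 0 K.≈ K.0# → ∀ a → subst (subst a t) u ≈ subst a (subst t u)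
  subst-assoc {t} {u} t0 u0 a = unmod λ N → go N a
    where
    tu0 = subst-0-order t0 u0
    go : ∀ N a → subst (subst a t) u ≈[ N ] subst a (subst t u)
    go zero    a = mod-zero
    go (suc N) a = Mod.trans (suc N) (mod (trans (subst-cong u0 (subst-unfold t0 a)) (trans (subst-+ u0 _ _)
        (+-cong (subst-const u0 (a 0)) (subst-* u0 t _)))))
      (Mod.trans (suc N) (Mod.+-congˡ (suc N) (*-mod-suc tu0 (go N (tail a)))) (mod (sym (subst-unfold tu0 a))))

  inverse : Series → Series
  inverse f = subst (λ _ → K.1#) (1# - f)

  *-inverse : ∀ {f} → f 0 K.≈ K.1# → f * inverse f ≈ 1#
  *-inverse {f} f0 = begin
    f * s                          ≈⟨ solve 2 (λ f s → f :* s := s :- (:1 :- f) :* s) refl f s ⟩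
    s - (1# - f) * s               ≈⟨ +-congʳ (subst-unfold u0 _) ⟩
    const K.1# + (1# - f) * s - (1# - f) * s  ≈⟨ +-congʳ (+-congʳ const-1) ⟩
    1# + (1# - f) * s - (1# - f) * s          ≈⟨ solve 2 (λ f s → :1 :+ (:1 :- f) :* s :- (:1 :- f) :* s := :1) refl f s ⟩
    1#                             ∎
    where
    s = inverse f
    u0 : (1# - f) 0 K.≈ K.0#
    u0 = K.trans (coeff-- 1# f 0) (K.trans (K.+-cong coeff-1-0 (K.-‿cong f0)) (K.-‿inverseʳ K.1#))

  open RingProperties ring using (-0#≈0#)

  private
    ×-0 : ∀ m → m K.× K.0# K.≈ K.0#
    ×-0 zero    = K.refl
    ×-0 (suc m) = K.trans (K.+-identityˡ _) (×-0 m)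

  opaque
    D ∂ : Series → Series
    D f n = n K.× f n
    ∂ f n = suc n K.× f (suc n)

    coeff-D : ∀ f n → D f n K.≈ n K.× f n
    coeff-D f n = K.refl

    coeff-∂ : ∀ f n → ∂ f n K.≈ suc n K.× f (suc n)
    coeff-∂ f n = K.refl

    D-cong-mod : ∀ {N f g} → f ≈[ N ] g → D f ≈[ N ] D g
    D-cong-mod h = ⟪ (λ n n<N → K.×-congʳ n (at[ h ] n n<N)) ⟫

    D-cong : ∀ {f g} → f ≈ g → D f ≈ D g
    D-cong h = ⟪ (λ n → K.×-congʳ n (at h n)) ⟫

    D-+ : ∀ f g → D (f + g) ≈ D f + D g
    D-+ f g = ⟪ (λ n → K.trans (K.×-congʳ n (coeff-+ f g n)) (K.trans (K.×-distrib-+ _ _ n) (K.sym (coeff-+ (D f) (D g) n)))) ⟫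

    D-* : ∀ f g → D (f * g) ≈ D f * g + f * D g
    D-* f g = ⟪ (λ n → K.trans (K.×-congʳ n (coeff-* f g n)) (K.trans (×-∑ n (suc n))
        (K.trans (K.∑-cong (suc n) (λ { i (s≤s i≤n) → leibniz n i i≤n }))
        (K.trans (K.∑-distrib-+ (suc n)) (K.trans (K.sym (K.+-cong (coeff-* (D f) g n) (coeff-* f (D g) n)))
          (K.sym (coeff-+ (D f * g) (f * D g) n))))))) ⟫
      where
      ×-∑ : ∀ m n {h} → m K.× K.∑ n h K.≈ K.∑ n (λ i → m K.× h i)
      ×-∑ m zero    = K.trans (K.×-congʳ m K.∑-nil) (K.trans (×-0 m) (K.sym K.∑-nil))
      ×-∑ m (suc n) = K.trans (K.×-congʳ m K.∑-cons) (K.trans (K.×-distrib-+ _ _ m)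
        (K.trans (K.+-congˡ (×-∑ m n)) (K.sym K.∑-cons)))
      leibniz : ∀ n i → i ℕ.≤ n → n K.× (f i K.* g (n ∸ i)) K.≈ (i K.× f i) K.* g (n ∸ i) K.+ f i K.* ((n ∸ i) K.× g (n ∸ i))
      leibniz n i i≤n = K.trans (K.reflexive (≡.cong (K._× (f i K.* g (n ∸ i))) (≡.sym (ℕ.m+[n∸m]≡n i≤n))))
        (K.trans (K.×-homo-+ _ i (n ∸ i)) (K.sym (K.+-cong (K.×-assoc-* i _ _) (K.×-comm-* (n ∸ i) _ _))))

    D-const : ∀ x → D (const x) ≈ 0#
    D-const x = ⟪ (λ { zero → K.sym (coeff-0 0) ; (suc n) → K.trans (×-0 (suc n)) (K.sym (coeff-0 (suc n))) }) ⟫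

    D≈X∂ : ∀ f → D f ≈ X * ∂ f
    D≈X∂ f = ⟪ (λ { zero → K.sym (K.trans (coeff-*-0 X _) (K.zeroˡ _)) ; (suc n) → K.sym (X-coeff (∂ f) n) }) ⟫

    ∂-tail : ∀ f → ∂ f ≈ tail f + X * ∂ (tail f)
    ∂-tail f = ⟪ aux ⟫
      where
      aux : ∀ n → ∂ f n K.≈ (tail f + X * ∂ (tail f)) n
      aux zero = K.trans (K.+-identityʳ _) (K.sym (K.trans (coeff-+ (tail f) _ 0) (K.trans (K.+-congˡ
        (K.trans (coeff-*-0 X _) (K.zeroˡ _))) (K.+-identityʳ _))))
      aux (suc n) = K.sym (K.trans (coeff-+ (tail f) _ (suc n)) (K.+-congˡ (X-coeff (∂ (tail f)) n)))

  D-1 : D 1# ≈ 0#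
  D-1 = trans (D-cong (sym const-1)) (D-const _)

  D-0 : D 0# ≈ 0#
  D-0 = trans (D-cong (sym const-0)) (D-const _)

  D-· : ∀ k f → D (k · f) ≈ k · D f
  D-· zero    f = D-0
  D-· (suc k) f = trans (D-+ f _) (+-congˡ (D-· k f))

  D-neg : ∀ f → D (- f) ≈ - D f
  D-neg f = begin
    D (- f)                 ≈⟨ solve 2 (λ x y → x := (x :+ y) :- y) refl (D (- f)) (D f) ⟩
    D (- f) + D f - D f     ≈⟨ +-congʳ (sym (D-+ (- f) f)) ⟩
    D (- f + f) - D f       ≈⟨ +-congʳ (trans (D-cong (-‿inverseˡ f)) D-0) ⟩
    0# - D f                ≈⟨ +-identityˡ _ ⟩
    - D f                   ∎

  D-- : ∀ f g → D (f - g) ≈ D f - D g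
  D-- f g = trans (D-+ f (- g)) (+-congˡ (D-neg g))

  D-X : D X ≈ X
  D-X = ⟪ (λ { zero → coeff-D X 0 ; (suc zero) → K.trans (coeff-D X 1) (K.+-identityʳ _)
             ; (suc (suc n)) → K.trans (coeff-D X (2 ℕ.+ n)) (×-0 (2 ℕ.+ n)) }) ⟫

  D-^ : ∀ f l k → D f ≈ l * f → D (f ^ k) ≈ (k · l) * f ^ k
  D-^ f l zero    h = trans D-1 (sym (zeroˡ _))
  D-^ f l (suc k) h = trans (D-* f _) (trans (+-cong (*-congʳ h) (*-congˡ (D-^ f l k h)))
    (solve 4 (λ f l m p → l :* f :* p :+ f :* (m :* p) := (l :+ m) :* (f :* p)) refl f l (k · l) (f ^ k)))

  D-*-log : ∀ {f g l m} → D f ≈ l * f → D g ≈ m * g → D (f * g) ≈ (l + m) * (f * g)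
  D-*-log {f} {g} {l} {m} hf hg = trans (D-* f g) (trans (+-cong (*-congʳ hf) (*-congˡ hg))
    (solve 4 (λ f g l m → l :* f :* g :+ f :* (m :* g) := (l :+ m) :* (f :* g)) refl f g l m))

  D-subst : ∀ {u} → u 0 K.≈ K.0# → ∀ a → D (subst a u) ≈ subst (∂ a) u * D u
  D-subst {u} u0 a = unmod λ N → go N a
    where
    go : ∀ N a → D (subst a u) ≈[ N ] subst (∂ a) u * D u
    go zero    a = mod-zero
    go (suc N) a = Mod.trans (suc N) (mod (trans (D-cong (subst-unfold u0 a)) (trans (D-+ _ _)
          (+-cong (D-const (a 0)) (D-* u _)))))
      (Mod.trans (suc N) (Mod.+-congˡ (suc N) (Mod.+-congˡ (suc N) (*-mod-suc u0 (go N (tail a)))))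
      (mod (begin
        0# + (D u * subst (tail a) u + u * (subst (∂ (tail a)) u * D u))
          ≈⟨ solve 4 (λ d s u p → # 0 :+ (d :* s :+ u :* (p :* d)) := (s :+ u :* p) :* d) refl (D u) (subst (tail a) u) u (subst (∂ (tail a)) u) ⟩
        (subst (tail a) u + u * subst (∂ (tail a)) u) * D u
          ≈⟨ *-congʳ (trans (subst-cong u0 (∂-tail a)) (trans (subst-+ u0 _ _) (+-congˡ (trans (subst-* u0 X _) (*-congʳ (subst-X u0)))))) ⟨
        subst (∂ a) u * D u ∎)))

  ode-zero : ∀ {g h y n₀} → g 0 K.≈ K.1# → (∀ n → n₀ ℕ.≤ n → ∀ x → (n K.× K.1# K.- h 0) K.* x K.≈ K.0# → x K.≈ K.0#) →
             y ≈[ n₀ ] 0# → g * D y ≈ h * y → y ≈ 0#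
  ode-zero {g} {h} {y} {n₀} g0 regular y≈0 eq = unmod λ N → mod-≤ (ℕ.m≤n+m N n₀) (go N)
    where
    go : ∀ N → y ≈[ n₀ ℕ.+ N ] 0#
    go zero    = ≡.subst (λ n → y ≈[ n ] 0#) (≡.sym (ℕ.+-identityʳ n₀)) y≈0
    go (suc N) = ≡.subst (λ n → y ≈[ n ] 0#) (≡.sym (ℕ.+-suc n₀ N)) (mod-suc (go N)
      (K.trans (regular n (ℕ.m≤m+n n₀ N) (y n) coeff) (K.sym (coeff-0 n))))
      where
      n = n₀ ℕ.+ N
      lhs : (g * D y) n K.≈ n K.× K.1# K.* y n
      lhs = K.trans (coeff-*-leading g (D y) n (Mod.trans n (D-cong-mod (go N)) (mod D-0)))
        (K.trans (K.*-cong g0 (coeff-D y n)) (K.trans (K.*-identityˡ _)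
          (K.trans (K.×-congʳ n (K.sym (K.*-identityˡ _))) (K.sym (K.×-assoc-* n _ _)))))
      coeff : (n K.× K.1# K.- h 0) K.* y n K.≈ K.0#
      coeff = K.trans (K.solve 3 (λ a b c → (a :- b) :* c := a :* c :- b :* c) K.refl _ _ _)
        (K.trans (K.+-cong (K.sym lhs) (K.-‿cong (K.sym (coeff-*-leading h y n (go N)))))
        (K.trans (K.+-congʳ (at eq n)) (K.-‿inverseʳ _)))

  ode-unique : ∀ {g h y z n₀} → g 0 K.≈ K.1# → (∀ n → n₀ ℕ.≤ n → ∀ x → (n K.× K.1# K.- h 0) K.* x K.≈ K.0# → x K.≈ K.0#) →
               y ≈[ n₀ ] z → g * D y ≈ h * y → g * D z ≈ h * z → y ≈ z
  ode-unique {g} {h} {y} {z} {n₀} g0 regular y≈z hy hz = x-y≈0⇒x≈y (ode-zero g0 regular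
    (Mod.trans n₀ (Mod.+-congʳ n₀ y≈z) (mod (-‿inverseʳ z)))
    (trans (*-congˡ (D-- y z)) (trans (solve 3 (λ g a b → g :* (a :- b) := g :* a :- g :* b) refl g _ _)
      (trans (+-cong hy (-‿cong hz)) (solve 3 (λ g a b → g :* a :- g :* b := g :* (a :- b)) refl h _ _)))))

  neg-X-0 : (- X) 0 K.≈ K.0#
  neg-X-0 = K.trans (coeff-neg X 0) K.-0#≈0#

  X²-0 : (X * X) 0 K.≈ K.0#
  X²-0 = K.trans (coeff-*-0 X X) (K.zeroˡ _)

  flip dilate : Series → Series
  flip f   = subst f (- X)
  dilate f = subst f (X * X)

  module Flip = SubstHom { - X } neg-X-0
  module Dilate = SubstHom {X * X} X²-0

  D-flip : ∀ f → D (flip f) ≈ flip (D f)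
  D-flip f = trans (D-subst neg-X-0 f) (trans (*-congˡ (trans (D-neg X) (-‿cong D-X))) (trans (*-comm _ _)
    (sym (trans (Flip.cong (D≈X∂ f)) (trans (Flip.homo-* X _) (*-congʳ (subst-X neg-X-0)))))))

  D-dilate : ∀ f → D (dilate f) ≈ 2 · dilate (D f)
  D-dilate f = trans (D-subst X²-0 f) (trans (*-congˡ (trans (D-* X X) (+-cong (*-congʳ D-X) (*-congˡ D-X))))
    (trans (solve 2 (λ a x → a :* (x :* x :+ x :* x) := 2 :× (x :* x :* a)) refl _ X)
      (sym (×-congʳ 2 (trans (Dilate.cong (D≈X∂ f)) (trans (Dilate.homo-* X _) (*-congʳ (subst-X X²-0))))))))

  flip-flip : ∀ f → flip (flip f) ≈ f
  flip-flip f = trans (subst-assoc neg-X-0 neg-X-0 f) (trans (subst-congʳ (K.trans (at e 0) K.refl) e f) subst-id)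
    where
    e : flip (- X) ≈ X
    e = trans (Flip.homo-neg X) (trans (-‿cong (subst-X neg-X-0)) (solve 1 (λ x → :- (:- x) := x) refl X))
    subst-id : subst f X ≈ f
    subst-id = unmod λ N → go N f
      where
      go : ∀ N f → subst f X ≈[ N ] f
      go zero    f = mod-zero
      go (suc N) f = Mod.trans (suc N) (mod (subst-unfold K.refl f)) (Mod.trans (suc N)
        (Mod.+-congˡ (suc N) (*-mod-suc K.refl (go N (tail f)))) (mod (sym (split f))))

  flip-dilate : ∀ f → flip (dilate f) ≈ dilate f
  flip-dilate f = trans (subst-assoc X²-0 neg-X-0 f) (subst-congʳ (K.trans (at e 0) X²-0) e f)
    where
    e : flip (X * X) ≈ X * X
    e = trans (Flip.homo-* X X) (trans (*-cong (subst-X neg-X-0) (subst-X neg-X-0)) (solve 1 (λ x → (:- x) :* (:- x) := x :* x) refl X))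

  dilate-order : ∀ N {f} → f ≈[ N ] 0# → dilate f ≈[ N ℕ.* 2 ] 0#
  dilate-order N = subst-order X²-0 N λ h → Mod.trans _ (mod (*-assoc X X _)) (*-order K.refl (*-order K.refl h))

  private
    flip-unfold : ∀ f → flip f ≈ const (f 0) + - X * flip (tail f)
    flip-unfold f = subst-unfold neg-X-0 f

    flip-odd-mod : ∀ N f → (∀ n → f (2 ℕ.* n) K.≈ K.0#) → flip f ≈[ N ] - f
    flip-even-mod : ∀ N f → (∀ n → f (suc (2 ℕ.* n)) K.≈ K.0#) → flip f ≈[ N ] f
    flip-odd-mod zero    f h = mod-zero
    flip-odd-mod (suc N) f h = Mod.trans (suc N) (mod (flip-unfold f)) (Mod.trans (suc N)
      (Mod.+-congˡ (suc N) (*-mod-suc neg-X-0 (flip-even-mod N (tail f) λ n →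
        K.trans (K.reflexive (≡.cong f (≡.sym (ℕ.*-suc 2 n)))) (h (suc n)))))
      (mod (trans (+-congʳ (trans (const-cong (h 0)) const-0)) (trans (solve 2 (λ x t → # 0 :+ :- x :* t := :- (# 0 :+ x :* t)) refl X (tail f))
        (-‿cong (trans (+-congʳ (sym (trans (const-cong (h 0)) const-0))) (sym (split f))))))))
    flip-even-mod zero    f h = mod-zero
    flip-even-mod (suc N) f h = Mod.trans (suc N) (mod (flip-unfold f)) (Mod.trans (suc N)
      (Mod.+-congˡ (suc N) (*-mod-suc neg-X-0 (flip-odd-mod N (tail f) h)))
      (mod (trans (solve 3 (λ a x t → a :+ :- x :* :- t := a :+ x :* t) refl _ X (tail f)) (sym (split f)))))

  flip-odd : ∀ f → (∀ n → f (2 ℕ.* n) K.≈ K.0#) → flip f ≈ - f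
  flip-odd f h = unmod λ N → flip-odd-mod N f h

  -- Infinite sums and products

  +ˢ≈+ : ∀ f g → f +ˢ g ≈ f + g
  +ˢ≈+ f g = ⟪ (λ n → K.sym (coeff-+ f g n)) ⟫

  -ˢ≈- : ∀ f g → f -ˢ g ≈ f - g
  -ˢ≈- f g = ⟪ (λ n → K.sym (coeff-- f g n)) ⟫

  *ˢ≈* : ∀ f g → f *ˢ g ≈ f * g
  *ˢ≈* f g = ⟪ (λ n → K.reflexive (≡.cong (λ h → h n) (≡.sym (SeriesRing.⊛≡*ˢ R f g)))) ⟫

  1ˢ≈1 : 1ˢ ≈ 1#
  1ˢ≈1 = ⟪ (λ n → K.reflexive (≡.cong (λ h → h n) (≡.sym (SeriesRing.𝟙≡1ˢ R)))) ⟫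

  ^ˢ≈^ : ∀ f k → f ^ˢ k ≈ f ^ k
  ^ˢ≈^ f k = ⟪ ^≈^ˢ f k ⟫

  substitute≈subst : ∀ a u → substitute a u ≈ subst a u
  substitute≈subst a u = reflexive (≡.sym (subst≡substitute a u))

  ^-cong : ∀ {f g} k → f ≈ g → f ^ k ≈ g ^ k
  ^-cong zero    h = refl
  ^-cong (suc k) h = *-cong h (^-cong k h)

  inverseˢ≈inverse : ∀ {f} → f 0 K.≈ K.1# → inverseˢ f ≈ inverse f
  inverseˢ≈inverse {f} f0 = trans (substitute≈subst _ _) (subst-congʳ
    (K.trans (K.+-congˡ (K.-‿cong f0)) (K.-‿inverseʳ K.1#)) (trans (-ˢ≈- 1ˢ f) (+-congʳ 1ˢ≈1)) _)

  Summable : (ℕ → Series) → Set ℓ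
  Summable s = ∀ k → s k ≈[ suc k ] 0#

  opaque
    Tot : (ℕ → Series) → Series
    Tot s n = ∑ n s n

    tot-mod : ∀ {s} → Summable s → ∀ N → Tot s ≈[ suc N ] ∑ N s
    tot-mod {s} s≈0 N = ⟪ (λ { n (s≤s n≤N) → K.trans (coeff-∑ n s n) (K.trans
      (K.sym (K.∑-truncate n≤N λ i n≤i → K.trans (at[ s≈0 i ] n (s≤s n≤i)) (coeff-0 n))) (K.sym (coeff-∑ N s n))) }) ⟫

  tot-unique : ∀ {s f} → Summable s → (∀ N → f ≈[ suc N ] ∑ N s) → f ≈ Tot s
  tot-unique s≈0 h = unmod λ N → mod-≤ (ℕ.n≤1+n N) (Mod.trans (suc N) (h N) (Mod.sym (suc N) (tot-mod s≈0 N)))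

  tot-cong : ∀ {s t} → Summable t → (∀ k → s k ≈ t k) → Tot s ≈ Tot t
  tot-cong t≈0 h = tot-unique t≈0 λ N → Mod.trans (suc N)
    (tot-mod (λ k → Mod.trans (suc k) (mod (h k)) (t≈0 k)) N) (mod (∑-cong′ N h))

  tot-+ : ∀ {s t} → Summable s → Summable t → Tot s + Tot t ≈ Tot (λ k → s k + t k)
  tot-+ s≈0 t≈0 = tot-unique (λ k → Mod.trans (suc k) (Mod.+-cong (suc k) (s≈0 k) (t≈0 k)) (mod (+-identityˡ 0#)))
    λ N → Mod.trans (suc N) (Mod.+-cong (suc N) (tot-mod s≈0 N) (tot-mod t≈0 N)) (mod (sym (∑-distrib-+ N)))

  summable-* : ∀ f {s} → Summable s → Summable (λ k → f * s k)
  summable-* f s≈0 k = Mod.trans (suc k) (Mod.*-congˡ (suc k) (s≈0 k)) (mod (zeroʳ f))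

  summable-*′ : ∀ (f : ℕ → Series) {s} → Summable s → Summable (λ k → f k * s k)
  summable-*′ f s≈0 k = Mod.trans (suc k) (Mod.*-congˡ (suc k) (s≈0 k)) (mod (zeroʳ (f k)))

  summable-+ : ∀ {s t} → Summable s → Summable t → Summable (λ k → s k + t k)
  summable-+ s≈0 t≈0 k = Mod.trans (suc k) (Mod.+-cong (suc k) (s≈0 k) (t≈0 k)) (mod (+-identityˡ 0#))

  summable-suc : ∀ {s} → Summable s → Summable (s ∘ suc)
  summable-suc s≈0 k = mod-≤ (ℕ.n≤1+n _) (s≈0 (suc k))

  tot-* : ∀ f {s} → Summable s → f * Tot s ≈ Tot (λ k → f * s k)
  tot-* f s≈0 = tot-unique (summable-* f s≈0) λ N →
    Mod.trans (suc N) (Mod.*-congˡ (suc N) (tot-mod s≈0 N)) (mod (*-distribˡ-∑ N f))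

  tot-neg : ∀ {s} → Summable s → - Tot s ≈ Tot (λ k → - s k)
  tot-neg s≈0 = tot-unique (λ k → Mod.trans (suc k) (Mod.-‿cong (suc k) (s≈0 k)) (mod (trans (solve 0 (:- # 0 := # 0) refl) refl)))
    λ N → Mod.trans (suc N) (Mod.-‿cong (suc N) (tot-mod s≈0 N)) (mod (sym (∑-distrib-neg N)))

  D-∑ : ∀ N F → D (∑ N F) ≈ ∑ N (D ∘ F)
  D-∑ zero    F = trans (D-cong ∑-nil) (trans D-0 (sym ∑-nil))
  D-∑ (suc N) F = trans (D-cong ∑-cons) (trans (D-+ _ _) (trans (+-congˡ (D-∑ N (F ∘ suc))) (sym ∑-cons)))

  tot-D : ∀ {s} → Summable s → D (Tot s) ≈ Tot (D ∘ s)
  tot-D {s} s≈0 = tot-unique (λ k → Mod.trans (suc k) (D-cong-mod (s≈0 k)) (mod D-0)) λ N →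
    Mod.trans (suc N) (D-cong-mod (tot-mod s≈0 N)) (mod (D-∑ N s))

  tot-subst : ∀ {u} (u0 : u 0 K.≈ K.0#) {s} → Summable s → subst (Tot s) u ≈ Tot (λ k → subst (s k) u)
  tot-subst u0 {s} s≈0 = tot-unique (λ k → Mod.trans (suc k) (subst-cong-mod u0 (suc k) (s≈0 k)) (mod (subst-0 u0))) λ N →
    Mod.trans (suc N) (subst-cong-mod u0 (suc N) (tot-mod s≈0 N)) (mod (subst-∑ u0 N s))

  tot-cons : ∀ {s} → Summable s → Tot s ≈ s 0 + Tot (s ∘ suc)
  tot-cons {s} s≈0 = unmod λ N → Mod.trans N (mod-≤ (ℕ.≤-trans (ℕ.n≤1+n N) (ℕ.n≤1+n _)) (tot-mod s≈0 (suc N)))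
    (Mod.trans N (mod ∑-cons) (Mod.+-congˡ N (Mod.sym N (mod-≤ (ℕ.n≤1+n N) (tot-mod (summable-suc s≈0) N)))))

  ∑-pairs : ∀ N {s : ℕ → Series} → ∑ (2 ℕ.* N) s ≈ ∑ N (λ k → s (2 ℕ.* k) + s (suc (2 ℕ.* k)))
  ∑-pairs zero    = trans ∑-nil (sym ∑-nil)
  ∑-pairs (suc N) {s} = trans (reflexive (≡.cong (λ n → ∑ n s) (ℕ.*-suc 2 N))) (trans (∑-snoc (suc (2 ℕ.* N)))
    (trans (+-congʳ (trans (∑-snoc (2 ℕ.* N)) (+-congʳ (∑-pairs N)))) (trans (+-assoc _ _ _) (sym (∑-snoc N)))))

  tot-pairs : ∀ {s} → Summable s → Tot s ≈ Tot (λ k → s (2 ℕ.* k) + s (suc (2 ℕ.* k)))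
  tot-pairs {s} s≈0 = tot-unique (λ k → Mod.trans (suc k) (Mod.+-cong (suc k)
      (mod-≤ (s≤s (ℕ.m≤m+n k _)) (s≈0 (2 ℕ.* k))) (mod-≤ (s≤s (ℕ.≤-trans (ℕ.m≤m+n k _) (ℕ.n≤1+n _))) (s≈0 (suc (2 ℕ.* k))))) (mod (+-identityˡ 0#)))
    λ N → Mod.trans (suc N) (mod-≤ (s≤s (ℕ.m≤m+n N _)) (tot-mod s≈0 (2 ℕ.* N))) (mod (∑-pairs N))

  tot-swap : ∀ {s : ℕ → ℕ → Series} → (∀ i → Summable (s i)) → (∀ j → Summable (λ i → s i j)) →
             Summable (λ i → Tot (s i)) → Summable (λ j → Tot (λ i → s i j)) →
             Tot (λ i → Tot (s i)) ≈ Tot (λ j → Tot (λ i → s i j))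
  tot-swap {s} si sj ti tj = tot-unique tj λ N → Mod.trans (suc N) (tot-mod ti N) (Mod.trans (suc N)
    (∑-cong-mod N N λ i → tot-mod (si i) N) (Mod.trans (suc N) (mod (∑-swap N N))
      (Mod.sym (suc N) (∑-cong-mod N N λ j → tot-mod (sj j) N))))
    where
    ∑-cong-mod : ∀ N m {F G} → (∀ i → F i ≈[ suc N ] G i) → ∑ m F ≈[ suc N ] ∑ m G
    ∑-cong-mod N zero    h = mod (trans ∑-nil (sym ∑-nil))
    ∑-cong-mod N (suc m) h = Mod.trans (suc N) (mod ∑-cons) (Mod.trans (suc N)
      (Mod.+-cong (suc N) (h 0) (∑-cong-mod N m λ i → h (suc i))) (mod (sym ∑-cons)))

  ∏ : ℕ → (ℕ → Series) → Series
  ∏ zero    f = 1#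
  ∏ (suc n) f = ∏ n f * f n

  ∏<≈∏ : ∀ N f → ∏< N f ≈ ∏ N f
  ∏<≈∏ zero    f = 1ˢ≈1
  ∏<≈∏ (suc N) f = trans (*ˢ≈* _ _) (*-congʳ (∏<≈∏ N f))

  module _ {f : ℕ → Series} (f≈1 : ∀ k → f (suc k) ≈[ suc k ] 1#) where

    private
      stable : ∀ n d → ∏ (n ℕ.+ d) (f ∘ suc) ≈[ suc n ] ∏ n (f ∘ suc)
      stable n zero    = mod (reflexive (≡.cong (λ m → ∏ m (f ∘ suc)) (ℕ.+-identityʳ n)))
      stable n (suc d) = Mod.trans (suc n) (mod (reflexive (≡.cong (λ m → ∏ m (f ∘ suc)) (ℕ.+-suc n d))))
        (Mod.trans (suc n) (Mod.*-cong (suc n) (stable n d) (mod-≤ (s≤s (ℕ.m≤m+n n d)) (f≈1 (n ℕ.+ d)))) (mod (*-identityʳ _)))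

    ∏₁-mod : ∀ N → ∏₁ f ≈[ suc N ] ∏ N (f ∘ suc)
    ∏₁-mod N = ⟪ (λ { n (s≤s n≤N) → K.trans (at (∏<≈∏ n _) n) (K.sym (at[ ≡.subst
      (λ m → ∏ m (f ∘ suc) ≈[ suc n ] ∏ n (f ∘ suc)) (ℕ.m+[n∸m]≡n n≤N) (stable n (N ∸ n)) ] n ℕ.≤-refl)) }) ⟫

    ∏₁-0 : ∏₁ f 0 K.≈ K.1#
    ∏₁-0 = K.trans (at (∏<≈∏ 0 (f ∘ suc)) 0) coeff-1-0

    D-∏₁ : ∀ {l} → Summable l → (∀ k → D (f (suc k)) ≈ l k * f (suc k)) → D (∏₁ f) ≈ Tot l * ∏₁ f
    D-∏₁ {l} l≈0 Df = unmod λ N → mod-≤ (ℕ.n≤1+n N) (Mod.trans (suc N) (D-cong-mod (∏₁-mod N)) (Mod.trans (suc N) (mod (D-∏ N))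
        (Mod.*-cong (suc N) (Mod.sym (suc N) (tot-mod l≈0 N)) (Mod.sym (suc N) (∏₁-mod N)))))
      where
      D-∏ : ∀ N → D (∏ N (f ∘ suc)) ≈ ∑ N l * ∏ N (f ∘ suc)
      D-∏ zero    = trans D-1 (sym (trans (*-congʳ ∑-nil) (zeroˡ _)))
      D-∏ (suc N) = trans (D-*-log (D-∏ N) (Df N)) (*-congʳ (sym (∑-snoc N)))

  open SemiringExp semiring using (^-homo-*)

  -- Lambert series

  torsion-freeˢ : ∀ n {f} → suc n · f ≈ 0# → f ≈ 0#
  torsion-freeˢ n {f} h = ⟪ (λ m → K.trans (torsion-free n (f m) (K.trans (K.sym (coeff-· (suc n) f m)) (K.trans (at h m) (coeff-0 m)))) (K.sym (coeff-0 m))) ⟫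

  cancel-· : ∀ n {f g} → suc n · f ≈ suc n · g → f ≈ g
  cancel-· n {f} {g} h = x-y≈0⇒x≈y (torsion-freeˢ n (begin
    suc n · (f - g)                  ≈⟨ ×≈* (suc n) (f - g) ⟩
    (suc n · 1#) * (f - g)           ≈⟨ solve 3 (λ a f g → a :* (f :- g) := a :* f :- a :* g) refl _ f g ⟩
    (suc n · 1#) * f - (suc n · 1#) * g  ≈⟨ +-cong (sym (×≈* (suc n) f)) (-‿cong (sym (×≈* (suc n) g))) ⟩
    suc n · f - suc n · g            ≈⟨ trans (+-congʳ h) (-‿inverseʳ _) ⟩
    0# ∎))
    where
    ×≈* : ∀ n f → n · f ≈ (n · 1#) * f
    ×≈* zero    f = sym (zeroˡ f)
    ×≈* (suc n) f = trans (+-congˡ (×≈* n f)) (solve 2 (λ f a → f :+ a :* f := (:1 :+ a) :* f) refl f _)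

  P U V : ℕ → Series
  P k = X ^ suc k
  U k = P k * inverse (1# - P k)
  V k = U k + U k * U k

  P-0 : ∀ k → P k 0 K.≈ K.0#
  P-0 k = 0-coeff (^-order {X} (suc k) K.refl)

  1-P-0 : ∀ k → (1# - P k) 0 K.≈ K.1#
  1-P-0 k = K.trans (coeff-- 1# (P k) 0) (K.trans (K.+-cong coeff-1-0 (K.-‿cong (P-0 k)))
    (K.solve 0 (:1 :- # 0 := :1) K.refl))

  U-eq : ∀ k → (1# - P k) * U k ≈ P k
  U-eq k = trans (solve 3 (λ a p i → a :* (p :* i) := p :* (a :* i)) refl (1# - P k) (P k) (inverse (1# - P k)))
    (trans (*-congˡ (*-inverse (1-P-0 k))) (*-identityʳ _))

  U-unique : ∀ k {y} → (1# - P k) * y ≈ P k → y ≈ U k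
  U-unique k h = cancel-*ˡ (≈1-cancel (1-P-0 k)) (trans h (sym (U-eq k)))

  U-summable : Summable U
  U-summable k = Mod.trans (suc k) (Mod.*-congʳ (suc k) (^-order {X} (suc k) K.refl)) (mod (zeroˡ _))

  P-+ : ∀ i j → P (suc (i ℕ.+ j)) ≈ P i * P j
  P-+ i j = trans (reflexive (≡.cong (λ n → X ^ suc n) (≡.sym (ℕ.+-suc i j)))) (^-homo-* X (suc i) (suc j))

  U-relation : ∀ i j → U (suc (i ℕ.+ j)) * (1# + U i + U j) ≈ U i * U j
  U-relation i j = cancel-*ˡ {g = (1# - P m) * ((1# - P i) * (1# - P j))} (≈1-cancel g0) (begin
    (1# - P m) * ((1# - P i) * (1# - P j)) * (U m * (1# + U i + U j))
      ≈⟨ solve 6 (λ m a b w u v → m :* (a :* b) :* (w :* (:1 :+ u :+ v)) := (m :* w) :* (a :* b :+ b :* (a :* u) :+ a :* (b :* v))) refl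
           (1# - P m) (1# - P i) (1# - P j) (U m) (U i) (U j) ⟩
    ((1# - P m) * U m) * ((1# - P i) * (1# - P j) + (1# - P j) * ((1# - P i) * U i) + (1# - P i) * ((1# - P j) * U j))
      ≈⟨ *-cong (trans (U-eq m) (P-+ i j)) (+-cong (+-congˡ (*-congˡ (U-eq i))) (*-congˡ (U-eq j))) ⟩
    (P i * P j) * ((1# - P i) * (1# - P j) + (1# - P j) * P i + (1# - P i) * P j)
      ≈⟨ solve 2 (λ a b → (a :* b) :* ((:1 :- a) :* (:1 :- b) :+ (:1 :- b) :* a :+ (:1 :- a) :* b) := (:1 :- a :* b) :* (a :* b)) refl (P i) (P j) ⟩
    (1# - P i * P j) * (P i * P j)
      ≈⟨ *-cong (+-congˡ (-‿cong (P-+ i j))) (*-cong (U-eq i) (U-eq j)) ⟨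
    (1# - P m) * (((1# - P i) * U i) * ((1# - P j) * U j))
      ≈⟨ solve 5 (λ m a b u v → m :* ((a :* u) :* (b :* v)) := m :* (a :* b) :* (u :* v)) refl (1# - P m) (1# - P i) (1# - P j) (U i) (U j) ⟩
    (1# - P m) * ((1# - P i) * (1# - P j)) * (U i * U j) ∎)
    where
    m = suc (i ℕ.+ j)
    g0 : ((1# - P m) * ((1# - P i) * (1# - P j))) 0 K.≈ K.1#
    g0 = K.trans (coeff-*-0 _ _) (K.trans (K.*-cong (1-P-0 m) (K.trans (coeff-*-0 _ _) (K.*-cong (1-P-0 i) (1-P-0 j))))
      (K.solve 0 (:1 :* (:1 :* :1) := :1) K.refl))

  D-P : ∀ k → D (P k) ≈ suc k · P k
  D-P k = trans (D-^ X 1# (suc k) (trans D-X (sym (*-identityˡ X)))) (·1-* (suc k) (P k))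
    where
    ·1-* : ∀ n f → (n · 1#) * f ≈ n · f
    ·1-* zero    f = zeroˡ f
    ·1-* (suc n) f = trans (solve 2 (λ a f → (:1 :+ a) :* f := f :+ a :* f) refl (n · 1#) f) (+-congˡ (·1-* n f))

  ·≈* : ∀ n f → n · f ≈ (n · 1#) * f
  ·≈* zero    f = sym (zeroˡ f)
  ·≈* (suc n) f = trans (+-congˡ (·≈* n f)) (solve 2 (λ f a → f :+ a :* f := (:1 :+ a) :* f) refl f _)

  D-1-P : ∀ k → D (1# - P k) ≈ (- (suc k · U k)) * (1# - P k)
  D-1-P k = trans (trans (D-- 1# (P k)) (+-cong D-1 (-‿cong (trans (D-P k) (·≈* (suc k) (P k))))))
    (trans (+-congˡ (-‿cong (*-congˡ (sym (U-eq k))))) (trans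
      (solve 3 (λ n a u → # 0 :- n :* (a :* u) := :- (n :* u) :* a) refl (suc k · 1#) (1# - P k) (U k))
      (*-congʳ (-‿cong (sym (·≈* (suc k) (U k)))))))

  D-U : ∀ k → D (U k) ≈ suc k · V k
  D-U k = cancel-*ˡ (≈1-cancel (1-P-0 k)) (begin
    (1# - P k) * D (U k)
      ≈⟨ solve 3 (λ a d u → a :* d := (d :* u :+ a :* d) :- d :* u) refl (1# - P k) (D (U k)) (U k) ⟩
    (D (U k) * U k + (1# - P k) * D (U k)) - D (U k) * U k
      ≈⟨ solve 4 (λ d u a e → d :* u :+ a :* d :- d :* u := (e :* u :+ a :* d) :- e :* u) refl (D (U k)) (U k) (1# - P k) (D (1# - P k)) ⟩
    (D (1# - P k) * U k + (1# - P k) * D (U k)) - D (1# - P k) * U k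
      ≈⟨ +-cong (trans (sym (D-* (1# - P k) (U k))) (trans (D-cong (U-eq k)) (trans (D-P k) (trans (·≈* (suc k) (P k)) (*-congˡ (sym (U-eq k)))))))
           (-‿cong (*-congʳ (trans (D-1-P k) (*-congʳ (-‿cong (·≈* (suc k) (U k))))))) ⟩
    n * ((1# - P k) * U k) - - (n * U k) * (1# - P k) * U k
      ≈⟨ solve 3 (λ n a u → n :* (a :* u) :- :- (n :* u) :* a :* u := a :* (n :* (u :+ u :* u))) refl n (1# - P k) (U k) ⟩
    (1# - P k) * (n * V k)
      ≈⟨ *-congˡ (·≈* (suc k) (V k)) ⟨
    (1# - P k) * (suc k · V k) ∎)
    where n = suc k · 1#

  V-summable : Summable V
  V-summable k = Mod.trans (suc k) (Mod.+-cong (suc k) (U-summable k) (summable-* (U k) U-summable k)) (mod (+-identityˡ 0#))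

  dilate-P : ∀ k → dilate (P k) ≈ P (suc (2 ℕ.* k))
  dilate-P k = trans (Dilate.homo-^ X (suc k)) (trans (^-cong (suc k) (subst-X X²-0)) (go (suc k) (≡.sym (ℕ.*-suc 2 k))))
    where
    square-^ : ∀ k → (X * X) ^ k ≈ X ^ (2 ℕ.* k)
    square-^ zero    = refl
    square-^ (suc k) = trans (*-congˡ (square-^ k)) (trans (*-assoc X X _) (reflexive (≡.cong (X ^_) (≡.sym (ℕ.*-suc 2 k)))))
    go : ∀ m {n} → n ≡ 2 ℕ.* m → (X * X) ^ m ≈ X ^ n
    go m ≡.refl = square-^ m

  dilate-1-P : ∀ k → dilate (1# - P k) ≈ 1# - P (suc (2 ℕ.* k))
  dilate-1-P k = trans (Dilate.homo-- 1# (P k)) (+-cong Dilate.homo-1 (-‿cong (dilate-P k)))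

  dilate-U : ∀ k → dilate (U k) ≈ U (suc (2 ℕ.* k))
  dilate-U k = U-unique (suc (2 ℕ.* k)) (trans (*-congʳ (sym (dilate-1-P k)))
    (trans (sym (Dilate.homo-* (1# - P k) (U k))) (trans (Dilate.cong (U-eq k)) (dilate-P k))))

  dilate-V : ∀ k → dilate (V k) ≈ V (suc (2 ℕ.* k))
  dilate-V k = trans (Dilate.homo-+ _ _) (+-cong (dilate-U k) (trans (Dilate.homo-* _ _) (*-cong (dilate-U k) (dilate-U k))))

  flip-P-odd : ∀ k → flip (P (2 ℕ.* k)) ≈ - P (2 ℕ.* k)
  flip-P-odd k = trans (Flip.homo-^ X (suc (2 ℕ.* k))) (trans (^-cong (suc (2 ℕ.* k)) (subst-X neg-X-0)) (go k))
    where
    go : ∀ k → (- X) ^ suc (2 ℕ.* k) ≈ - (X ^ suc (2 ℕ.* k))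
    go zero    = solve 1 (λ x → :- x :* :1 := :- (x :* :1)) refl X
    go (suc k) = trans (reflexive (≡.cong (λ n → (- X) ^ suc n) (ℕ.*-suc 2 k)))
      (trans (*-congˡ (*-congˡ (go k))) (trans (solve 2 (λ x y → :- x :* (:- x :* :- y) := :- (x :* (x :* y))) refl X _)
        (-‿cong (reflexive (≡.cong (λ n → X ^ suc n) (≡.sym (ℕ.*-suc 2 k)))))))

  flip-U-odd : ∀ k → flip (U (2 ℕ.* k)) ≈ 2 · dilate (U (2 ℕ.* k)) - U (2 ℕ.* k)
  flip-U-odd k = cancel-*ˡ {g = (1# - P n) * (1# + P n)} (≈1-cancel g0) (begin
    (1# - P n) * (1# + P n) * flip (U n)
      ≈⟨ *-assoc _ _ _ ⟩
    (1# - P n) * ((1# + P n) * flip (U n))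
      ≈⟨ *-congˡ (trans (*-congʳ (sym flip-1-P)) (trans (sym (Flip.homo-* (1# - P n) (U n))) (trans (Flip.cong (U-eq n)) (flip-P-odd k)))) ⟩
    (1# - P n) * - P n
      ≈⟨ solve 1 (λ p → (:1 :- p) :* :- p := 2 :× (p :* p) :- (:1 :+ p) :* p) refl (P n) ⟩
    2 · (P n * P n) - (1# + P n) * P n
      ≈⟨ +-cong (×-congʳ 2 (trans (sym (trans (*-congʳ dil) (Ueq′))) (*-assoc _ _ _) )) (-‿cong (*-congˡ (sym (U-eq n)))) ⟩
    2 · ((1# - P n) * ((1# + P n) * dilate (U n))) - (1# + P n) * ((1# - P n) * U n)
      ≈⟨ solve 4 (λ a b d u → 2 :× (a :* (b :* d)) :- b :* (a :* u) := a :* b :* (2 :× d :- u)) refl (1# - P n) (1# + P n) (dilate (U n)) (U n) ⟩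
    (1# - P n) * (1# + P n) * (2 · dilate (U n) - U n) ∎)
    where
    n = 2 ℕ.* k
    flip-1-P : flip (1# - P n) ≈ 1# + P n
    flip-1-P = trans (Flip.homo-- 1# (P n)) (trans (+-cong Flip.homo-1 (-‿cong (flip-P-odd k))) (solve 1 (λ p → :1 :- :- p := :1 :+ p) refl (P n)))
    P² : P (suc (2 ℕ.* n)) ≈ P n * P n
    P² = trans (reflexive (≡.cong (λ m → P (suc (n ℕ.+ m))) (ℕ.+-identityʳ n))) (P-+ n n)
    dil : (1# - P n) * (1# + P n) ≈ 1# - P (suc (2 ℕ.* n))
    dil = trans (solve 1 (λ p → (:1 :- p) :* (:1 :+ p) := :1 :- p :* p) refl (P n)) (+-congˡ (-‿cong (sym P²)))
    Ueq′ : (1# - P (suc (2 ℕ.* n))) * dilate (U n) ≈ P n * P n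
    Ueq′ = trans (*-congˡ (dilate-U n)) (trans (U-eq (suc (2 ℕ.* n))) P²)
    g0 : ((1# - P n) * (1# + P n)) 0 K.≈ K.1#
    g0 = K.trans (at dil 0) (1-P-0 (suc (2 ℕ.* n)))

  summable-· : ∀ (w : ℕ → ℕ) {s} → Summable s → Summable (λ k → w k · s k)
  summable-· w {s} s≈0 k = Mod.trans (suc k) (mod (·≈* (w k) (s k))) (summable-* (w k · 1#) s≈0 k)

  private
    P^ : ℕ → ℕ → Series
    P^ k m = P k ^ suc m

    P-^ : ∀ k m → P k ^ suc m ≈ X ^ (suc k ℕ.* suc m)
    P-^ k m = SemiringExp.^-assocʳ semiring X (suc k) (suc m)

    e-sym : ∀ k m → P^ k m ≈ P^ m k
    e-sym k m = trans (P-^ k m) (trans (reflexive (≡.cong (X ^_) (ℕ.*-comm (suc k) (suc m)))) (sym (P-^ m k)))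

    e-summable : ∀ k → Summable (P^ k)
    e-summable k m = ^-order (suc m) (P-0 k)

    e-summable′ : ∀ m → Summable (λ k → P^ k m)
    e-summable′ m k = Mod.trans (suc k) (mod (e-sym k m)) (e-summable m k)

    U≈tot : ∀ k → U k ≈ Tot (P^ k)
    U≈tot k = sym (U-unique k (begin
      (1# - P k) * Tot (P^ k)                          ≈⟨ solve 2 (λ p t → (:1 :- p) :* t := t :- p :* t) refl (P k) _ ⟩
      Tot (P^ k) - P k * Tot (P^ k)                     ≈⟨ +-congʳ (tot-cons (e-summable k)) ⟩
      P k * 1# + Tot (P^ k ∘ suc) - P k * Tot (P^ k)    ≈⟨ +-congˡ (-‿cong (trans (tot-* (P k) (e-summable k)) refl)) ⟩
      P k * 1# + Tot (P^ k ∘ suc) - Tot (P^ k ∘ suc)    ≈⟨ solve 2 (λ p t → p :* :1 :+ t :- t := p) refl (P k) _ ⟩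
      P k ∎))

    D-e : ∀ k m → D (P^ k m) ≈ suc k · (suc m · P^ k m)
    D-e k m = begin
      D (P k ^ suc m)                  ≈⟨ D-^ (P k) (suc k · 1#) (suc m) (trans (D-P k) (·≈* (suc k) (P k))) ⟩
      (suc m · (suc k · 1#)) * P^ k m   ≈⟨ *-congʳ (·≈* (suc m) (suc k · 1#)) ⟩
      (suc m · 1# * suc k · 1#) * P^ k m ≈⟨ solve 3 (λ a b c → (a :* b) :* c := b :* (a :* c)) refl (suc m · 1#) (suc k · 1#) (P^ k m) ⟩
      suc k · 1# * (suc m · 1# * P^ k m) ≈⟨ *-congˡ (·≈* (suc m) (P^ k m)) ⟨
      suc k · 1# * (suc m · P^ k m)     ≈⟨ ·≈* (suc k) _ ⟨
      suc k · (suc m · P^ k m) ∎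

    V≈tot : ∀ k → V k ≈ Tot (λ m → suc m · P^ k m)
    V≈tot k = cancel-· k (begin
      suc k · V k              ≈⟨ D-U k ⟨
      D (U k)                  ≈⟨ D-cong (U≈tot k) ⟩
      D (Tot (P^ k))            ≈⟨ tot-D (e-summable k) ⟩
      Tot (λ m → D (P^ k m))    ≈⟨ tot-cong (summable-* _ (summable-· suc (e-summable k))) (λ m → trans (D-e k m) (·≈* (suc k) _)) ⟩
      Tot (λ m → suc k · 1# * (suc m · P^ k m)) ≈⟨ tot-* _ (summable-· suc (e-summable k)) ⟨
      suc k · 1# * Tot (λ m → suc m · P^ k m) ≈⟨ ·≈* (suc k) _ ⟨
      suc k · Tot (λ m → suc m · P^ k m) ∎)

  S : Series
  S = Tot λ k → suc k · U k

  S-summable : Summable λ k → suc k · U k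
  S-summable = summable-· suc U-summable

  -- Both sides are Σ_{m,n} n q^{mn}.
  tot-V : Tot V ≈ S
  tot-V = begin
    Tot V                                          ≈⟨ tot-cong (λ k → Mod.trans (suc k) (mod (sym (V≈tot k))) (V-summable k)) V≈tot ⟩
    Tot (λ k → Tot λ m → suc m · P^ k m)            ≈⟨ tot-swap (λ k → summable-· suc (e-summable k)) (λ m → summable-· (λ _ → suc m) (e-summable′ m))
                                                       (λ k → Mod.trans (suc k) (mod (sym (V≈tot k))) (V-summable k))
                                                       (λ m → Mod.trans (suc m) (mod (sym (col m))) (S-summable m)) ⟩
    Tot (λ m → Tot λ k → suc m · P^ k m)            ≈⟨ tot-cong S-summable (λ m → sym (col m)) ⟩
    S ∎
    where
    col : ∀ m → suc m · U m ≈ Tot λ k → suc m · P^ k m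
    col m = begin
      suc m · U m                         ≈⟨ ·≈* (suc m) (U m) ⟩
      suc m · 1# * U m                    ≈⟨ *-congˡ (trans (U≈tot m) (tot-cong (e-summable′ m) (λ k → e-sym m k))) ⟩
      suc m · 1# * Tot (λ k → P^ k m)      ≈⟨ tot-* _ (e-summable′ m) ⟩
      Tot (λ k → suc m · 1# * P^ k m)      ≈⟨ tot-cong (summable-· (λ _ → suc m) (e-summable′ m)) (λ k → sym (·≈* (suc m) (P^ k m))) ⟩
      Tot (λ k → suc m · P^ k m)           ∎

  ⟨_⟩ : ℕ → Series
  ⟨ n ⟩ = n · 1#

  X^-order : ∀ k {N f} → f ≈[ N ] 0# → X ^ k * f ≈[ k ℕ.+ N ] 0#
  X^-order zero    {N} h = Mod.trans N (mod (*-identityˡ _)) h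
  X^-order (suc k) h = Mod.trans _ (mod (*-assoc X _ _)) (*-order K.refl (X^-order k h))

  UU-order : ∀ i j → U i * U j ≈[ suc i ℕ.+ suc j ] 0#
  UU-order i j = Mod.trans _ (mod (solve 3 (λ p a u → p :* a :* u := p :* (u :* a)) refl (P i) (inverse (1# - P i)) (U j)))
    (X^-order (suc i) (Mod.trans (suc j) (Mod.*-congʳ (suc j) (U-summable j)) (mod (zeroˡ _))))

  module _ (f : ℕ → Series) (κ : Series) (g : ℕ → Series)
           (diag : ∀ i → κ * (g i * g i) + f (2 ℕ.+ (i ℕ.+ i)) ≈ f 0)
           (off : ∀ i k → κ * (g i * g (suc (i ℕ.+ k))) + f (2 ℕ.+ (i ℕ.+ suc (i ℕ.+ k))) ≈ f (suc k)) where

    private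
      F : ℕ → Series
      F k = ∑ k (λ i → f (suc i))

      term : ℕ → Series
      term k = f 0 * (U k * U k) + (2 · (f (suc k) * (U k * U k)) - ⟨ k ⟩ * (f (suc k) * U k) - 2 · (F k * U k))

      gU-summable : Summable (λ k → g k * U k)
      gU-summable = summable-*′ g U-summable

      ∑-mod : ∀ N n h → Sums.∑ (𝕊/q^ N) n h ≈[ N ] ∑ n h
      ∑-mod N zero    h = Mod.trans N (Sums.∑-nil (𝕊/q^ N)) (mod (sym ∑-nil))
      ∑-mod N (suc n) h = Mod.trans N (Sums.∑-cons (𝕊/q^ N)) (Mod.trans N (Mod.+-congˡ N (∑-mod N n (h ∘ suc))) (mod (sym ∑-cons)))

      ·-mod : ∀ N n h → PowerSeries._·_ (𝕊/q^ N) n h ≈[ N ] n · h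
      ·-mod N zero    h = Mod.refl N
      ·-mod N (suc n) h = Mod.+-congˡ N (·-mod N n h)

      finite : ∀ N → ∑ N (λ i → ∑ N λ j → κ * (g i * g j) * (U i * U j)) ≈[ suc N ] ∑ N term
      finite N = M.trans (M.sym (M.trans (S.∑-cong′ N λ i → ∑-mod (suc N) N _) (∑-mod (suc N) N _))) (M.trans
        (Liouville.liouville (𝕊/q^ (suc N)) U (λ i j → mod (U-relation i j)) N
          (λ i j N≤ → mod-≤ (s≤s (ℕ.≤-trans N≤ (ℕ.≤-reflexive (≡.sym (ℕ.+-suc i j))))) (UU-order i j))
          f (λ i j → κ * (g i * g j)) (λ i j → mod (*-congˡ (*-comm (g i) (g j))))
          (mod ∘ diag) (λ i k → mod (off i k)))
        (M.trans (∑-mod (suc N) N _) (M.trans (M.sym (∑-mod (suc N) N _)) (M.trans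
          (S.∑-cong′ N λ k → M.+-congˡ (M.+-cong (M.+-congˡ (M.-‿cong (M.*-congʳ (·-mod (suc N) k 1#))))
            (M.-‿cong (M.+-cong (M.*-congʳ (∑-mod (suc N) k _)) (M.+-congʳ (M.*-congʳ (∑-mod (suc N) k _)))))))
          (∑-mod (suc N) N term)))))
        where
        module M = Mod (suc N)
        module S = Sums (𝕊/q^ (suc N))

    liouville-tot : Summable term → κ * (Tot (λ k → g k * U k) * Tot (λ k → g k * U k)) ≈ Tot term
    liouville-tot term-summable = tot-unique term-summable λ N → Mod.trans (suc N) (Mod.*-congˡ (suc N)
        (Mod.*-cong (suc N) (tot-mod gU-summable N) (tot-mod gU-summable N))) (Mod.trans (suc N) (mod (expand N)) (finite N))
      where
      expand : ∀ N → κ * (∑ N (λ k → g k * U k) * ∑ N (λ k → g k * U k)) ≈ ∑ N (λ i → ∑ N λ j → κ * (g i * g j) * (U i * U j))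
      expand N = trans (*-congˡ (*-distribʳ-∑ N _)) (trans (*-distribˡ-∑ N κ) (∑-cong′ N λ i →
        trans (*-congˡ (*-distribˡ-∑ N _)) (trans (*-distribˡ-∑ N κ) (∑-cong′ N λ j →
          solve 5 (λ κ a u b v → κ :* (a :* u :* (b :* v)) := κ :* (a :* b) :* (u :* v)) refl κ (g i) (U i) (g j) (U j)))))

    term-summable : Summable term
    term-summable k = Mod.trans (suc k) (mod (solve 5 (λ f₀ u f₁ n F →
        f₀ :* (u :* u) :+ (2 :× (f₁ :* (u :* u)) :- n :* (f₁ :* u) :- 2 :× (F :* u)) :=
        (f₀ :* u :+ (2 :× (f₁ :* u) :- n :* f₁ :- 2 :× F)) :* u) refl (f 0) (U k) (f (suc k)) ⟨ k ⟩ (F k)))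
      (summable-*′ (λ k → f 0 * U k + (2 · (f (suc k) * U k) - ⟨ k ⟩ * f (suc k) - 2 · F k)) U-summable k)

    liouville-U : κ * (Tot (λ k → g k * U k) * Tot (λ k → g k * U k)) ≈ Tot term
    liouville-U = liouville-tot term-summable

  S′ W : Series
  S′ = Tot λ k → ⟨ suc k ⟩ * U k
  W  = Tot λ k → ⟨ suc k ⟩ ^ 3 * U k

  S≈S′ : S ≈ S′
  S≈S′ = tot-cong (summable-*′ _ U-summable) (λ k → ·≈* (suc k) (U k))

  D-S : D S ≈ Tot λ k → ⟨ suc k ⟩ * ⟨ suc k ⟩ * V k
  D-S = trans (tot-D S-summable) (tot-cong (summable-*′ _ V-summable) λ k → trans (D-· (suc k) (U k))
    (trans (·≈* (suc k) _) (trans (*-congˡ (trans (D-U k) (·≈* (suc k) (V k)))) (sym (*-assoc _ _ _)))))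

  -- Liouville's identity for f(k) = k², where f(i-j) - f(i+j) = -4ij
  S²-identity : 12 · (S * S) + 6 · D S ≈ 5 · W + S
  S²-identity = begin
    12 · (S * S) + 6 · D S
      ≈⟨ solve 2 (λ s d → 12 :× (s :* s) :+ 6 :× d := 6 :× d :- 3 :× ((:- (# 4)) :* (s :* s))) refl S (D S) ⟩
    6 · D S - 3 · (- (4 · 1#) * (S * S))
      ≈⟨ +-congˡ (-‿cong (×-congʳ 3 (trans (*-congˡ (*-cong S≈S′ S≈S′)) (liouville-U f (- (4 · 1#)) (λ k → ⟨ suc k ⟩) diag off)))) ⟩
    6 · D S - 3 · Tot term
      ≈⟨ +-congˡ (-‿cong rhs) ⟩
    6 · D S - (6 · D S - 5 · W - S)
      ≈⟨ solve 3 (λ d w s → d :- (d :- w :- s) := w :+ s) refl (6 · D S) (5 · W) S ⟩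
    5 · W + S ∎
    where
    f : ℕ → Series
    f k = ⟨ k ⟩ * ⟨ k ⟩
    F : ℕ → Series
    F k = ∑ k (λ i → f (suc i))
    term : ℕ → Series
    term k = f 0 * (U k * U k) + (2 · (f (suc k) * (U k * U k)) - ⟨ k ⟩ * (f (suc k) * U k) - 2 · (F k * U k))
    diag : ∀ i → - (4 · 1#) * (⟨ suc i ⟩ * ⟨ suc i ⟩) + f (2 ℕ.+ (i ℕ.+ i)) ≈ f 0
    diag i = trans (+-congˡ (*-cong e e)) (solve 1 (λ i → (:- # 4) :* ((:1 :+ i) :* (:1 :+ i)) :+ (:1 :+ (:1 :+ (i :+ i))) :* (:1 :+ (:1 :+ (i :+ i))) := # 0 :* # 0) refl ⟨ i ⟩)
      where e = +-congˡ (+-congˡ (×-homo-+ 1# i i))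
    off : ∀ i k → - (4 · 1#) * (⟨ suc i ⟩ * ⟨ suc (suc (i ℕ.+ k)) ⟩) + f (2 ℕ.+ (i ℕ.+ suc (i ℕ.+ k))) ≈ f (suc k)
    off i k = trans (+-cong (*-congˡ (*-congˡ (+-congˡ (+-congˡ e)))) (*-cong e′ e′))
      (solve 2 (λ i k → (:- # 4) :* ((:1 :+ i) :* (:1 :+ (:1 :+ (i :+ k)))) :+ (:1 :+ (:1 :+ (i :+ (:1 :+ (i :+ k))))) :* (:1 :+ (:1 :+ (i :+ (:1 :+ (i :+ k))))) := (:1 :+ k) :* (:1 :+ k)) refl ⟨ i ⟩ ⟨ k ⟩)
      where
      e  = ×-homo-+ 1# i k
      e′ = +-congˡ (+-congˡ (trans (×-homo-+ 1# i (suc (i ℕ.+ k))) (+-congˡ (+-congˡ e))))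
    6F : ∀ k → 6 · F k ≈ ⟨ k ⟩ * (1# + ⟨ k ⟩) * (1# + 2 · ⟨ k ⟩)
    6F zero    = trans (×-congʳ 6 ∑-nil) (solve 0 (6 :× # 0 := # 0 :* (:1 :+ # 0) :* (:1 :+ 2 :× # 0)) refl)
    6F (suc k) = trans (×-congʳ 6 (∑-snoc k)) (trans (solve 2 (λ F f → 6 :× (F :+ f) := 6 :× F :+ 6 :× f) refl _ _)
      (trans (+-congʳ (6F k)) (solve 1 (λ k → k :* (:1 :+ k) :* (:1 :+ 2 :× k) :+ 6 :× ((:1 :+ k) :* (:1 :+ k)) :=
        (:1 :+ k) :* (:1 :+ (:1 :+ k)) :* (:1 :+ 2 :× (:1 :+ k))) refl ⟨ k ⟩)))
    rhs : 3 · Tot term ≈ 6 · D S - 5 · W - S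
    rhs = begin
      3 · Tot term
        ≈⟨ trans (·≈* 3 _) (tot-* ⟨ 3 ⟩ (term-summable f (- (4 · 1#)) (λ k → ⟨ suc k ⟩) diag off)) ⟩
      Tot (λ k → ⟨ 3 ⟩ * term k)
        ≈⟨ tot-cong (summable-+ (summable-+ (summable-* ⟨ 6 ⟩ (summable-*′ _ V-summable)) (summable-* (- ⟨ 5 ⟩) (summable-*′ _ U-summable))) (summable-* (- 1#) (summable-*′ _ U-summable))) step ⟩
      Tot (λ k → ⟨ 6 ⟩ * (⟨ suc k ⟩ * ⟨ suc k ⟩ * V k) + - ⟨ 5 ⟩ * (⟨ suc k ⟩ ^ 3 * U k) + - 1# * (⟨ suc k ⟩ * U k))
        ≈⟨ trans (+-congʳ (tot-+ (summable-* ⟨ 6 ⟩ (summable-*′ _ V-summable)) (summable-* (- ⟨ 5 ⟩) (summable-*′ _ U-summable))))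
             (tot-+ (summable-+ (summable-* ⟨ 6 ⟩ (summable-*′ _ V-summable)) (summable-* (- ⟨ 5 ⟩) (summable-*′ _ U-summable))) (summable-* (- 1#) (summable-*′ _ U-summable))) ⟨
      Tot (λ k → ⟨ 6 ⟩ * (⟨ suc k ⟩ * ⟨ suc k ⟩ * V k)) + Tot (λ k → - ⟨ 5 ⟩ * (⟨ suc k ⟩ ^ 3 * U k)) + Tot (λ k → - 1# * (⟨ suc k ⟩ * U k))
        ≈⟨ +-cong (+-cong (trans (sym (tot-* ⟨ 6 ⟩ (summable-*′ _ V-summable))) (*-congˡ (sym D-S))) (sym (tot-* (- ⟨ 5 ⟩) (summable-*′ _ U-summable))))
                  (trans (sym (tot-* (- 1#) (summable-*′ _ U-summable))) (*-congˡ (sym S≈S′))) ⟩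
      ⟨ 6 ⟩ * D S + - ⟨ 5 ⟩ * W + - 1# * S
        ≈⟨ solve 3 (λ d w s → # 6 :* d :+ (:- # 5) :* w :+ (:- :1) :* s := 6 :× d :- 5 :× w :- s) refl (D S) W S ⟩
      6 · D S - 5 · W - S ∎
      where
      step : ∀ k → ⟨ 3 ⟩ * term k ≈ ⟨ 6 ⟩ * (⟨ suc k ⟩ * ⟨ suc k ⟩ * V k) + - ⟨ 5 ⟩ * (⟨ suc k ⟩ ^ 3 * U k) + - 1# * (⟨ suc k ⟩ * U k)
      step k = begin
        ⟨ 3 ⟩ * term k
          ≈⟨ solve 3 (λ k u F → # 3 :* (# 0 :* # 0 :* (u :* u) :+ (2 :× ((:1 :+ k) :* (:1 :+ k) :* (u :* u)) :- k :* ((:1 :+ k) :* (:1 :+ k) :* u) :- 2 :× (F :* u))) :=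
               (6 :× ((:1 :+ k) :* (:1 :+ k) :* (u :* u)) :- 3 :× (k :* ((:1 :+ k) :* (:1 :+ k) :* u)) :- (6 :× F) :* u)) refl ⟨ k ⟩ (U k) (F k) ⟩
        _ ≈⟨ +-congˡ (-‿cong (*-congʳ (6F k))) ⟩
        _ ≈⟨ solve 2 (λ k u → 6 :× ((:1 :+ k) :* (:1 :+ k) :* (u :* u)) :- 3 :× (k :* ((:1 :+ k) :* (:1 :+ k) :* u)) :- (k :* (:1 :+ k) :* (:1 :+ 2 :× k)) :* u :=
               # 6 :* ((:1 :+ k) :* (:1 :+ k) :* (u :+ u :* u)) :+ (:- # 5) :* ((:1 :+ k) :^ 3 :* u) :+ (:- :1) :* ((:1 :+ k) :* u)) refl ⟨ k ⟩ (U k) ⟩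
        _ ∎

  -- cos(πn/2), sin(πn/2), and cos(πn)
  cosq sinq alt : ℕ → Series
  cosq zero    = 1#
  cosq (suc n) = - sinq n
  sinq zero    = 0#
  sinq (suc n) = cosq n
  alt zero     = 1#
  alt (suc n)  = - alt n

  cosq-+ : ∀ m n → cosq (m ℕ.+ n) ≈ cosq m * cosq n - sinq m * sinq n
  sinq-+ : ∀ m n → sinq (m ℕ.+ n) ≈ sinq m * cosq n + cosq m * sinq n
  cosq-+ zero    n = solve 2 (λ a b → a := :1 :* a :- # 0 :* b) refl (cosq n) (sinq n)
  cosq-+ (suc m) n = trans (-‿cong (sinq-+ m n)) (solve 4 (λ a b c d → :- (b :* c :+ a :* d) := (:- b) :* c :- a :* d) refl (cosq m) (sinq m) (cosq n) (sinq n))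
  sinq-+ zero    n = solve 2 (λ a b → b := # 0 :* a :+ :1 :* b) refl (cosq n) (sinq n)
  sinq-+ (suc m) n = trans (cosq-+ m n) (solve 4 (λ a b c d → a :* c :- b :* d := a :* c :+ (:- b) :* d) refl (cosq m) (sinq m) (cosq n) (sinq n))

  cosq²+sinq² : ∀ n → cosq n * cosq n + sinq n * sinq n ≈ 1#
  cosq²+sinq² zero    = solve 0 (:1 :* :1 :+ # 0 :* # 0 := :1) refl
  cosq²+sinq² (suc n) = trans (solve 2 (λ a b → (:- b) :* (:- b) :+ a :* a := a :* a :+ b :* b) refl (cosq n) (sinq n)) (cosq²+sinq² n)

  cosq-even : ∀ n → cosq (2 ℕ.* n) ≈ alt n
  cosq-even zero    = refl
  cosq-even (suc n) = trans (reflexive (≡.cong cosq (ℕ.*-suc 2 n))) (-‿cong (cosq-even n))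

  sinq-even : ∀ n → sinq (2 ℕ.* n) ≈ 0#
  sinq-even zero    = refl
  sinq-even (suc n) = trans (reflexive (≡.cong sinq (ℕ.*-suc 2 n))) (trans (-‿cong (sinq-even n)) (solve 0 (:- # 0 := # 0) refl))

  alt-even : ∀ n → alt (2 ℕ.* n) ≈ 1#
  alt-even zero    = refl
  alt-even (suc n) = trans (reflexive (≡.cong alt (ℕ.*-suc 2 n))) (trans (-‿cong (-‿cong (alt-even n))) (solve 0 (:- (:- :1) := :1) refl))

  summable-odd : ∀ {s} → Summable s → Summable (λ j → s (suc (2 ℕ.* j)))
  summable-odd s≈0 j = mod-≤ (s≤s (ℕ.≤-trans (ℕ.m≤m+n j _) (ℕ.n≤1+n _))) (s≈0 (suc (2 ℕ.* j)))

  summable-even : ∀ {s} → Summable s → Summable (λ j → s (2 ℕ.* j))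
  summable-even s≈0 j = mod-≤ (s≤s (ℕ.m≤m+n j _)) (s≈0 (2 ℕ.* j))

  summable-neg : ∀ {s} → Summable s → Summable (λ j → - s j)
  summable-neg s≈0 k = Mod.trans (suc k) (Mod.-‿cong (suc k) (s≈0 k)) (mod (solve 0 (:- # 0 := # 0) refl))

  tot-cosq : ∀ {s} → Summable s → Tot (λ k → cosq (suc k) * s k) ≈ Tot (λ j → alt (suc j) * s (suc (2 ℕ.* j)))
  tot-cosq {s} s≈0 = trans (tot-pairs (summable-*′ _ s≈0)) (tot-cong (summable-*′ _ (summable-odd s≈0)) λ j →
    trans (+-cong (trans (*-congʳ (trans (-‿cong (sinq-even j)) (solve 0 (:- # 0 := # 0) refl))) (zeroˡ _)) (*-congʳ (-‿cong (cosq-even j)))) (+-identityˡ _))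

  tot-alt : ∀ {s} → Summable s → Tot (λ j → alt (suc j) * s j) ≈ 2 · Tot (λ j → s (suc (2 ℕ.* j))) - Tot s
  tot-alt {s} s≈0 = begin
    Tot (λ j → alt (suc j) * s j)
      ≈⟨ trans (tot-pairs (summable-*′ _ s≈0)) (tot-cong (summable-+ (summable-+ so so) (summable-neg (summable-+ se so))) λ j →
           trans (+-cong (*-congʳ (-‿cong (alt-even j))) (*-congʳ (-‿cong (-‿cong (alt-even j)))))
             (solve 2 (λ a b → (:- :1) :* a :+ (:- (:- :1)) :* b := b :+ b :- (a :+ b)) refl (s (2 ℕ.* j)) (s (suc (2 ℕ.* j))))) ⟩
    Tot (λ j → s (suc (2 ℕ.* j)) + s (suc (2 ℕ.* j)) - (s (2 ℕ.* j) + s (suc (2 ℕ.* j))))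
      ≈⟨ trans (+-cong (tot-+ so so) (trans (-‿cong (tot-pairs s≈0)) (tot-neg (summable-+ se so)))) (tot-+ (summable-+ so so) (summable-neg (summable-+ se so))) ⟨
    Tot (λ j → s (suc (2 ℕ.* j))) + Tot (λ j → s (suc (2 ℕ.* j))) - Tot s
      ≈⟨ solve 2 (λ a b → a :+ a :- b := 2 :× a :- b) refl _ _ ⟩
    2 · Tot (λ j → s (suc (2 ℕ.* j))) - Tot s ∎
    where
    so = summable-odd s≈0
    se = summable-even s≈0

  tot-· : ∀ w {s} → Summable s → w · Tot s ≈ Tot (λ k → w · s k)
  tot-· w s≈0 = trans (·≈* w _) (trans (tot-* ⟨ w ⟩ s≈0) (tot-cong (summable-· (λ _ → w) s≈0) λ k → sym (·≈* w _)))

  summable-dilate : ∀ {s} → Summable s → Summable (dilate ∘ s)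
  summable-dilate s≈0 k = Mod.trans (suc k) (Dilate.cong-mod (s≈0 k)) (mod Dilate.homo-0)

  module _ (w : ℕ) {s : ℕ → Series} (s≈0 : Summable s) (s-dilate : ∀ j → s (suc (2 ℕ.* j)) ≈ w · dilate (s j)) where

    tot-odd : Tot (λ j → s (suc (2 ℕ.* j))) ≈ w · dilate (Tot s)
    tot-odd = trans (tot-cong (summable-· (λ _ → w) (summable-dilate s≈0)) s-dilate)
      (trans (sym (tot-· w (summable-dilate s≈0))) (×-congʳ w (sym (tot-subst X²-0 s≈0))))

    tot-cosq-dilate : Tot (λ k → cosq (suc k) * s k) ≈ 2 · (w · dilate (w · dilate (Tot s))) - w · dilate (Tot s)
    tot-cosq-dilate = begin
      Tot (λ k → cosq (suc k) * s k)
        ≈⟨ tot-cosq s≈0 ⟩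
      Tot (λ j → alt (suc j) * s (suc (2 ℕ.* j)))
        ≈⟨ tot-alt (summable-odd s≈0) ⟩
      2 · Tot (λ j → s (suc (2 ℕ.* suc (2 ℕ.* j)))) - Tot (λ j → s (suc (2 ℕ.* j)))
        ≈⟨ +-cong (×-congʳ 2 (trans (tot-cong (summable-· (λ _ → w) (summable-dilate (summable-odd s≈0))) (λ j → s-dilate (suc (2 ℕ.* j))))
             (trans (sym (tot-· w (summable-dilate (summable-odd s≈0)))) (×-congʳ w (trans (sym (tot-subst X²-0 (summable-odd s≈0))) (Dilate.cong tot-odd)))))) (-‿cong tot-odd) ⟩
      2 · (w · dilate (w · dilate (Tot s))) - w · dilate (Tot s) ∎

  G : Series
  G = Tot λ k → sinq (suc k) * U k

  nU-dilate : ∀ j → ⟨ suc (suc (2 ℕ.* j)) ⟩ * U (suc (2 ℕ.* j)) ≈ 2 · dilate (⟨ suc j ⟩ * U j)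
  nU-dilate j = trans (*-cong (trans (reflexive (≡.cong ⟨_⟩ (≡.sym (ℕ.*-suc 2 j)))) (×1-homo-* 2 (suc j))) (sym (dilate-U j)))
    (trans (solve 2 (λ n u → (# 2 :* n) :* u := 2 :× (n :* u)) refl ⟨ suc j ⟩ _)
      (×-congʳ 2 (sym (trans (Dilate.homo-* _ _) (*-congʳ (trans (Dilate.homo-· (suc j) 1#) (×-congʳ (suc j) Dilate.homo-1)))))))

  -- Liouville's identity for f(k) = cos(πk/2)
  G²-identity : 2 · (G * G) + G ≈ S - 4 · dilate (dilate S)
  G²-identity = begin
    2 · (G * G) + G
      ≈⟨ solve 1 (λ g → 2 :× (g :* g) :+ g := # 2 :* (g :* g) :+ g) refl G ⟩
    ⟨ 2 ⟩ * (G * G) + G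
      ≈⟨ +-congʳ (trans (liouville-U cosq ⟨ 2 ⟩ (λ k → sinq (suc k)) diag off) rhs) ⟩
    S + (2 · dilate (dilate S) - dilate S + (2 · dilate (dilate S) - dilate S)) - (2 · (2 · dilate (2 · dilate S)) - 2 · dilate S) - G + G
      ≈⟨ +-congʳ (+-congʳ (+-congˡ (-‿cong (+-congʳ (×-congʳ 2 (×-congʳ 2 (Dilate.homo-· 2 (dilate S)))))))) ⟩
    S + (2 · dilate (dilate S) - dilate S + (2 · dilate (dilate S) - dilate S)) - (2 · (2 · (2 · dilate (dilate S))) - 2 · dilate S) - G + G
      ≈⟨ solve 4 (λ s s₂ s₄ g → s :+ (2 :× s₄ :- s₂ :+ (2 :× s₄ :- s₂)) :- (2 :× (2 :× (2 :× s₄)) :- 2 :× s₂) :- g :+ g := s :- 4 :× s₄) refl S (dilate S) (dilate (dilate S)) G ⟩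
    S - 4 · dilate (dilate S) ∎
    where
    F : ℕ → Series
    F k = ∑ k (λ i → cosq (suc i))
    term : ℕ → Series
    term k = cosq 0 * (U k * U k) + (2 · (cosq (suc k) * (U k * U k)) - ⟨ k ⟩ * (cosq (suc k) * U k) - 2 · (F k * U k))
    diag : ∀ i → ⟨ 2 ⟩ * (sinq (suc i) * sinq (suc i)) + cosq (2 ℕ.+ (i ℕ.+ i)) ≈ cosq 0
    diag i = trans (+-congˡ (trans (reflexive (≡.cong (λ n → cosq (suc n)) (≡.sym (ℕ.+-suc i i)))) (cosq-+ (suc i) (suc i))))
      (trans (solve 2 (λ c s → # 2 :* (s :* s) :+ (c :* c :- s :* s) := c :* c :+ s :* s) refl (cosq (suc i)) (sinq (suc i))) (cosq²+sinq² (suc i)))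
    off : ∀ i k → ⟨ 2 ⟩ * (sinq (suc i) * sinq (suc (suc (i ℕ.+ k)))) + cosq (2 ℕ.+ (i ℕ.+ suc (i ℕ.+ k))) ≈ cosq (suc k)
    off i k = begin
      ⟨ 2 ⟩ * (sinq (suc i) * sinq (suc (suc (i ℕ.+ k)))) + cosq (2 ℕ.+ (i ℕ.+ suc (i ℕ.+ k)))
        ≈⟨ +-congˡ (trans (reflexive (≡.cong (λ n → cosq (suc n)) (≡.sym (ℕ.+-suc i (suc (i ℕ.+ k)))))) (cosq-+ (suc i) (suc (suc (i ℕ.+ k))))) ⟩
      ⟨ 2 ⟩ * (a * sinq j) + (b * cosq j - a * sinq j)
        ≈⟨ solve 4 (λ a b s c → # 2 :* (a :* s) :+ (b :* c :- a :* s) := b :* c :+ a :* s) refl a b (sinq j) (cosq j) ⟩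
      b * cosq j + a * sinq j
        ≈⟨ +-cong (*-congˡ (trans (reflexive (≡.cong cosq e)) (cosq-+ (suc i) (suc k)))) (*-congˡ (trans (reflexive (≡.cong sinq e)) (sinq-+ (suc i) (suc k)))) ⟩
      b * (b * cosq (suc k) - a * sinq (suc k)) + a * (a * cosq (suc k) + b * sinq (suc k))
        ≈⟨ solve 4 (λ a b c s → b :* (b :* c :- a :* s) :+ a :* (a :* c :+ b :* s) := (b :* b :+ a :* a) :* c) refl a b (cosq (suc k)) (sinq (suc k)) ⟩
      (b * b + a * a) * cosq (suc k)
        ≈⟨ trans (*-congʳ (cosq²+sinq² (suc i))) (*-identityˡ _) ⟩
      cosq (suc k) ∎
      where
      a = sinq (suc i)
      b = cosq (suc i)
      j = suc (suc (i ℕ.+ k))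
      e : j ≡ suc i ℕ.+ suc k
      e = ≡.cong suc (≡.sym (ℕ.+-suc i k))
    2F : ∀ k → 2 · F k ≈ sinq (suc k) - cosq (suc k) - 1#
    2F zero    = trans (×-congʳ 2 ∑-nil) (solve 0 (2 :× # 0 := :1 :- (:- # 0) :- :1) refl)
    2F (suc k) = trans (×-congʳ 2 (∑-snoc k)) (trans (solve 2 (λ F f → 2 :× (F :+ f) := 2 :× F :+ 2 :× f) refl _ _)
      (trans (+-congʳ (2F k)) (solve 2 (λ s c → s :- c :- :1 :+ 2 :× c := c :- (:- s) :- :1) refl (sinq (suc k)) (cosq (suc k)))))
    nU : ℕ → Series
    nU k = ⟨ suc k ⟩ * U k
    nU≈0 : Summable nU
    nU≈0 = summable-*′ _ U-summable
    cV = summable-*′ (cosq ∘ suc) V-summable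
    cnU = summable-neg (summable-*′ (cosq ∘ suc) nU≈0)
    sU = summable-neg (summable-*′ (sinq ∘ suc) U-summable)
    step : ∀ k → term k ≈ V k + (cosq (suc k) * V k + cosq (suc k) * V k) + - (cosq (suc k) * nU k) + - (sinq (suc k) * U k)
    step k = begin
      term k
        ≈⟨ solve 4 (λ c u n F → :1 :* (u :* u) :+ (2 :× (c :* (u :* u)) :- n :* (c :* u) :- 2 :× (F :* u)) :=
             (:1 :+ 2 :× c) :* (u :* u) :- n :* (c :* u) :- (2 :× F) :* u) refl (cosq (suc k)) (U k) ⟨ k ⟩ (F k) ⟩
      _ ≈⟨ +-congˡ (-‿cong (*-congʳ (2F k))) ⟩
      _ ≈⟨ solve 4 (λ c s u n → (:1 :+ 2 :× c) :* (u :* u) :- n :* (c :* u) :- (s :- c :- :1) :* u :=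
             (u :+ u :* u) :+ (c :* (u :+ u :* u) :+ c :* (u :+ u :* u)) :+ :- (c :* ((:1 :+ n) :* u)) :+ :- (s :* u)) refl (cosq (suc k)) (sinq (suc k)) (U k) ⟨ k ⟩ ⟩
      _ ∎
    rhs : Tot term ≈ S + (2 · dilate (dilate S) - dilate S + (2 · dilate (dilate S) - dilate S)) - (2 · (2 · dilate (2 · dilate S)) - 2 · dilate S) - G
    rhs = begin
      Tot term
        ≈⟨ tot-cong (summable-+ (summable-+ (summable-+ V-summable (summable-+ cV cV)) cnU) sU) step ⟩
      _ ≈⟨ trans (+-congʳ (trans (+-congʳ (trans (+-congˡ (tot-+ cV cV)) (tot-+ V-summable (summable-+ cV cV)))) (tot-+ (summable-+ V-summable (summable-+ cV cV)) cnU)))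
             (tot-+ (summable-+ (summable-+ V-summable (summable-+ cV cV)) cnU) sU) ⟨
      Tot V + (Tot (λ k → cosq (suc k) * V k) + Tot (λ k → cosq (suc k) * V k)) + Tot (λ k → - (cosq (suc k) * nU k)) + Tot (λ k → - (sinq (suc k) * U k))
        ≈⟨ +-cong (+-cong (+-cong tot-V (+-cong totcV totcV))
             (trans (sym (tot-neg (summable-*′ (cosq ∘ suc) nU≈0))) (-‿cong totcnU))) (sym (tot-neg (summable-*′ (sinq ∘ suc) U-summable))) ⟩
      S + (2 · dilate (dilate S) - dilate S + (2 · dilate (dilate S) - dilate S)) - (2 · (2 · dilate (2 · dilate S)) - 2 · dilate S) - G ∎
      where
      totcV : Tot (λ k → cosq (suc k) * V k) ≈ 2 · dilate (dilate S) - dilate S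
      totcV = trans (tot-cosq-dilate 1 V-summable (λ j → trans (sym (dilate-V j)) (sym (+-identityʳ _))))
        (+-cong (×-congʳ 2 (trans (+-identityʳ _) (Dilate.cong (trans (+-identityʳ _) (Dilate.cong tot-V))))) (-‿cong (trans (+-identityʳ _) (Dilate.cong tot-V))))
      totcnU : Tot (λ k → cosq (suc k) * nU k) ≈ 2 · (2 · dilate (2 · dilate S)) - 2 · dilate S
      totcnU = trans (tot-cosq-dilate 2 nU≈0 nU-dilate)
        (+-cong (×-congʳ 2 (×-congʳ 2 (Dilate.cong (×-congʳ 2 (Dilate.cong (sym S≈S′)))))) (-‿cong (×-congʳ 2 (Dilate.cong (sym S≈S′)))))

  private
    constant : ∀ {u} (u0 : u 0 K.≈ K.0#) n → subst ⟨ n ⟩ u ≈ ⟨ n ⟩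
    constant u0 n = trans (subst-· u0 n 1#) (×-congʳ n (subst-1 u0))

    cosq-constant : ∀ {u} (u0 : u 0 K.≈ K.0#) n → subst (cosq n) u ≈ cosq n
    sinq-constant : ∀ {u} (u0 : u 0 K.≈ K.0#) n → subst (sinq n) u ≈ sinq n
    cosq-constant u0 zero    = subst-1 u0
    cosq-constant u0 (suc n) = trans (subst-neg u0 _) (-‿cong (sinq-constant u0 n))
    sinq-constant u0 zero    = subst-0 u0
    sinq-constant u0 (suc n) = cosq-constant u0 n

    flip-odd-part : ∀ (a : ℕ → Series) → (∀ j → flip (a j) ≈ a j) → (∀ j → dilate (a j) ≈ a j) →
      flip (Tot λ j → a j * U (2 ℕ.* j)) ≈ 2 · dilate (Tot λ j → a j * U (2 ℕ.* j)) - Tot (λ j → a j * U (2 ℕ.* j))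
    flip-odd-part a af ad = begin
      flip (Tot t)                                ≈⟨ tot-subst neg-X-0 t≈0 ⟩
      Tot (λ j → flip (t j))                      ≈⟨ tot-cong (summable-+ 2dt (summable-neg t≈0)) (λ j →
          trans (Flip.homo-* _ _) (trans (*-cong (af j) (flip-U-odd j)) (trans (solve 3 (λ a d u → a :* (2 :× d :- u) := 2 :× (a :* d) :- a :* u) refl (a j) _ _)
            (+-congʳ (×-congʳ 2 (trans (*-congʳ (sym (ad j))) (sym (Dilate.homo-* _ _)))))))) ⟩
      Tot (λ j → 2 · dilate (t j) - t j)          ≈⟨ tot-+ 2dt (summable-neg t≈0) ⟨
      Tot (λ j → 2 · dilate (t j)) + Tot (λ j → - t j)  ≈⟨ +-cong (trans (×-congʳ 2 (tot-subst X²-0 t≈0)) (tot-· 2 (summable-dilate t≈0))) (tot-neg t≈0) ⟨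
      2 · dilate (Tot t) - Tot t                  ∎
      where
      t : ℕ → Series
      t j = a j * U (2 ℕ.* j)
      t≈0 : Summable t
      t≈0 = summable-*′ a (summable-even U-summable)
      2dt = summable-· (λ _ → 2) (summable-dilate t≈0)

  flip-G : flip G ≈ 2 · dilate G - G
  flip-G = trans (Flip.cong G≈) (trans (flip-odd-part _ (λ j → sinq-constant neg-X-0 (suc (2 ℕ.* j))) (λ j → sinq-constant X²-0 (suc (2 ℕ.* j))))
    (+-cong (×-congʳ 2 (Dilate.cong (sym G≈))) (-‿cong (sym G≈))))
    where
    G≈ : G ≈ Tot (λ j → sinq (suc (2 ℕ.* j)) * U (2 ℕ.* j))
    G≈ = trans (tot-pairs (summable-*′ _ U-summable)) (tot-cong (summable-*′ _ (summable-even U-summable)) λ j →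
      trans (+-congˡ (trans (*-congʳ (trans (-‿cong (sinq-even j)) (solve 0 (:- # 0 := # 0) refl))) (zeroˡ _))) (+-identityʳ _))

  flip-S : flip S ≈ 6 · dilate S - 4 · dilate (dilate S) - S
  flip-S = begin
    flip S                       ≈⟨ Flip.cong S≈O+E ⟩
    flip (O + 2 · dilate S)      ≈⟨ trans (Flip.homo-+ _ _) (+-cong (flip-odd-part _ (λ j → constant neg-X-0 (suc (2 ℕ.* j))) (λ j → constant X²-0 (suc (2 ℕ.* j))))
                                      (trans (Flip.homo-· 2 _) (×-congʳ 2 (flip-dilate S)))) ⟩
    2 · dilate O - O + 2 · dilate S
                                 ≈⟨ +-congʳ (+-cong (×-congʳ 2 (trans (Dilate.cong O≈) (trans (Dilate.homo-- _ _) (+-congˡ (-‿cong (Dilate.homo-· 2 _)))))) (-‿cong O≈)) ⟩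
    2 · (dilate S - 2 · dilate (dilate S)) - (S - 2 · dilate S) + 2 · dilate S
                                 ≈⟨ solve 3 (λ s s₂ s₄ → 2 :× (s₂ :- 2 :× s₄) :- (s :- 2 :× s₂) :+ 2 :× s₂ := 6 :× s₂ :- 4 :× s₄ :- s) refl S (dilate S) _ ⟩
    6 · dilate S - 4 · dilate (dilate S) - S ∎
    where
    nU≈0 : Summable (λ k → ⟨ suc k ⟩ * U k)
    nU≈0 = summable-*′ _ U-summable
    O = Tot λ j → ⟨ suc (2 ℕ.* j) ⟩ * U (2 ℕ.* j)
    S≈O+E : S ≈ O + 2 · dilate S
    S≈O+E = trans S≈S′ (trans (tot-pairs nU≈0) (trans (sym (tot-+ (summable-even nU≈0) (summable-odd nU≈0)))
      (+-congˡ (trans (tot-odd 2 nU≈0 nU-dilate) (×-congʳ 2 (Dilate.cong (sym S≈S′)))))))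
    O≈ : O ≈ S - 2 · dilate S
    O≈ = trans (solve 2 (λ o e → o := (o :+ e) :- e) refl O (2 · dilate S)) (+-congʳ (sym S≈O+E))

  -- Theta constants

  S₂ S₄ S₈ c₁ e₁ w₁ w₂ w₃ x₁ y₁ : Series
  S₂ = dilate S
  S₄ = dilate S₂
  S₈ = dilate S₄
  c₁ = 1# + 4 · G
  e₁ = flip c₁
  w₁ = 8 · (S - 5 · S₂ + 4 · S₄)
  w₂ = 8 · (S₂ - S)
  w₃ = 1# + 8 · (S₂ - 4 · S₄)
  x₁ = c₁ * c₁
  y₁ = e₁ * e₁

  x≈w₃-w₂ : x₁ ≈ w₃ - w₂
  x≈w₃-w₂ = begin
    c₁ * c₁                     ≈⟨ solve 1 (λ g → (:1 :+ 4 :× g) :* (:1 :+ 4 :× g) := :1 :+ 8 :× (2 :× (g :* g) :+ g)) refl G ⟩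
    1# + 8 · (2 · (G * G) + G)  ≈⟨ +-congˡ (×-congʳ 8 G²-identity) ⟩
    1# + 8 · (S - 4 · S₄)       ≈⟨ solve 3 (λ s s₂ s₄ → :1 :+ 8 :× (s :- 4 :× s₄) := :1 :+ 8 :× (s₂ :- 4 :× s₄) :- 8 :× (s₂ :- s)) refl S S₂ S₄ ⟩
    w₃ - w₂                     ∎

  flip-S₂ : flip S₂ ≈ S₂
  flip-S₂ = flip-dilate S

  flip-S₄ : flip S₄ ≈ S₄
  flip-S₄ = flip-dilate S₂

  flip-w₁ : flip w₁ ≈ w₂
  flip-w₁ = trans (Flip.homo-· 8 _) (trans (×-congʳ 8 (trans (Flip.homo-+ _ _) (+-cong (trans (Flip.homo-- _ _)
      (+-cong flip-S (-‿cong (trans (Flip.homo-· 5 _) (×-congʳ 5 flip-S₂))))) (trans (Flip.homo-· 4 _) (×-congʳ 4 flip-S₄)))))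
    (solve 3 (λ s s₂ s₄ → 8 :× ((6 :× s₂ :- 4 :× s₄ :- s) :- 5 :× s₂ :+ 4 :× s₄) := 8 :× (s₂ :- s)) refl S S₂ S₄))

  flip-w₂ : flip w₂ ≈ w₁
  flip-w₂ = trans (Flip.homo-· 8 _) (trans (×-congʳ 8 (trans (Flip.homo-- _ _) (+-cong flip-S₂ (-‿cong flip-S))))
    (solve 3 (λ s s₂ s₄ → 8 :× (s₂ :- (6 :× s₂ :- 4 :× s₄ :- s)) := 8 :× (s :- 5 :× s₂ :+ 4 :× s₄)) refl S S₂ S₄))

  flip-w₃ : flip w₃ ≈ w₃
  flip-w₃ = trans (Flip.homo-+ _ _) (+-cong Flip.homo-1 (trans (Flip.homo-· 8 _) (×-congʳ 8
    (trans (Flip.homo-- _ _) (+-cong flip-S₂ (-‿cong (trans (Flip.homo-· 4 _) (×-congʳ 4 flip-S₄))))))))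

  y≈w₃-w₁ : y₁ ≈ w₃ - w₁
  y≈w₃-w₁ = trans (sym (Flip.homo-* c₁ c₁)) (trans (Flip.cong x≈w₃-w₂) (trans (Flip.homo-- _ _) (+-cong flip-w₃ (-‿cong flip-w₂))))

  c₂ e₂ : Series
  c₂ = dilate c₁
  e₂ = dilate e₁

  2c₂ : 2 · c₂ ≈ c₁ + e₁
  2c₂ = begin
    2 · dilate (1# + 4 · G)     ≈⟨ ×-congʳ 2 (trans (Dilate.homo-+ _ _) (+-cong Dilate.homo-1 (Dilate.homo-· 4 G))) ⟩
    2 · (1# + 4 · dilate G)     ≈⟨ solve 2 (λ d g → 2 :× (:1 :+ 4 :× d) := (:1 :+ 4 :× g) :+ (:1 :+ 4 :× (2 :× d :- g))) refl (dilate G) G ⟩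
    c₁ + (1# + 4 · (2 · dilate G - G)) ≈⟨ +-congˡ (trans (Flip.homo-+ _ _) (+-cong Flip.homo-1 (trans (Flip.homo-· 4 G) (×-congʳ 4 flip-G)))) ⟨
    c₁ + e₁                     ∎

  x₁-S : x₁ ≈ 1# + 8 · (S - 4 · S₄)
  x₁-S = trans x≈w₃-w₂ (solve 3 (λ s s₂ s₄ → :1 :+ 8 :× (s₂ :- 4 :× s₄) :- 8 :× (s₂ :- s) := :1 :+ 8 :× (s :- 4 :× s₄)) refl S S₂ S₄)

  y₁-S : y₁ ≈ 1# + 8 · (6 · S₂ - S - 8 · S₄)
  y₁-S = trans y≈w₃-w₁ (solve 3 (λ s s₂ s₄ → :1 :+ 8 :× (s₂ :- 4 :× s₄) :- 8 :× (s :- 5 :× s₂ :+ 4 :× s₄) := :1 :+ 8 :× (6 :× s₂ :- s :- 8 :× s₄)) refl S S₂ S₄)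

  dilate-x : c₂ * c₂ ≈ 1# + 8 · (S₂ - 4 · S₈)
  dilate-x = trans (sym (Dilate.homo-* c₁ c₁)) (trans (Dilate.cong x₁-S) (trans (Dilate.homo-+ _ _) (+-cong Dilate.homo-1
    (trans (Dilate.homo-· 8 _) (×-congʳ 8 (trans (Dilate.homo-- _ _) (+-congˡ (-‿cong (Dilate.homo-· 4 S₄)))))))))

  dilate-y : e₂ * e₂ ≈ 1# + 8 · (6 · S₄ - S₂ - 8 · S₈)
  dilate-y = trans (sym (Dilate.homo-* e₁ e₁)) (trans (Dilate.cong y₁-S) (trans (Dilate.homo-+ _ _) (+-cong Dilate.homo-1
    (trans (Dilate.homo-· 8 _) (×-congʳ 8 (trans (Dilate.homo-- _ _) (+-cong (trans (Dilate.homo-- _ _) (+-congʳ (Dilate.homo-· 6 S₂))) (-‿cong (Dilate.homo-· 8 S₄)))))))))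

  e₂² : e₂ * e₂ ≈ c₁ * e₁
  e₂² = cancel-· 1 (begin
    2 · (e₂ * e₂)
      ≈⟨ ×-congʳ 2 dilate-y ⟩
    2 · (1# + 8 · (6 · S₄ - S₂ - 8 · S₈))
      ≈⟨ solve 4 (λ s s₂ s₄ s₈ → 2 :× (:1 :+ 8 :× (6 :× s₄ :- s₂ :- 8 :× s₈)) :=
           4 :× (:1 :+ 8 :× (s₂ :- 4 :× s₈)) :- (:1 :+ 8 :× (s :- 4 :× s₄)) :- (:1 :+ 8 :× (6 :× s₂ :- s :- 8 :× s₄))) refl S S₂ S₄ S₈ ⟩
    4 · (1# + 8 · (S₂ - 4 · S₈)) - (1# + 8 · (S - 4 · S₄)) - (1# + 8 · (6 · S₂ - S - 8 · S₄))
      ≈⟨ +-cong (+-cong (×-congʳ 4 (sym dilate-x)) (-‿cong (sym x₁-S))) (-‿cong (sym y₁-S)) ⟩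
    4 · (c₂ * c₂) - c₁ * c₁ - e₁ * e₁
      ≈⟨ solve 3 (λ d c e → 4 :× (d :* d) :- c :* c :- e :* e := (2 :× d) :* (2 :× d) :- c :* c :- e :* e) refl c₂ c₁ e₁ ⟩
    (2 · c₂) * (2 · c₂) - c₁ * c₁ - e₁ * e₁
      ≈⟨ +-congʳ (+-congʳ (*-cong 2c₂ 2c₂)) ⟩
    (c₁ + e₁) * (c₁ + e₁) - c₁ * c₁ - e₁ * e₁
      ≈⟨ solve 2 (λ c e → (c :+ e) :* (c :+ e) :- c :* c :- e :* e := 2 :× (c :* e)) refl c₁ e₁ ⟩
    2 · (c₁ * e₁) ∎)

  4Dc₂ : 4 · dilate (D c₁) ≈ D c₁ + D e₁
  4Dc₂ = begin
    4 · dilate (D c₁)         ≈⟨ solve 1 (λ a → 4 :× a := 2 :× (2 :× a)) refl _ ⟩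
    2 · (2 · dilate (D c₁))   ≈⟨ ×-congʳ 2 (sym (D-dilate c₁)) ⟩
    2 · D c₂                  ≈⟨ D-· 2 c₂ ⟨
    D (2 · c₂)                ≈⟨ D-cong 2c₂ ⟩
    D (c₁ + e₁)               ≈⟨ D-+ c₁ e₁ ⟩
    D c₁ + D e₁               ∎

  4e₂De₂ : 4 · (e₂ * dilate (D e₁)) ≈ D c₁ * e₁ + c₁ * D e₁
  4e₂De₂ = begin
    4 · (e₂ * dilate (D e₁))  ≈⟨ solve 2 (λ e d → 4 :× (e :* d) := (2 :× d) :* e :+ e :* (2 :× d)) refl e₂ (dilate (D e₁)) ⟩
    (2 · dilate (D e₁)) * e₂ + e₂ * (2 · dilate (D e₁)) ≈⟨ +-cong (*-congʳ (D-dilate e₁)) (*-congˡ (D-dilate e₁)) ⟨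
    D e₂ * e₂ + e₂ * D e₂     ≈⟨ D-* e₂ e₂ ⟨
    D (e₂ * e₂)               ≈⟨ D-cong e₂² ⟩
    D (c₁ * e₁)               ≈⟨ D-* c₁ e₁ ⟩
    D c₁ * e₁ + c₁ * D e₁     ∎

  grow : ∀ {f} n₀ → f ≈[ n₀ ] 0# → (∀ n → n₀ ℕ.≤ n → f ≈[ n ] 0# → f ≈[ suc n ] 0#) → f ≈ 0#
  grow {f} n₀ h step = unmod λ N → mod-≤ (ℕ.m≤n+m N n₀) (go N)
    where
    go : ∀ N → f ≈[ n₀ ℕ.+ N ] 0#
    go zero    = ≡.subst (λ n → f ≈[ n ] 0#) (≡.sym (ℕ.+-identityʳ n₀)) h
    go (suc N) = ≡.subst (λ n → f ≈[ n ] 0#) (≡.sym (ℕ.+-suc n₀ N)) (step (n₀ ℕ.+ N) (ℕ.m≤m+n n₀ N) (go N))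

  U₀-mod-2 : U 0 ≈[ 2 ] X
  U₀-mod-2 = Mod.trans 2 (mod (trans (solve 2 (λ x i → x :* :1 :* i := x :* i) refl X _) refl))
    (Mod.trans 2 (*-mod-suc K.refl (⟪ (λ { zero _ → inv0 ; (suc n) (s≤s ()) }) ⟫)) (mod (*-identityʳ X)))
    where
    inv0 : inverse (1# - P 0) 0 K.≈ 1# 0
    inv0 = K.trans (K.sym (K.*-identityˡ _)) (K.trans (K.*-congʳ (K.sym (1-P-0 0))) (K.trans (K.sym (coeff-*-0 _ _))
      (at (*-inverse (1-P-0 0)) 0)))

  tot-mod-2 : ∀ {s} → Summable s → Tot s ≈[ 2 ] s 0
  tot-mod-2 s≈0 = Mod.trans 2 (tot-mod s≈0 1) (mod (trans ∑-cons (trans (+-congˡ ∑-nil) (+-identityʳ _))))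

  G-mod-2 : G ≈[ 2 ] X
  G-mod-2 = Mod.trans 2 (tot-mod-2 (summable-*′ _ U-summable)) (Mod.trans 2 (mod (*-identityˡ _)) U₀-mod-2)

  S-mod-2 : S ≈[ 2 ] X
  S-mod-2 = Mod.trans 2 (tot-mod-2 S-summable) (Mod.trans 2 (mod (+-identityʳ _)) U₀-mod-2)

  ·-cong-mod : ∀ {N} k {f g} → f ≈[ N ] g → k · f ≈[ N ] k · g
  ·-cong-mod {N} zero    h = Mod.refl N
  ·-cong-mod {N} (suc k) h = Mod.+-cong N h (·-cong-mod k h)

  c-mod-2 : c₁ ≈[ 2 ] 1# + 4 · X
  c-mod-2 = Mod.+-congˡ 2 (·-cong-mod 4 G-mod-2)

  e-mod-2 : e₁ ≈[ 2 ] 1# - 4 · X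
  e-mod-2 = Mod.trans 2 (Flip.cong-mod c-mod-2) (mod (trans (Flip.homo-+ 1# _) (+-cong Flip.homo-1
    (trans (Flip.homo-· 4 X) (trans (×-congʳ 4 (subst-X neg-X-0)) (solve 1 (λ x → 4 :× (:- x) := :- (4 :× x)) refl X))))))

  c-0 : c₁ 0 K.≈ K.1#
  c-0 = K.trans (at[ c-mod-2 ] 0 (s≤s z≤n)) (K.trans (coeff-+ 1# _ 0) (K.trans (K.+-cong coeff-1-0 (coeff-· 4 X 0))
    (K.solve 0 (:1 :+ 4 :× # 0 := :1) K.refl)))

  e-0 : e₁ 0 K.≈ K.1#
  e-0 = K.trans (subst-coeff-0 neg-X-0 c₁) c-0

  X²-mod-2 : ∀ f → X * X * f ≈[ 2 ] 0#
  X²-mod-2 f = Mod.trans 2 (mod (*-assoc X X f)) (*-order K.refl (*-order K.refl mod-zero))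

  -- 2 D log (c/e) = c² - e²: the difference Z satisfies
  -- 8 e(q²) Z(q²) = (c - e) Z, by c(q²) = (c+e)/2 and e(q²)² = c e.
  D-log-c/e : 2 · (e₁ * D c₁ - c₁ * D e₁) ≈ c₁ * e₁ * (x₁ - y₁)
  D-log-c/e = x-y≈0⇒x≈y (grow 2 base step)
    where
    Z = 2 · (e₁ * D c₁ - c₁ * D e₁) - c₁ * e₁ * (x₁ - y₁)
    base : Z ≈[ 2 ] 0#
    base = M.trans (M.+-cong (·-cong-mod 2 (M.+-cong (M.*-cong e-mod-2 Dc) (M.-‿cong (M.*-cong c-mod-2 De))))
        (M.-‿cong (M.*-cong (M.*-cong c-mod-2 e-mod-2) (M.+-cong (M.*-cong c-mod-2 c-mod-2) (M.-‿cong (M.*-cong e-mod-2 e-mod-2))))))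
      (M.trans (mod (solve 1 (λ x → 2 :× ((:1 :- 4 :× x) :* (4 :× x) :- (:1 :+ 4 :× x) :* (:- (4 :× x))) :-
          (:1 :+ 4 :× x) :* (:1 :- 4 :× x) :* ((:1 :+ 4 :× x) :* (:1 :+ 4 :× x) :- (:1 :- 4 :× x) :* (:1 :- 4 :× x)) :=
          x :* x :* (256 :× x)) refl X)) (X²-mod-2 _))
      where
      module M = Mod 2
      Dc : D c₁ ≈[ 2 ] 4 · X
      Dc = M.trans (D-cong-mod c-mod-2) (mod (trans (D-+ 1# _) (trans (+-cong D-1 (trans (D-· 4 X) (×-congʳ 4 D-X))) (+-identityˡ _))))
      De : D e₁ ≈[ 2 ] - (4 · X)
      De = M.trans (D-cong-mod e-mod-2) (mod (trans (D-- 1# _) (trans (+-cong D-1 (-‿cong (trans (D-· 4 X) (×-congʳ 4 D-X)))) (+-identityˡ _))))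
    relation : 8 · (e₂ * dilate Z) ≈ (c₁ - e₁) * Z
    relation = begin
      8 · (e₂ * dilate Z)
        ≈⟨ ×-congʳ 8 (*-congˡ (trans (Dilate.homo-- _ _) (+-cong (trans (Dilate.homo-· 2 _) (×-congʳ 2 (trans (Dilate.homo-- _ _) (+-cong (Dilate.homo-* _ _) (-‿cong (Dilate.homo-* _ _))))))
             (-‿cong (trans (Dilate.homo-* _ _) (*-cong (Dilate.homo-* _ _) (trans (Dilate.homo-- _ _) (+-cong (Dilate.homo-* _ _) (-‿cong (Dilate.homo-* _ _)))))))))) ⟩
      8 · (e₂ * (2 · (e₂ * p - c₂ * q) - c₂ * e₂ * (c₂ * c₂ - e₂ * e₂)))
        ≈⟨ solve 4 (λ c e p q → 8 :× (e :* (2 :× (e :* p :- c :* q) :- c :* e :* (c :* c :- e :* e))) :=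
             4 :× ((e :* e) :* (4 :× p)) :- 2 :× ((2 :× c) :* (4 :× (e :* q))) :- (2 :× c) :* (e :* e) :* ((2 :× c) :* (2 :× c) :- 4 :× (e :* e))) refl c₂ e₂ p q ⟩
      4 · ((e₂ * e₂) * (4 · p)) - 2 · ((2 · c₂) * (4 · (e₂ * q))) - (2 · c₂) * (e₂ * e₂) * ((2 · c₂) * (2 · c₂) - 4 · (e₂ * e₂))
        ≈⟨ +-cong (+-cong (×-congʳ 4 (*-cong e₂² 4Dc₂)) (-‿cong (×-congʳ 2 (*-cong 2c₂ 4e₂De₂)))) (-‿cong (*-cong (*-cong 2c₂ e₂²) (+-cong (*-cong 2c₂ 2c₂) (-‿cong (×-congʳ 4 e₂²))))) ⟩
      _ ≈⟨ solve 4 (λ c e p q → 4 :× ((c :* e) :* (p :+ q)) :- 2 :× ((c :+ e) :* (p :* e :+ c :* q)) :- (c :+ e) :* (c :* e) :* ((c :+ e) :* (c :+ e) :- 4 :× (c :* e)) :=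
             (c :- e) :* (2 :× (e :* p :- c :* q) :- c :* e :* (c :* c :- e :* e))) refl c₁ e₁ (D c₁) (D e₁) ⟩
      (c₁ - e₁) * Z ∎
      where
      p = dilate (D c₁)
      q = dilate (D e₁)
    t : Series
    t = tail (c₁ - e₁)
    8X : c₁ - e₁ ≈[ 2 ] 8 · X
    8X = Mod.trans 2 (Mod.+-cong 2 c-mod-2 (Mod.-‿cong 2 e-mod-2)) (mod (solve 1 (λ x → (:1 :+ 4 :× x) :- (:1 :- 4 :× x) := 8 :× x) refl X))
    c-e : c₁ - e₁ ≈ X * t
    c-e = trans (split (c₁ - e₁)) (trans (+-congʳ (trans (const-cong (K.trans (at[ 8X ] 0 (s≤s z≤n)) (K.trans (coeff-· 8 X 0)
      (K.solve 0 (8 :× # 0 := # 0) K.refl)))) const-0)) (+-identityˡ _))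
    t-regular : ∀ x → t 0 K.* x K.≈ K.0# → x K.≈ K.0#
    t-regular x h = torsion-free 7 x (K.trans (K.solve 1 (λ x → 8 :× x := (8 :× :1) :* x) K.refl x)
      (K.trans (K.*-congʳ (K.sym (K.trans (at[ 8X ] 1 (s≤s (s≤s z≤n))) (coeff-· 8 X 1)))) h))
    step : ∀ n → 2 ℕ.≤ n → Z ≈[ n ] 0# → Z ≈[ suc n ] 0#
    step n 2≤n h = cancel-*ˡ-mod (suc n) t-regular (Mod.trans (suc n) (Mod.sym (suc n) (mod ⟪ (λ m → X-coeff (t * Z) m) ⟫))
        (Mod.trans (suc n) (tail-cong {X * (t * Z)} {0#} XtZ) ⟪ (λ m _ → K.trans (coeff-0 (suc m)) (K.sym (coeff-0 m))) ⟫))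
      where
      XtZ : X * (t * Z) ≈[ suc (suc n) ] 0#
      XtZ = mod-≤ (ℕ.≤-trans (ℕ.+-monoˡ-≤ n 2≤n) (ℕ.≤-reflexive (≡.trans (≡.cong (n ℕ.+_) (≡.sym (ℕ.+-identityʳ n))) (ℕ.*-comm 2 n))))
        (Mod.trans (n ℕ.* 2) (mod (trans (sym (*-assoc X t Z)) (trans (*-congʳ (sym c-e)) (sym relation))))
          (Mod.trans (n ℕ.* 2) (·-cong-mod 8 (Mod.trans (n ℕ.* 2) (Mod.*-congˡ (n ℕ.* 2) (dilate-order n h)) (mod (zeroʳ e₂))))
            (mod (solve 0 (8 :× # 0 := # 0) refl))))

  n+n≡n*2 : ∀ n → n ℕ.+ n ≡ n ℕ.* 2
  n+n≡n*2 n = ≡.trans (≡.cong (n ℕ.+_) (≡.sym (ℕ.+-identityʳ n))) (ℕ.*-comm 2 n)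

  suc≤*2 : ∀ n → 1 ℕ.≤ n → suc n ℕ.≤ n ℕ.* 2
  suc≤*2 n 1≤n = ℕ.≤-trans (ℕ.+-monoˡ-≤ n 1≤n) (ℕ.≤-reflexive (n+n≡n*2 n))

  dilate-S-mod-1 : ∀ f → f ≈[ 1 ] 0# → dilate f ≈[ 1 ] 0#
  dilate-S-mod-1 f h = mod-≤ (s≤s z≤n) (dilate-order 1 h)

  S-mod-1 : S ≈[ 1 ] 0#
  S-mod-1 = Mod.trans 1 (mod-≤ (s≤s z≤n) S-mod-2) (mod-1 K.refl)

  w₁-mod-1 : w₁ ≈[ 1 ] 0#
  w₁-mod-1 = Mod.trans 1 (·-cong-mod 8 (Mod.+-cong 1 (Mod.+-cong 1 S-mod-1 (Mod.-‿cong 1 (·-cong-mod 5 (dilate-S-mod-1 S S-mod-1))))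
      (·-cong-mod 4 (dilate-S-mod-1 S₂ (dilate-S-mod-1 S S-mod-1)))))
    (mod (solve 0 (8 :× (# 0 :- 5 :× # 0 :+ 4 :× # 0) := # 0) refl))

  D-mod-1 : ∀ f → D f ≈[ 1 ] 0#
  D-mod-1 f = mod-1 (coeff-D f 0)

  2Dc : 2 · D c₁ ≈ c₁ * w₁
  2Dc = x-y≈0⇒x≈y (grow 1 base step)
    where
    Z = 2 · D c₁ - c₁ * w₁
    base : Z ≈[ 1 ] 0#
    base = Mod.trans 1 (Mod.+-cong 1 (·-cong-mod 2 (D-mod-1 c₁)) (Mod.-‿cong 1 (Mod.trans 1 (Mod.*-congˡ 1 w₁-mod-1) (mod (zeroʳ c₁)))))
      (mod (solve 0 (2 :× # 0 :- # 0 := # 0) refl))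
    fZ : flip Z ≈ 2 · D e₁ - e₁ * w₂
    fZ = trans (Flip.homo-- _ _) (+-cong (trans (Flip.homo-· 2 _) (×-congʳ 2 (sym (D-flip c₁)))) (-‿cong (trans (Flip.homo-* _ _) (*-congˡ flip-w₁))))
    eZ≈cfZ : e₁ * Z ≈ c₁ * flip Z
    eZ≈cfZ = begin
      e₁ * (2 · D c₁ - c₁ * w₁)
        ≈⟨ solve 5 (λ c e p q w → e :* (2 :× p :- c :* w) := 2 :× (e :* p :- c :* q) :+ 2 :× (c :* q) :- c :* e :* w) refl c₁ e₁ (D c₁) (D e₁) w₁ ⟩
      2 · (e₁ * D c₁ - c₁ * D e₁) + 2 · (c₁ * D e₁) - c₁ * e₁ * w₁
        ≈⟨ +-congʳ (+-congʳ (trans D-log-c/e (*-congˡ (+-cong x≈w₃-w₂ (-‿cong y≈w₃-w₁))))) ⟩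
      c₁ * e₁ * (w₃ - w₂ - (w₃ - w₁)) + 2 · (c₁ * D e₁) - c₁ * e₁ * w₁
        ≈⟨ solve 6 (λ c e q w₁ w₂ w₃ → c :* e :* (w₃ :- w₂ :- (w₃ :- w₁)) :+ 2 :× (c :* q) :- c :* e :* w₁ := c :* (2 :× q :- e :* w₂)) refl c₁ e₁ (D e₁) w₁ w₂ w₃ ⟩
      c₁ * (2 · D e₁ - e₁ * w₂)
        ≈⟨ *-congˡ fZ ⟨
      c₁ * flip Z ∎
    dilate-w₂ : 4 · dilate w₂ ≈ w₁ + w₂
    dilate-w₂ = trans (×-congʳ 4 (trans (Dilate.homo-· 8 _) (×-congʳ 8 (Dilate.homo-- _ _))))
      (solve 3 (λ s s₂ s₄ → 4 :× (8 :× (s₄ :- s₂)) := 8 :× (s :- 5 :× s₂ :+ 4 :× s₄) :+ 8 :× (s₂ :- s)) refl S S₂ S₄)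
    relation : e₁ * Z ≈ 2 · (e₂ * dilate (flip Z))
    relation = cancel-· 1 (begin
      2 · (e₁ * Z)
        ≈⟨ solve 1 (λ a → 2 :× a := a :+ a) refl _ ⟩
      e₁ * Z + e₁ * Z
        ≈⟨ +-congˡ (trans eZ≈cfZ (*-congˡ fZ)) ⟩
      e₁ * (2 · D c₁ - c₁ * w₁) + c₁ * (2 · D e₁ - e₁ * w₂)
        ≈⟨ solve 6 (λ c e p q w v → e :* (2 :× p :- c :* w) :+ c :* (2 :× q :- e :* v) := 2 :× (p :* e :+ c :* q) :- (c :* e) :* (w :+ v)) refl c₁ e₁ (D c₁) (D e₁) w₁ w₂ ⟩
      2 · (D c₁ * e₁ + c₁ * D e₁) - (c₁ * e₁) * (w₁ + w₂)
        ≈⟨ +-cong (×-congʳ 2 4e₂De₂) (-‿cong (*-cong e₂² dilate-w₂)) ⟨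
      2 · (4 · (e₂ * dilate (D e₁))) - (e₂ * e₂) * (4 · dilate w₂)
        ≈⟨ solve 3 (λ e q w → 2 :× (4 :× (e :* q)) :- (e :* e) :* (4 :× w) := 2 :× (2 :× (e :* (2 :× q :- e :* w)))) refl e₂ (dilate (D e₁)) (dilate w₂) ⟩
      2 · (2 · (e₂ * (2 · dilate (D e₁) - e₂ * dilate w₂)))
        ≈⟨ ×-congʳ 2 (×-congʳ 2 (*-congˡ (trans (Dilate.cong fZ) (trans (Dilate.homo-- _ _) (+-cong (Dilate.homo-· 2 _) (-‿cong (Dilate.homo-* _ _))))))) ⟨
      2 · (2 · (e₂ * dilate (flip Z))) ∎)
    step : ∀ n → 1 ℕ.≤ n → Z ≈[ n ] 0# → Z ≈[ suc n ] 0#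
    step n 1≤n h = mod-≤ (suc≤*2 n 1≤n) (cancel-*ˡ-mod (n ℕ.* 2) (≈1-cancel e-0) (Mod.trans (n ℕ.* 2) (mod relation)
      (Mod.trans (n ℕ.* 2) (·-cong-mod 2 (Mod.trans (n ℕ.* 2) (Mod.*-congˡ (n ℕ.* 2) (dilate-order n (Mod.trans n (Flip.cong-mod h) (mod Flip.homo-0)))) (mod (zeroʳ e₂))))
        (mod (solve 0 (2 :× # 0 := # 0) refl)))))

  2De : 2 · D e₁ ≈ e₁ * w₂
  2De = trans (×-congʳ 2 (D-flip c₁)) (trans (sym (Flip.homo-· 2 _)) (trans (Flip.cong 2Dc) (trans (Flip.homo-* _ _) (*-congˡ flip-w₁))))

  w₁≈ : w₁ ≈ w₃ - y₁
  w₁≈ = trans (solve 2 (λ a b → a := b :- (b :- a)) refl w₁ w₃) (+-congˡ (-‿cong (sym y≈w₃-w₁)))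

  w₂≈ : w₂ ≈ w₃ - x₁
  w₂≈ = trans (solve 2 (λ a b → a := b :- (b :- a)) refl w₂ w₃) (+-congˡ (-‿cong (sym x≈w₃-w₂)))

  -- The difference of the two sides is multiplied by 4 under q ↦ q².
  2Dw₃ : 2 · D w₃ ≈ w₃ * w₃ - x₁ * y₁
  2Dw₃ = sym (x-y≈0⇒x≈y (grow 1 base step))
    where
    Z = w₃ * w₃ - x₁ * y₁ - 2 · D w₃
    dilate-w₃ : 2 · dilate w₃ ≈ w₃ + c₁ * e₁
    dilate-w₃ = trans (×-congʳ 2 (trans (Dilate.homo-+ _ _) (+-cong Dilate.homo-1 (trans (Dilate.homo-· 8 _) (×-congʳ 8
        (trans (Dilate.homo-- _ _) (+-congˡ (-‿cong (Dilate.homo-· 4 _)))))))))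
      (trans (solve 3 (λ s₂ s₄ s₈ → 2 :× (:1 :+ 8 :× (s₄ :- 4 :× s₈)) := (:1 :+ 8 :× (s₂ :- 4 :× s₄)) :+ (:1 :+ 8 :× (6 :× s₄ :- s₂ :- 8 :× s₈))) refl S₂ S₄ S₈)
        (+-congˡ (trans (sym dilate-y) e₂²)))
    2Dp : 2 · D (c₁ * e₁) ≈ (c₁ * e₁) * (w₃ + w₃ - x₁ - y₁)
    2Dp = trans (×-congʳ 2 (D-* c₁ e₁)) (trans (solve 4 (λ p e c q → 2 :× (p :* e :+ c :* q) := (2 :× p) :* e :+ c :* (2 :× q)) refl _ _ _ _)
      (trans (+-cong (*-congʳ (trans 2Dc (*-congˡ w₁≈))) (*-congˡ (trans 2De (*-congˡ w₂≈))))
        (solve 5 (λ c e w x y → c :* (w :- y) :* e :+ c :* (e :* (w :- x)) := (c :* e) :* (w :+ w :- x :- y)) refl c₁ e₁ w₃ x₁ y₁)))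
    4Dw₃₂ : 4 · dilate (D w₃) ≈ D w₃ + D (c₁ * e₁)
    4Dw₃₂ = trans (solve 1 (λ a → 4 :× a := 2 :× (2 :× a)) refl _) (trans (×-congʳ 2 (sym (D-dilate w₃)))
      (trans (sym (D-· 2 _)) (trans (D-cong dilate-w₃) (D-+ _ _))))
    relation : Z ≈ 4 · dilate Z
    relation = sym (begin
      4 · dilate Z
        ≈⟨ ×-congʳ 4 (trans (Dilate.homo-- _ _) (+-cong (trans (Dilate.homo-- _ _) (+-cong (Dilate.homo-* _ _) (-‿cong (trans (Dilate.homo-* _ _) (*-cong (Dilate.homo-* _ _) (Dilate.homo-* _ _))))))
             (-‿cong (Dilate.homo-· 2 _)))) ⟩
      4 · (dilate w₃ * dilate w₃ - (c₂ * c₂) * (e₂ * e₂) - 2 · dilate (D w₃))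
        ≈⟨ solve 4 (λ w c e d → 4 :× (w :* w :- (c :* c) :* e :- 2 :× d) := (2 :× w) :* (2 :× w) :- (2 :× c) :* (2 :× c) :* e :- 2 :× (4 :× d)) refl (dilate w₃) c₂ (e₂ * e₂) (dilate (D w₃)) ⟩
      (2 · dilate w₃) * (2 · dilate w₃) - (2 · c₂) * (2 · c₂) * (e₂ * e₂) - 2 · (4 · dilate (D w₃))
        ≈⟨ +-cong (+-cong (*-cong dilate-w₃ dilate-w₃) (-‿cong (*-cong (*-cong 2c₂ 2c₂) e₂²))) (-‿cong (×-congʳ 2 4Dw₃₂)) ⟩
      (w₃ + c₁ * e₁) * (w₃ + c₁ * e₁) - (c₁ + e₁) * (c₁ + e₁) * (c₁ * e₁) - 2 · (D w₃ + D (c₁ * e₁))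
        ≈⟨ solve 6 (λ w p s d q z → (w :+ p) :* (w :+ p) :- s :* p :- 2 :× (d :+ q) := (w :+ p) :* (w :+ p) :- s :* p :- 2 :× d :- 2 :× q) refl w₃ (c₁ * e₁) ((c₁ + e₁) * (c₁ + e₁)) (D w₃) (D (c₁ * e₁)) 0# ⟩
      _ ≈⟨ +-congˡ (-‿cong 2Dp) ⟩
      _ ≈⟨ solve 4 (λ w c e d → (w :+ c :* e) :* (w :+ c :* e) :- (c :+ e) :* (c :+ e) :* (c :* e) :- 2 :× d :- (c :* e) :* (w :+ w :- c :* c :- e :* e) :=
             w :* w :- (c :* c) :* (e :* e) :- 2 :× d) refl w₃ c₁ e₁ (D w₃) ⟩
      Z ∎)
    base : Z ≈[ 1 ] 0#
    base = mod-1 (torsion-free 2 (Z 0) (K.trans (K.solve 1 (λ z → 3 :× z := 4 :× z :- z) K.refl (Z 0))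
      (K.trans (K.+-congʳ (K.sym (K.trans (at relation 0) (K.trans (coeff-· 4 _ 0) (K.×-congʳ 4 (subst-coeff-0 X²-0 Z)))))) (K.-‿inverseʳ _))))
    step : ∀ n → 1 ℕ.≤ n → Z ≈[ n ] 0# → Z ≈[ suc n ] 0#
    step n 1≤n h = mod-≤ (suc≤*2 n 1≤n) (Mod.trans (n ℕ.* 2) (mod relation) (Mod.trans (n ℕ.* 2) (·-cong-mod 4 (dilate-order n h))
      (mod (solve 0 (4 :× # 0 := # 0) refl))))

  Dx : D x₁ ≈ w₁ * x₁
  Dx = trans (D-* c₁ c₁) (trans (solve 2 (λ c d → d :* c :+ c :* d := c :* (2 :× d)) refl c₁ (D c₁)) (trans (*-congˡ 2Dc) (solve 2 (λ c w → c :* (c :* w) := w :* (c :* c)) refl c₁ w₁)))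

  Dy : D y₁ ≈ w₂ * y₁
  Dy = trans (D-* e₁ e₁) (trans (solve 2 (λ c d → d :* c :+ c :* d := c :* (2 :× d)) refl e₁ (D e₁)) (trans (*-congˡ 2De) (solve 2 (λ c w → c :* (c :* w) := w :* (c :* c)) refl e₁ w₂)))

  D[x-y] : D (x₁ - y₁) ≈ w₃ * (x₁ - y₁)
  D[x-y] = trans (D-- x₁ y₁) (trans (+-cong (trans Dx (*-congʳ w₁≈)) (-‿cong (trans Dy (*-congʳ w₂≈))))
    (solve 3 (λ w x y → (w :- y) :* x :- (w :- x) :* y := w :* (x :- y)) refl w₃ x₁ y₁))

  E₂ : Series
  E₂ = 1# - 24 · S

  E₂≈ : E₂ ≈ 6 · w₃ - y₁ - 4 · x₁
  E₂≈ = sym (trans (+-cong (+-congˡ (-‿cong y₁-S)) (-‿cong (×-congʳ 4 x₁-S)))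
    (solve 3 (λ s s₂ s₄ → 6 :× (:1 :+ 8 :× (s₂ :- 4 :× s₄)) :- (:1 :+ 8 :× (6 :× s₂ :- s :- 8 :× s₄)) :- 4 :× (:1 :+ 8 :× (s :- 4 :× s₄)) := :1 :- 24 :× s) refl S S₂ S₄))

  -- Ramanujan's E₄ = E₂² - 12 D E₂, in terms of theta constants
  E₄-theta : 1# + 240 · W ≈ y₁ * y₁ + 16 · (x₁ * (x₁ - y₁))
  E₄-theta = begin
    1# + 240 · W
      ≈⟨ solve 2 (λ w s → :1 :+ 240 :× w := :1 :+ 48 :× (5 :× w :+ s) :- 48 :× s) refl W S ⟩
    1# + 48 · (5 · W + S) - 48 · S
      ≈⟨ +-congʳ (+-congˡ (×-congʳ 48 S²-identity)) ⟨
    1# + 48 · (12 · (S * S) + 6 · D S) - 48 · S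
      ≈⟨ solve 2 (λ s d → :1 :+ 48 :× (12 :× (s :* s) :+ 6 :× d) :- 48 :× s := (:1 :- 24 :× s) :* (:1 :- 24 :× s) :- 12 :× (:- (24 :× d))) refl S (D S) ⟩
    E₂ * E₂ - 12 · (- (24 · D S))
      ≈⟨ +-congˡ (-‿cong (×-congʳ 12 (trans (D-- 1# _) (trans (+-cong D-1 (-‿cong (D-· 24 S))) (+-identityˡ _))))) ⟨
    E₂ * E₂ - 12 · D E₂
      ≈⟨ +-cong (*-cong E₂≈ E₂≈) (-‿cong (×-congʳ 12 (trans (D-cong E₂≈) (trans (D-- _ _) (+-cong (trans (D-- _ _) (+-cong (D-· 6 w₃) (-‿cong (trans Dy (*-congʳ w₂≈)))))
           (-‿cong (trans (D-· 4 x₁) (×-congʳ 4 (trans Dx (*-congʳ w₁≈)))))))))) ⟩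
    A * A - 12 · (6 · D w₃ - (w₃ - x₁) * y₁ - 4 · ((w₃ - y₁) * x₁))
      ≈⟨ solve 5 (λ a w x y d → a :- 12 :× (6 :× d :- (w :- x) :* y :- 4 :× ((w :- y) :* x)) := a :- 36 :× (2 :× d) :+ 12 :× ((w :- x) :* y) :+ 48 :× ((w :- y) :* x)) refl (A * A) w₃ x₁ y₁ (D w₃) ⟩
    A * A - 36 · (2 · D w₃) + 12 · ((w₃ - x₁) * y₁) + 48 · ((w₃ - y₁) * x₁)
      ≈⟨ +-congʳ (+-congʳ (+-congˡ (-‿cong (×-congʳ 36 2Dw₃)))) ⟩
    A * A - 36 · (w₃ * w₃ - x₁ * y₁) + 12 · ((w₃ - x₁) * y₁) + 48 · ((w₃ - y₁) * x₁)
      ≈⟨ solve 3 (λ w x y → (6 :× w :- y :- 4 :× x) :* (6 :× w :- y :- 4 :× x) :- 36 :× (w :* w :- x :* y) :+ 12 :× ((w :- x) :* y) :+ 48 :× ((w :- y) :* x) :=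
           y :* y :+ 16 :× (x :* (x :- y))) refl w₃ x₁ y₁ ⟩
    y₁ * y₁ + 16 · (x₁ * (x₁ - y₁)) ∎
    where A = 6 · w₃ - y₁ - 4 · x₁

  -- Modular forms

  monomial≈X^ : ∀ k → monomial k ≈ X ^ k
  monomial≈X^ zero    = 1ˢ≈1
  monomial≈X^ (suc k) = trans (split (monomial (suc k))) (trans (+-cong const-0 (*-congˡ (monomial≈X^ k))) (+-identityˡ _))

  X^-coeff-< : ∀ a f n → n ℕ.< a → (X ^ a * f) n K.≈ K.0#
  X^-coeff-< a f n n<a = K.trans (at[ Mod.trans a (mod-≤ (ℕ.≤-reflexive (≡.sym (ℕ.+-identityʳ a))) (X^-order a {0} {f} mod-zero)) (Mod.refl a) ] n n<a) (coeff-0 n)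

  X^-coeff : ∀ a f n → (X ^ a * f) (a ℕ.+ n) K.≈ f n
  X^-coeff zero    f n = at (*-identityˡ f) n
  X^-coeff (suc a) f n = K.trans (at (*-assoc X (X ^ a) f) _) (K.trans (X-coeff (X ^ a * f) (a ℕ.+ n)) (X^-coeff a f n))

  private
    indicator : ℕ → ℕ → K.Carrier
    indicator a zero      = K.0#
    indicator a n@(suc _) = if does (a ∣? n) then K.1# else K.0#

    indicator-1 : ∀ a n → a ∣ suc n → indicator a (suc n) K.≈ K.1#
    indicator-1 a n d = K.reflexive (≡.cong (if_then K.1# else K.0#) (dec-true (a ∣? suc n) d))

    indicator-0 : ∀ a n → ¬ a ∣ suc n → indicator a (suc n) K.≈ K.0#
    indicator-0 a n d = K.reflexive (≡.cong (if_then K.1# else K.0#) (dec-false (a ∣? suc n) d))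

    indicator-+ : ∀ a m → indicator (suc a) (suc a ℕ.+ suc m) K.≈ indicator (suc a) (suc m)
    indicator-+ a m = aux (suc a ∣? suc m)
      where
      aux : Dec (suc a ∣ suc m) → indicator (suc a) (suc a ℕ.+ suc m) K.≈ indicator (suc a) (suc m)
      aux (yes d) = K.trans (indicator-1 (suc a) _ (∣m∣n⇒∣m+n ∣-refl d)) (K.sym (indicator-1 (suc a) m d))
      aux (no ¬d) = K.trans (indicator-0 (suc a) _ (λ d → ¬d (∣m+n∣m⇒∣n d ∣-refl))) (K.sym (indicator-0 (suc a) m ¬d))

    coeff-1-P* : ∀ k f n → ((1# - P k) * f) n K.≈ f n K.- (P k * f) n
    coeff-1-P* k f n = K.trans (at (solve 2 (λ p f → (:1 :- p) :* f := f :- p :* f) refl (P k) f) n) (coeff-- f _ n)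

  coeff-U : ∀ k n → U k n K.≈ indicator (suc k) n
  coeff-U k n = K.sym (at (U-unique k {indicator (suc k)} ⟪ (λ n → K.trans (coeff-1-P* k (indicator (suc k)) n) (aux n (n ℕ.<? suc k))) ⟫) n)
    where
    I = indicator (suc k)
    Pn : ∀ n → P k n K.≈ (P k * 1#) n
    Pn n = at (sym (*-identityʳ (P k))) n
    aux : ∀ n → Dec (n ℕ.< suc k) → I n K.- (P k * I) n K.≈ P k n
    aux n (yes n<k) = K.trans (K.+-cong (I-0 n n<k) (K.-‿cong (X^-coeff-< (suc k) I n n<k)))
      (K.trans (K.solve 0 (# 0 :- # 0 := # 0) K.refl) (K.sym (K.trans (Pn n) (X^-coeff-< (suc k) 1# n n<k))))
      where
      I-0 : ∀ n → n ℕ.< suc k → I n K.≈ K.0#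
      I-0 zero    _   = K.refl
      I-0 (suc n) n<k = indicator-0 (suc k) n (λ d → ℕ.<⇒≱ n<k (∣⇒≤ d))
    aux n (no n≮k) = ≡.subst (λ n → I n K.- (P k * I) n K.≈ P k n) (ℕ.m+[n∸m]≡n (ℕ.≮⇒≥ n≮k)) (shift (n ∸ suc k))
      where
      shift : ∀ m → I (suc k ℕ.+ m) K.- (P k * I) (suc k ℕ.+ m) K.≈ P k (suc k ℕ.+ m)
      shift zero    = K.trans (K.+-cong (indicator-1 (suc k) _ (≡.subst (suc k ∣_) (≡.sym (ℕ.+-identityʳ (suc k))) ∣-refl)) (K.-‿cong (X^-coeff (suc k) I 0)))
        (K.trans (K.solve 0 (:1 :- # 0 := :1) K.refl) (K.sym (K.trans (Pn (suc k ℕ.+ 0)) (K.trans (X^-coeff (suc k) 1# 0) coeff-1-0))))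
      shift (suc m) = K.trans (K.+-cong (indicator-+ k m) (K.-‿cong (X^-coeff (suc k) I (suc m))))
        (K.trans (K.-‿inverseʳ _) (K.sym (K.trans (Pn (suc k ℕ.+ suc m)) (K.trans (X^-coeff (suc k) 1# (suc m)) (coeff-1-suc m)))))

  private
    sum-of-cubes : ∀ n m f → List.sum (map (ℕ._^ 3) (filter (_∣? suc n) (map suc (applyUpTo f m)))) K.× K.1# K.≈
                   K.∑ m (λ i → ((suc (f i) ℕ.^ 3) K.× K.1#) K.* indicator (suc (f i)) (suc n))
    sum-of-cubes n zero    f = K.sym K.∑-nil
    sum-of-cubes n (suc m) f = K.trans (head (suc (f 0) ∣? suc n)) (K.sym K.∑-cons)
      where
      rest = sum-of-cubes n m (f ∘ suc)
      head : (d : Dec (suc (f 0) ∣ suc n)) → List.sum (map (ℕ._^ 3) (filter (_∣? suc n) (map suc (applyUpTo f (suc m))))) K.× K.1# K.≈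
             ((suc (f 0) ℕ.^ 3) K.× K.1#) K.* indicator (suc (f 0)) (suc n) K.+ K.∑ m (λ i → ((suc (f (suc i)) ℕ.^ 3) K.× K.1#) K.* indicator (suc (f (suc i))) (suc n))
      head (yes d) = K.trans (K.reflexive (≡.cong (λ l → List.sum (map (ℕ._^ 3) l) K.× K.1#) (filter-accept (_∣? suc n) d)))
        (K.trans (K.×-homo-+ K.1# (suc (f 0) ℕ.^ 3) _)
          (K.+-cong (K.sym (K.trans (K.*-congˡ (indicator-1 (suc (f 0)) n d)) (K.*-identityʳ _))) rest))
      head (no ¬d) = K.trans (K.reflexive (≡.cong (λ l → List.sum (map (ℕ._^ 3) l) K.× K.1#) (filter-reject (_∣? suc n) ¬d)))
        (K.trans rest (K.sym (K.trans (K.+-congʳ (K.trans (K.*-congˡ (indicator-0 (suc (f 0)) n ¬d)) (K.zeroʳ _))) (K.+-identityˡ _))))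

    coeff-⟨⟩ : ∀ n f m → (⟨ n ⟩ * f) m K.≈ n K.× K.1# K.* f m
    coeff-⟨⟩ n f m = K.trans (at (*-congʳ (trans (×-congʳ n (sym const-1)) (sym (const-· n K.1#)))) m) (coeff-const-* _ f m)

    ⟨⟩^ : ∀ n k → ⟨ n ⟩ ^ k ≈ ⟨ n ℕ.^ k ⟩
    ⟨⟩^ n zero    = sym (+-identityʳ 1#)
    ⟨⟩^ n (suc k) = trans (*-congˡ (⟨⟩^ n k)) (sym (×1-homo-* n (n ℕ.^ k)))

    coeff-W : ∀ n → W (suc n) K.≈ σ₃ (suc n) K.× K.1#
    coeff-W n = K.trans (at[ tot-mod (summable-*′ _ U-summable) (suc n) ] (suc n) ℕ.≤-refl)
      (K.trans (coeff-∑ (suc n) (λ k → ⟨ suc k ⟩ ^ 3 * U k) (suc n))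
      (K.trans (K.∑-cong′ (suc n) λ k → K.trans (at (*-congʳ (⟨⟩^ (suc k) 3)) (suc n))
        (K.trans (coeff-⟨⟩ (suc k ℕ.^ 3) (U k) (suc n)) (K.*-congˡ (coeff-U k (suc n)))))
      (K.sym (sum-of-cubes n (suc n) id))))

  E₄≈ : E₄ ≈ 1# + 240 · W
  E₄≈ = ⟪ aux ⟫
    where
    aux : ∀ n → E₄ n K.≈ (1# + 240 · W) n
    aux zero = K.sym (K.trans (coeff-+ 1# _ 0) (K.trans (K.+-cong coeff-1-0 (K.trans (coeff-· 240 W 0)
      (K.×-congʳ 240 (K.trans (at[ tot-mod (summable-*′ _ U-summable) 0 ] 0 (s≤s z≤n)) (K.trans (coeff-∑ 0 _ 0) K.∑-nil)))))
      (K.trans (K.+-congˡ (K.trans (K.×-assocˡ K.0# 240 0) K.refl)) (K.+-identityʳ _))))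
    aux (suc n) = K.sym (K.trans (coeff-+ 1# _ (suc n)) (K.trans (K.+-cong (coeff-1-suc n) (K.trans (coeff-· 240 W (suc n))
      (K.×-congʳ 240 (coeff-W n)))) (K.trans (K.+-identityˡ _) (K.×-assocˡ K.1# 240 (σ₃ (suc n))))))

  private
    1-q^ : ∀ k → 1ˢ -ˢ monomial (suc k) ≈ 1# - P k
    1-q^ k = trans (-ˢ≈- 1ˢ (monomial (suc k))) (+-cong 1ˢ≈1 (-‿cong (monomial≈X^ (suc k))))

    1+q^ : ∀ k → 1ˢ +ˢ monomial (suc k) ≈ 1# + P k
    1+q^ k = trans (+ˢ≈+ 1ˢ (monomial (suc k))) (+-cong 1ˢ≈1 (monomial≈X^ (suc k)))

    ^-cong-mod : ∀ {N f g} k → f ≈[ N ] g → f ^ k ≈[ N ] g ^ k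
    ^-cong-mod {N} zero    h = Mod.refl N
    ^-cong-mod {N} (suc k) h = Mod.*-cong N h (^-cong-mod k h)

    1^ : ∀ k → 1# ^ k ≈ 1#
    1^ zero    = refl
    1^ (suc k) = trans (*-identityˡ _) (1^ k)

    1-P-mod : ∀ k → 1# - P k ≈[ suc k ] 1#
    1-P-mod k = Mod.trans (suc k) (Mod.+-congˡ (suc k) (Mod.-‿cong (suc k) (^-order {X} (suc k) K.refl))) (mod (solve 0 (:1 :- # 0 := :1) refl))

    1+P-mod : ∀ k → 1# + P k ≈[ suc k ] 1#
    1+P-mod k = Mod.trans (suc k) (Mod.+-congˡ (suc k) (^-order {X} (suc k) K.refl)) (mod (+-identityʳ 1#))

    1+P-0 : ∀ k → (1# + P k) 0 K.≈ K.1#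
    1+P-0 k = K.trans (at[ 1+P-mod k ] 0 (s≤s z≤n)) coeff-1-0

  D-Δ : D Δ ≈ E₂ * Δ
  D-Δ = trans (D-cong Δ≈) (trans (D-*-log (trans D-X (sym (*-identityˡ X))) (D-∏₁ {f} f≈1 l≈0 Df)) (*-cong (+-congˡ l≈) (sym Δ≈)))
    where
    f : ℕ → Series
    f n = (1ˢ -ˢ monomial n) ^ˢ 24
    f≈ : ∀ k → f (suc k) ≈ (1# - P k) ^ 24
    f≈ k = trans (^ˢ≈^ (1ˢ -ˢ monomial (suc k)) 24) (^-cong 24 (1-q^ k))
    f≈1 : ∀ k → f (suc k) ≈[ suc k ] 1#
    f≈1 k = Mod.trans (suc k) (mod (f≈ k)) (Mod.trans (suc k) (^-cong-mod 24 (1-P-mod k)) (mod (1^ 24)))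
    Δ≈ : Δ ≈ X * ∏₁ f
    Δ≈ = *ˢ≈* (monomial 1) (∏₁ f)
    l : ℕ → Series
    l k = - ⟨ 24 ⟩ * (suc k · U k)
    l≈0 : Summable l
    l≈0 = summable-* _ S-summable
    Df : ∀ k → D (f (suc k)) ≈ l k * f (suc k)
    Df k = trans (D-cong (f≈ k)) (trans (D-^ (1# - P k) _ 24 (D-1-P k))
      (*-cong (trans (·≈* 24 _) (solve 2 (λ a b → a :* :- b := :- a :* b) refl ⟨ 24 ⟩ _)) (sym (f≈ k))))
    l≈ : Tot l ≈ - (24 · S)
    l≈ = trans (sym (tot-* _ S-summable)) (solve 1 (λ s → (:- # 24) :* s := :- (24 :× s)) refl S)

  Θ : Series
  Θ = x₁ * (x₁ - y₁) * y₁ ^ 4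

  private
    mod-2-Δ : Δ ≈[ 2 ] X
    mod-2-Δ = Mod.trans 2 (mod (*ˢ≈* (monomial 1) (∏₁ λ n → (1ˢ -ˢ monomial n) ^ˢ 24))) (Mod.trans 2 (*-mod-suc K.refl ⟪ (λ { zero _ → K.sym coeff-1-0 ; (suc n) (s≤s ()) }) ⟫) (mod (*-identityʳ X)))

    x-0 : x₁ ≈[ 1 ] 1#
    x-0 = ⟪ (λ { zero _ → K.trans (coeff-*-0 c₁ c₁) (K.trans (K.*-cong c-0 c-0) (K.trans (K.*-identityˡ _) (K.sym coeff-1-0))) ; (suc n) (s≤s ()) }) ⟫

    y-0 : y₁ ≈[ 1 ] 1#
    y-0 = ⟪ (λ { zero _ → K.trans (coeff-*-0 e₁ e₁) (K.trans (K.*-cong e-0 e-0) (K.trans (K.*-identityˡ _) (K.sym coeff-1-0))) ; (suc n) (s≤s ()) }) ⟫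

    x-y-mod-2 : x₁ - y₁ ≈[ 2 ] 16 · X
    x-y-mod-2 = Mod.trans 2 (Mod.+-cong 2 (Mod.*-cong 2 c-mod-2 c-mod-2) (Mod.-‿cong 2 (Mod.*-cong 2 e-mod-2 e-mod-2)))
      (mod (solve 1 (λ x → (:1 :+ 4 :× x) :* (:1 :+ 4 :× x) :- (:1 :- 4 :× x) :* (:1 :- 4 :× x) := 16 :× x) refl X))

    mod-2-Θ : Θ ≈[ 2 ] 16 · X
    mod-2-Θ = Mod.trans 2 (Mod.*-congʳ 2 (Mod.*-congˡ 2 x-y-mod-2)) (Mod.trans 2
      (mod (solve 3 (λ X x y → x :* (16 :× X) :* y := X :* (16 :× (x :* y))) refl X x₁ (y₁ ^ 4)))
      (Mod.trans 2 (*-mod-suc K.refl (·-cong-mod 16 (Mod.*-cong 1 x-0 (^-cong-mod 4 y-0))))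
        (mod (solve 1 (λ X → X :* (16 :× (:1 :* :1 :^ 4)) := 16 :× X) refl X))))

  D-Θ : D Θ ≈ E₂ * Θ
  D-Θ = trans (D-*-log (D-*-log Dx D[x-y]) (D-^ y₁ w₂ 4 Dy)) (*-congʳ (trans
    (solve 3 (λ s s₂ s₄ → 8 :× (s :- 5 :× s₂ :+ 4 :× s₄) :+ (:1 :+ 8 :× (s₂ :- 4 :× s₄)) :+ 4 :× (8 :× (s₂ :- s)) := :1 :- 24 :× s) refl S S₂ S₄) refl))

  E₂-0 : E₂ 0 K.≈ K.1#
  E₂-0 = K.trans (coeff-- 1# _ 0) (K.trans (K.+-cong coeff-1-0 (K.-‿cong (K.trans (coeff-· 24 S 0) (K.×-congʳ 24 (0-coeff S-mod-1)))))
    (K.solve 0 (:1 :- 24 :× # 0 := :1) K.refl))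

  16Δ≈Θ : 16 · Δ ≈ Θ
  16Δ≈Θ = ode-unique {1#} {E₂} {n₀ = 2} coeff-1-0 regular (Mod.trans 2 (·-cong-mod 16 mod-2-Δ) (Mod.sym 2 mod-2-Θ))
    (trans (*-identityˡ _) (trans (D-· 16 Δ) (trans (×-congʳ 16 D-Δ) (solve 2 (λ e d → 16 :× (e :* d) := e :* (16 :× d)) refl E₂ Δ))))
    (trans (*-identityˡ _) D-Θ)
    where
    regular : ∀ n → 2 ℕ.≤ n → ∀ x → (n K.× K.1# K.- E₂ 0) K.* x K.≈ K.0# → x K.≈ K.0#
    regular (suc zero) (s≤s ()) x h
    regular (suc (suc n)) _ x h = torsion-free n x (K.trans (K.trans (·≈*K (suc n) x) (K.*-congʳ
      (K.trans (K.solve 1 (λ a → a := (:1 :+ a) :- :1) K.refl (suc n K.× K.1#)) (K.+-congˡ (K.-‿cong (K.sym E₂-0)))))) h)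
      where
      ·≈*K : ∀ n x → n K.× x K.≈ n K.× K.1# K.* x
      ·≈*K n x = K.sym (K.trans (K.×-assoc-* n K.1# x) (K.×-congʳ n (K.*-identityˡ x)))

  h : Series
  h = h^⅛

  private
    hf : ℕ → Series
    hf n = ((1ˢ -ˢ monomial n) *ˢ inverseˢ (1ˢ +ˢ monomial n)) ^ˢ 3

    hf≈ : ∀ k → hf (suc k) ≈ ((1# - P k) * inverse (1# + P k)) ^ 3
    hf≈ k = trans (^ˢ≈^ ((1ˢ -ˢ monomial (suc k)) *ˢ inverseˢ (1ˢ +ˢ monomial (suc k))) 3) (^-cong 3 (trans (*ˢ≈* (1ˢ -ˢ monomial (suc k)) (inverseˢ (1ˢ +ˢ monomial (suc k)))) (*-cong (1-q^ k) (trans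
      (inverseˢ≈inverse (K.trans (at (1+q^ k) 0) (1+P-0 k))) (inverse-cong (1+P-0 k) (1+q^ k))))))
      where
      inverse-cong : ∀ {f g} → g 0 K.≈ K.1# → f ≈ g → inverse f ≈ inverse g
      inverse-cong {f} {g} g0 f≈g = subst-congʳ (K.trans (coeff-- 1# f 0) (K.trans (K.+-cong coeff-1-0 (K.-‿cong (K.trans (at f≈g 0) g0))) (K.-‿inverseʳ _)))
        (+-congˡ (-‿cong f≈g)) _

    inverse-mod : ∀ k → inverse (1# + P k) ≈[ suc k ] 1#
    inverse-mod k = Mod.trans (suc k) (mod (sym (*-identityˡ _))) (Mod.trans (suc k) (Mod.*-congʳ (suc k) (Mod.sym (suc k) (1+P-mod k)))
      (mod (*-inverse (1+P-0 k))))

    hf≈1 : ∀ k → hf (suc k) ≈[ suc k ] 1#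
    hf≈1 k = Mod.trans (suc k) (mod (hf≈ k)) (Mod.trans (suc k) (^-cong-mod 3 (Mod.*-cong (suc k) (1-P-mod k) (inverse-mod k)))
      (mod (solve 0 ((:1 :* :1) :^ 3 := :1) refl)))

  h-0 : h 0 K.≈ K.1#
  h-0 = ∏₁-0 {hf} hf≈1

  D-h : D h ≈ (6 · (S₂ - S)) * h
  D-h = trans (D-∏₁ {hf} hf≈1 l≈0 Df) (*-congʳ l≈)
    where
    nU : ℕ → Series
    nU k = suc k · U k
    l : ℕ → Series
    l k = ⟨ 6 ⟩ * (dilate (nU k) + - nU k)
    dn≈0 = summable-dilate S-summable
    l≈0 : Summable l
    l≈0 = summable-* _ (summable-+ dn≈0 (summable-neg S-summable))
    l≈ : Tot l ≈ 6 · (S₂ - S)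
    l≈ = trans (sym (tot-* ⟨ 6 ⟩ (summable-+ dn≈0 (summable-neg S-summable)))) (trans (*-congˡ (sym (trans (+-cong (tot-subst X²-0 S-summable) (tot-neg S-summable)) (tot-+ dn≈0 (summable-neg S-summable)))))
      (solve 2 (λ a b → # 6 :* (a :- b) := 6 :× (a :- b)) refl S₂ S))
    Df : ∀ k → D (hf (suc k)) ≈ l k * hf (suc k)
    Df k = trans (D-cong (hf≈ k)) (trans (D-^ _ (- (n * U k) + - (n * T)) 3 (D-*-log (trans (D-1-P k) (*-congʳ (-‿cong (·≈* (suc k) (U k))))) D-inv))
        (*-cong l-eq (sym (hf≈ k))))
      where
      n = ⟨ suc k ⟩
      I = inverse (1# + P k)
      T = U k - 2 · dilate (U k)
      T-eq : (1# + P k) * T ≈ P k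
      T-eq = cancel-*ˡ (≈1-cancel (1-P-0 k)) (begin
        (1# - P k) * ((1# + P k) * (U k - 2 · dilate (U k)))
          ≈⟨ solve 3 (λ p u d → (:1 :- p) :* ((:1 :+ p) :* (u :- 2 :× d)) := (:1 :+ p) :* ((:1 :- p) :* u) :- 2 :× ((:1 :- p :* p) :* d)) refl (P k) (U k) (dilate (U k)) ⟩
        (1# + P k) * ((1# - P k) * U k) - 2 · ((1# - P k * P k) * dilate (U k))
          ≈⟨ +-cong (*-congˡ (U-eq k)) (-‿cong (×-congʳ 2 (trans (*-cong (+-congˡ (-‿cong (sym PP))) (dilate-U k)) (trans (U-eq (suc (2 ℕ.* k))) PP)))) ⟩
        (1# + P k) * P k - 2 · (P k * P k)
          ≈⟨ solve 1 (λ p → (:1 :+ p) :* p :- 2 :× (p :* p) := (:1 :- p) :* p) refl (P k) ⟩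
        (1# - P k) * P k ∎)
        where
        PP : P (suc (2 ℕ.* k)) ≈ P k * P k
        PP = trans (reflexive (≡.cong (λ m → P (suc (k ℕ.+ m))) (ℕ.+-identityʳ k))) (P-+ k k)
      D-1+P : D (1# + P k) ≈ n * P k
      D-1+P = trans (D-+ 1# (P k)) (trans (+-cong D-1 (trans (D-P k) (·≈* (suc k) (P k)))) (+-identityˡ _))
      D-inv : D I ≈ - (n * T) * I
      D-inv = cancel-*ˡ (≈1-cancel (1+P-0 k)) (begin
        (1# + P k) * D I
          ≈⟨ solve 2 (λ x y → y := (x :+ y) :- x) refl (D (1# + P k) * I) ((1# + P k) * D I) ⟩
        (D (1# + P k) * I + (1# + P k) * D I) - D (1# + P k) * I
          ≈⟨ +-cong (trans (sym (D-* (1# + P k) I)) (trans (D-cong (*-inverse (1+P-0 k))) D-1)) (-‿cong (*-congʳ (trans D-1+P (*-congˡ (sym T-eq))))) ⟩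
        0# - n * ((1# + P k) * T) * I
          ≈⟨ solve 4 (λ n a t i → # 0 :- n :* (a :* t) :* i := a :* (:- (n :* t) :* i)) refl n (1# + P k) T I ⟩
        (1# + P k) * (- (n * T) * I) ∎)
      l-eq : 3 · (- (n * U k) + - (n * T)) ≈ l k
      l-eq = trans (solve 3 (λ n u d → 3 :× (:- (n :* u) :+ :- (n :* (u :- 2 :× d))) := # 6 :* (n :* d :+ :- (n :* u))) refl n (U k) (dilate (U k)))
        (*-congˡ (+-cong (sym (trans (Dilate.homo-· (suc k) (U k)) (·≈* (suc k) _))) (-‿cong (sym (·≈* (suc k) (U k))))))

  -- u = θ₃⁴/θ₄⁴
  u₁ : Series
  u₁ = x₁ * inverse y₁

  private
    y₁-0 : y₁ 0 K.≈ K.1#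
    y₁-0 = K.trans (at[ y-0 ] 0 (s≤s z≤n)) coeff-1-0

  uy≈x : u₁ * y₁ ≈ x₁
  uy≈x = trans (solve 3 (λ x i y → x :* i :* y := x :* (y :* i)) refl x₁ (inverse y₁) y₁) (trans (*-congˡ (*-inverse y₁-0)) (*-identityʳ _))

  u-0 : u₁ 0 K.≈ K.1#
  u-0 = K.trans (K.sym (K.*-identityʳ _)) (K.trans (K.*-congˡ (K.sym y₁-0)) (K.trans (K.sym (coeff-*-0 u₁ y₁)) (K.trans (at uy≈x 0) (K.trans (at[ x-0 ] 0 (s≤s z≤n)) coeff-1-0))))

  D-u : D u₁ ≈ (w₁ - w₂) * u₁
  D-u = cancel-*ˡ {y₁} (≈1-cancel y₁-0) (begin
    y₁ * D u₁
      ≈⟨ solve 3 (λ y d z → y :* d := (d :* y :+ z) :- z) refl y₁ (D u₁) (u₁ * D y₁) ⟩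
    (D u₁ * y₁ + u₁ * D y₁) - u₁ * D y₁
      ≈⟨ +-cong (trans (sym (D-* u₁ y₁)) (trans (D-cong uy≈x) (trans Dx (*-congˡ (sym uy≈x))))) (-‿cong (*-congˡ Dy)) ⟩
    w₁ * (u₁ * y₁) - u₁ * (w₂ * y₁)
      ≈⟨ solve 4 (λ a b u y → a :* (u :* y) :- u :* (b :* y) := y :* ((a :- b) :* u)) refl w₁ w₂ u₁ y₁ ⟩
    y₁ * ((w₁ - w₂) * u₁) ∎)

  w₁-w₂ : w₁ - w₂ ≈ 8 · (flip (S₂ - S) - (S₂ - S))
  w₁-w₂ = trans (+-congʳ (trans (sym flip-w₂) (Flip.homo-· 8 _))) (solve 2 (λ a b → 8 :× a :- 8 :× b := 8 :× (a :- b)) refl _ _)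

  flip-u*u : flip u₁ * u₁ ≈ 1#
  flip-u*u = cancel-*ˡ {x₁ * y₁} (≈1-cancel (K.trans (coeff-*-0 x₁ y₁) (K.trans (K.*-cong (K.trans (at[ x-0 ] 0 (s≤s z≤n)) coeff-1-0) y₁-0) (K.*-identityˡ _)))) (begin
    (x₁ * y₁) * (flip u₁ * u₁)   ≈⟨ solve 4 (λ x y f u → (x :* y) :* (f :* u) := (f :* x) :* (u :* y)) refl x₁ y₁ (flip u₁) u₁ ⟩
    (flip u₁ * x₁) * (u₁ * y₁)   ≈⟨ *-cong (trans (*-congˡ (sym flip-y)) (trans (sym (Flip.homo-* u₁ y₁)) (trans (Flip.cong uy≈x) (Flip.homo-* c₁ c₁)))) uy≈x ⟩
    y₁ * x₁                      ≈⟨ solve 2 (λ x y → y :* x := (x :* y) :* :1) refl x₁ y₁ ⟩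
    (x₁ * y₁) * 1#               ∎)
    where
    flip-y : flip y₁ ≈ x₁
    flip-y = trans (Flip.homo-* e₁ e₁) (*-cong (flip-flip c₁) (flip-flip c₁))

  u-1 : u₁ - 1# ≈[ 2 ] 16 · X
  u-1 = Mod.trans 2 (mod lemma) (Mod.trans 2 (Mod.*-congʳ 2 x-y-mod-2) (Mod.trans 2 (mod (solve 2 (λ x i → 16 :× x :* i := x :* (16 :× i)) refl X (inverse y₁)))
    (Mod.trans 2 (*-mod-suc K.refl (·-cong-mod 16 i≈1)) (mod (solve 1 (λ x → x :* (16 :× :1) := 16 :× x) refl X)))))
    where
    lemma : u₁ - 1# ≈ (x₁ - y₁) * inverse y₁
    lemma = trans (+-congˡ (-‿cong (sym (*-inverse y₁-0)))) (solve 3 (λ x y i → x :* i :- y :* i := (x :- y) :* i) refl x₁ y₁ (inverse y₁))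
    i≈1 : inverse y₁ ≈[ 1 ] 1#
    i≈1 = Mod.trans 1 (mod (sym (*-identityˡ _))) (Mod.trans 1 (Mod.*-congʳ 1 (Mod.sym 1 y-0)) (mod (*-inverse y₁-0)))

  -- 16/j = w/(1+16w)³, for w = u² - u
  JEquation : Series → Series → Set ℓ
  JEquation w j = 16 · j * (1# + 16 · w) ^ 3 ≈ w

  private
    E₄-u : E₄ ≈ y₁ * y₁ * (1# + 16 · (u₁ * u₁ - u₁))
    E₄-u = trans E₄≈ (trans E₄-theta (trans (+-congˡ (×-congʳ 16 (*-cong (sym uy≈x) (+-congʳ (sym uy≈x)))))
      (solve 2 (λ u y → y :* y :+ 16 :× ((u :* y) :* (u :* y :- y)) := y :* y :* (:1 :+ 16 :× (u :* u :- u))) refl u₁ y₁)))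

    E₄³-0 : (E₄ ^ˢ 3) 0 K.≈ K.1#
    E₄³-0 = K.trans (at (^ˢ≈^ E₄ 3) 0) (K.trans (coeff-*-0 E₄ _) (K.trans (K.*-identityˡ _) (K.trans (coeff-*-0 E₄ _) (K.trans (K.*-identityˡ _) (K.trans (coeff-*-0 E₄ _) (K.trans (K.*-identityˡ _) coeff-1-0))))))

  j-equation : JEquation (u₁ * u₁ - u₁) j⁻¹
  j-equation = cancel-*ˡ {y₁ ^ 6} (≈1-cancel y⁶-0) (begin
    y₁ ^ 6 * (16 · j⁻¹ * (1# + 16 · w) ^ 3)
      ≈⟨ solve 3 (λ y j w → y :^ 6 :* (16 :× j :* (:1 :+ 16 :× w) :^ 3) := 16 :× (j :* (y :* y :* (:1 :+ 16 :× w)) :^ 3)) refl y₁ j⁻¹ w ⟩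
    16 · (j⁻¹ * (y₁ * y₁ * (1# + 16 · w)) ^ 3)
      ≈⟨ ×-congʳ 16 (*-congˡ (^-cong 3 (sym E₄-u))) ⟩
    16 · (j⁻¹ * E₄ ^ 3)
      ≈⟨ ×-congʳ 16 jE≈Δ ⟩
    16 · Δ
      ≈⟨ 16Δ≈Θ ⟩
    x₁ * (x₁ - y₁) * y₁ ^ 4
      ≈⟨ *-congʳ (*-cong (sym uy≈x) (+-congʳ (sym uy≈x))) ⟩
    (u₁ * y₁) * (u₁ * y₁ - y₁) * y₁ ^ 4
      ≈⟨ solve 2 (λ u y → (u :* y) :* (u :* y :- y) :* y :^ 4 := y :^ 6 :* (u :* u :- u)) refl u₁ y₁ ⟩
    y₁ ^ 6 * w ∎)
    where
    w = u₁ * u₁ - u₁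
    y⁶-0 : (y₁ ^ 6) 0 K.≈ K.1#
    y⁶-0 = K.trans (at[ ^-cong-mod 6 y-0 ] 0 (s≤s z≤n)) (K.trans (at (1^ 6) 0) coeff-1-0)
    jE≈Δ : j⁻¹ * E₄ ^ 3 ≈ Δ
    jE≈Δ = trans (*-congʳ (trans (*ˢ≈* Δ (inverseˢ (E₄ ^ˢ 3))) (*-congˡ (inverseˢ≈inverse E₄³-0)))) (trans
      (trans (*-assoc Δ _ _) (*-congˡ (trans (*-comm _ _) (trans (*-congʳ (sym (^ˢ≈^ E₄ 3))) (*-inverse E₄³-0))))) (*-identityʳ Δ))

-- A ring solver for ℚ, whose operations must not unfold during the
-- comparison of normal forms.
module ℚSolver where
  open ≡ using (refl; cong)
  opaque
    ℚ-ring : CommutativeRing 0ℓ 0ℓ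
    ℚ-ring = ℚ.+-*-commutativeRing

  private
    module R = CommutativeRing ℚ-ring
    module O = IntegerSolver ℚ-ring
    module T = IntegerSolver ℚ.+-*-commutativeRing
    open PowerSeries ℚ.+-*-commutativeRing using (_·_; _^_)

  same : ∀ {n} {f : Vec R.Carrier n → R.Carrier} ρ → f ρ R.≈ f ρ
  same _ = R.refl

  ⟦_⟧ : ∀ {n} → Expr n → Vec ℚ n → ℚ
  ⟦ con c  ⟧ ρ = T.constant c
  ⟦ var x  ⟧ ρ = lookup ρ x
  ⟦ p :+ q ⟧ ρ = ⟦ p ⟧ ρ ℚ.+ ⟦ q ⟧ ρ
  ⟦ p :* q ⟧ ρ = ⟦ p ⟧ ρ ℚ.* ⟦ q ⟧ ρ
  ⟦ :- p   ⟧ ρ = ℚ.- ⟦ p ⟧ ρ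
  ⟦ p :^ n ⟧ ρ = ⟦ p ⟧ ρ ^ n
  ⟦ n :× p ⟧ ρ = n · ⟦ p ⟧ ρ

  opaque
    unfolding ℚ-ring

    transfer : ∀ {n} (p q : Expr n) → (∀ ρ → O.⟦ p ⟧↓ ρ R.≈ O.⟦ q ⟧↓ ρ) → ∀ ρ → ⟦ p ⟧ ρ ≡ ⟦ q ⟧ ρ
    transfer p q h ρ = ≡.trans (≡.sym (agree p)) (≡.trans (≡.trans (≡.sym (O.correct p ρ)) (≡.trans (h ρ) (O.correct q ρ))) (agree q))
      where
      agree : ∀ p → O.⟦ p ⟧ₑ ρ ≡ ⟦ p ⟧ ρ
      agree (con c)  = refl
      agree (var x)  = refl
      agree (p :+ q) = ≡.cong₂ ℚ._+_ (agree p) (agree q)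
      agree (p :* q) = ≡.cong₂ ℚ._*_ (agree p) (agree q)
      agree (:- p)   = cong ℚ.-_ (agree p)
      agree (p :^ n) = cong (_^ n) (agree p)
      agree (n :× p) = cong (n ·_) (agree p)

  solve : ∀ n (f : N-ary n (Expr n) (Expr n × Expr n)) →
          (∀ ρ → O.⟦ proj₁ (close n f) ⟧↓ ρ R.≈ O.⟦ proj₂ (close n f) ⟧↓ ρ) →
          Eq n _≡_ (curryⁿ ⟦ proj₁ (close n f) ⟧) (curryⁿ ⟦ proj₂ (close n f) ⟧)
  solve n f h = curryⁿ-cong _≡_ ⟦ proj₁ (close n f) ⟧ ⟦ proj₂ (close n f) ⟧ (transfer (proj₁ (close n f)) (proj₂ (close n f)) h)

decide : ∀ {a b} {P : Set a} {Q : Set b} → Dec P → (P → Q) → (¬ P → Q) → Q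
decide (yes p) f g = f p
decide (no ¬p) f g = g ¬p

module RationalLemmas where
  open ≡ using (refl; cong)
  open import Data.Rational.Base using (_+_; _*_; _-_; -_; _≤_; _<_)
  open ℚSolver using (solve; same)

  fromNat-+ : ∀ m n → fromNat (m ℕ.+ n) ≡ fromNat m + fromNat n
  fromNat-+ m n = ℚ.toℚᵘ-injective (begin
    ℚ.toℚᵘ (fromNat (m ℕ.+ n))                ≈⟨ unnormalise (m ℕ.+ n) ⟩
    ℤ.+ (m ℕ.+ n) ℚᵘ./ 1                      ≈⟨ ℚᵘ.*≡* (cong (ℤ._* ℤ.1ℤ) (≡.trans (ℤ.pos-+ m n) (≡.sym (≡.cong₂ ℤ._+_ (ℤ.*-identityʳ (ℤ.+ m)) (ℤ.*-identityʳ (ℤ.+ n)))))) ⟩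
    (ℤ.+ m ℚᵘ./ 1) ℚᵘ.+ (ℤ.+ n ℚᵘ./ 1)        ≈⟨ ℚᵘ.+-cong (unnormalise m) (unnormalise n) ⟨
    ℚ.toℚᵘ (fromNat m) ℚᵘ.+ ℚ.toℚᵘ (fromNat n) ≈⟨ ℚ.toℚᵘ-homo-+ (fromNat m) (fromNat n) ⟨
    ℚ.toℚᵘ (fromNat m + fromNat n)            ∎)
    where
    open import Relation.Binary.Reasoning.Setoid ℚᵘ.≃-setoid
    unnormalise : ∀ n → ℚ.toℚᵘ (fromNat n) ℚᵘ.≃ ℤ.+ n ℚᵘ./ 1
    unnormalise n = ℚ.toℚᵘ-fromℚᵘ (ℤ.+ n ℚᵘ./ 1)

  -- The embedding of ℕ, opaque to keep fromNat from unfolding into gcds.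
  opaque
    ι : ℕ → ℚ
    ι = fromNat

    ι≡fromNat : ∀ n → ι n ≡ fromNat n
    ι≡fromNat n = refl

    ι-0 : ι 0 ≡ 0ℚ
    ι-0 = refl

    ι-+ : ∀ m n → ι (m ℕ.+ n) ≡ ι m + ι n
    ι-+ = fromNat-+

    ι-suc : ∀ n → ι (suc n) ≡ 1ℚ + ι n
    ι-suc = fromNat-+ 1

  0≤1 : 0ℚ ≤ 1ℚ
  0≤1 = ℚ.nonNegative⁻¹ 1ℚ

  0<1 : 0ℚ < 1ℚ
  0<1 = ℚ.positive⁻¹ 1ℚ

  ≤-by : ∀ {a b} c → 0ℚ ≤ c → a + c ≡ b → a ≤ b
  ≤-by {a} c 0≤c refl = ≡.subst (_≤ a + c) (ℚ.+-identityʳ a) (ℚ.+-monoʳ-≤ a 0≤c)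

  <-by : ∀ {a b} c → 0ℚ < c → a + c ≡ b → a < b
  <-by {a} c 0<c refl = ≡.subst (_< a + c) (ℚ.+-identityʳ a) (ℚ.+-monoʳ-< a 0<c)

  0≤- : ∀ {a b} → a ≤ b → 0ℚ ≤ b - a
  0≤- {a} {b} h = ≡.subst (_≤ b - a) (ℚ.+-inverseʳ a) (ℚ.+-monoˡ-≤ (- a) h)

  0<- : ∀ {a b} → a < b → 0ℚ < b - a
  0<- {a} {b} h = ≡.subst (_< b - a) (ℚ.+-inverseʳ a) (ℚ.+-monoˡ-< (- a) h)

  0≤+ : ∀ {a b} → 0ℚ ≤ a → 0ℚ ≤ b → 0ℚ ≤ a + b
  0≤+ = ℚ.+-mono-≤

  0≤* : ∀ {a b} → 0ℚ ≤ a → 0ℚ ≤ b → 0ℚ ≤ a * b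
  0≤* {a} {b} ha hb = ≡.subst (_≤ a * b) (ℚ.*-zeroʳ a) (ℚ.*-monoˡ-≤-nonNeg a {{ℚ.nonNegative ha}} hb)

  0<* : ∀ {a b} → 0ℚ < a → 0ℚ < b → 0ℚ < a * b
  0<* {a} {b} ha hb = ≡.subst (_< a * b) (ℚ.*-zeroʳ a) (ℚ.*-monoʳ-<-pos a {{ℚ.positive ha}} hb)

  <⇒≱ : ∀ {a b} → a < b → ¬ b ≤ a
  <⇒≱ h k = ℚ.<-irrefl refl (ℚ.<-≤-trans h k)

  ≮⇒≥ : ∀ {a b} → ¬ a < b → b ≤ a
  ≮⇒≥ {a} {b} h with ℚ.<-cmp a b
  ... | tri< a<b _ _ = contradiction a<b h
  ... | tri≈ _ refl _ = ℚ.≤-refl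
  ... | tri> _ _ b<a = ℚ.<⇒≤ b<a

  0≤ι : ∀ n → 0ℚ ≤ ι n
  0≤ι zero    = ℚ.≤-reflexive (≡.sym ι-0)
  0≤ι (suc n) = ≡.subst (0ℚ ≤_) (≡.sym (ι-suc n)) (0≤+ 0≤1 (0≤ι n))

  ι-mono : ∀ {m n} → m ℕ.≤ n → ι m ≤ ι n
  ι-mono {m} {n} m≤n = ≤-by (ι (n ∸ m)) (0≤ι (n ∸ m))
    (≡.trans (≡.sym (ι-+ m (n ∸ m))) (cong ι (ℕ.m+[n∸m]≡n m≤n)))

  ι-mono-< : ∀ {m n} → m ℕ.< n → ι m < ι n
  ι-mono-< {m} m<n = ℚ.<-≤-trans (<-by 1ℚ 0<1 (≡.trans (ℚ.+-comm (ι m) 1ℚ) (≡.sym (ι-suc m)))) (ι-mono m<n)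

  ≤ι : ∀ (p : ℚ) → ∃[ n ] p ≤ ι n
  ≤ι p@(ℚ.mkℚ n d _) = ℤ.∣ n ∣ , ≡.subst (p ≤_) (≡.sym (ι≡fromNat ℤ.∣ n ∣)) (ℚ.toℚᵘ-cancel-≤ (ℚᵘ.≤-respʳ-≃ (ℚᵘ.≃-sym (ℚ.toℚᵘ-fromℚᵘ (ℤ.+ ℤ.∣ n ∣ ℚᵘ./ 1)))
    (ℚᵘ.*≤* (ℤ.≤-trans (ℤ.≤-reflexive (ℤ.*-identityʳ n)) (ℤ.≤-trans (i≤∣i∣ n)
      (≡.subst (ℤ._≤ ℤ.+ ℤ.∣ n ∣ ℤ.* ℤ.+ suc d) (ℤ.*-identityʳ (ℤ.+ ℤ.∣ n ∣)) (ℤ.*-monoˡ-≤-nonNeg (ℤ.+ ℤ.∣ n ∣) (ℤ.+≤+ (s≤s z≤n)))))))))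
    where
    i≤∣i∣ : ∀ i → i ℤ.≤ ℤ.+ ℤ.∣ i ∣
    i≤∣i∣ (ℤ.+ n)    = ℤ.≤-refl
    i≤∣i∣ ℤ.-[1+ n ] = ℤ.-≤+

  archimedean : ∀ {δ} → 0ℚ < δ → ∀ p → ∃[ m ] ∀ n → m ℕ.≤ n → p ≤ δ * ι n
  archimedean {δ} 0<δ p with ≤ι (p * (ℚ.1/ δ) {{nz}})
    where nz = ℚ.>-nonZero 0<δ
  ... | m , p/δ≤m = m , λ n m≤n → ℚ.≤-trans (ℚ.≤-trans (ℚ.≤-reflexive (eq)) (ℚ.*-monoˡ-≤-nonNeg δ {{ℚ.nonNegative (ℚ.<⇒≤ 0<δ)}} p/δ≤m))
                                    (ℚ.*-monoˡ-≤-nonNeg δ {{ℚ.nonNegative (ℚ.<⇒≤ 0<δ)}} (ι-mono m≤n))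
    where
    instance nz = ℚ.>-nonZero 0<δ
    eq : p ≡ δ * (p * (ℚ.1/ δ))
    eq = ≡.sym (≡.trans (solve 3 (λ d p i → d :* (p :* i) := (d :* i) :* p) same δ p (ℚ.1/ δ)) (≡.trans (cong (_* p) (ℚ.*-inverseʳ δ)) (ℚ.*-identityˡ p)))

open RationalLemmas public

module Valuation {c ℓ} (F : ValuedField c ℓ) where
  open ≡ using (refl; cong)
  open ValuedField F public hiding (refl; sym; trans; reflexive)
  module E = CommutativeRing commutativeRing using (refl; sym; trans; reflexive)
  open SemiringMult semiring public using (×-homo-+; ×1-homo-*; ×-congʳ; ×-assoc-*; ×-comm-*)
  open RingProperties ring public using (-‿distribˡ-*; -‿distribʳ-*; -1*x≈-x; -‿involutive; -0#≈0#)
  open IntegerSolver commutativeRing public using (solve)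
  open Sums commutativeRing public

  infix 4 _≼_ _≺_

  _≼_ _≺_ : ℚ → Carrier → Set
  a ≼ x = [ a ] ≤⁺ v x
  a ≺ x = [ a ] <⁺ v x

  finite : ∀ {x} → ¬ x ≈ 0# → ∃[ q ] v x ≡ [ q ]
  finite {x} x≉0 with v x in eq
  ... | [ q ] = q , refl
  ... | ⊤⁺    = ⊥-elim (x≉0 (v-∞ x eq))

  nonzero : ∀ {x q} → v x ≡ [ q ] → ¬ x ≈ 0#
  nonzero vx x≈0 with ≡.trans (≡.sym vx) (≡.trans (v-cong x≈0) v-0)
  ... | ()

  _≈0? : ∀ x → Dec (x ≈ 0#)
  x ≈0? with v x in eq
  ... | ⊤⁺    = yes (v-∞ x eq)
  ... | [ q ] = no (nonzero eq)

  ≼-resp : ∀ {a x y} → x ≈ y → a ≼ x → a ≼ y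
  ≼-resp {a} e = ≡.subst ([ a ] ≤⁺_) (v-cong e)

  ≺-resp : ∀ {a x y} → x ≈ y → a ≺ x → a ≺ y
  ≺-resp {a} e = ≡.subst ([ a ] <⁺_) (v-cong e)

  ≼-0 : ∀ {a x} → x ≈ 0# → a ≼ x
  ≼-0 {a} e = ≡.subst ([ a ] ≤⁺_) (≡.sym (≡.trans (v-cong e) v-0)) ([ a ] NonStrict.≤⊤⁺)

  ≺-0 : ∀ {a x} → x ≈ 0# → a ≺ x
  ≺-0 {a} e = ≡.subst ([ a ] <⁺_) (≡.sym (≡.trans (v-cong e) v-0)) (Strict.[ a ]<⊤⁺)

  ≼-val : ∀ {a x q} → v x ≡ [ q ] → a ℚ.≤ q → a ≼ x
  ≼-val {a} e h = ≡.subst ([ a ] ≤⁺_) (≡.sym e) NonStrict.[ h ]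

  ≺-val : ∀ {a x q} → v x ≡ [ q ] → a ℚ.< q → a ≺ x
  ≺-val {a} e h = ≡.subst ([ a ] <⁺_) (≡.sym e) Strict.[ h ]

  val-≼ : ∀ {a x q} → v x ≡ [ q ] → a ≼ x → a ℚ.≤ q
  val-≼ e h with ≡.subst ([ _ ] ≤⁺_) e h
  ... | NonStrict.[ p ] = p

  val-≺ : ∀ {a x q} → v x ≡ [ q ] → a ≺ x → a ℚ.< q
  val-≺ e h with ≡.subst ([ _ ] <⁺_) e h
  ... | Strict.[ p ] = p

  ≼-weaken : ∀ {a b x} → a ℚ.≤ b → b ≼ x → a ≼ x
  ≼-weaken {x = x} h k with v x
  ≼-weaken h NonStrict.[ k ]         | [ _ ] = NonStrict.[ ℚ.≤-trans h k ]
  ≼-weaken h (_ NonStrict.≤⊤⁺)      | ⊤⁺    = _ NonStrict.≤⊤⁺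

  ≺-weaken : ∀ {a b x} → a ℚ.≤ b → b ≺ x → a ≺ x
  ≺-weaken {x = x} h k with v x
  ≺-weaken h Strict.[ k ]       | [ _ ] = Strict.[ ℚ.≤-<-trans h k ]
  ≺-weaken h Strict.[ _ ]<⊤⁺    | ⊤⁺    = Strict.[ _ ]<⊤⁺

  ≼⇒≺ : ∀ {a b x} → a ℚ.< b → b ≼ x → a ≺ x
  ≼⇒≺ {x = x} h k with v x
  ≼⇒≺ h NonStrict.[ k ]      | [ _ ] = Strict.[ ℚ.<-≤-trans h k ]
  ≼⇒≺ h (_ NonStrict.≤⊤⁺)   | ⊤⁺    = Strict.[ _ ]<⊤⁺

  ≺⇒≼ : ∀ {a x} → a ≺ x → a ≼ x
  ≺⇒≼ {x = x} k with v x
  ≺⇒≼ Strict.[ k ]      | [ _ ] = NonStrict.[ ℚ.<⇒≤ k ]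
  ≺⇒≼ Strict.[ _ ]<⊤⁺   | ⊤⁺    = _ NonStrict.≤⊤⁺

  _≺?_ : ∀ a x → Dec (a ≺ x)
  a ≺? x = Strict.<⁺-dec ℚ._<_ ℚ._<?_ [ a ] (v x)

  _≼?_ : ∀ a x → Dec (a ≼ x)
  a ≼? x = NonStrict.≤⁺-dec ℚ._≤_ ℚ._≤?_ [ a ] (v x)

  ≼-+ : ∀ {a x y} → a ≼ x → a ≼ y → a ≼ x + y
  ≼-+ = v-+ _ _

  ≼-* : ∀ {a b x y} → a ≼ x → b ≼ y → a ℚ.+ b ≼ x * y
  ≼-* {x = x} {y} h k = ≡.subst ([ _ ] ≤⁺_) (≡.sym (v-* x y)) (aux (v x) (v y) h k)
    where
    aux : ∀ {a b} p q → [ a ] ≤⁺ p → [ b ] ≤⁺ q → [ a ℚ.+ b ] ≤⁺ p +⁺ q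
    aux [ _ ] [ _ ] NonStrict.[ h ] NonStrict.[ k ] = NonStrict.[ ℚ.+-mono-≤ h k ]
    aux [ _ ] ⊤⁺    _ _ = _ NonStrict.≤⊤⁺
    aux ⊤⁺    _     _ _ = _ NonStrict.≤⊤⁺

  ≺-* : ∀ {a b x y} → a ≺ x → b ≼ y → a ℚ.+ b ≺ x * y
  ≺-* {x = x} {y} h k = ≡.subst ([ _ ] <⁺_) (≡.sym (v-* x y)) (aux (v x) (v y) h k)
    where
    aux : ∀ {a b} p q → [ a ] <⁺ p → [ b ] ≤⁺ q → [ a ℚ.+ b ] <⁺ p +⁺ q
    aux [ _ ] [ _ ] Strict.[ h ] NonStrict.[ k ] = Strict.[ ℚ.+-mono-<-≤ h k ]
    aux [ _ ] ⊤⁺    _ _ = Strict.[ _ ]<⊤⁺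
    aux ⊤⁺    _     _ _ = Strict.[ _ ]<⊤⁺

  v-*-val : ∀ {x y p q} → v x ≡ [ p ] → v y ≡ [ q ] → v (x * y) ≡ [ p ℚ.+ q ]
  v-*-val hx hy = ≡.trans (v-* _ _) (≡.cong₂ _+⁺_ hx hy)

  private
    []-injective : ∀ {p q : ℚ} → _≡_ {A = ℚ∞} [ p ] [ q ] → p ≡ q
    []-injective refl = refl

    p+p≡p⇒p≡0 : ∀ p → p ≡ p ℚ.+ p → p ≡ 0ℚ
    p+p≡p⇒p≡0 p h = ≡.trans (ℚSolver.solve 1 (λ p → p := (p :+ p) :- p) ℚSolver.same p)
      (≡.trans (cong (ℚ._- p) (≡.sym h)) (ℚ.+-inverseʳ p))

  val-unique : ∀ {x p q} → v x ≡ [ p ] → v x ≡ [ q ] → p ≡ q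
  val-unique h k = []-injective (≡.trans (≡.sym h) k)

  1≉0 : ¬ 1# ≈ 0#
  1≉0 h = nonzero v-2 (E.trans (+-cong h (E.trans (+-congʳ h) (+-identityˡ _))) (+-identityˡ 0#))

  v-1 : v 1# ≡ [ 0ℚ ]
  v-1 with finite 1≉0
  ... | p , e = ≡.trans e (cong [_] (p+p≡p⇒p≡0 p (val-unique e (≡.trans (v-cong (E.sym (*-identityˡ 1#))) (v-*-val e e)))))

  -1≉0 : ¬ - 1# ≈ 0#
  -1≉0 h = 1≉0 (E.trans (solve 0 (:1 := :- (:- :1)) E.refl) (E.trans (-‿cong h) -0#≈0#))

  v--1 : v (- 1#) ≡ [ 0ℚ ]
  v--1 with finite -1≉0
  ... | p , e = ≡.trans e (cong [_] (half p (val-unique (≡.trans (v-cong (solve 0 ((:- :1) :* (:- :1) := :1) E.refl)) v-1) (v-*-val e e))))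
    where
    half : ∀ p → 0ℚ ≡ p ℚ.+ p → p ≡ 0ℚ
    half p h with ℚ.<-cmp p 0ℚ
    ... | tri< p<0 _ _ = contradiction (≡.sym h) (ℚ.<⇒≢ (ℚ.+-mono-< p<0 p<0))
    ... | tri≈ _ e _   = e
    ... | tri> _ _ 0<p = contradiction h (ℚ.<⇒≢ (ℚ.+-mono-< 0<p 0<p))

  v-neg : ∀ x → v (- x) ≡ v x
  v-neg x = ≡.trans (v-cong (E.sym (-1*x≈-x x))) (≡.trans (v-* _ x) (≡.trans (cong (_+⁺ v x) v--1) (aux (v x))))
    where
    aux : ∀ p → [ 0ℚ ] +⁺ p ≡ p
    aux [ p ] = cong [_] (ℚ.+-identityˡ p)
    aux ⊤⁺    = refl

  ≼-neg : ∀ {a x} → a ≼ x → a ≼ - x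
  ≼-neg {a} {x} = ≡.subst ([ a ] ≤⁺_) (≡.sym (v-neg x))

  ≺-neg : ∀ {a x} → a ≺ x → a ≺ - x
  ≺-neg {a} {x} = ≡.subst ([ a ] <⁺_) (≡.sym (v-neg x))

  ≼-- : ∀ {a x y} → a ≼ x → a ≼ y → a ≼ x - y
  ≼-- h k = ≼-+ h (≼-neg k)

  ≺-+ : ∀ {a x y} → a ≺ x → a ≺ y → a ≺ x + y
  ≺-+ {a} {x} {y} h k with v x in ex | v y in ey
  ≺-+ {a} {x} {y} Strict.[ h ] Strict.[ k ] | [ p ] | [ q ] with ℚ.≤-total p q
  ... | inj₁ p≤q = ≼⇒≺ h (≼-+ (≼-val ex ℚ.≤-refl) (≼-val ey p≤q))
  ... | inj₂ q≤p = ≼⇒≺ k (≼-+ (≼-val ex q≤p) (≼-val ey ℚ.≤-refl))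
  ≺-+ {a} {x} {y} h k | ⊤⁺ | _ = ≺-resp (E.sym (E.trans (+-congʳ (v-∞ x ex)) (+-identityˡ y))) (≡.subst ([ a ] <⁺_) (≡.sym ey) k)
  ≺-+ {a} {x} {y} h k | [ _ ] | ⊤⁺ = ≺-resp (E.sym (E.trans (+-congˡ (v-∞ y ey)) (+-identityʳ x))) (≡.subst ([ a ] <⁺_) (≡.sym ex) h)

  ≺-- : ∀ {a x y} → a ≺ x → a ≺ y → a ≺ x - y
  ≺-- h k = ≺-+ h (≺-neg k)

  v-dominant : ∀ {x y q} → v x ≡ [ q ] → q ≺ y → v (x + y) ≡ [ q ]
  v-dominant {x} {y} {q} ex k with v (x + y) in e
  ... | ⊤⁺ = contradiction (val-≺ ex (≺-resp x≈-y (≺-neg k))) (ℚ.<-irrefl refl)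
    where
    x≈-y : - y ≈ x
    x≈-y = E.trans (solve 2 (λ x y → :- y := x :- (x :+ y)) E.refl x y) (E.trans (+-congˡ (E.trans (-‿cong (v-∞ _ e)) -0#≈0#)) (+-identityʳ x))
  ... | [ p ] with ℚ.<-cmp p q
  ...   | tri< p<q _ _ = contradiction (val-≼ e (≼-+ (≼-val ex ℚ.≤-refl) (≺⇒≼ k))) (<⇒≱ p<q)
  ...   | tri≈ _ refl _ = refl
  ...   | tri> _ _ q<p = contradiction (val-≺ ex (≺-resp (solve 2 (λ x y → (x :+ y) :- y := x) E.refl x y) (≺-- (≺-val e q<p) k))) (ℚ.<-irrefl refl)

  ≼-∑ : ∀ {a} n {f} → (∀ i → i ℕ.< n → a ≼ f i) → a ≼ ∑ n f
  ≼-∑ zero    h = ≼-0 ∑-nil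
  ≼-∑ (suc n) h = ≼-resp (E.sym ∑-cons) (≼-+ (h 0 (s≤s z≤n)) (≼-∑ n λ i i<n → h (suc i) (s≤s i<n)))

  ≺-∑ : ∀ {a} n {f} → (∀ i → i ℕ.< n → a ≺ f i) → a ≺ ∑ n f
  ≺-∑ zero    h = ≺-0 ∑-nil
  ≺-∑ (suc n) h = ≺-resp (E.sym ∑-cons) (≺-+ (h 0 (s≤s z≤n)) (≺-∑ n λ i i<n → h (suc i) (s≤s i<n)))

  0≼1 : 0ℚ ≼ 1#
  0≼1 = ≼-val v-1 ℚ.≤-refl

  0≼-* : ∀ {x y} → 0ℚ ≼ x → 0ℚ ≼ y → 0ℚ ≼ x * y
  0≼-* = ≼-*

  ≼-*ˡ : ∀ {a x y} → 0ℚ ≼ x → a ≼ y → a ≼ x * y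
  ≼-*ˡ {a} h k = ≡.subst (_≼ _) (ℚ.+-identityˡ a) (≼-* h k)

  ≼-*ʳ : ∀ {a x y} → a ≼ x → 0ℚ ≼ y → a ≼ x * y
  ≼-*ʳ {a} h k = ≡.subst (_≼ _) (ℚ.+-identityʳ a) (≼-* h k)

  ≺-*ʳ : ∀ {a x y} → a ≺ x → 0ℚ ≼ y → a ≺ x * y
  ≺-*ʳ {a} h k = ≡.subst (_≺ _) (ℚ.+-identityʳ a) (≺-* h k)

  ≺-*ˡ : ∀ {a x y} → 0ℚ ≼ x → a ≺ y → a ≺ x * y
  ≺-*ˡ h k = ≺-resp (*-comm _ _) (≺-*ʳ k h)

  0≼nat : ∀ n → 0ℚ ≼ n · 1#
  0≼nat zero    = ≼-0 E.refl
  0≼nat (suc n) = ≼-+ 0≼1 (0≼nat n)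

  0≼^ : ∀ {x} n → 0ℚ ≼ x → 0ℚ ≼ x ^ n
  0≼^ zero    h = 0≼1
  0≼^ (suc n) h = 0≼-* h (0≼^ n h)

  ⁻¹-invˡ : ∀ x → ¬ x ≈ 0# → x ⁻¹ * x ≈ 1#
  ⁻¹-invˡ x h = E.trans (*-comm _ _) (⁻¹-inv x h)

  cancel-0 : ∀ {x y} → ¬ x ≈ 0# → x * y ≈ 0# → y ≈ 0#
  cancel-0 {x} {y} h k = E.trans (E.sym (*-identityˡ y)) (E.trans (*-congʳ (E.sym (⁻¹-invˡ x h))) (E.trans (*-assoc _ _ _) (E.trans (*-congˡ k) (zeroʳ _))))

  v-⁻¹ : ∀ {x q} → v x ≡ [ q ] → v (x ⁻¹) ≡ [ ℚ.- q ]
  v-⁻¹ {x} {q} e with finite {x ⁻¹} (λ h → 1≉0 (E.trans (E.sym (⁻¹-inv x (nonzero e))) (E.trans (*-congˡ h) (zeroʳ x))))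
  ... | p , e′ = ≡.trans e′ (cong [_] (≡.trans (ℚSolver.solve 2 (λ p q → p := (q :+ p) :- q) ℚSolver.same p q)
      (≡.trans (cong (ℚ._- q) (val-unique (v-*-val e e′) (≡.trans (v-cong (⁻¹-inv x (nonzero e))) v-1))) (ℚ.+-identityˡ (ℚ.- q)))))

  ≼-⁻¹ : ∀ {a x y q} → v x ≡ [ q ] → a ℚ.+ q ≼ y → a ≼ y * x ⁻¹
  ≼-⁻¹ {a} {q = q} e h = ≡.subst (_≼ _) (ℚSolver.solve 2 (λ a q → (a :+ q) :+ (:- q) := a) ℚSolver.same a q)
    (≼-* h (≼-val (v-⁻¹ e) ℚ.≤-refl))

  halve : ∀ n → (∃[ m ] n ≡ 2 ℕ.* m) ⊎ (∃[ m ] n ≡ suc (2 ℕ.* m))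
  halve zero = inj₁ (0 , refl)
  halve (suc n) with halve n
  ... | inj₁ (m , refl) = inj₂ (m , refl)
  ... | inj₂ (m , refl) = inj₁ (suc m , ≡.sym (ℕ.*-suc 2 m))

  v-even : ∀ m {q} → v (m · 1#) ≡ [ q ] → v ((2 ℕ.* m) · 1#) ≡ [ 1ℚ ℚ.+ q ]
  v-even m e = ≡.trans (v-cong (×1-homo-* 2 m)) (v-*-val v-2 e)

  v-odd : ∀ m → v (suc (2 ℕ.* m) · 1#) ≡ [ 0ℚ ]
  v-odd m = v-dominant v-1 (≼⇒≺ 0<1 (≼-resp (E.sym (×1-homo-* 2 m)) (≼-*ʳ (≼-val v-2 ℚ.≤-refl) (0≼nat m))))

  v-nat : ∀ K n → 0 ℕ.< n → n ℕ.< 2 ℕ.^ K → ∃[ o ] v (n · 1#) ≡ [ ι o ] × o ℕ.< K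
  v-nat zero    (suc n) 0<n (s≤s ())
  v-nat (suc K) n 0<n n< with halve n
  ... | inj₂ (m , refl) = 0 , ≡.trans (v-odd m) (cong [_] (≡.sym ι-0)) , s≤s z≤n
  ... | inj₁ (zero , refl) = contradiction 0<n (λ ())
  ... | inj₁ (m@(suc _) , refl) with v-nat K m (s≤s z≤n) (ℕ.*-cancelˡ-< 2 m (2 ℕ.^ K) n<)
  ...   | o , e , o<K = suc o , ≡.trans (v-even m e) (cong [_] (≡.sym (ι-suc o))) , s≤s o<K

  n<2^n : ∀ n → n ℕ.< 2 ℕ.^ n
  n<2^n zero    = s≤s z≤n
  n<2^n (suc n) = ℕ.≤-trans (ℕ.+-mono-≤ (ℕ.m^n>0 2 n) (n<2^n n)) (ℕ.+-monoʳ-≤ (2 ℕ.^ n) (ℕ.m≤m+n _ 0))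

  v-suc : ∀ n → ∃[ o ] v (suc n · 1#) ≡ [ ι o ]
  v-suc n with v-nat (suc n) (suc n) (s≤s z≤n) (n<2^n (suc n))
  ... | o , e , _ = o , e

  nat≉0 : ∀ n → ¬ suc n · 1# ≈ 0#
  nat≉0 n = nonzero (proj₂ (v-suc n))

  ·≈· : ∀ n x → n · x ≈ n · 1# * x
  ·≈· n x = E.sym (E.trans (×-assoc-* n 1# x) (×-congʳ n (*-identityˡ x)))

  torsion-free : ∀ n x → suc n · x ≈ 0# → x ≈ 0#
  torsion-free n x h = cancel-0 (nat≉0 n) (E.trans (E.sym (·≈· (suc n) x)) h)

  v-! : ∀ n → ∃[ q ] v ((n !) · 1#) ≡ [ q ]
  v-! zero    = 0ℚ , ≡.trans (v-cong (+-identityʳ 1#)) v-1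
  v-! (suc n) = _ , ≡.trans (v-cong (×1-homo-* (suc n) (n !))) (v-*-val (proj₂ (v-suc n)) (proj₂ (v-! n)))

  2^-val : ∀ K → v ((2 ℕ.^ K) · 1#) ≡ [ ι K ]
  2^-val zero    = ≡.trans (v-cong (+-identityʳ 1#)) (≡.trans v-1 (cong [_] (≡.sym ι-0)))
  2^-val (suc K) = ≡.trans (v-even (2 ℕ.^ K) (2^-val K)) (cong [_] (≡.sym (ι-suc K)))

  v-^ : ∀ {x q} → v x ≡ [ q ] → ∀ k → v (x ^ k) ≡ [ ι k ℚ.* q ]
  v-^ {q = q} e zero    = ≡.trans v-1 (cong [_] (≡.sym (≡.trans (cong (ℚ._* q) ι-0) (ℚ.*-zeroˡ q))))
  v-^ {q = q} e (suc k) = ≡.trans (v-*-val e (v-^ e k)) (cong [_] (≡.trans (ℚSolver.solve 2 (λ q k → q :+ k :* q := (:1 :+ k) :* q) ℚSolver.same q (ι k))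
    (cong (ℚ._* q) (≡.sym (ι-suc k)))))

module Overconvergence {c ℓ} (C : ℂ₂ c ℓ) where
  module V = Valuation (ℂ₂.valuedField C)
  open OverconvergentForms C using (falling; binomial; h^; Isβ; Rigid; M; M₀; Character; _≐⟨·⟩^_; IsExp; IsLog1+; algebraicallyClosed)

  module S where
    open V using (Series; j⁻¹; h^⅛; _-ˢ_; 1ˢ)
    open ModularForms V.commutativeRing V.torsion-free public
    open import Relation.Binary.Reasoning.Setoid setoid

    pow : K.Carrier → Series
    pow a = binomial a

    cancel-field : ∀ {x y z} → ¬ x K.≈ K.0# → x K.* y K.≈ x K.* z → y K.≈ z
    cancel-field {x} {y} {z} x≉0 h = K.trans (K.solve 2 (λ y z → y := (y :- z) :+ z) K.refl y z)
      (K.trans (K.+-congʳ (V.cancel-0 x≉0 (K.trans (K.solve 3 (λ x y z → x :* (y :- z) := x :* y :- x :* z) K.refl x y z)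
        (K.trans (K.+-congʳ h) (K.-‿inverseʳ _))))) (K.+-identityˡ z))

    !≉0 : ∀ k → ¬ (k !) K.× K.1# K.≈ K.0#
    !≉0 k = V.nonzero (proj₂ (V.v-! k))

    binomial-! : ∀ a k → (k !) K.× K.1# K.* binomial a k K.≈ falling a k
    binomial-! a k = K.trans (K.solve 3 (λ x f i → x :* (f :* i) := f :* (x :* i)) K.refl _ _ _)
      (K.trans (K.*-congˡ (V.⁻¹-inv _ (!≉0 k))) (K.*-identityʳ _))

    binomial-suc : ∀ a k → suc k K.× K.1# K.* binomial a (suc k) K.≈ (a K.- k K.× K.1#) K.* binomial a k
    binomial-suc a k = cancel-field (!≉0 k) (K.trans (K.solve 3 (λ x n b → x :* (n :* b) := (n :* x) :* b) K.refl _ _ _)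
      (K.trans (K.*-congʳ (K.sym (K.×1-homo-* (suc k) (k !)))) (K.trans (binomial-! a (suc k))
      (K.trans (K.*-congʳ (K.sym (binomial-! a k))) (K.solve 3 (λ x b m → (x :* b) :* m := x :* (m :* b)) K.refl _ _ _)))))

    binomial-0 : ∀ a → binomial a 0 K.≈ K.1#
    binomial-0 a = K.trans (K.sym (K.trans (K.*-congʳ (K.+-identityʳ K.1#)) (K.*-identityˡ _))) (binomial-! a 0)

    pow-∂ : ∀ a → (1# + X) * ∂ (pow a) ≈ const a * pow a
    pow-∂ a = trans (solve 2 (λ x p → (:1 :+ x) :* p := p :+ x :* p) refl X (∂ (pow a))) (trans (+-congˡ (sym (D≈X∂ (pow a)))) ⟪ coeff ⟫)
      where
      coeff : ∀ k → (∂ (pow a) + D (pow a)) k K.≈ (const a * pow a) k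
      coeff k = K.trans (coeff-+ _ _ k) (K.trans (K.+-cong
          (K.trans (coeff-∂ (pow a) k) (K.trans (V.·≈· (suc k) _) (binomial-suc a k))) (K.trans (coeff-D (pow a) k) (V.·≈· k _)))
        (K.trans (K.solve 3 (λ a n b → (a :- n) :* b :+ n :* b := a :* b) K.refl a (k K.× K.1#) (binomial a k))
          (K.sym (coeff-const-* a (pow a) k))))

    log-unique : ∀ {g h y z} → g 0 K.≈ K.1# → h 0 K.≈ K.0# → y 0 K.≈ z 0 → g * D y ≈ h * y → g * D z ≈ h * z → y ≈ z
    log-unique {h = h} g0 h0 y0 = ode-unique g0 regular ⟪ (λ { zero _ → y0 ; (suc n) (s≤s ()) }) ⟫
      where
      regular : ∀ n → 1 ℕ.≤ n → ∀ x → (n K.× K.1# K.- h 0) K.* x K.≈ K.0# → x K.≈ K.0#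
      regular (suc n) _ x e = V.cancel-0 (V.nat≉0 n) (K.trans (K.*-congʳ (K.sym (K.trans (K.+-congˡ (K.trans (K.-‿cong h0) K.-0#≈0#)) (K.+-identityʳ _)))) e)

    1+X-0 : (1# + X) 0 K.≈ K.1#
    1+X-0 = K.trans (coeff-+ 1# X 0) (K.trans (K.+-congʳ coeff-1-0) (K.+-identityʳ K.1#))

    private
      pow-D : ∀ a → (1# + X) * D (pow a) ≈ (const a * X) * pow a
      pow-D a = trans (*-congˡ (D≈X∂ (pow a))) (trans (solve 3 (λ g x p → g :* (x :* p) := x :* (g :* p)) refl (1# + X) X _)
        (trans (*-congˡ (pow-∂ a)) (solve 3 (λ x a p → x :* (a :* p) := a :* x :* p) refl X (const a) (pow a))))

      aX-0 : ∀ a → (const a * X) 0 K.≈ K.0#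
      aX-0 a = K.trans (coeff-*-0 (const a) X) (K.zeroʳ a)

    pow-+ : ∀ a b → pow a * pow b ≈ pow (a K.+ b)
    pow-+ a b = log-unique {h = const (a K.+ b) * X} 1+X-0 (aX-0 (a K.+ b))
      (K.trans (coeff-*-0 _ _) (K.trans (K.*-cong (binomial-0 a) (binomial-0 b)) (K.trans (K.*-identityˡ _) (K.sym (binomial-0 (a K.+ b))))))
      (trans (*-congˡ (D-* (pow a) (pow b))) (trans (solve 5 (λ g p q p′ q′ → g :* (p′ :* q :+ p :* q′) := (g :* p′) :* q :+ p :* (g :* q′)) refl (1# + X) (pow a) (pow b) (D (pow a)) (D (pow b)))
        (trans (+-cong (*-congʳ (pow-D a)) (*-congˡ (pow-D b))) (trans
          (solve 5 (λ x p q a b → a :* x :* p :* q :+ p :* (b :* x :* q) := (a :+ b) :* x :* (p :* q)) refl X (pow a) (pow b) (const a) (const b))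
          (*-congʳ (*-congʳ (sym (const-+ a b))))))))
      (pow-D (a K.+ b))

    pow-cong : ∀ {a b} → a K.≈ b → pow a ≈ pow b
    pow-cong {a} {b} a≈b = ⟪ (λ k → K.*-congʳ (falling-cong k)) ⟫
      where
      falling-cong : ∀ k → falling a k K.≈ falling b k
      falling-cong zero    = K.refl
      falling-cong (suc k) = K.*-cong (falling-cong k) (K.+-congʳ a≈b)

    pow-0 : pow K.0# ≈ 1#
    pow-0 = log-unique {h = const K.0# * X} 1+X-0 (aX-0 K.0#) (K.trans (binomial-0 K.0#) (K.sym coeff-1-0)) (pow-D K.0#)
      (trans (*-congˡ D-1) (trans (zeroʳ _) (sym (trans (*-congʳ (trans (*-congʳ const-0) (zeroˡ X))) (zeroˡ _)))))

    pow-1 : pow K.1# ≈ 1# + X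
    pow-1 = log-unique {h = const K.1# * X} 1+X-0 (aX-0 K.1#) (K.trans (binomial-0 K.1#) (K.sym 1+X-0)) (pow-D K.1#)
      (trans (*-congˡ (trans (D-+ 1# X) (trans (+-cong D-1 D-X) (+-identityˡ X)))) (trans (*-comm _ X) (*-congʳ (sym (trans (*-congʳ const-1) (*-identityˡ X))))))

    pow-suc : ∀ n → pow (suc n K.× K.1#) ≈ (1# + X) * pow (n K.× K.1#)
    pow-suc n = trans (sym (pow-+ K.1# _)) (*-congʳ pow-1)

    pow-nat : ∀ n → pow (n K.× K.1#) ≈ (1# + X) ^ n
    pow-nat zero    = pow-0
    pow-nat (suc n) = trans (pow-suc n) (*-congˡ (pow-nat n))

    minus-1-0 : ∀ {g} → g 0 K.≈ K.1# → (g - 1#) 0 K.≈ K.0#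
    minus-1-0 {g} g0 = K.trans (coeff-- g 1# 0) (K.trans (K.+-cong g0 (K.-‿cong coeff-1-0)) (K.-‿inverseʳ _))

    D-power : ∀ a {g l} → g 0 K.≈ K.1# → D g ≈ l * g → D (subst (pow a) (g - 1#)) ≈ (const a * l) * subst (pow a) (g - 1#)
    D-power a {g} {l} g0 Dg = cancel-*ˡ {g} (≈1-cancel g0) (begin
      g * D y                          ≈⟨ *-congˡ (trans (D-subst u0 (pow a)) (*-congˡ (trans (D-- g 1#) (trans (+-cong Dg (trans (-‿cong D-1) (solve 0 (:- # 0 := # 0) refl))) (+-identityʳ _))))) ⟩
      g * (y′ * (l * g))               ≈⟨ solve 3 (λ g y l → g :* (y :* (l :* g)) := (g :* y) :* (l :* g)) refl g y′ l ⟩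
      (g * y′) * (l * g)               ≈⟨ *-congʳ gy′ ⟩
      (const a * y) * (l * g)          ≈⟨ solve 4 (λ a y l g → (a :* y) :* (l :* g) := g :* ((a :* l) :* y)) refl (const a) y l g ⟩
      g * ((const a * l) * y)          ∎)
      where
      u0 = minus-1-0 {g} g0
      y  = subst (pow a) (g - 1#)
      y′ = subst (∂ (pow a)) (g - 1#)
      gy′ : g * y′ ≈ const a * y
      gy′ = begin
        g * y′                                     ≈⟨ *-congʳ (solve 1 (λ g → g := :1 :+ (g :- :1)) refl g) ⟩
        (1# + (g - 1#)) * y′                       ≈⟨ *-congʳ (trans (subst-+ u0 1# X) (+-cong (subst-1 u0) (subst-X u0))) ⟨
        subst (1# + X) (g - 1#) * y′               ≈⟨ subst-* u0 (1# + X) (∂ (pow a)) ⟨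
        subst ((1# + X) * ∂ (pow a)) (g - 1#)      ≈⟨ subst-cong u0 (pow-∂ a) ⟩
        subst (const a * pow a) (g - 1#)           ≈⟨ trans (subst-* u0 (const a) (pow a)) (*-congʳ (subst-const u0 a)) ⟩
        const a * y                                ∎

    power-0 : ∀ a {g} → g 0 K.≈ K.1# → subst (pow a) (g - 1#) 0 K.≈ K.1#
    power-0 a {g} g0 = K.trans (subst-coeff-0 (minus-1-0 {g} g0) (pow a)) (binomial-0 a)

    h^≈ : ∀ s → h^ s ≈ subst (pow (8 V.· s)) (h - 1#)
    h^≈ s = trans (substitute≈subst _ _) (subst-congʳ (K.trans (K.+-congˡ K.refl) (minus K.refl)) (trans (-ˢ≈- h 1ˢ) (+-congˡ (-‿cong 1ˢ≈1))) _)
      where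
      minus : ∀ {x} → x K.≈ K.1# → x K.- K.1# K.≈ K.0#
      minus e = K.trans (K.+-congʳ e) (K.-‿inverseʳ _)

    Q : Series
    Q = u₁ - 1#

    Q-0 : Q 0 K.≈ K.0#
    Q-0 = minus-1-0 {u₁} u-0

    -- h(-q)^s = h(q)^s u^{6s}, since h = θ₄²⁴ and u = θ₃⁴/θ₄⁴
    flip-h^ : ∀ s → flip (h^ s) ≈ h^ s * subst (pow (6 V.· s)) Q
    flip-h^ s = trans (Flip.cong (h^≈ s)) (trans flip-H (trans main (*-congʳ (sym (h^≈ s)))))
      where
      H = subst (pow (8 V.· s)) (h - 1#)
      flip-h-0 : flip h 0 K.≈ K.1#
      flip-h-0 = K.trans (subst-coeff-0 neg-X-0 h) h-0
      flip-H : flip H ≈ subst (pow (8 V.· s)) (flip h - 1#)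
      flip-H = trans (subst-assoc (minus-1-0 {h} h-0) neg-X-0 _) (subst-congʳ (K.trans (subst-coeff-0 neg-X-0 (h - 1#)) (minus-1-0 {h} h-0))
        (trans (Flip.homo-- h 1#) (+-congˡ (-‿cong Flip.homo-1))) _)
      m = S₂ - S
      Dfh : D (flip h) ≈ (6 · flip m) * flip h
      Dfh = trans (D-flip h) (trans (Flip.cong D-h) (trans (Flip.homo-* _ _) (*-congʳ (Flip.homo-· 6 m))))
      main : subst (pow (8 V.· s)) (flip h - 1#) ≈ H * subst (pow (6 V.· s)) Q
      main = log-unique {1#} {const (8 V.· s) * (6 · flip m)} coeff-1-0
        (K.trans (coeff-*-0 _ _) (K.trans (K.*-congˡ (K.trans (coeff-· 6 (flip m) 0) (K.×-congʳ 6 (K.trans (subst-coeff-0 neg-X-0 m)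
          (0-coeff (Mod.trans 1 (Mod.+-cong 1 (dilate-S-mod-1 S S-mod-1) (Mod.-‿cong 1 S-mod-1)) (mod (-‿inverseʳ 0#)))))))) (K.solve 1 (λ a → a :* (6 :× # 0) := # 0) K.refl _)))
        (K.trans (power-0 _ {flip h} flip-h-0) (K.sym (K.trans (coeff-*-0 _ _) (K.trans (K.*-cong (power-0 _ {h} h-0) (power-0 _ {u₁} u-0)) (K.*-identityˡ _)))))
        (trans (*-identityˡ _) (D-power _ {flip h} flip-h-0 Dfh))
        (trans (*-identityˡ _) (trans (D-*-log (D-power _ {h} h-0 D-h) (D-power _ {u₁} u-0 D-u)) (*-congʳ (begin
          const (8 V.· s) * (6 · m) + const (6 V.· s) * (w₁ - w₂)
            ≈⟨ +-cong (*-congʳ (const-· 8 s)) (*-cong (const-· 6 s) w₁-w₂) ⟩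
          8 · const s * (6 · m) + 6 · const s * (8 · (flip m - m))
            ≈⟨ solve 3 (λ s m f → 8 :× s :* (6 :× m) :+ 6 :× s :* (8 :× (f :- m)) := 8 :× s :* (6 :× f)) refl (const s) m (flip m) ⟩
          8 · const s * (6 · flip m)
            ≈⟨ *-congʳ (const-· 8 s) ⟨
          const (8 V.· s) * (6 · flip m) ∎))))

    t : Series → Series
    t w = w * inverse ((1# + 16 · w) ^ 3)

    1/16 : K.Carrier
    1/16 = (16 V.· K.1#) V.⁻¹

    16*1/16 : (16 V.· K.1#) K.* 1/16 K.≈ K.1#
    16*1/16 = V.⁻¹-inv _ (V.nat≉0 15)

    denominator-0 : ∀ {w} → w 0 K.≈ K.0# → ((1# + 16 · w) ^ 3) 0 K.≈ K.1#
    denominator-0 {w} w0 = K.trans (coeff-*-0 b _) (K.trans (K.*-cong b0 (K.trans (coeff-*-0 b _) (K.*-cong b0 (K.trans (coeff-*-0 b _) (K.*-cong b0 coeff-1-0)))))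
      (K.solve 0 (:1 :* (:1 :* (:1 :* :1)) := :1) K.refl))
      where
      b = 1# + 16 · w
      b0 : b 0 K.≈ K.1#
      b0 = K.trans (coeff-+ 1# _ 0) (K.trans (K.+-cong coeff-1-0 (K.trans (coeff-· 16 w 0) (K.×-congʳ 16 w0)))
        (K.solve 0 (:1 :+ 16 :× # 0 := :1) K.refl))

    t-equation : ∀ {w} → w 0 K.≈ K.0# → JEquation w (const 1/16 * t w)
    t-equation {w} w0 = begin
      16 · (const 1/16 * (w * I)) * d
        ≈⟨ solve 5 (λ k w i d n → 16 :× (k :* (w :* i)) :* d := (# 16 :* k) :* (w :* (d :* i))) refl (const 1/16) w I d 0# ⟩
      (⟨ 16 ⟩ * const 1/16) * (w * (d * I))
        ≈⟨ *-cong (trans (*-congʳ (trans (×-congʳ 16 (sym const-1)) (sym (const-· 16 K.1#)))) (trans (sym (const-* _ _)) (trans (const-cong 16*1/16) const-1)))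
                  (*-congˡ (*-inverse (denominator-0 w0))) ⟩
      1# * (w * 1#)
        ≈⟨ trans (*-identityˡ _) (*-identityʳ w) ⟩
      w ∎
      where
      d = (1# + 16 · w) ^ 3
      I = inverse d

    J-unique : ∀ {w j j′} → w 0 K.≈ K.0# → JEquation w j → JEquation w j′ → j ≈ j′
    J-unique {w} {j} {j′} w0 e e′ = cancel-· 15 (cancel-*ˡ {(1# + 16 · w) ^ 3} (≈1-cancel (denominator-0 w0))
      (trans (*-comm _ _) (trans e (trans (sym e′) (*-comm _ _)))))

    J-subst : ∀ {u w j} → u 0 K.≈ K.0# → JEquation w j → JEquation (subst w u) (subst j u)
    J-subst {u} {w} {j} u0 e = trans (sym (trans (H.homo-* _ _) (*-cong (H.homo-· 16 j) (trans (H.homo-^ _ 3) (^-cong 3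
        (trans (H.homo-+ _ _) (+-cong H.homo-1 (H.homo-· 16 w)))))))) (H.cong e)
      where module H = SubstHom {u} u0

    J-cong : ∀ {w w′ j} → w ≈ w′ → JEquation w j → JEquation w′ j
    J-cong h e = trans (*-congˡ (^-cong 3 (+-congˡ (×-congʳ 16 (sym h))))) (trans e h)

    -- w = u² - u and its conjugate under u ↦ 1/u, in terms of X = u - 1
    w₊ w₋ : Series
    w₊ = X + X * X
    w₋ = pow (K.- K.1#) * pow (K.- K.1#) - pow (K.- K.1#)

    w₊-0 : w₊ 0 K.≈ K.0#
    w₊-0 = K.trans (coeff-+ X _ 0) (K.trans (K.+-identityˡ _) X²-0)

    w₋-0 : w₋ 0 K.≈ K.0#
    w₋-0 = K.trans (coeff-- _ _ 0) (K.trans (K.+-cong (K.trans (coeff-*-0 _ _) (K.*-cong p0 p0)) (K.-‿cong p0)) (K.solve 0 (:1 :* :1 :- :1 := # 0) K.refl))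
      where p0 = binomial-0 (K.- K.1#)

    1+X*pow-1 : (1# + X) * pow (K.- K.1#) ≈ 1#
    1+X*pow-1 = trans (*-congʳ (sym pow-1)) (trans (pow-+ _ _) (trans (pow-cong (K.-‿inverseʳ K.1#)) pow-0))

    subst-Q-injective : ∀ {f} → subst f Q ≈ 0# → f ≈ 0#
    subst-Q-injective {f} h = ⟪ (λ n → K.trans (go n f h) (K.sym (coeff-0 n))) ⟫
      where
      tQ = tail Q
      Q≈XtQ : Q ≈ X * tQ
      Q≈XtQ = trans (split Q) (trans (+-congʳ (trans (const-cong Q-0) const-0)) (+-identityˡ _))
      tQ-regular : ∀ x → tQ 0 K.* x K.≈ K.0# → x K.≈ K.0#
      tQ-regular x e = V.torsion-free 15 x (K.trans (K.solve 1 (λ x → 16 :× x := (16 :× :1) :* x) K.refl x)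
        (K.trans (K.*-congʳ (K.sym (K.trans (at[ u-1 ] 1 (s≤s (s≤s z≤n))) (coeff-· 16 X 1)))) e))
      go : ∀ n f → subst f Q ≈ 0# → f n K.≈ K.0#
      go zero    f h = K.trans (K.sym (subst-coeff-0 Q-0 f)) (K.trans (at h 0) (coeff-0 0))
      go (suc n) f h = go n (tail f) (cancel-*ˡ {tQ} tQ-regular (trans XtQ (sym (zeroʳ tQ))))
        where
        Q*≈0 : X * (tQ * subst (tail f) Q) ≈ 0#
        Q*≈0 = trans (sym (*-assoc X tQ _)) (trans (*-congʳ (sym Q≈XtQ)) (trans (sym (+-identityˡ _))
          (trans (+-congʳ (sym (trans (const-cong (go zero f h)) const-0))) (trans (sym (subst-unfold Q-0 f)) h))))
        XtQ : tQ * subst (tail f) Q ≈ 0#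
        XtQ = ⟪ (λ n → K.trans (K.sym (X-coeff _ n)) (K.trans (at Q*≈0 (suc n)) (K.trans (coeff-0 (suc n)) (K.sym (coeff-0 n))))) ⟫

    core-equation : ∀ s a (G : Series) → flip G ≈ - G → h^ s * G ≈ subst a j⁻¹ →
      subst a (const 1/16 * t w₊) * pow (6 V.· s) ≈ - subst a (const 1/16 * t w₋)
    core-equation s a G flip-G hG = trans (solve 2 (λ x y → x := (x :+ y) :- y) refl (A * p) A′) (trans (+-congʳ (subst-Q-injective zero-sum)) (+-identityˡ _))
      where
      A  = subst a (const 1/16 * t w₊)
      A′ = subst a (const 1/16 * t w₋)
      p  = pow (6 V.· s)
      module H = SubstHom {Q} Q-0
      w-0 : (u₁ * u₁ - u₁) 0 K.≈ K.0#
      w-0 = K.trans (coeff-- _ _ 0) (K.trans (K.+-cong (K.trans (coeff-*-0 _ _) (K.*-cong u-0 u-0)) (K.-‿cong u-0)) (K.solve 0 (:1 :* :1 :- :1 := # 0) K.refl))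
      j≈ : j⁻¹ ≈ subst (const 1/16 * t w₊) Q
      j≈ = J-unique w-0 j-equation (J-cong (trans (H.homo-+ _ _) (trans (+-cong (subst-X Q-0) (trans (H.homo-* X X) (*-cong (subst-X Q-0) (subst-X Q-0))))
        (solve 1 (λ u → (u :- :1) :+ (u :- :1) :* (u :- :1) := u :* u :- u) refl u₁))) (J-subst Q-0 (t-equation w₊-0)))
      u-inverse : flip u₁ ≈ subst (pow (K.- K.1#)) Q
      u-inverse = cancel-*ˡ {u₁} (≈1-cancel u-0) (trans (*-comm _ _) (trans flip-u*u (sym (trans (*-congʳ (sym 1+Q)) (trans (sym (H.homo-* _ _)) (trans (H.cong 1+X*pow-1) H.homo-1))))))
        where
        1+Q : subst (1# + X) Q ≈ u₁
        1+Q = trans (H.homo-+ _ _) (trans (+-cong H.homo-1 (subst-X Q-0)) (solve 1 (λ u → :1 :+ (u :- :1) := u) refl u₁))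
      w-flip-0 : (flip u₁ * flip u₁ - flip u₁) 0 K.≈ K.0#
      w-flip-0 = K.trans (coeff-- _ _ 0) (K.trans (K.+-cong (K.trans (coeff-*-0 _ _) (K.*-cong f0 f0)) (K.-‿cong f0)) (K.solve 0 (:1 :* :1 :- :1 := # 0) K.refl))
        where f0 = K.trans (subst-coeff-0 neg-X-0 u₁) u-0
      flip-j≈ : flip j⁻¹ ≈ subst (const 1/16 * t w₋) Q
      flip-j≈ = J-unique w-flip-0 (J-cong (trans (Flip.homo-- _ _) (+-congʳ (Flip.homo-* _ _))) (J-subst neg-X-0 j-equation))
        (J-cong (trans (H.homo-- _ _) (trans (+-congʳ (H.homo-* _ _)) (+-cong (*-cong (sym u-inverse) (sym u-inverse)) (-‿cong (sym u-inverse))))) (J-subst Q-0 (t-equation w₋-0)))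
      κt-0 : ∀ {w} → w 0 K.≈ K.0# → (const 1/16 * t w) 0 K.≈ K.0#
      κt-0 {w} w0 = K.trans (coeff-*-0 _ _) (K.trans (K.*-congˡ (K.trans (coeff-*-0 w _) (K.trans (K.*-congʳ w0) (K.zeroˡ _)))) (K.zeroʳ _))
      j-0 : j⁻¹ 0 K.≈ K.0#
      j-0 = K.trans (at j≈ 0) (subst-0-order (κt-0 w₊-0) Q-0)
      F≈ : h^ s * G ≈ subst A Q
      F≈ = trans hG (trans (subst-congʳ j-0 j≈ a) (sym (subst-assoc (κt-0 w₊-0) Q-0 a)))
      flip-F≈ : flip (h^ s * G) ≈ subst A′ Q
      flip-F≈ = trans (Flip.cong hG) (trans (subst-assoc j-0 neg-X-0 a) (trans (subst-congʳ (subst-0-order j-0 neg-X-0) flip-j≈ a) (sym (subst-assoc (κt-0 w₋-0) Q-0 a))))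
      zero-sum : subst (A * p + A′) Q ≈ 0#
      zero-sum = begin
        subst (A * p + A′) Q                   ≈⟨ trans (H.homo-+ _ _) (+-congʳ (H.homo-* _ _)) ⟩
        subst A Q * subst p Q + subst A′ Q     ≈⟨ +-cong (*-congʳ (sym F≈)) (trans (sym flip-F≈) (trans (Flip.homo-* _ _) (*-cong (flip-h^ s) flip-G))) ⟩
        h^ s * G * subst p Q + h^ s * subst p Q * - G ≈⟨ solve 3 (λ h g p → h :* g :* p :+ h :* p :* (:- g) := # 0) refl (h^ s) G (subst p Q) ⟩
        0# ∎

  open ≡ using (refl; cong)
  open V
  open S using (at)
  open ℚSolver using (same) renaming (solve to solveℚ)

  -- The functional equation for finite β

  2ℚ : ℚ
  2ℚ = 1ℚ ℚ.+ 1ℚ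

  Decays : ℚ → Series → Set
  Decays δ f = ∀ (N : ℚ) → ∃[ m ] ∀ n → m ℕ.≤ n → N ℚ.- δ ℚ.* ι n ≼ f n

  lower-bound : ∀ m (f : Series) → ∃[ B ] ∀ k → k ℕ.< m → B ≼ f k
  lower-bound zero    f = 0ℚ , λ _ ()
  lower-bound (suc m) f with lower-bound m f | f m ≈0?
  ... | B , h | yes e = B , λ k k<1+m → aux k (ℕ.m<1+n⇒m<n∨m≡n k<1+m)
    where
    aux : ∀ k → k ℕ.< m ⊎ k ≡ m → B ≼ f k
    aux k (inj₁ k<m)  = h k k<m
    aux k (inj₂ refl) = ≼-0 e
  ... | B , h | no ne = B ⊓ q , λ k k<1+m → aux k (ℕ.m<1+n⇒m<n∨m≡n k<1+m)
    where
    q = proj₁ (finite ne)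
    aux : ∀ k → k ℕ.< m ⊎ k ≡ m → B ⊓ q ≼ f k
    aux k (inj₁ k<m)  = ≼-weaken (ℚ.p⊓q≤p B q) (h k k<m)
    aux k (inj₂ refl) = ≼-val (proj₂ (finite ne)) (ℚ.p⊓q≤q B q)

  decays-transform : ∀ {δ} → 0ℚ ℚ.< δ → ∀ {φ} → Decays δ φ → ∀ {γ : ℕ → ℕ → Carrier} → (∀ k n → 0ℚ ≼ γ k n) →
                     ∀ {f} → (∀ n → f n ≈ ∑ (suc n) (λ k → φ k * γ k n)) → Decays δ f
  decays-transform {δ} 0<δ {φ} hφ {γ} hγ {f} f≈ N with hφ N
  ... | m₀ , h₀ with lower-bound m₀ φ
  ...   | B , hB with archimedean 0<δ (N ℚ.- B)
  ...     | m₁ , h₁ = m₀ ℕ.⊔ m₁ , λ n m≤n → ≼-resp (E.sym (f≈ n)) (≼-∑ (suc n) λ { k (s≤s k≤n) → ≼-*ʳ (aux n k k≤n m≤n) (hγ k n) })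
    where
    aux : ∀ n k → k ℕ.≤ n → m₀ ℕ.⊔ m₁ ℕ.≤ n → N ℚ.- δ ℚ.* ι n ≼ φ k
    aux n k k≤n m≤n with k ℕ.<? m₀
    ... | yes k<m₀ = ≼-weaken (≤-by (δ ℚ.* ι n ℚ.- (N ℚ.- B)) (0≤- (h₁ n (ℕ.≤-trans (ℕ.m≤n⊔m m₀ m₁) m≤n)))
          (solveℚ 3 (λ N d B → (N :- d) :+ (d :- (N :- B)) := B) same N (δ ℚ.* ι n) B)) (hB k k<m₀)
    ... | no k≮m₀ = ≼-weaken (≤-by (δ ℚ.* (ι n ℚ.- ι k)) (0≤* (ℚ.<⇒≤ 0<δ) (0≤- (ι-mono k≤n)))
          (solveℚ 4 (λ N d n k → (N :- d :* n) :+ d :* (n :- k) := N :- d :* k) same N δ (ι n) (ι k)))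
          (h₀ k (ℕ.≮⇒≥ k≮m₀))

  record Minimum (δ : ℚ) (f : Series) : Set where
    field
      index   : ℕ
      weight  : ℚ
      attains : v (f index) ≡ [ weight ℚ.- δ ℚ.* ι index ]
      minimal : ∀ n → weight ℚ.- δ ℚ.* ι n ≼ f n

  minimum : ∀ {δ f} → Decays δ f → ∀ j → ¬ f j ≈ 0# → Minimum δ f
  minimum {δ} {f} dec j fj≉0 with finite fj≉0
  ... | q , e = result
    where
    q₀ = q ℚ.+ δ ℚ.* ι j
    search : ∀ m → ∃[ N ] ∃[ ω ] v (f N) ≡ [ ω ℚ.- δ ℚ.* ι N ] × ω ℚ.≤ q₀ × (∀ n → n ℕ.< m → ω ℚ.- δ ℚ.* ι n ≼ f n)
    search zero = j , q₀ , ≡.trans e (cong [_] (solveℚ 2 (λ q d → q := (q :+ d) :- d) same q (δ ℚ.* ι j))) , ℚ.≤-refl , λ _ ()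
    search (suc m) with search m
    ... | N , ω , at-N , ω≤q₀ , below with (ω ℚ.- δ ℚ.* ι m) ≼? f m
    ...   | yes h = N , ω , at-N , ω≤q₀ , λ n n<1+m → aux n (ℕ.m<1+n⇒m<n∨m≡n n<1+m)
      where
      aux : ∀ n → n ℕ.< m ⊎ n ≡ m → ω ℚ.- δ ℚ.* ι n ≼ f n
      aux n (inj₁ n<m)  = below n n<m
      aux n (inj₂ refl) = h
    ...   | no ¬h with finite {f m} (λ z → ¬h (≼-0 z))
    ...     | p , ep = m , p ℚ.+ δ ℚ.* ι m , ≡.trans ep (cong [_] (solveℚ 2 (λ q d → q := (q :+ d) :- d) same p (δ ℚ.* ι m)))
              , ℚ.≤-trans p+≤ω ω≤q₀ , λ n n<1+m → aux n (ℕ.m<1+n⇒m<n∨m≡n n<1+m)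
      where
      p<ω- : p ℚ.< ω ℚ.- δ ℚ.* ι m
      p<ω- = ℚ.≰⇒> λ h → ¬h (≼-val ep h)
      p+≤ω : p ℚ.+ δ ℚ.* ι m ℚ.≤ ω
      p+≤ω = ≤-by (ω ℚ.- δ ℚ.* ι m ℚ.- p) (0≤- (ℚ.<⇒≤ p<ω-)) (solveℚ 3 (λ p d ω → (p :+ d) :+ (ω :- d :- p) := ω) same p (δ ℚ.* ι m) ω)
      aux : ∀ n → n ℕ.< m ⊎ n ≡ m → p ℚ.+ δ ℚ.* ι m ℚ.- δ ℚ.* ι n ≼ f n
      aux n (inj₁ n<m)  = ≼-weaken (ℚ.+-monoˡ-≤ _ p+≤ω) (below n n<m)
      aux n (inj₂ refl) = ≼-val ep (ℚ.≤-reflexive (solveℚ 2 (λ q d → (q :+ d) :- d := q) same p (δ ℚ.* ι m)))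
    result : Minimum δ f
    result with dec q₀
    ... | m , tail-bound with search m
    ...   | N , ω , at-N , ω≤q₀ , below = record { index = N ; weight = ω ; attains = at-N ; minimal = all }
      where
      all : ∀ n → ω ℚ.- δ ℚ.* ι n ≼ f n
      all n with n ℕ.<? m
      ... | yes n<m = below n n<m
      ... | no n≮m = ≼-weaken (ℚ.+-monoˡ-≤ _ ω≤q₀) (tail-bound n (ℕ.≮⇒≥ n≮m))

  Lacunary : ℚ → Series → Set
  Lacunary δ f = (∀ k → ℚ.- (δ ℚ.* ι k) ≼ f k)
    × ∃[ a₀ ] (∀ a → a₀ ℕ.≤ a → v (f (2 ℕ.^ a)) ≡ [ 1ℚ ℚ.- δ ℚ.* ι (2 ℕ.^ a) ])
            × (∀ k → 2 ℕ.^ a₀ ℕ.≤ k → (∃[ a ] k ≡ 2 ℕ.^ a) ⊎ (1ℚ ℚ.- δ ℚ.* ι k ≺ f k))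

  ∑-isolate : ∀ {q} m {f} N → N ℕ.< m → (∀ i → i ℕ.< m → ¬ i ≡ N → q ≺ f i) → q ≺ ∑ m f → q ≺ f N
  ∑-isolate (suc m) {f} zero    _       h total = ≺-resp (E.trans (+-congʳ ∑-cons) (solve 2 (λ a b → (a :+ b) :- b := a) E.refl (f 0) _))
    (≺-- total (≺-∑ m λ i i<m → h (suc i) (s≤s i<m) λ ()))
  ∑-isolate (suc m) {f} (suc N) (s≤s N<m) h total = ∑-isolate m N N<m (λ i i<m i≢N → h (suc i) (s≤s i<m) λ { refl → i≢N refl })
    (≺-resp (E.trans (+-congʳ ∑-cons) (solve 2 (λ a b → (a :+ b) :- a := b) E.refl (f 0) _)) (≺-- total (h 0 (s≤s z≤n) λ ())))

  2^-cancel-< : ∀ {a b} → 2 ℕ.^ a ℕ.< 2 ℕ.^ b → a ℕ.< b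
  2^-cancel-< {a} {b} h with a ℕ.<? b
  ... | yes a<b = a<b
  ... | no a≮b = contradiction (ℕ.^-monoʳ-≤ 2 (ℕ.≮⇒≥ a≮b)) (ℕ.<⇒≱ h)

  -- The coefficient of index 2^a + N of the product, N being the index of the
  -- minimum of A, has a unique dominant term, of weight exactly one more than
  -- the minimum.
  lacunary-product : ∀ {δ A B f} → Minimum δ A → Decays δ A → Decays δ B → Lacunary δ f → A S.* f S.≈ B → ⊥
  lacunary-product {δ} {A} {B} {f} min dA dB (f≥ , a₀ , f-2^ , f-rest) eq with dA (weight ℚ.+ 2ℚ) | dB (weight ℚ.+ 2ℚ)
    where open Minimum min
  ... | g , A-tail | m , B-tail = ℚ.<-irrefl refl (val-≺ exact (∑-isolate (suc n) N (s≤s (ℕ.m≤n+m N K)) others total))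
    where
    open Minimum min renaming (index to N; weight to ω)
    a = g ℕ.+ N ℕ.+ 2 ℕ.^ a₀ ℕ.+ m
    K = 2 ℕ.^ suc a
    n = K ℕ.+ N
    a<2^a : a ℕ.< 2 ℕ.^ a
    a<2^a = n<2^n a
    sumsTo : ∀ {x} → x ℕ.≤ a → x ℕ.< 2 ℕ.^ a
    sumsTo h = ℕ.≤-<-trans h a<2^a
    g≤a : g ℕ.≤ a
    g≤a = ℕ.≤-trans (ℕ.m≤m+n g N) (ℕ.≤-trans (ℕ.m≤m+n _ (2 ℕ.^ a₀)) (ℕ.m≤m+n _ m))
    N≤a : N ℕ.≤ a
    N≤a = ℕ.≤-trans (ℕ.m≤n+m N g) (ℕ.≤-trans (ℕ.m≤m+n _ (2 ℕ.^ a₀)) (ℕ.m≤m+n _ m))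
    2^a₀≤a : 2 ℕ.^ a₀ ℕ.≤ a
    2^a₀≤a = ℕ.≤-trans (ℕ.m≤n+m _ (g ℕ.+ N)) (ℕ.m≤m+n _ m)
    m≤a : m ℕ.≤ a
    m≤a = ℕ.m≤n+m m _
    2^a≤K : 2 ℕ.^ a ℕ.≤ K
    2^a≤K = ℕ.m≤m+n _ _
    a₀≤a : a₀ ℕ.≤ a
    a₀≤a = ℕ.≤-trans (ℕ.<⇒≤ (n<2^n a₀)) 2^a₀≤a
    q = ω ℚ.+ 1ℚ ℚ.- δ ℚ.* ι n
    n∸N : n ∸ N ≡ K
    n∸N = ℕ.m+n∸n≡m K N
    exact : v (A N * f (n ∸ N)) ≡ [ q ]
    exact = ≡.trans (v-*-val attains (≡.trans (cong (v ∘ f) n∸N) (f-2^ (suc a) (ℕ.≤-trans a₀≤a (ℕ.n≤1+n a)))))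
      (cong [_] (≡.trans (solveℚ 4 (λ ω d k n → (ω :- d :* n) :+ (:1 :- d :* k) := ω :+ :1 :- d :* (k :+ n)) same ω δ (ι K) (ι N))
        (cong (λ x → ω ℚ.+ 1ℚ ℚ.- δ ℚ.* x) (≡.sym (ι-+ K N)))))
    raise : ∀ x d → (x ℚ.+ 1ℚ ℚ.- d) ℚ.< (x ℚ.+ 2ℚ ℚ.- d)
    raise x d = <-by 1ℚ 0<1 (solveℚ 2 (λ x d → (x :+ :1 :- d) :+ :1 := x :+ (:1 :+ :1) :- d) same x d)
    total : q ≺ ∑ (suc n) (λ i → A i * f (n ∸ i))
    total = ≺-resp (E.trans (E.sym (at eq n)) (S.coeff-* A f n)) (≼⇒≺ (raise ω _) (B-tail n (ℕ.≤-trans m≤a (ℕ.≤-trans (ℕ.<⇒≤ a<2^a) (ℕ.≤-trans 2^a≤K (ℕ.m≤m+n K N))))))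
    others : ∀ i → i ℕ.< suc n → ¬ i ≡ N → q ≺ A i * f (n ∸ i)
    others i (s≤s i≤n) i≢N with i ℕ.<? g
    ... | no i≮g = ≼⇒≺ (raise ω _) (≡.subst (_≼ A i * f (n ∸ i))
            (≡.trans (solveℚ 5 (λ ω t d i k → (ω :+ t :- d :* i) :+ (:- (d :* k)) := ω :+ t :- d :* (i :+ k)) same ω 2ℚ δ (ι i) (ι (n ∸ i)))
              (cong (λ x → ω ℚ.+ 2ℚ ℚ.- δ ℚ.* x) (≡.trans (≡.sym (ι-+ i (n ∸ i))) (cong ι (ℕ.m+[n∸m]≡n i≤n)))))
            (≼-* (A-tail i (ℕ.≮⇒≥ i≮g)) (f≥ (n ∸ i))))
    ... | yes i<g = ≺-resp (*-comm _ _) (≡.subst (_≺ f k * A i)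
            (≡.trans (solveℚ 4 (λ ω d k i → (:1 :- d :* k) :+ (ω :- d :* i) := ω :+ :1 :- d :* (i :+ k)) same ω δ (ι k) (ι i))
              (cong (λ x → ω ℚ.+ 1ℚ ℚ.- δ ℚ.* x) (≡.trans (≡.sym (ι-+ i k)) (cong ι (ℕ.m+[n∸m]≡n i≤n)))))
            (≺-* f-k (minimal i)))
      where
      k = n ∸ i
      k-low : 2 ℕ.^ a ℕ.< k
      k-low = ℕ.m+n≤o⇒m≤o∸n (suc (2 ℕ.^ a)) (≡.subst (λ x → suc x ℕ.≤ n) (ℕ.+-comm i (2 ℕ.^ a)) n<)
        where
        n< : i ℕ.+ 2 ℕ.^ a ℕ.< n
        n< = ℕ.<-≤-trans (ℕ.+-monoˡ-< (2 ℕ.^ a) (ℕ.<-trans i<g (sumsTo g≤a)))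
               (ℕ.≤-trans (ℕ.≤-reflexive (cong (2 ℕ.^ a ℕ.+_) (≡.sym (ℕ.+-identityʳ (2 ℕ.^ a))))) (ℕ.m≤m+n K N))
      k-high : k ℕ.< 2 ℕ.^ suc (suc a)
      k-high = ℕ.≤-<-trans (ℕ.m∸n≤m n i) (ℕ.<-≤-trans (ℕ.+-monoʳ-< K (ℕ.<-≤-trans (sumsTo N≤a) 2^a≤K))
        (ℕ.≤-reflexive (cong (K ℕ.+_) (≡.sym (ℕ.+-identityʳ K)))))
      f-k : 1ℚ ℚ.- δ ℚ.* ι k ≺ f k
      f-k with f-rest k (ℕ.≤-trans 2^a₀≤a (ℕ.≤-trans (ℕ.<⇒≤ a<2^a) (ℕ.<⇒≤ k-low)))
      ... | inj₂ h = h
      ... | inj₁ (b , k≡2^b) = contradiction i≡N i≢N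
        where
        b≡ : b ≡ suc a
        b≡ = ℕ.≤-antisym (ℕ.≤-pred (2^-cancel-< (≡.subst (ℕ._< 2 ℕ.^ suc (suc a)) k≡2^b k-high))) (2^-cancel-< (≡.subst (2 ℕ.^ a ℕ.<_) k≡2^b k-low))
        i≡N : i ≡ N
        i≡N = ℕ.+-cancelˡ-≡ K i N (≡.trans (ℕ.+-comm K i) (≡.trans (cong (i ℕ.+_) (≡.sym (≡.trans k≡2^b (cong (2 ℕ.^_) b≡)))) (ℕ.m+[n∸m]≡n i≤n)))

  opaque
    o : ℕ → ℚ
    o n = ι (proj₁ (v-suc n))

    v-o : ∀ n → v (suc n · 1#) ≡ [ o n ]
    v-o n = proj₂ (v-suc n)

    0≤o : ∀ n → 0ℚ ℚ.≤ o n
    0≤o n = 0≤ι _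

  o-even : ∀ k → o (2 ℕ.* k) ≡ 0ℚ
  o-even k = val-unique (v-o (2 ℕ.* k)) (v-odd k)

  o-odd : ∀ k → o (suc (2 ℕ.* k)) ≡ 1ℚ ℚ.+ o k
  o-odd k = val-unique (v-o (suc (2 ℕ.* k))) (≡.trans (cong (λ n → v (n · 1#)) (≡.sym (ℕ.*-suc 2 k))) (v-even (suc k) (v-o k)))

  -- With w k = v(ε - k), this is v(binomial ε k) + δ k.
  partial : (ℕ → ℚ) → ℚ → ℕ → ℚ
  partial w δ zero    = 0ℚ
  partial w δ (suc k) = partial w δ k ℚ.+ (w k ℚ.- o k) ℚ.+ δ

  IsPowerOf2 : ℕ → Set
  IsPowerOf2 k = ∃[ a ] k ≡ 2 ℕ.^ a

  LacunaryWeights : (ℕ → ℚ) → Set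
  LacunaryWeights s = (∀ k → 0ℚ ℚ.≤ s k)
    × ∃[ a₀ ] (∀ a → a₀ ℕ.≤ a → s (2 ℕ.^ a) ≡ 1ℚ) × (∀ k → 2 ℕ.^ a₀ ℕ.≤ k → IsPowerOf2 k ⊎ (1ℚ ℚ.< s k))

  partial-even : ∀ {w w′ δ δ′} →
    (∀ k → (w (2 ℕ.* k) ℚ.+ δ) ℚ.+ (w (suc (2 ℕ.* k)) ℚ.+ δ) ≡ 1ℚ ℚ.+ (w′ k ℚ.+ δ′)) →
    ∀ k → partial w δ (2 ℕ.* k) ≡ partial w′ δ′ k
  partial-even h zero = refl
  partial-even {w} {w′} {δ} {δ′} h (suc k) = ≡.trans (cong (partial w δ) (ℕ.*-suc 2 k)) (begin
    p ℚ.+ (a ℚ.- o (2 ℕ.* k)) ℚ.+ δ ℚ.+ (b ℚ.- o (suc (2 ℕ.* k))) ℚ.+ δ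
      ≡⟨ ≡.cong₂ (λ x y → p ℚ.+ (a ℚ.- x) ℚ.+ δ ℚ.+ (b ℚ.- y) ℚ.+ δ) (o-even k) (o-odd k) ⟩
    p ℚ.+ (a ℚ.- 0ℚ) ℚ.+ δ ℚ.+ (b ℚ.- (1ℚ ℚ.+ o k)) ℚ.+ δ
      ≡⟨ solveℚ 5 (λ p a b d q → p :+ (a :- # 0) :+ d :+ (b :- (:1 :+ q)) :+ d := p :+ ((a :+ d) :+ (b :+ d)) :- :1 :- q) same p a b δ (o k) ⟩
    p ℚ.+ ((a ℚ.+ δ) ℚ.+ (b ℚ.+ δ)) ℚ.- 1ℚ ℚ.- o k
      ≡⟨ ≡.cong₂ (λ x y → x ℚ.+ y ℚ.- 1ℚ ℚ.- o k) (partial-even h k) (h k) ⟩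
    partial w′ δ′ k ℚ.+ (1ℚ ℚ.+ (w′ k ℚ.+ δ′)) ℚ.- 1ℚ ℚ.- o k
      ≡⟨ solveℚ 4 (λ p a d q → p :+ (:1 :+ (a :+ d)) :- :1 :- q := p :+ (a :- q) :+ d) same (partial w′ δ′ k) (w′ k) δ′ (o k) ⟩
    partial w′ δ′ (suc k) ∎)
    where
    open ≡.≡-Reasoning
    p = partial w δ (2 ℕ.* k)
    a = w (2 ℕ.* k)
    b = w (suc (2 ℕ.* k))

  partial-odd : ∀ w δ k → partial w δ (suc (2 ℕ.* k)) ≡ partial w δ (2 ℕ.* k) ℚ.+ (w (2 ℕ.* k) ℚ.+ δ)
  partial-odd w δ k = ≡.trans (cong (λ x → partial w δ (2 ℕ.* k) ℚ.+ (w (2 ℕ.* k) ℚ.- x) ℚ.+ δ) (o-even k))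
    (solveℚ 3 (λ p a d → p :+ (a :- # 0) :+ d := p :+ (a :+ d)) same (partial w δ (2 ℕ.* k)) (w (2 ℕ.* k)) δ)

  weights : ℚ → ℕ → ℚ
  weights β zero    = β
  weights β (suc i) = o i ⊓ β

  -- For β ≤ 0 the weight of k is the binary digit sum of k.
  lacunary-base : ∀ β → β ℚ.≤ 0ℚ → LacunaryWeights (partial (weights β) (1ℚ ℚ.- β))
  lacunary-base β β≤0 = nonneg , 0 , (λ a _ → power a) , λ { (suc k) _ → Data.Sum.Base.map₁ proj₁ (classify (suc k) (s≤s z≤n)) }
    where
    import Data.Sum.Base
    δ = 1ℚ ℚ.- β
    s = partial (weights β) δ
    w≡β : ∀ i → weights β i ≡ β
    w≡β zero    = refl
    w≡β (suc i) = ℚ.p≥q⇒p⊓q≡q (ℚ.≤-trans β≤0 (0≤o i))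
    even : ∀ k → s (2 ℕ.* k) ≡ s k
    even = partial-even λ k → ≡.trans (≡.cong₂ (λ x y → (x ℚ.+ δ) ℚ.+ (y ℚ.+ δ)) (w≡β (2 ℕ.* k)) (w≡β (suc (2 ℕ.* k))))
      (≡.trans (solveℚ 1 (λ β → (β :+ (:1 :- β)) :+ (β :+ (:1 :- β)) := :1 :+ (β :+ (:1 :- β))) same β) (cong (λ x → 1ℚ ℚ.+ (x ℚ.+ δ)) (≡.sym (w≡β k))))
    odd : ∀ k → s (suc (2 ℕ.* k)) ≡ s k ℚ.+ 1ℚ
    odd k = ≡.trans (partial-odd (weights β) δ k) (≡.cong₂ ℚ._+_ (even k) (≡.trans (cong (ℚ._+ δ) (w≡β (2 ℕ.* k))) (solveℚ 1 (λ β → β :+ (:1 :- β) := :1) same β)))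
    power : ∀ a → s (2 ℕ.^ a) ≡ 1ℚ
    power zero    = ≡.trans (odd 0) (ℚ.+-identityˡ 1ℚ)
    power (suc a) = ≡.trans (even (2 ℕ.^ a)) (power a)
    classify : ∀ k → 0 ℕ.< k → (IsPowerOf2 k × s k ≡ 1ℚ) ⊎ (1ℚ ℚ.< s k)
    classify = <-rec _ step
      where
      step : ∀ k → (∀ {j} → j ℕ.< k → 0 ℕ.< j → (IsPowerOf2 j × s j ≡ 1ℚ) ⊎ (1ℚ ℚ.< s j)) → 0 ℕ.< k → (IsPowerOf2 k × s k ≡ 1ℚ) ⊎ (1ℚ ℚ.< s k)
      step k rec 0<k with halve k
      step k rec 0<k | inj₁ (zero , refl) = contradiction 0<k λ ()
      step k rec 0<k | inj₁ (m@(suc m′) , refl) with rec {m} (ℕ.m<m+n m (s≤s z≤n)) (s≤s z≤n)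
      ... | inj₁ ((a , m≡) , e) = inj₁ ((suc a , cong (2 ℕ.*_) m≡) , ≡.trans (even m) e)
      ... | inj₂ h = inj₂ (≡.subst (1ℚ ℚ.<_) (≡.sym (even m)) h)
      step k rec 0<k | inj₂ (zero , refl) = inj₁ ((0 , refl) , power 0)
      step k rec 0<k | inj₂ (m@(suc m′) , refl) = inj₂ (≡.subst (1ℚ ℚ.<_) (≡.sym (odd m)) (bound (rec {m} (s≤s (ℕ.m≤m+n m _)) (s≤s z≤n))))
        where
        bound : (IsPowerOf2 m × s m ≡ 1ℚ) ⊎ (1ℚ ℚ.< s m) → 1ℚ ℚ.< s m ℚ.+ 1ℚ
        bound (inj₁ (_ , e)) = <-by 1ℚ 0<1 (cong (ℚ._+ 1ℚ) (≡.sym e))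
        bound (inj₂ h)       = ℚ.<-trans h (<-by 1ℚ 0<1 refl)
    nonneg : ∀ k → 0ℚ ℚ.≤ s k
    nonneg zero    = ℚ.≤-refl
    nonneg (suc k) with classify (suc k) (s≤s z≤n)
    ... | inj₁ (_ , e) = ≡.subst (0ℚ ℚ.≤_) (≡.sym e) 0≤1
    ... | inj₂ h       = ℚ.≤-trans 0≤1 (ℚ.<⇒≤ h)

  lacunary-step : ∀ {w δ s′} → (∀ k → partial w δ (2 ℕ.* k) ≡ s′ k) → (∀ k → 0ℚ ℚ.< w (2 ℕ.* k) ℚ.+ δ) →
                  LacunaryWeights s′ → LacunaryWeights (partial w δ)
  lacunary-step {w} {δ} {s′} even 0<w (nonneg′ , a₀ , power′ , rest′) = nonneg , suc a₀ , power , rest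
    where
    s = partial w δ
    odd-< : ∀ k → s′ k ℚ.< s (suc (2 ℕ.* k))
    odd-< k = <-by _ (0<w k) (≡.trans (cong (ℚ._+ _) (≡.sym (even k))) (≡.sym (partial-odd w δ k)))
    nonneg : ∀ k → 0ℚ ℚ.≤ s k
    nonneg k with halve k
    ... | inj₁ (m , refl) = ≡.subst (0ℚ ℚ.≤_) (≡.sym (even m)) (nonneg′ m)
    ... | inj₂ (m , refl) = ℚ.≤-trans (nonneg′ m) (ℚ.<⇒≤ (odd-< m))
    power : ∀ a → suc a₀ ℕ.≤ a → s (2 ℕ.^ a) ≡ 1ℚ
    power (suc a) (s≤s a₀≤a) = ≡.trans (even (2 ℕ.^ a)) (power′ a a₀≤a)
    rest : ∀ k → 2 ℕ.^ suc a₀ ℕ.≤ k → IsPowerOf2 k ⊎ (1ℚ ℚ.< s k)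
    rest k ≤k with halve k
    rest k ≤k | inj₁ (m , refl) with rest′ m (ℕ.*-cancelˡ-≤ 2 ≤k)
    ... | inj₁ (a , m≡) = inj₁ (suc a , cong (2 ℕ.*_) m≡)
    ... | inj₂ h = inj₂ (≡.subst (1ℚ ℚ.<_) (≡.sym (even m)) h)
    rest k ≤k | inj₂ (m , refl) = inj₂ (bound (rest′ m a₀≤m))
      where
      a₀≤m : 2 ℕ.^ a₀ ℕ.≤ m
      a₀≤m with 2 ℕ.^ a₀ ℕ.≤? m
      ... | yes h = h
      ... | no h = contradiction ≤k (ℕ.<⇒≱ (ℕ.≤-trans (ℕ.≤-reflexive (≡.sym (ℕ.*-suc 2 m))) (ℕ.*-monoʳ-≤ 2 (ℕ.≰⇒> h))))
      1≤s′ : 1ℚ ℚ.≤ s′ m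
      1≤s′ with rest′ m a₀≤m
      ... | inj₂ h = ℚ.<⇒≤ h
      ... | inj₁ (a , refl) = ℚ.≤-reflexive (≡.sym (power′ a a₀≤a))
        where
        a₀≤a : a₀ ℕ.≤ a
        a₀≤a = ℕ.≤-pred (2^-cancel-< {a₀} {suc a} (ℕ.≤-<-trans a₀≤m (ℕ.m<m+n (2 ℕ.^ a) (ℕ.≤-trans (ℕ.m^n>0 2 a) (ℕ.m≤m+n _ 0)))))
      bound : IsPowerOf2 m ⊎ (1ℚ ℚ.< s′ m) → 1ℚ ℚ.< s (suc (2 ℕ.* m))
      bound _ = ℚ.≤-<-trans 1≤s′ (odd-< m)

  -- 1 - ν β, for β ≤ 0 if n = 0 and n - 1 ≤ β ≤ n otherwise
  radius : ℕ → ℚ → ℚ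
  radius zero    β = 1ℚ ℚ.- β
  radius (suc n) β = ½ ℚ.* radius n (β ℚ.- 1ℚ)

  InPiece : ℕ → ℚ → Set
  InPiece zero    β = β ℚ.≤ 0ℚ
  InPiece (suc n) β = ι n ℚ.≤ β × β ℚ.≤ ι (suc n)

  ½+½ : ∀ x → ½ ℚ.* x ℚ.+ ½ ℚ.* x ≡ x
  ½+½ x = ≡.trans (≡.sym (ℚ.*-distribʳ-+ x ½ ½)) (ℚ.*-identityˡ x)

  private
    pred-piece : ∀ n {β} → InPiece (suc n) β → InPiece n (β ℚ.- 1ℚ)
    pred-piece zero {β} (_ , h) = ℚ.≤-trans (ℚ.+-monoˡ-≤ (ℚ.- 1ℚ) h)
      (ℚ.≤-reflexive (≡.trans (cong (ℚ._- 1ℚ) (≡.trans (ι-suc 0) (cong (1ℚ ℚ.+_) ι-0))) refl))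
    pred-piece (suc n) {β} (h , k) =
        ≡.subst (ℚ._≤ β ℚ.- 1ℚ) (≡.trans (cong (ℚ._- 1ℚ) (ι-suc n)) (solveℚ 1 (λ a → (:1 :+ a) :- :1 := a) same (ι n))) (ℚ.+-monoˡ-≤ (ℚ.- 1ℚ) h)
      , ≡.subst (β ℚ.- 1ℚ ℚ.≤_) (≡.trans (cong (ℚ._- 1ℚ) (ι-suc (suc n))) (solveℚ 1 (λ a → (:1 :+ a) :- :1 := a) same (ι (suc n)))) (ℚ.+-monoˡ-≤ (ℚ.- 1ℚ) k)

  0<½ : 0ℚ ℚ.< ½
  0<½ = ℚ.positive⁻¹ ½

  0<radius : ∀ n {β} → InPiece n β → 0ℚ ℚ.< radius n β
  0<radius zero {β} h = ℚ.<-≤-trans 0<1 (≤-by (ℚ.- β) (0≤-β) refl)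
    where
    0≤-β : 0ℚ ℚ.≤ ℚ.- β
    0≤-β = ≡.subst (0ℚ ℚ.≤_) (ℚ.+-identityˡ (ℚ.- β)) (0≤- h)
  0<radius (suc n) h = 0<* 0<½ (0<radius n (pred-piece n h))

  lacunary-weights : ∀ n β → InPiece n β → LacunaryWeights (partial (weights β) (radius n β))
  lacunary-weights zero    β h = lacunary-base β h
  lacunary-weights (suc n) β h = lacunary-step {weights β} {δ} (partial-even pairs) positive (lacunary-weights n (β ℚ.- 1ℚ) (pred-piece n h))
    where
    δ = radius (suc n) β
    δ′ = radius n (β ℚ.- 1ℚ)
    0≤β : 0ℚ ℚ.≤ β
    0≤β = ℚ.≤-trans (0≤ι n) (proj₁ h)
    w-even : ∀ k → weights β (2 ℕ.* k) ≡ 1ℚ ℚ.+ weights (β ℚ.- 1ℚ) k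
    w-even zero    = solveℚ 1 (λ β → β := :1 :+ (β :- :1)) same β
    w-even (suc k) = ≡.trans (cong (weights β) (ℕ.*-suc 2 k)) (≡.trans (≡.cong₂ _⊓_ (o-odd k) (solveℚ 1 (λ β → β := :1 :+ (β :- :1)) same β))
      (≡.sym (ℚ.mono-≤-distrib-⊓ (ℚ.+-monoʳ-≤ 1ℚ) (o k) (β ℚ.- 1ℚ))))
    w-odd : ∀ k → weights β (suc (2 ℕ.* k)) ≡ 0ℚ
    w-odd k = ≡.trans (cong (_⊓ β) (o-even k)) (ℚ.p≤q⇒p⊓q≡p 0≤β)
    pairs : ∀ k → (weights β (2 ℕ.* k) ℚ.+ δ) ℚ.+ (weights β (suc (2 ℕ.* k)) ℚ.+ δ) ≡ 1ℚ ℚ.+ (weights (β ℚ.- 1ℚ) k ℚ.+ δ′)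
    pairs k = ≡.trans (≡.cong₂ (λ x y → (x ℚ.+ δ) ℚ.+ (y ℚ.+ δ)) (w-even k) (w-odd k))
      (≡.trans (solveℚ 2 (λ w d → ((:1 :+ w) :+ d) :+ (# 0 :+ d) := :1 :+ (w :+ (d :+ d))) same (weights (β ℚ.- 1ℚ) k) δ) (cong (λ x → 1ℚ ℚ.+ (weights (β ℚ.- 1ℚ) k ℚ.+ x)) (½+½ δ′)))
    0≤w : ∀ k → 0ℚ ℚ.≤ weights β k
    0≤w zero    = 0≤β
    0≤w (suc k) = ℚ.⊓-glb (0≤o k) 0≤β
    positive : ∀ k → 0ℚ ℚ.< weights β (2 ℕ.* k) ℚ.+ δ
    positive k = ℚ.+-mono-≤-< (0≤w (2 ℕ.* k)) (0<radius (suc n) h)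

  lacunary-binomial : ∀ {n β ε} → InPiece n β → (∀ k → v (ε - k · 1#) ≡ [ weights β k ]) → Lacunary (radius n β) (binomial ε)
  lacunary-binomial {n} {β} {ε} h vε with lacunary-weights n β h
  ... | nonneg , a₀ , power , rest = (λ k → ≼-val (v-binomial k) (≤-by (s k) (nonneg k) (ℚ.+-comm (ℚ.- (δ ℚ.* ι k)) (s k))))
    , a₀ , (λ a a₀≤a → ≡.trans (v-binomial (2 ℕ.^ a)) (cong (λ x → [ x ℚ.- δ ℚ.* ι (2 ℕ.^ a) ]) (power a a₀≤a)))
    , λ k ≤k → Data.Sum.Base.map₂ (λ 1<s → ≺-val (v-binomial k) (ℚ.+-monoˡ-< _ 1<s)) (rest k ≤k)
    where
    import Data.Sum.Base
    δ = radius n β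
    s = partial (weights β) δ
    v-binomial : ∀ k → v (binomial ε k) ≡ [ s k ℚ.- δ ℚ.* ι k ]
    v-binomial zero = ≡.trans (v-cong (S.binomial-0 ε)) (≡.trans v-1 (cong [_] (≡.sym (≡.trans (cong (λ x → 0ℚ ℚ.- δ ℚ.* x) ι-0)
      (solveℚ 1 (λ d → # 0 :- d :* # 0 := # 0) same δ)))))
    v-binomial (suc k) = ≡.trans (v-cong b≈) (≡.trans (v-*-val (v-*-val (vε k) (v-binomial k)) (v-⁻¹ (v-o k)))
      (cong [_] (≡.trans (solveℚ 5 (λ w s d k o → w :+ (s :- d :* k) :+ (:- o) := s :+ (w :- o) :+ d :- d :* (:1 :+ k)) same (weights β k) (s k) δ (ι k) (o k))
        (cong (λ x → s (suc k) ℚ.- δ ℚ.* x) (≡.sym (ι-suc k))))))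
      where
      b≈ : binomial ε (suc k) ≈ (ε - k · 1#) * binomial ε k * (suc k · 1#) ⁻¹
      b≈ = S.cancel-field (nat≉0 k) (E.trans (S.binomial-suc ε k) (E.trans (E.sym (*-identityʳ _)) (E.trans (*-congˡ (E.sym (⁻¹-inv _ (nat≉0 k))))
        (solve 3 (λ x n i → x :* (n :* i) := n :* (x :* i)) E.refl _ _ _))))

  Divisible : ℚ → Series → Set
  Divisible q f = ∀ n → q ≼ f n

  Integral : Series → Set
  Integral = Divisible 0ℚ

  divisible-resp : ∀ {q f g} → f S.≈ g → Divisible q f → Divisible q g
  divisible-resp e h n = ≼-resp (at e n) (h n)
    where open S using (at)

  divisible-* : ∀ {q f g} → Divisible q f → Integral g → Divisible q (f S.* g)
  divisible-* {f = f} {g} hf hg n = ≼-resp (E.sym (S.coeff-* f g n)) (≼-∑ (suc n) λ i _ → ≼-*ʳ (hf i) (hg (n ∸ i)))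

  divisible-+ : ∀ {q f g} → Divisible q f → Divisible q g → Divisible q (f S.+ g)
  divisible-+ {f = f} {g} hf hg n = ≼-resp (E.sym (S.coeff-+ f g n)) (≼-+ (hf n) (hg n))

  divisible-neg : ∀ {q f} → Divisible q f → Divisible q (S.- f)
  divisible-neg {f = f} hf n = ≼-resp (E.sym (S.coeff-neg f n)) (≼-neg (hf n))

  divisible-- : ∀ {q f g} → Divisible q f → Divisible q g → Divisible q (f S.- g)
  divisible-- hf hg = divisible-+ hf (divisible-neg hg)

  integral-0 : ∀ {q} → Divisible q S.0#
  integral-0 n = ≼-0 (S.coeff-0 n)

  integral-1 : Integral S.1#
  integral-1 zero    = ≼-resp (E.sym S.coeff-1-0) 0≼1
  integral-1 (suc n) = ≼-0 (S.coeff-1-suc n)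

  integral-X : Integral S.X
  integral-X zero          = ≼-0 E.refl
  integral-X (suc zero)    = 0≼1
  integral-X (suc (suc n)) = ≼-0 E.refl

  integral-· : ∀ k {f} → Integral f → Integral (k S.· f)
  integral-· zero    h = integral-0
  integral-· (suc k) h = divisible-+ h (integral-· k h)

  integral-^ : ∀ k {f} → Integral f → Integral (f S.^ k)
  integral-^ zero    h = integral-1
  integral-^ (suc k) h = divisible-* h (integral-^ k h)

  integral-inverse : ∀ {f} → Integral f → Integral (S.inverse f)
  integral-inverse {f} h n = ≼-resp (E.sym (S.coeff-subst (λ _ → 1#) (S.1# S.- f) n))
    (≼-∑ (suc n) λ k _ → 0≼-* 0≼1 (integral-^ k (divisible-- integral-1 h) n))

  integral-1+X : Integral (S.1# S.+ S.X)
  integral-1+X = divisible-+ integral-1 integral-X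

  integral-pow-nat : ∀ m → Integral (S.pow (m · 1#))
  integral-pow-nat m = divisible-resp (S.sym (S.pow-nat m)) (integral-^ m integral-1+X)

  integral-pow--1 : Integral (S.pow (- 1#))
  integral-pow--1 = divisible-resp (S.cancel-*ˡ {S.1# S.+ S.X} (S.≈1-cancel S.1+X-0)
    (S.trans (S.*-inverse S.1+X-0) (S.sym S.1+X*pow-1))) (integral-inverse integral-1+X)

  integral-w₊ : Integral S.w₊
  integral-w₊ = divisible-+ integral-X (divisible-* integral-X integral-X)

  integral-w₋ : Integral S.w₋
  integral-w₋ = divisible-- (divisible-* integral-pow--1 integral-pow--1) integral-pow--1

  integral-t : ∀ {w} → Integral w → Integral (S.t w)
  integral-t h = divisible-* h (integral-inverse (integral-^ 3 (divisible-+ integral-1 (integral-· 16 h))))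

  t-0 : ∀ {w} → w 0 ≈ 0# → S.t w 0 ≈ 0#
  t-0 {w} w0 = E.trans (S.coeff-*-0 w _) (E.trans (*-congʳ w0) (zeroˡ _))

  rescale : (ℕ → Carrier) → ℕ → Carrier
  rescale a k = a k * S.1/16 ^ k

  subst-rescale : ∀ a t → S.subst a (S.const S.1/16 S.* t) S.≈ S.subst (rescale a) t
  subst-rescale a t = S.⟪ (λ n → E.trans (S.coeff-subst a _ n) (E.trans (∑-cong′ (suc n) λ k →
      E.trans (*-congˡ (E.trans (at (scale-^ k) n) (S.coeff-const-* _ _ n))) (E.sym (*-assoc _ _ _))) (E.sym (S.coeff-subst (rescale a) t n)))) ⟫
    where
    open S using (at)
    scale-^ : ∀ k → (S.const S.1/16 S.* t) S.^ k S.≈ S.const (S.1/16 ^ k) S.* t S.^ k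
    scale-^ zero    = S.sym (S.trans (S.*-identityʳ _) S.const-1)
    scale-^ (suc k) = S.trans (S.*-congˡ (scale-^ k)) (S.trans
      (S.solve 4 (λ x t y s → (x :* t) :* (y :* s) := (x :* y) :* (t :* s)) S.refl _ t _ _)
      (S.*-congʳ (S.sym (S.const-* _ _))))

  t₊-1 : S.t S.w₊ 1 ≈ 1#
  t₊-1 = E.trans (S.at (S.solve 2 (λ x i → (x :+ x :* x) :* i := x :* ((:1 :+ x) :* i)) S.refl S.X _) 1)
    (E.trans (S.X-coeff _ 0) (E.trans (S.coeff-*-0 _ _) (E.trans (*-cong S.1+X-0 inv0) (*-identityˡ 1#))))
    where
    inv0 : S.inverse ((S.1# S.+ 16 S.· S.w₊) S.^ 3) 0 ≈ 1#
    inv0 = E.trans (E.sym (*-identityˡ _)) (E.trans (*-congʳ (E.sym (S.denominator-0 {S.w₊} S.w₊-0)))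
      (E.trans (E.sym (S.coeff-*-0 _ _)) (E.trans (S.at (S.*-inverse (S.denominator-0 {S.w₊} S.w₊-0)) 0) S.coeff-1-0)))

  decays-* : ∀ {δ f g} → 0ℚ ℚ.< δ → Decays δ f → Integral g → Decays δ (g S.* f)
  decays-* {f = f} {g} 0<δ hf hg = decays-transform {_} 0<δ {f} hf {λ k n → g (n ∸ k)} (λ k n → hg (n ∸ k))
    (λ n → E.trans (S.at (S.*-comm g f) n) (S.coeff-* f g n))

  decays-neg : ∀ {δ f} → Decays δ f → Decays δ (S.- f)
  decays-neg {f = f} hf N with hf N
  ... | k , h = k , λ n k≤n → ≼-resp (E.sym (S.coeff-neg f n)) (≼-neg (h n k≤n))

  finite-case : ∀ {z ε m n β φ} → z ≈ m · 1# + ε → InPiece n β → (∀ k → v (ε - k · 1#) ≡ [ weights β k ]) →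
                Decays (radius n β) φ → φ 0 ≈ 0# → ¬ φ 1 ≈ 0# →
                S.subst φ (S.t S.w₊) S.* S.pow z S.≈ S.- S.subst φ (S.t S.w₋) → ⊥
  finite-case {z} {ε} {m} {n} {β} {φ} z≈ piece vε φ-decays φ0 φ1 eq =
      lacunary-product {radius n β} {A′} {S.- A₋} {S.pow ε} (minimum {radius n β} {A′} A′-decays 1 A′1≉0) A′-decays A₋-decays (lacunary-binomial {n} {β} {ε} piece vε) product
    where
    0<δ = 0<radius n piece
    A₊ = S.subst φ (S.t S.w₊)
    A₋ = S.subst φ (S.t S.w₋)
    A′ = S.pow (m · 1#) S.* A₊
    A-decays : ∀ w → Integral w → Decays (radius n β) (S.subst φ (S.t w))
    A-decays w hw = decays-transform {radius n β} 0<δ {φ} φ-decays {λ k n → (S.t w S.^ k) n} (λ k n → integral-^ k (integral-t hw) n) (S.coeff-subst φ (S.t w))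
    A₋-decays : Decays (radius n β) (S.- A₋)
    A₋-decays = decays-neg {radius n β} {A₋} (A-decays S.w₋ integral-w₋)
    A′-decays : Decays (radius n β) A′
    A′-decays = decays-* {radius n β} {A₊} {S.pow (m · 1#)} 0<δ (A-decays S.w₊ integral-w₊) (integral-pow-nat m)
    A₊0 : A₊ S.≈[ 1 ] S.0#
    A₊0 = S.mod-1 (E.trans (S.subst-coeff-0 (t-0 {S.w₊} S.w₊-0) φ) φ0)
    A₊1 : A₊ 1 ≈ φ 1
    A₊1 = E.trans (S.coeff-subst φ (S.t S.w₊) 1) (E.trans ∑-cons (E.trans (+-congʳ (E.trans (*-congʳ φ0) (zeroˡ _)))
      (E.trans (+-identityˡ _) (E.trans ∑-cons (E.trans (+-congˡ ∑-nil) (E.trans (+-identityʳ _)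
        (E.trans (*-congˡ (E.trans (S.at (S.*-identityʳ (S.t S.w₊)) 1) t₊-1)) (*-identityʳ _))))))))
    A′1≉0 : ¬ A′ 1 ≈ 0#
    A′1≉0 h = φ1 (E.trans (E.sym A₊1) (E.trans (E.sym (*-identityˡ _)) (E.trans (*-congʳ (E.sym (S.binomial-0 (m · 1#))))
      (E.trans (E.sym (S.coeff-*-leading _ A₊ 1 A₊0)) h))))
    product : A′ S.* S.pow ε S.≈ S.- A₋
    product = S.trans (S.solve 3 (λ a b d → (a :* b) :* d := b :* (a :* d)) S.refl (S.pow (m · 1#)) A₊ (S.pow ε))
      (S.trans (S.*-congˡ (S.trans (S.pow-+ _ _) (S.pow-cong (E.sym z≈)))) eq)

  -- ∈ℤ₂ with natural numbers in place of integers
  Ẑ : Carrier → Set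
  Ẑ x = ∀ K → ∃[ n ] ι K ≼ x - n · 1#

  0≼ι : ∀ {K x} → ι K ≼ x → 0ℚ ≼ x
  0≼ι {K} = ≼-weaken (0≤ι K)

  Ẑ-integral : ∀ {x} → Ẑ x → 0ℚ ≼ x
  Ẑ-integral {x} h with h 0
  ... | n , e = ≼-resp (solve 2 (λ x n → (x :- n) :+ n := x) E.refl x (n · 1#)) (≼-+ (0≼ι e) (0≼nat n))

  Ẑ-resp : ∀ {x y} → x ≈ y → Ẑ x → Ẑ y
  Ẑ-resp e h K with h K
  ... | n , a = n , ≼-resp (+-congʳ e) a

  Ẑ-nat : ∀ n → Ẑ (n · 1#)
  Ẑ-nat n K = n , ≼-0 (-‿inverseʳ _)

  Ẑ-+ : ∀ {x y} → Ẑ x → Ẑ y → Ẑ (x + y)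
  Ẑ-+ {x} {y} hx hy K with hx K | hy K
  ... | m , a | n , b = m ℕ.+ n , ≼-resp (E.trans (solve 4 (λ x m y n → (x :- m) :+ (y :- n) := (x :+ y) :- (m :+ n)) E.refl x (m · 1#) y (n · 1#))
    (+-congˡ (-‿cong (E.sym (×-homo-+ 1# m n))))) (≼-+ a b)

  Ẑ-* : ∀ {x y} → Ẑ x → Ẑ y → Ẑ (x * y)
  Ẑ-* {x} {y} hx hy K with hx K | hy K
  ... | m , a | n , b = m ℕ.* n , ≼-resp (E.trans (solve 4 (λ x m y n → (x :- m) :* y :+ m :* (y :- n) := x :* y :- m :* n) E.refl x (m · 1#) y (n · 1#))
    (+-congˡ (-‿cong (E.sym (×1-homo-* m n))))) (≼-+ (≼-*ʳ a (Ẑ-integral hy)) (≼-*ˡ (0≼nat m) b))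

  Ẑ--1 : Ẑ (- 1#)
  Ẑ--1 K = 2 ℕ.^ K ∸ 1 , ≼-resp eq (≼-neg (≼-val (2^-val K) ℚ.≤-refl))
    where
    eq : - ((2 ℕ.^ K) · 1#) ≈ - 1# - (2 ℕ.^ K ∸ 1) · 1#
    eq = E.trans (-‿cong (E.reflexive (cong (_· 1#) (≡.sym (ℕ.m+[n∸m]≡n (ℕ.m^n>0 2 K))))))
      (solve 1 (λ n → :- (:1 :+ n) := :- :1 :- n) E.refl _)

  Ẑ-neg : ∀ {x} → Ẑ x → Ẑ (- x)
  Ẑ-neg h = Ẑ-resp (-1*x≈-x _) (Ẑ-* Ẑ--1 h)

  binomial-integral : ∀ {y} → Ẑ y → ∀ k → 0ℚ ≼ binomial y k
  binomial-integral {y} hy k with v-! k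
  ... | q , vk with ≤ι q
  ...   | K , q≤K with hy K
  ...     | n , a = ≼-⁻¹ vk (≡.subst (_≼ falling y k) (≡.sym (ℚ.+-identityˡ q)) q≼)
    where
    0≼y-i : ∀ {x} → 0ℚ ≼ x → ∀ i → 0ℚ ≼ x - i · 1#
    0≼y-i h i = ≼-- h (0≼nat i)
    falling-integral : ∀ {x} → 0ℚ ≼ x → ∀ k → 0ℚ ≼ falling x k
    falling-integral h zero    = 0≼1
    falling-integral h (suc k) = 0≼-* (falling-integral h k) (0≼y-i h k)
    approximated : ∀ k → ι K ≼ falling y k - falling (n · 1#) k
    approximated zero    = ≼-0 (-‿inverseʳ _)
    approximated (suc k) = ≼-resp (solve 5 (λ f g y m k → (f :- g) :* (y :- k) :+ g :* (y :- m) := f :* (y :- k) :- g :* (m :- k)) E.refl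
        (falling y k) (falling (n · 1#) k) y (n · 1#) (k · 1#))
      (≼-+ (≼-*ʳ (approximated k) (0≼y-i (Ẑ-integral hy) k)) (≼-*ˡ (falling-integral (0≼nat n) k) a))
    q≼ : q ≼ falling y k
    q≼ = ≼-resp (solve 2 (λ f g → (f :- g) :+ g := f) E.refl (falling y k) (falling (n · 1#) k))
      (≼-+ (≼-weaken q≤K (approximated k)) (≼-resp (S.binomial-! (n · 1#) k) (≼-*ʳ (≼-val vk ℚ.≤-refl) (integral-pow-nat n k))))

  integral-pow : ∀ {y} → Ẑ y → Integral (S.pow y)
  integral-pow = binomial-integral

  Small : Series → Set
  Small f = ∀ n → 1ℚ ≺ f n

  small-resp : ∀ {f g} → f S.≈ g → Small f → Small g
  small-resp e h n = ≺-resp (at e n) (h n)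

  small-* : ∀ {f g} → Small f → Integral g → Small (f S.* g)
  small-* {f} {g} hf hg n = ≺-resp (E.sym (S.coeff-* f g n)) (≺-∑ (suc n) λ i _ → ≺-*ʳ (hf i) (hg (n ∸ i)))

  small-+ : ∀ {f g} → Small f → Small g → Small (f S.+ g)
  small-+ {f} {g} hf hg n = ≺-resp (E.sym (S.coeff-+ f g n)) (≺-+ (hf n) (hg n))

  1<ι4 : 1ℚ ℚ.< ι 4
  1<ι4 = ≡.subst (ℚ._< ι 4) (≡.trans (ι-suc 0) (≡.trans (cong (1ℚ ℚ.+_) ι-0) (ℚ.+-identityʳ 1ℚ))) (ι-mono-< (s≤s (s≤s z≤n)))

  t-close : ∀ {w} → Integral w → w 0 ≈ 0# → Divisible (ι 4) (S.t w S.- w)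
  t-close {w} hw w0 = divisible-resp eq (divisible-* (λ n → ≼-resp (E.sym (S.coeff-· 16 g n)) (≼-resp (E.sym (·≈· 16 (g n))) (≼-*ʳ (≼-val (2^-val 4) ℚ.≤-refl) (hg n))))
      (divisible-* hw (integral-inverse (integral-^ 3 (divisible-+ integral-1 (integral-· 16 hw))))))
    where
    g = S.- (3 S.· w S.+ 48 S.· (w S.* w) S.+ 256 S.· (w S.* w S.* w))
    hg : Integral g
    hg = divisible-neg (divisible-+ (divisible-+ (integral-· 3 hw) (integral-· 48 (divisible-* hw hw))) (integral-· 256 (divisible-* (divisible-* hw hw) hw)))
    d = (S.1# S.+ 16 S.· w) S.^ 3
    I = S.inverse d
    eq : 16 S.· g S.* (w S.* I) S.≈ S.t w S.- w
    eq = S.trans (S.*-congʳ (S.solve 1 (λ w → 16 :× (:- (3 :× w :+ 48 :× (w :* w) :+ 256 :× (w :* w :* w))) := :1 :- (:1 :+ 16 :× w) :^ 3) S.refl w))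
      (S.trans (S.solve 3 (λ d w i → (:1 :- d) :* (w :* i) := w :* i :- w :* (d :* i)) S.refl d w I)
        (S.+-congˡ (S.-‿cong (S.trans (S.*-congˡ (S.*-inverse (S.denominator-0 {w} w0))) (S.*-identityʳ w)))))

  ^-close : ∀ {q f g} → Integral f → Integral g → Divisible q (f S.- g) → ∀ k → Divisible q (f S.^ k S.- g S.^ k)
  ^-close hf hg h zero    = divisible-resp (S.sym (S.-‿inverseʳ S.1#)) integral-0
  ^-close {f = f} {g} hf hg h (suc k) = divisible-resp
    (S.solve 4 (λ f g p q → (f :- g) :* p :+ (p :- q) :* g := f :* p :- g :* q) S.refl f g (f S.^ k) (g S.^ k))
    (divisible-+ (divisible-* h (integral-^ k hf)) (divisible-* (^-close hf hg h k) hg))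

  polynomial : ℕ → (ℕ → Carrier) → Series → Series
  polynomial M φ w = S.∑ M λ k → S.const (φ k) S.* w S.^ k

  ∑-split : ∀ m {n f} → ∑ (m ℕ.+ n) f ≈ ∑ m f + ∑ n (λ i → f (m ℕ.+ i))
  ∑-split zero    = E.trans (E.sym (+-identityˡ _)) (+-congʳ (E.sym ∑-nil))
  ∑-split (suc m) = E.trans ∑-cons (E.trans (+-congˡ (∑-split m)) (E.trans (E.sym (+-assoc _ _ _)) (+-congʳ (E.sym ∑-cons))))

  -- Modulo v > 1, the form is a polynomial in w = u² - u.
  subst-t-small : ∀ M {φ w} → (∀ k → 0ℚ ≼ φ k) → (∀ k → M ℕ.≤ k → 1ℚ ≺ φ k) → Integral w → w 0 ≈ 0# →
                  Small (S.subst φ (S.t w) S.- polynomial M φ w)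
  subst-t-small M {φ} {w} hφ φ-tail hw w0 n = ≺-resp (E.sym eq) (≺-+
      (≺-∑ M λ k _ → ≺-*ˡ (hφ k) (≼⇒≺ 1<ι4 (≼-resp (S.coeff-- _ _ n) (^-close (integral-t hw) hw (t-close hw w0) k n))))
      (≺-∑ (suc n) λ i _ → ≺-*ʳ (φ-tail (M ℕ.+ i) (ℕ.m≤m+n M i)) (integral-^ (M ℕ.+ i) (integral-t hw) n)))
    where
    τ : ℕ → Carrier
    τ k = (S.t w S.^ k) n
    eq : (S.subst φ (S.t w) S.- polynomial M φ w) n ≈ ∑ M (λ k → φ k * (τ k - (w S.^ k) n)) + ∑ (suc n) (λ i → φ (M ℕ.+ i) * τ (M ℕ.+ i))
    eq = E.trans (S.coeff-- _ _ n) (E.trans (+-cong (E.trans (S.coeff-subst φ (S.t w) n) (E.trans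
        (E.sym (∑-truncate (ℕ.m≤n+m (suc n) M) λ k n<k → E.trans (*-congˡ (E.trans (S.at[_] (S.^-order k (t-0 {w} w0)) n n<k) (S.coeff-0 n))) (zeroʳ _))) (∑-split M)))
        (-‿cong (E.trans (S.coeff-∑ M _ n) (∑-cong′ M λ k → S.coeff-const-* _ _ n))))
      (E.trans (solve 3 (λ a b c → a :+ b :- c := (a :- c) :+ b) E.refl _ _ _)
        (+-congʳ (E.trans (E.sym (∑-distrib-- M)) (∑-cong′ M λ k → solve 3 (λ f a b → f :* a :- f :* b := f :* (a :- b)) E.refl _ _ _)))))

  evaluate : Series → ℕ → Series → Series
  evaluate f B u = S.∑ B λ n → S.const (f n) S.* u S.^ n

  Degree< : ℕ → Series → Set ℓ
  Degree< B f = ∀ n → B ℕ.≤ n → f n ≈ 0#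

  evaluate-cong : ∀ {f g} B {u} → f S.≈ g → evaluate f B u S.≈ evaluate g B u
  evaluate-cong B e = S.∑-cong′ B λ n → S.*-congʳ (S.const-cong (at e n))

  evaluate-extend : ∀ {f B B′ u} → B ℕ.≤ B′ → Degree< B f → evaluate f B′ u S.≈ evaluate f B u
  evaluate-extend B≤ h = S.∑-truncate B≤ λ n B≤n → S.trans (S.*-congʳ (S.trans (S.const-cong (h n B≤n)) S.const-0)) (S.zeroˡ _)

  evaluate-X : ∀ {f B u} → evaluate (S.X S.* f) (suc B) u S.≈ u S.* evaluate f B u
  evaluate-X {f} {B} {u} = S.trans S.∑-cons (S.trans (S.+-cong (S.trans (S.*-congʳ (S.trans (S.const-cong (E.trans (S.coeff-*-0 S.X f) (zeroˡ _))) S.const-0)) (S.zeroˡ _))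
      (S.∑-cong′ B λ n → S.trans (S.*-congʳ (S.const-cong (S.X-coeff f n))) (S.solve 3 (λ a u p → a :* (u :* p) := u :* (a :* p)) S.refl _ u _)))
    (S.trans (S.+-identityˡ _) (S.sym (S.*-distribˡ-∑ B u))))

  evaluate-- : ∀ {f g B u} → evaluate (f S.- g) B u S.≈ evaluate f B u S.- evaluate g B u
  evaluate-- {f} {g} {B} = S.trans (S.∑-cong′ B λ n → S.trans (S.*-congʳ (S.trans (S.const-cong (S.coeff-- f g n)) (S.trans (S.const-+ _ _) (S.+-congˡ (S.const-neg _)))))
    (S.solve 3 (λ a b p → (a :- b) :* p := a :* p :- b :* p) S.refl _ _ _)) (S.∑-distrib-- B)

  degree-X : ∀ {B f} → Degree< B f → Degree< (suc B) (S.X S.* f)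
  degree-X {f = f} h (suc n) (s≤s B≤n) = E.trans (S.X-coeff f n) (h n B≤n)

  π : ℕ → Series
  π k = (S.X S.* S.X S.- S.X) S.^ k

  private
    π-suc : ∀ k → π (suc k) S.≈ S.X S.* (S.X S.* π k) S.- S.X S.* π k
    π-suc k = S.solve 2 (λ x p → (x :* x :- x) :* p := x :* (x :* p) :- x :* p) S.refl S.X (π k)

  degree-π : ∀ k → Degree< (suc (2 ℕ.* k)) (π k)
  degree-π zero    (suc n) _ = S.coeff-1-suc n
  degree-π (suc k) n h = E.trans (at (π-suc k) n) (E.trans (S.coeff-- _ _ n) (E.trans (+-cong (degree-X (degree-X (degree-π k)) n h′)
    (-‿cong (degree-X (degree-π k) n (ℕ.≤-trans (ℕ.n≤1+n _) h′)))) (-‿inverseʳ 0#)))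
    where
    h′ : suc (suc (suc (2 ℕ.* k))) ℕ.≤ n
    h′ = ≡.subst (λ m → suc m ℕ.≤ n) (ℕ.*-suc 2 k) h

  evaluate-π : ∀ k u → evaluate (π k) (suc (2 ℕ.* k)) u S.≈ (u S.* u S.- u) S.^ k
  evaluate-π zero    u = S.trans S.∑-cons (S.trans (S.+-cong (S.trans (S.*-identityʳ _) (S.trans (S.const-cong S.coeff-1-0) S.const-1)) S.∑-nil) (S.+-identityʳ _))
  evaluate-π (suc k) u = S.trans (S.reflexive (cong (λ m → evaluate (π (suc k)) (suc m) u) (ℕ.*-suc 2 k))) (S.trans (evaluate-cong _ (π-suc k))
    (S.trans (evaluate-- {S.X S.* (S.X S.* π k)} {S.X S.* π k}) (S.trans (S.+-cong (S.trans (evaluate-X {S.X S.* π k}) (S.*-congˡ (evaluate-X {π k})))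
      (S.-‿cong (S.trans (evaluate-extend (ℕ.n≤1+n _) (degree-X (degree-π k))) (evaluate-X {π k}))))
    (S.trans (S.+-cong (S.*-congˡ (S.*-congˡ (evaluate-π k u))) (S.-‿cong (S.*-congˡ (evaluate-π k u))))
      (S.solve 2 (λ u p → u :* (u :* p) :- u :* p := (u :* u :- u) :* p) S.refl u _)))))

  -- the coefficients of P(u² - u) as a polynomial in u
  coefficients : ℕ → (ℕ → Carrier) → Series
  coefficients M φ = S.∑ M λ k → S.const (φ k) S.* π k

  degree-coefficients : ∀ M φ → Degree< (2 ℕ.* M) (coefficients M φ)
  degree-coefficients M φ n h = E.trans (S.coeff-∑ M _ n) (∑-zero M λ k k<M → E.trans (S.coeff-const-* _ _ n) (E.trans (*-congˡ (degree-π k n (ℕ.≤-trans (2k<2M k<M) h))) (zeroʳ _)))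
    where
    2k<2M : ∀ {k} → k ℕ.< M → suc (2 ℕ.* k) ℕ.≤ 2 ℕ.* M
    2k<2M k<M = ℕ.≤-trans (ℕ.n≤1+n _) (ℕ.≤-trans (ℕ.≤-reflexive (≡.sym (ℕ.*-suc 2 _))) (ℕ.*-monoʳ-≤ 2 k<M))

  evaluate-coefficients : ∀ M φ B u → 2 ℕ.* M ℕ.≤ B → evaluate (coefficients M φ) B u S.≈ polynomial M φ (u S.* u S.- u)
  evaluate-coefficients M φ B u 2M≤B = S.trans (S.∑-cong′ B λ n → S.trans (S.*-congʳ (expand n)) (S.*-distribʳ-∑ M _))
    (S.trans (S.∑-swap B M) (S.∑-cong M λ k k<M → S.trans (S.∑-cong′ B λ n → S.solve 3 (λ a b p → a :* b :* p := a :* (b :* p)) S.refl _ _ _)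
      (S.trans (S.sym (S.*-distribˡ-∑ B _)) (S.*-congˡ (S.trans (evaluate-extend (ℕ.≤-trans (2k<2M k<M) 2M≤B) (degree-π k)) (evaluate-π k u))))))
    where
    2k<2M : ∀ {k} → k ℕ.< M → suc (2 ℕ.* k) ℕ.≤ 2 ℕ.* M
    2k<2M k<M = ℕ.≤-trans (ℕ.n≤1+n _) (ℕ.≤-trans (ℕ.≤-reflexive (≡.sym (ℕ.*-suc 2 _))) (ℕ.*-monoʳ-≤ 2 k<M))
    const-∑ : ∀ m {f} → S.const (∑ m f) S.≈ S.∑ m (S.const ∘ f)
    const-∑ zero    = S.trans (S.const-cong ∑-nil) (S.trans S.const-0 (S.sym S.∑-nil))
    const-∑ (suc m) = S.trans (S.const-cong ∑-cons) (S.trans (S.const-+ _ _) (S.trans (S.+-congˡ (const-∑ m)) (S.sym S.∑-cons)))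
    expand : ∀ n → S.const (coefficients M φ n) S.≈ S.∑ M (λ k → S.const (φ k) S.* S.const (π k n))
    expand n = S.trans (S.const-cong (E.trans (S.coeff-∑ M _ n) (∑-cong′ M λ k → S.coeff-const-* _ _ n))) (S.trans (const-∑ M) (S.∑-cong′ M λ k → S.const-* _ _))

  integral-coefficients : ∀ M {φ} → (∀ k → 0ℚ ≼ φ k) → Integral (coefficients M φ)
  integral-coefficients M hφ n = ≼-resp (E.sym (S.coeff-∑ M _ n)) (≼-∑ M λ k _ → ≼-resp (E.sym (S.coeff-const-* _ _ n))
    (0≼-* (hφ k) (integral-^ k (divisible-- (divisible-* integral-X integral-X) integral-X) n)))

  pow-^ : ∀ a n → S.pow a S.^ n S.≈ S.pow (n · a)
  pow-^ a zero    = S.sym S.pow-0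
  pow-^ a (suc n) = S.trans (S.*-congˡ (pow-^ a n)) (S.pow-+ a _)

  -- Integrating a polynomial test function y ↦ binomial y j against the two
  -- sides of the functional equation, seen as atomic measures on ℤ₂: u^n is the
  -- point mass at n.
  test : ∀ {z φ} M B → Ẑ z → (∀ k → 0ℚ ≼ φ k) → (∀ k → M ℕ.≤ k → 1ℚ ≺ φ k) → 2 ℕ.* M ℕ.≤ B →
         S.subst φ (S.t S.w₊) S.* S.pow z S.≈ S.- S.subst φ (S.t S.w₋) → ∀ N j →
         let α = coefficients M φ in
         1ℚ ≺ ∑ B (λ n → α n * binomial (n · 1# + z + N · 1# - 1#) j) + ∑ B (λ n → α n * binomial (N · 1# - n · 1# - 1#) j)
  test {z} {φ} M B hz hφ φ-tail 2M≤B eq N j = ≺-resp (E.trans (S.coeff-+ _ _ j) (+-cong (coeff _) (coeff _))) (small-resp total small j)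
    where
    α = coefficients M φ
    ν′ = N · 1# - 1#
    P₊ = polynomial M φ S.w₊
    P₋ = polynomial M φ S.w₋
    A₊ = S.subst φ (S.t S.w₊)
    A₋ = S.subst φ (S.t S.w₋)
    shift = S.pow ν′
    small : Small ((P₊ S.* S.pow z S.+ P₋) S.* shift)
    small = small-resp (S.*-congʳ (S.trans (S.solve 5 (λ a p a′ p′ z → :- ((a :- p) :* z) :+ (:- (a′ :- p′)) := p :* z :+ p′ :- (a :* z :+ a′)) S.refl A₊ P₊ A₋ P₋ (S.pow z))
        (S.trans (S.+-congˡ (S.-‿cong (S.trans (S.+-congʳ eq) (S.-‿inverseˡ _)))) (S.trans (S.+-congˡ (S.solve 0 (:- # 0 := # 0) S.refl)) (S.+-identityʳ _)))))
      (small-* (small-+ (small-neg (small-* (subst-t-small M hφ φ-tail integral-w₊ S.w₊-0) (integral-pow hz)))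
                        (small-neg (subst-t-small M hφ φ-tail integral-w₋ S.w₋-0))) (integral-pow (Ẑ-+ (Ẑ-nat N) Ẑ--1)))
      where
      small-neg : ∀ {f} → Small f → Small (S.- f)
      small-neg {f} h n = ≺-resp (E.sym (S.coeff-neg f n)) (≺-neg (h n))
    V = S.pow (- 1#)
    expand : ∀ a (y : ℕ → Carrier) b → (∀ n → n · a + b ≈ y n) → evaluate α B (S.pow a) S.* S.pow b S.≈ S.∑ B λ n → S.const (α n) S.* S.pow (y n)
    expand a y b h = S.trans (S.*-distribʳ-∑ B _) (S.∑-cong′ B λ n → S.trans (S.*-assoc _ _ _) (S.*-congˡ (S.trans (S.*-congʳ (pow-^ a n))
      (S.trans (S.pow-+ _ _) (S.pow-cong (h n))))))
    y₊ y₋ : ℕ → Carrier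
    y₊ n = n · 1# + z + N · 1# - 1#
    y₋ n = N · 1# - n · 1# - 1#
    total : (P₊ S.* S.pow z S.+ P₋) S.* shift S.≈ S.∑ B (λ n → S.const (α n) S.* S.pow (y₊ n)) S.+ S.∑ B (λ n → S.const (α n) S.* S.pow (y₋ n))
    total = S.trans (S.solve 4 (λ p z p′ s → (p :* z :+ p′) :* s := p :* (z :* s) :+ p′ :* s) S.refl P₊ (S.pow z) P₋ shift)
      (S.+-cong (S.trans (S.*-cong P₊≈ (S.pow-+ z ν′)) (expand 1# y₊ (z + ν′) λ n → solve 3 (λ n z N → n :+ (z :+ (N :- :1)) := n :+ z :+ N :- :1) E.refl _ z _))
                (S.trans (S.*-congʳ P₋≈) (expand (- 1#) y₋ ν′ λ n → E.trans (+-congʳ (·-neg n)) (solve 2 (λ n N → :- n :+ (N :- :1) := N :- n :- :1) E.refl _ _))))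
      where
      P₊≈ : P₊ S.≈ evaluate α B (S.pow 1#)
      P₊≈ = S.sym (S.trans (evaluate-coefficients M φ B (S.pow 1#) 2M≤B) (S.∑-cong′ M λ k → S.*-congˡ (S.^-cong k (S.trans (S.+-cong (S.*-cong S.pow-1 S.pow-1) (S.-‿cong S.pow-1))
        (S.solve 1 (λ x → (:1 :+ x) :* (:1 :+ x) :- (:1 :+ x) := x :+ x :* x) S.refl S.X)))))
      P₋≈ : P₋ S.≈ evaluate α B V
      P₋≈ = S.sym (evaluate-coefficients M φ B V 2M≤B)
      ·-neg : ∀ n → n · (- 1#) ≈ - (n · 1#)
      ·-neg n = E.trans (·≈· n (- 1#)) (solve 1 (λ n → n :* (:- :1) := :- n) E.refl (n · 1#))
    coeff : (y : ℕ → Carrier) → S.∑ B (λ n → S.const (α n) S.* S.pow (y n)) j ≈ ∑ B (λ n → α n * binomial (y n) j)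
    coeff y = E.trans (S.coeff-∑ B _ j) (∑-cong′ B λ n → S.coeff-const-* _ _ j)

  falling-suc : ∀ y k → falling y (suc k) ≈ y * falling (y - 1#) k
  falling-suc y zero    = solve 1 (λ y → :1 :* (y :- # 0) := y :* :1) E.refl y
  falling-suc y (suc k) = E.trans (*-congʳ (falling-suc y k)) (solve 3 (λ y f k → y :* f :* (y :- (:1 :+ k)) := y :* (f :* (y :- :1 :- k))) E.refl y _ (k · 1#))

  binomial-absorb : ∀ y k → suc k · 1# * binomial y (suc k) ≈ y * binomial (y - 1#) k
  binomial-absorb y k = S.cancel-field (S.!≉0 k) (E.trans (solve 3 (λ f n b → f :* (n :* b) := (n :* f) :* b) E.refl _ _ _)
    (E.trans (*-congʳ (E.sym (×1-homo-* (suc k) (k !)))) (E.trans (S.binomial-! y (suc k)) (E.trans (falling-suc y k)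
      (E.trans (*-congˡ (E.sym (S.binomial-! (y - 1#) k))) (solve 3 (λ y f b → y :* (f :* b) := f :* (y :* b)) E.refl _ _ _))))))

  -- The test function y ↦ binomial(y - 1, 2^K - 1) is the indicator of
  -- 2^K ℤ₂ up to sign and up to a small error, except near the boundary.
  indicator-zero : ∀ K {y q} → Ẑ y → v y ≡ [ q ] → ι K ℚ.- q ≼ binomial (y - 1#) (2 ℕ.^ K ∸ 1)
  indicator-zero K {y} {q} hy vy = ≼-resp eq (≼-⁻¹ vy (≡.subst (_≼ y * b) (≡.sym (solveℚ 2 (λ k q → (k :- q) :+ q := k) same (ι K) q))
      (≼-resp (absorb (2 ℕ.^ K) (ℕ.m^n>0 2 K)) (≼-*ʳ (≼-val (2^-val K) ℚ.≤-refl) (binomial-integral hy (2 ℕ.^ K))))))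
    where
    b = binomial (y - 1#) (2 ℕ.^ K ∸ 1)
    absorb : ∀ L → 0 ℕ.< L → L · 1# * binomial y L ≈ y * binomial (y - 1#) (L ∸ 1)
    absorb (suc k) _ = binomial-absorb y k
    eq : y * b * y ⁻¹ ≈ b
    eq = E.trans (solve 3 (λ y b i → y :* b :* i := b :* (y :* i)) E.refl y b (y ⁻¹)) (E.trans (*-congˡ (⁻¹-inv y (nonzero vy))) (*-identityʳ b))

  ι-1 : ι 1 ≡ 1ℚ
  ι-1 = ≡.trans (ι-suc 0) (≡.trans (cong (1ℚ ℚ.+_) ι-0) (ℚ.+-identityʳ 1ℚ))

  ι2 : ι 2 ≡ 2ℚ
  ι2 = ≡.trans (ι-suc 1) (cong (1ℚ ℚ.+_) ι-1)

  1<2 : 1ℚ ℚ.< 2ℚ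
  1<2 = <-by 1ℚ 0<1 refl

  indicator-one : ∀ K {y} → 0 ℕ.< K → ι (suc K) ≼ y → 1ℚ ≺ binomial (y - 1#) (2 ℕ.^ K ∸ 1) + 1#
  indicator-one (suc K′) {y} _ hy = ≼⇒≺ 1<2
      (≼-resp (+-congˡ (E.trans (-‿cong (sign-odd (2 ℕ.^ K′) (ℕ.m^n>0 2 K′))) (-‿involutive 1#))) (approx (2 ℕ.^ K ∸ 1) (ℕ.∸-monoʳ-< {o = 0} (s≤s z≤n) (ℕ.m^n>0 2 K))))
    where
    K = suc K′
    sign : ℕ → Carrier
    sign zero    = 1#
    sign (suc n) = - sign n
    sign-odd : ∀ L → 0 ℕ.< L → sign (2 ℕ.* L ∸ 1) ≈ - 1#
    sign-odd (suc zero)      _ = E.refl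
    sign-odd (suc L@(suc _)) _ = E.trans (E.reflexive (cong (λ n → sign (n ∸ 1)) (ℕ.*-suc 2 L)))
      (E.trans (E.reflexive (cong (λ n → - sign n) (≡.sym (ℕ.m+[n∸m]≡n {1} {2 ℕ.* L} (s≤s z≤n))))) (E.trans (-‿involutive _) (sign-odd L (s≤s z≤n))))
    0≼sign : ∀ n → 0ℚ ≼ sign n
    0≼sign zero    = 0≼1
    0≼sign (suc n) = ≼-neg (0≼sign n)
    approx : ∀ k → k ℕ.< 2 ℕ.^ K → 2ℚ ≼ binomial (y - 1#) k - sign k
    approx zero    _ = ≼-0 (E.trans (+-congʳ (S.binomial-0 (y - 1#))) (-‿inverseʳ 1#))
    approx (suc k) 1+k< with v-nat K (suc k) (s≤s z≤n) 1+k<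
    ... | i , vi , i<K = ≼-resp eq (≼-+ (≼-*ʳ y/k (integral-b k (ℕ.<-trans (ℕ.n<1+n k) 1+k<))) (≼-neg (approx k (ℕ.<-trans (ℕ.n<1+n k) 1+k<))))
      where
      integral-b : ∀ k → k ℕ.< 2 ℕ.^ K → 0ℚ ≼ binomial (y - 1#) k
      integral-b k k< = ≼-resp (solve 2 (λ b s → (b :- s) :+ s := b) E.refl _ (sign k)) (≼-+ (≼-weaken (ℚ.<⇒≤ (ℚ.<-trans 0<1 1<2)) (approx k k<)) (0≼sign k))
      y/k : 2ℚ ≼ y * (suc k · 1#) ⁻¹
      y/k = ≼-⁻¹ vi (≼-weaken (ℚ.≤-trans (ℚ.≤-reflexive (≡.trans (cong (ℚ._+ ι i) (≡.sym ι2)) (≡.sym (ι-+ 2 i)))) (ι-mono (s≤s i<K))) hy)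
      i⁻¹ = (suc k · 1#) ⁻¹
      eq : y * i⁻¹ * binomial (y - 1#) k + - (binomial (y - 1#) k - sign k) ≈ binomial (y - 1#) (suc k) - sign (suc k)
      eq = E.trans (solve 4 (λ y i b s → y :* i :* b :+ (:- (b :- s)) := ((y :* i) :- :1) :* b :+ s) E.refl y i⁻¹ (binomial (y - 1#) k) (sign k))
        (+-cong (S.cancel-field (nat≉0 k) (E.trans (solve 4 (λ n y i b → n :* ((y :* i :- :1) :* b) := (y :* (n :* i) :- n) :* b) E.refl (suc k · 1#) y i⁻¹ _)
            (E.trans (*-congʳ (E.trans (+-congʳ (E.trans (*-congˡ (⁻¹-inv _ (nat≉0 k))) (*-identityʳ y))) (solve 2 (λ y k → y :- (:1 :+ k) := y :- :1 :- k) E.refl y (k · 1#)))) (E.sym (S.binomial-suc (y - 1#) k)))))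
          (E.sym (-‿involutive (sign k))))

  -- The functional equation for infinite β

  unit : ∀ {x} → 0ℚ ≼ x → ¬ 0ℚ ≺ x → v x ≡ [ 0ℚ ]
  unit {x} h k with finite {x} (λ z → k (≺-0 z))
  ... | q , e = ≡.trans e (cong [_] (ℚ.≤-antisym (≮⇒≥ λ 0<q → k (≺-val e 0<q)) (val-≼ e h)))

  unit-not-small : ∀ {x} → v x ≡ [ 0ℚ ] → ¬ 0ℚ ≺ x
  unit-not-small e h = ℚ.<-irrefl refl (val-≺ e h)

  unit-⁻¹ : ∀ {x} → v x ≡ [ 0ℚ ] → v (x ⁻¹) ≡ [ 0ℚ ]
  unit-⁻¹ = v-⁻¹

  unit-factor : ∀ {x y} → 0ℚ ≼ x → 0ℚ ≼ y → v (x * y) ≡ [ 0ℚ ] → v x ≡ [ 0ℚ ]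
  unit-factor hx hy e = unit hx λ h → unit-not-small e (≺-*ʳ h hy)

  small-or-not : ∀ D (f : ℕ → Carrier) → (∀ n → n ℕ.< D → 0ℚ ≺ f n) ⊎ (∃[ n ] n ℕ.< D × ¬ 0ℚ ≺ f n)
  small-or-not zero    f = inj₁ λ _ ()
  small-or-not (suc D) f with 0ℚ ≺? f 0 | small-or-not D (f ∘ suc)
  ... | no h  | _ = inj₂ (0 , s≤s z≤n , h)
  ... | yes _ | inj₂ (n , n<D , h) = inj₂ (suc n , s≤s n<D , h)
  ... | yes h | inj₁ k = inj₁ λ { zero _ → h ; (suc n) (s≤s n<D) → k n n<D }

  last-unit : ∀ M (f : ℕ → Carrier) k → k ℕ.< M → ¬ 0ℚ ≺ f k →
              ∃[ d ] d ℕ.< M × ¬ 0ℚ ≺ f d × (∀ i → d ℕ.< i → i ℕ.< M → 0ℚ ≺ f i)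
  last-unit (suc M) f k k<M h with 0ℚ ≺? f M
  ... | no h′ = M , ℕ.≤-refl , h′ , λ i M<i i≤M → contradiction (ℕ.≤-trans M<i (ℕ.≤-pred i≤M)) (ℕ.<-irrefl refl)
  ... | yes h′ with ℕ.m<1+n⇒m<n∨m≡n k<M
  ...   | inj₂ refl = contradiction h′ h
  ...   | inj₁ k<M′ with last-unit M f k k<M′ h
  ...     | d , d<M , hd , above = d , ℕ.≤-trans d<M (ℕ.n≤1+n M) , hd , λ i d<i i<1+M → aux i d<i (ℕ.m<1+n⇒m<n∨m≡n i<1+M)
    where
    aux : ∀ i → d ℕ.< i → i ℕ.< M ⊎ i ≡ M → 0ℚ ≺ f i
    aux i d<i (inj₁ i<M)  = above i d<i i<M
    aux i d<i (inj₂ refl) = h′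

  root : ∀ n (cs : ℕ → Carrier) → ∃[ x ] x ^ suc n + ∑ (suc n) (λ k → cs k * x ^ k) ≈ 0#
  root n cs with algebraicallyClosed n (λ i → cs (toℕ i))
  ... | x , e = x , E.trans (+-congˡ (E.sym (E.reflexive (sum≡∑ (suc n) λ k → cs k * x ^ k)))) e

  root-integral : ∀ m {cs : ℕ → Carrier} {x} → (∀ k → k ℕ.< m → 0ℚ ≼ cs k) → x ^ m + ∑ m (λ k → cs k * x ^ k) ≈ 0# → 0ℚ ≼ x
  root-integral m {cs} {x} hcs e with 0ℚ ≼? x
  ... | yes h = h
  ... | no h with finite {x} (λ z → h (≼-0 z))
  ...   | q , vx = contradiction (val-≺ (v-^ vx m) (≺-resp eq (≺-neg (≺-∑ m dominated)))) (ℚ.<-irrefl refl)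
    where
    q<0 : q ℚ.< 0ℚ
    q<0 = ℚ.≰⇒> λ 0≤q → h (≼-val vx 0≤q)
    eq : - ∑ m (λ k → cs k * x ^ k) ≈ x ^ m
    eq = E.trans (solve 2 (λ a b → :- b := a :- (a :+ b)) E.refl (x ^ m) _) (E.trans (+-congˡ (E.trans (-‿cong e) -0#≈0#)) (+-identityʳ _))
    dominated : ∀ k → k ℕ.< m → ι m ℚ.* q ≺ cs k * x ^ k
    dominated k k<m = ≺-*ˡ (hcs k k<m) (≺-val (v-^ vx k) (<-by ((ι m ℚ.- ι k) ℚ.* (0ℚ ℚ.- q)) (0<* (0<- (ι-mono-< k<m)) (0<- q<0))
      (solveℚ 3 (λ m k q → m :* q :+ (m :- k) :* (# 0 :- q) := k :* q) same (ι m) (ι k) q)))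

  value : ℕ → (ℕ → Carrier) → Carrier → Carrier
  value M φ w = ∑ M λ k → φ k * w ^ k

  ^-cong : ∀ {x y} k → x ≈ y → x ^ k ≈ y ^ k
  ^-cong zero    h = E.refl
  ^-cong (suc k) h = *-cong h (^-cong k h)

  good-point : ∀ M {φ} → (∀ k → 0ℚ ≼ φ k) → φ 0 ≈ 0# → ∀ N₀ → N₀ ℕ.< M → v (φ N₀) ≡ [ 0ℚ ] →
               ∃[ u ] v u ≡ [ 0ℚ ] × v (1# - u) ≡ [ 0ℚ ] × v (value M φ (u * u - u)) ≡ [ 0ℚ ]
  good-point M {φ} hφ φ0 N₀ N₀<M vN₀ with last-unit M φ N₀ N₀<M (unit-not-small vN₀)
  ... | zero , _ , h , _ = contradiction (≺-0 φ0) h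
  ... | d@(suc n) , d<M , hd , above = u , vu , v1-u , vvalue
    where
    vd : v (φ d) ≡ [ 0ℚ ]
    vd = unit (hφ d) hd
    i = φ d ⁻¹
    vi = v-⁻¹ vd
    cs : ℕ → Carrier
    cs zero    = - i
    cs (suc k) = φ (suc k) * i
    hcs : ∀ k → 0ℚ ≼ cs k
    hcs zero    = ≼-neg (≼-val vi (ℚ.≤-reflexive refl))
    hcs (suc k) = 0≼-* (hφ (suc k)) (≼-val vi (ℚ.≤-reflexive refl))
    w = proj₁ (root n cs)
    w-root = proj₂ (root n cs)
    hw : 0ℚ ≼ w
    hw = root-integral d {cs} (λ k _ → hcs k) w-root
    rest = ∑ n (λ k → φ (suc k) * w ^ suc k)
    head≈1 : ∑ (suc d) (λ k → φ k * w ^ k) ≈ 1#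
    head≈1 = E.trans (∑-snoc d) (E.trans (+-congʳ (E.trans ∑-cons (E.trans (+-congʳ (E.trans (*-congʳ φ0) (zeroˡ _))) (+-identityˡ _))))
      (E.trans (solve 2 (λ r p → r :+ p := (p :+ r :- :1) :+ :1) E.refl rest (φ d * w ^ d)) (E.trans (+-congʳ (E.trans (E.sym expand) (E.trans (*-congˡ w-root) (zeroʳ _)))) (+-identityˡ 1#))))
      where
      φdi : φ d * i ≈ 1#
      φdi = ⁻¹-inv (φ d) (nonzero vd)
      expand : φ d * (w ^ d + ∑ d (λ k → cs k * w ^ k)) ≈ φ d * w ^ d + rest - 1#
      expand = E.trans (*-congˡ (+-congˡ ∑-cons)) (E.trans (solve 4 (λ f p i s → f :* (p :+ ((:- i) :* :1 :+ s)) := f :* p :+ f :* s :- f :* i) E.refl (φ d) (w ^ d) i _)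
        (+-cong (+-congˡ (E.trans (*-distribˡ-∑ n _) (∑-cong′ n λ k → E.trans (solve 4 (λ f a i p → f :* (a :* i :* p) := (f :* i) :* (a :* p)) E.refl (φ d) (φ (suc k)) i _)
          (E.trans (*-congʳ φdi) (*-identityˡ _))))) (-‿cong φdi)))
    P-w-1 : 0ℚ ≺ value M φ w - 1#
    P-w-1 = ≺-resp (E.trans (solve 2 (λ a b → b := (a :+ b) :- a) E.refl _ _) (+-cong (E.trans (E.sym (∑-split (suc d))) (E.reflexive (cong (λ m → value m φ w) (ℕ.m+[n∸m]≡n d<M)))) (-‿cong head≈1)))
      (≺-∑ (M ∸ suc d) λ k k< → ≺-*ʳ (above (suc d ℕ.+ k) (s≤s (ℕ.m≤m+n d k)) (≡.subst (suc d ℕ.+ k ℕ.<_) (ℕ.m+[n∸m]≡n d<M) (ℕ.+-monoʳ-< (suc d) k<))) (0≼^ (suc d ℕ.+ k) hw))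
    v-value : v (value M φ w) ≡ [ 0ℚ ]
    v-value = ≡.trans (v-cong (solve 1 (λ a → a := :1 :+ (a :- :1)) E.refl _)) (v-dominant v-1 P-w-1)
    vw : v w ≡ [ 0ℚ ]
    vw = unit hw λ 0≺w → unit-not-small v-value (≺-∑ M λ { zero _ → ≺-0 (E.trans (*-congʳ φ0) (zeroˡ _)) ; (suc k) _ → ≺-*ˡ (hφ (suc k)) (≺-*ʳ 0≺w (0≼^ k hw)) })
    cs₂ : ℕ → Carrier
    cs₂ zero    = - w
    cs₂ (suc _) = - 1#
    u = proj₁ (root 1 cs₂)
    u-root = proj₂ (root 1 cs₂)
    hu : 0ℚ ≼ u
    hu = root-integral 2 {cs₂} (λ { zero _ → ≼-neg hw ; (suc _) _ → ≼-neg 0≼1 }) u-root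
    u²-u : u * u - u ≈ w
    u²-u = E.trans (solve 2 (λ u w → u :* u :- u := (u :* (u :* :1) :+ ((:- w) :* :1 :+ ((:- :1) :* (u :* :1) :+ # 0))) :+ w) E.refl u w)
      (E.trans (+-congʳ (E.trans (+-congˡ (E.sym (E.trans ∑-cons (+-congˡ (E.trans ∑-cons (+-congˡ ∑-nil)))))) u-root)) (+-identityˡ w))
    h1-u : 0ℚ ≼ 1# - u
    h1-u = ≼-- 0≼1 hu
    v-product : v (u * (1# - u)) ≡ [ 0ℚ ]
    v-product = ≡.trans (v-cong (E.trans (solve 1 (λ u → u :* (:1 :- u) := :- (u :* u :- u)) E.refl u) (-‿cong u²-u))) (≡.trans (v-neg w) vw)
    vu = unit-factor hu h1-u v-product
    v1-u = unit-factor h1-u hu (≡.trans (v-cong (*-comm _ _)) v-product)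
    vvalue : v (value M φ (u * u - u)) ≡ [ 0ℚ ]
    vvalue = ≡.trans (v-cong (∑-cong′ M λ k → *-congˡ (^-cong k u²-u))) v-value

  evaluate-constant : ∀ M φ x → value (2 ℕ.* M) (coefficients M φ) x ≈ value M φ (x * x - x)
  evaluate-constant M φ x = E.trans (E.sym (lhs (2 ℕ.* M) (coefficients M φ) (S.const x) E.refl)) (E.trans (at (evaluate-coefficients M φ (2 ℕ.* M) (S.const x) ℕ.≤-refl) 0)
      (lhs M φ (S.const x S.* S.const x S.- S.const x) (E.trans (S.coeff-- _ _ 0) (+-congʳ (S.coeff-*-0 _ _)))))
    where
    ^-coeff-0 : ∀ f k {y} → f 0 ≈ y → (f S.^ k) 0 ≈ y ^ k
    ^-coeff-0 f zero    h = S.coeff-1-0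
    ^-coeff-0 f (suc k) h = E.trans (S.coeff-*-0 f _) (*-cong h (^-coeff-0 f k h))
    lhs : ∀ B α (f : Series) {y} → f 0 ≈ y → (S.∑ B (λ n → S.const (α n) S.* f S.^ n)) 0 ≈ value B α y
    lhs B α f h = E.trans (S.coeff-∑ B _ 0) (∑-cong′ B λ n → E.trans (S.coeff-const-* _ _ 0) (*-congˡ (^-coeff-0 f n h)))

  ∑-complete : ∀ {q} m {f a} N → N ℕ.< m → (∀ i → i ℕ.< m → ¬ i ≡ N → q ≺ f i) → q ≺ f N + a → q ≺ ∑ m f + a
  ∑-complete (suc m) {f} {a} zero    _ h k = ≺-resp (E.trans (solve 3 (λ x a s → (x :+ a) :+ s := (x :+ s) :+ a) E.refl (f 0) a _) (+-congʳ (E.sym ∑-cons)))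
    (≺-+ k (≺-∑ m λ i i<m → h (suc i) (s≤s i<m) λ ()))
  ∑-complete (suc m) {f} {a} (suc N) (s≤s N<m) h k = ≺-resp (E.trans (E.sym (+-assoc _ _ _)) (+-congʳ (E.sym ∑-cons)))
    (≺-+ (h 0 (s≤s z≤n) λ ()) (∑-complete m N N<m (λ i i<m i≢N → h (suc i) (s≤s i<m) λ { refl → i≢N refl }) k))

  v-difference : ∀ K a b → a ℕ.< 2 ℕ.^ K → b ℕ.< 2 ℕ.^ K → ¬ a ≡ b → ∃[ j ] v (a · 1# - b · 1#) ≡ [ ι j ] × j ℕ.< K
  v-difference K a b a< b< a≢b with ℕ.<-cmp a b
  ... | tri≈ _ a≡b _ = contradiction a≡b a≢b
  ... | tri< a<b _ _ with v-nat K (b ∸ a) (ℕ.m<n⇒0<n∸m a<b) (ℕ.≤-<-trans (ℕ.m∸n≤m b a) b<)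
  ...   | j , e , j<K = j , ≡.trans (v-cong (nat-- a<b)) (≡.trans (v-neg _) e) , j<K
    where
    nat-- : ∀ {a b} → a ℕ.< b → a · 1# - b · 1# ≈ - ((b ∸ a) · 1#)
    nat-- {a} {b} a<b = E.trans (+-congˡ (-‿cong (E.trans (E.reflexive (cong (_· 1#) (≡.sym (ℕ.m+[n∸m]≡n (ℕ.<⇒≤ a<b))))) (×-homo-+ 1# a (b ∸ a)))))
      (solve 2 (λ a d → a :- (a :+ d) := :- d) E.refl _ _)
  v-difference K a b a< b< a≢b | tri> _ _ b<a with v-nat K (a ∸ b) (ℕ.m<n⇒0<n∸m b<a) (ℕ.≤-<-trans (ℕ.m∸n≤m a b) a<)
  ...   | j , e , j<K = j , ≡.trans (v-cong nat--) e , j<K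
    where
    nat-- : a · 1# - b · 1# ≈ (a ∸ b) · 1#
    nat-- = E.trans (+-congʳ (E.trans (E.reflexive (cong (_· 1#) (≡.sym (ℕ.m+[n∸m]≡n (ℕ.<⇒≤ b<a))))) (×-homo-+ 1# b (a ∸ b))))
      (solve 2 (λ b d → (b :+ d) :- b := d) E.refl _ _)

  -- The congruences of `test` at j = 2^K - 1, where the binomial coefficients
  -- are indicator functions.
  record Congruences : Set (c ⊔ ℓ) where
    field
      z       : Carrier
      D       : ℕ
      α       : ℕ → Carrier
      ẑ       : Ẑ z
      z-even  : 1ℚ ≼ z
      0≼α     : ∀ n → 0ℚ ≼ α n
      degree  : ∀ n → D ℕ.≤ n → α n ≈ 0#
      sums    : ∀ N j → 1ℚ ≺ ∑ D (λ n → α n * binomial (n · 1# + z + N · 1# - 1#) j) + ∑ D (λ n → α n * binomial (N · 1# - n · 1# - 1#) j)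
      N       : ℕ
      N<D     : N ℕ.< D
      unit-αN : ¬ 0ℚ ≺ α N

  module Palindrome (I : Congruences) where
    open Congruences I

    private
      K₁ K L : ℕ
      K₁ = D ℕ.+ D
      K  = suc K₁
      L  = suc K

      y₊ y₋ : ℕ → ℕ → Carrier
      y₊ N n = n · 1# + z + N · 1#
      y₋ N n = N · 1# - n · 1#

      Ẑ-y₊ : ∀ N n → Ẑ (y₊ N n)
      Ẑ-y₊ N n = Ẑ-+ (Ẑ-+ (Ẑ-nat n) ẑ) (Ẑ-nat N)

      Ẑ-y₋ : ∀ N n → Ẑ (y₋ N n)
      Ẑ-y₋ N n = Ẑ-+ (Ẑ-nat N) (Ẑ-neg (Ẑ-nat n))

      χ : ℕ → Carrier → Carrier
      χ L y = binomial (y - 1#) (2 ℕ.^ L ∸ 1)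

      χ-0 : ∀ L {y} → 0 ℕ.< L → y ≈ 0# → 1ℚ ≺ χ L y + 1#
      χ-0 L 0<L h = indicator-one L 0<L (≼-0 h)

      <K₁ : ∀ {n} → n ℕ.≤ K₁ → n ℕ.< 2 ℕ.^ K₁
      <K₁ h = ℕ.≤-<-trans h (n<2^n K₁)

      D≤K₁ : ∀ {n} → n ℕ.< D → n ℕ.≤ K₁
      D≤K₁ h = ℕ.≤-trans (ℕ.<⇒≤ h) (ℕ.m≤m+n D D)

      2D≤K₁ : ∀ {m n} → m ℕ.< D → n ℕ.< D → m ℕ.+ n ℕ.≤ K₁
      2D≤K₁ h k = ℕ.+-mono-≤ (ℕ.<⇒≤ h) (ℕ.<⇒≤ k)

      χ-small : ∀ L {y j} → K ℕ.≤ L → Ẑ y → v y ≡ [ ι j ] → j ℕ.< K₁ → 1ℚ ≺ χ L y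
      χ-small L {y} {j} K≤L hy vy j<K₁ = ≼⇒≺ 1<2 (≼-weaken bound (indicator-zero L hy vy))
        where
        bound : 2ℚ ℚ.≤ ι L ℚ.- ι j
        bound = ≡.subst (ℚ._≤ ι L ℚ.- ι j) (≡.trans (cong (ℚ._- ι j) (ι-+ 2 j)) (≡.trans (solveℚ 2 (λ t j → (t :+ j) :- j := t) same (ι 2) (ι j)) ι2))
          (ℚ.+-monoˡ-≤ (ℚ.- ι j) (ι-mono (ℕ.≤-trans (s≤s j<K₁) K≤L)))

      χ-y₋ : ∀ L {N n} → K ℕ.≤ L → N ℕ.< D → n ℕ.< D → ¬ n ≡ N → 1ℚ ≺ χ L (y₋ N n)
      χ-y₋ L {N} {n} K≤L N<D n<D n≢N = from (v-difference K₁ N n (<K₁ (D≤K₁ N<D)) (<K₁ (D≤K₁ n<D)) (n≢N ∘ ≡.sym))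
        where
        from : ∃[ j ] v (y₋ N n) ≡ [ ι j ] × j ℕ.< K₁ → 1ℚ ≺ χ L (y₋ N n)
        from (j , vj , j<K₁) = χ-small L K≤L (Ẑ-y₋ N n) vj j<K₁

      -- Otherwise α N would be small.
      partner : ∃[ n ] n ℕ.< D × ¬ 0ℚ ≺ α n * χ L (y₊ N n)
      partner = Sum.[ (λ h → contradiction (0≺αN h) unit-αN) , id ]′ (small-or-not D (λ n → α n * χ L (y₊ N n)))
        where
        0≺αN : (∀ n → n ℕ.< D → 0ℚ ≺ α n * χ L (y₊ N n)) → 0ℚ ≺ α N
        0≺αN h = ≺-resp (solve 2 (λ a x → a :* (x :+ :1) :- a :* x := a) E.refl (α N) (χ L (y₋ N N))) (≺-- (≺-*ˡ (0≼α N) (≺-weaken 0≤1 (χ-0 L (s≤s z≤n) (-‿inverseʳ _)))) termN)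
          where
          second : 0ℚ ≺ ∑ D (λ n → α n * χ L (y₋ N n))
          second = ≺-resp (solve 2 (λ a b → (a :+ b) :- a := b) E.refl (∑ D (λ n → α n * χ L (y₊ N n))) _) (≺-- (≺-weaken 0≤1 (sums N (2 ℕ.^ L ∸ 1))) (≺-∑ D h))
          termN : 0ℚ ≺ α N * χ L (y₋ N N)
          termN = ∑-isolate D N N<D (λ n n<D n≢N → ≺-*ˡ (0≼α n) (≺-weaken 0≤1 (χ-y₋ L (ℕ.n≤1+n K) N<D n<D n≢N))) second

      n₁ = proj₁ partner
      n₁<D = proj₁ (proj₂ partner)
      c₁ : ℕ
      c₁ = N ℕ.+ n₁

      z+c : ι L ≼ z + c₁ · 1#
      z+c = ≼-resp (E.trans (solve 3 (λ n z N → n :+ z :+ N := z :+ (N :+ n)) E.refl (n₁ · 1#) z (N · 1#)) (+-congˡ (E.sym (×-homo-+ 1# N n₁))))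
          (decide (ι L ≼? y₊ N n₁) id (λ h → ⊥-elim (far h (finite {y₊ N n₁} (h ∘ ≼-0)))))
        where
        far : ¬ ι L ≼ y₊ N n₁ → ¬ (∃[ q ] v (y₊ N n₁) ≡ [ q ])
        far h (q , vq) = proj₂ (proj₂ partner) (≺-*ˡ (0≼α n₁) (≼⇒≺ (0<- (ℚ.≰⇒> λ L≤q → h (≼-val vq L≤q))) (indicator-zero L (Ẑ-y₊ N n₁) vq)))

      c-even : ∃[ m ] c₁ ≡ 2 ℕ.* m
      c-even = Sum.[ id , (λ { (m , c≡) → contradiction (ℚ.<-≤-trans 0<1 (val-≼ (≡.trans (cong (λ n → v (n · 1#)) c≡) (v-odd m)) 1≼c)) (ℚ.<-irrefl refl) }) ]′ (halve c₁)
        where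
        1≼c : 1ℚ ≼ c₁ · 1#
        1≼c = ≼-resp (solve 2 (λ z c → (z :+ c) :- z := c) E.refl z (c₁ · 1#)) (≼-- (≼-weaken (ℚ.≤-trans (ℚ.≤-reflexive (≡.sym ι-1)) (ι-mono (s≤s z≤n))) z+c) z-even)

      c≤K₁ : c₁ ℕ.≤ K₁
      c≤K₁ = 2D≤K₁ N<D n₁<D

      χ-y₊-off : ∀ {i n} → i ℕ.< D → n ℕ.< D → ¬ n ℕ.+ i ≡ c₁ → 1ℚ ≺ χ K (y₊ i n)
      χ-y₊-off {i} {n} i<D n<D ≢c = from (v-difference K₁ (n ℕ.+ i) c₁ (<K₁ (2D≤K₁ n<D i<D)) (<K₁ c≤K₁) ≢c)
        where
        from : ∃[ j ] v ((n ℕ.+ i) · 1# - c₁ · 1#) ≡ [ ι j ] × j ℕ.< K₁ → 1ℚ ≺ χ K (y₊ i n)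
        from (j , vj , j<K₁) = χ-small K ℕ.≤-refl (Ẑ-y₊ i n) (≡.trans (v-cong shift) (v-dominant vj (≼⇒≺ (ι-mono-< (ℕ.<-trans j<K₁ (ℕ.≤-trans (ℕ.n<1+n K₁) (ℕ.n≤1+n K)))) z+c))) j<K₁
          where
          shift : y₊ i n ≈ (n ℕ.+ i) · 1# - c₁ · 1# + (z + c₁ · 1#)
          shift = E.trans (solve 4 (λ n z i c → n :+ z :+ i := ((n :+ i) :- c) :+ (z :+ c)) E.refl (n · 1#) z (i · 1#) (c₁ · 1#)) (+-congʳ (+-congʳ (E.sym (×-homo-+ 1# n i))))

      χ-y₊-on : ∀ {i n} → n ℕ.+ i ≡ c₁ → 1ℚ ≺ χ K (y₊ i n) + 1#
      χ-y₊-on {i} {n} n+i≡c = indicator-one K (s≤s z≤n) (≼-resp (E.trans (+-congˡ (E.trans (E.reflexive (cong (_· 1#) (≡.sym n+i≡c))) (×-homo-+ 1# n i)))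
        (solve 3 (λ n z i → z :+ (n :+ i) := n :+ z :+ i) E.refl (n · 1#) z (i · 1#))) z+c)

      Σ₊ Σ₋ : ℕ → Carrier
      Σ₊ i = ∑ D (λ n → α n * χ K (y₊ i n))
      Σ₋ i = ∑ D (λ n → α n * χ K (y₋ i n))

      signed : ∀ n {x} → 1ℚ ≺ x + 1# → 1ℚ ≺ α n * x + α n
      signed n {x} h = ≺-resp (solve 2 (λ a x → a :* (x :+ :1) := a :* x :+ a) E.refl (α n) x) (≺-*ˡ (0≼α n) h)

      Σ₋-value : ∀ i → i ℕ.< D → 1ℚ ≺ Σ₋ i + α i
      Σ₋-value i i<D = ∑-complete D i i<D (λ n n<D n≢i → ≺-*ˡ (0≼α n) (χ-y₋ K ℕ.≤-refl i<D n<D n≢i)) (signed i (χ-0 K (s≤s z≤n) (-‿inverseʳ _)))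

      Σ₊-value : ∀ i → i ℕ.< D → 1ℚ ≺ Σ₊ i - α i
      Σ₊-value i i<D = ≺-resp (solve 3 (λ a b x → (a :+ b) :- (b :+ x) := a :- x) E.refl (Σ₊ i) (Σ₋ i) (α i)) (≺-- (sums i (2 ℕ.^ K ∸ 1)) (Σ₋-value i i<D))

      Σ₊-pair : ∀ i j → i ℕ.< D → j ℕ.< D → j ℕ.+ i ≡ c₁ → 1ℚ ≺ Σ₊ i + α j
      Σ₊-pair i j i<D j<D j+i≡c = ∑-complete D j j<D
        (λ n n<D n≢j → ≺-*ˡ (0≼α n) (χ-y₊-off i<D n<D λ n+i≡c → n≢j (ℕ.+-cancelʳ-≡ i n j (≡.trans n+i≡c (≡.sym j+i≡c))))) (signed j (χ-y₊-on {i} {j} j+i≡c))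

      Σ₊-small : ∀ i → i ℕ.< D → (∀ n → n ℕ.< D → ¬ n ℕ.+ i ≡ c₁) → 1ℚ ≺ Σ₊ i
      Σ₊-small i i<D h = ≺-∑ D λ n n<D → ≺-*ˡ (0≼α n) (χ-y₊-off i<D n<D (h n n<D))

      isolated : ∀ i → i ℕ.< D → (∀ n → n ℕ.< D → ¬ n ℕ.+ i ≡ c₁) → 1ℚ ≺ α i
      isolated i i<D h = ≺-resp (solve 2 (λ s a → s :- (s :- a) := a) E.refl (Σ₊ i) (α i)) (≺-- (Σ₊-small i i<D h) (Σ₊-value i i<D))

      pair-inside : ∀ i j → i ℕ.< D → j ℕ.+ i ≡ c₁ → 1ℚ ≺ α i + α j
      pair-inside i j i<D j+i≡c = decide (j ℕ.<? D)
        (λ j<D → ≺-resp (solve 3 (λ s a b → (s :+ b) :- (s :- a) := a :+ b) E.refl (Σ₊ i) (α i) (α j)) (≺-- (Σ₊-pair i j i<D j<D j+i≡c) (Σ₊-value i i<D)))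
        (λ j≮D → ≺-resp (E.trans (E.sym (+-identityʳ (α i))) (+-congˡ (E.sym (degree j (ℕ.≮⇒≥ j≮D)))))
          (isolated i i<D λ n n<D n+i≡c → j≮D (≡.subst (ℕ._< D) (ℕ.+-cancelʳ-≡ i n j (≡.trans n+i≡c (≡.sym j+i≡c))) n<D)))

    half : ℕ
    half = proj₁ c-even

    centre : ℕ
    centre = c₁

    centre-even : centre ≡ 2 ℕ.* half
    centre-even = proj₂ c-even

    pair : ∀ i → i ℕ.≤ centre → 1ℚ ≺ α i + α (centre ∸ i)
    pair i i≤c = decide (i ℕ.<? D) (λ i<D → pair-inside i (c₁ ∸ i) i<D (ℕ.m∸n+n≡m i≤c))
      λ i≮D → decide ((c₁ ∸ i) ℕ.<? D) (λ j<D → ≺-resp (+-comm _ _) (pair-inside (c₁ ∸ i) i j<D (ℕ.m+[n∸m]≡n i≤c)))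
        λ j≮D → ≺-0 (E.trans (+-cong (degree i (ℕ.≮⇒≥ i≮D)) (degree _ (ℕ.≮⇒≥ j≮D))) (+-identityˡ 0#))

    beyond : ∀ i → centre ℕ.< i → 1ℚ ≺ α i
    beyond i c<i = decide (i ℕ.<? D)
      (λ i<D → isolated i i<D λ n _ n+i≡c → ℕ.<-irrefl refl (ℕ.<-≤-trans c<i (ℕ.≤-trans (ℕ.m≤n+m i n) (ℕ.≤-reflexive n+i≡c))))
      (λ i≮D → ≺-0 (degree i (ℕ.≮⇒≥ i≮D)))

  record SymmetricPalindrome : Set (c ⊔ ℓ) where
    field
      D       : ℕ
      α       : ℕ → Carrier
      degree  : ∀ n → D ℕ.≤ n → α n ≈ 0#
      c₁ half : ℕ
      c-even  : c₁ ≡ 2 ℕ.* half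
      pair    : ∀ i → i ℕ.≤ c₁ → 1ℚ ≺ α i + α (c₁ ∸ i)
      beyond  : ∀ i → c₁ ℕ.< i → 1ℚ ≺ α i

    e : Carrier → Carrier
    e x = value D α x

    field
      e-symmetric : ∀ x → e (1# - x) ≈ e x

  module _ (I : SymmetricPalindrome) where
    open SymmetricPalindrome I

    private
      reciprocal : ∀ x y → 0ℚ ≼ x → 0ℚ ≼ y → x * y ≈ 1# → 1ℚ ≺ e x + x ^ c₁ * e y
      reciprocal x y hx hy xy≈1 = ≺-resp (solve 5 (λ a b p ex ey → (a :+ p :* b) :+ ((ex :- a) :+ p :* (ey :- b)) := ex :+ p :* ey) E.refl a b (x ^ c₁) (e x) (e y))
          (≺-+ main (≺-+ (truncated x hx) (≺-*ˡ (0≼^ c₁ hx) (truncated y hy))))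
        where
        a = value (suc c₁) α x
        b = value (suc c₁) α y
        truncated : ∀ x → 0ℚ ≼ x → 1ℚ ≺ e x - value (suc c₁) α x
        truncated x hx = ≺-resp (E.trans (solve 2 (λ s t → t := (s :+ t) :- s) E.refl (value (suc c₁) α x) _) (+-congʳ (E.trans (E.sym (∑-split (suc c₁)))
            (∑-truncate (ℕ.m≤n+m D (suc c₁)) λ n D≤n → E.trans (*-congʳ (degree n D≤n)) (zeroˡ _)))))
          (≺-∑ D λ k _ → ≺-*ʳ (beyond (suc c₁ ℕ.+ k) (ℕ.m≤m+n (suc c₁) k)) (0≼^ (suc c₁ ℕ.+ k) hx))
        cancel-power : ∀ n k → x ^ (n ℕ.+ k) * y ^ n ≈ x ^ k
        cancel-power zero    k = *-identityʳ _
        cancel-power (suc n) k = E.trans (solve 4 (λ x y p q → x :* p :* (y :* q) := (x :* y) :* (p :* q)) E.refl x y _ _) (E.trans (*-congʳ xy≈1) (E.trans (*-identityˡ _) (cancel-power n k)))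
        flipped : x ^ c₁ * b ≈ ∑ (suc c₁) (λ n → α (c₁ ∸ n) * x ^ n)
        flipped = E.trans (*-distribˡ-∑ (suc c₁) _) (E.trans (∑-cong (suc c₁) λ { n (s≤s n≤c) → E.trans (solve 3 (λ p a q → p :* (a :* q) := a :* (p :* q)) E.refl _ _ _)
            (*-congˡ (E.trans (*-congʳ (E.reflexive (cong (x ^_) (≡.sym (ℕ.m+[n∸m]≡n n≤c))))) (cancel-power n (c₁ ∸ n)))) })
          (E.trans (∑-reverse c₁) (∑-cong (suc c₁) λ { n (s≤s n≤c) → *-congˡ (E.reflexive (cong (x ^_) (ℕ.m∸[m∸n]≡n n≤c))) })))
        main : 1ℚ ≺ a + x ^ c₁ * b
        main = ≺-resp (E.trans (E.trans (∑-cong′ (suc c₁) λ n → distribʳ _ _ _) (∑-distrib-+ (suc c₁))) (+-congˡ (E.sym flipped)))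
          (≺-∑ (suc c₁) λ { n (s≤s n≤c) → ≺-*ʳ (pair n n≤c) (0≼^ n hx) })

      even-power : ∀ x → x * x ≈ 1# → x ^ c₁ ≈ 1#
      even-power x h = E.trans (E.reflexive (cong (x ^_) c-even)) (go half)
        where
        go : ∀ m → x ^ (2 ℕ.* m) ≈ 1#
        go zero    = E.refl
        go (suc m) = E.trans (E.reflexive (cong (x ^_) (ℕ.*-suc 2 m))) (E.trans (E.sym (*-assoc _ _ _)) (E.trans (*-cong h (go m)) (*-identityˡ 1#)))

      ^-* : ∀ x y n → (x * y) ^ n ≈ x ^ n * y ^ n
      ^-* x y zero    = E.sym (*-identityˡ 1#)
      ^-* x y (suc n) = E.trans (*-congˡ (^-* x y n)) (solve 4 (λ x y p q → x :* y :* (p :* q) := x :* p :* (y :* q)) E.refl x y _ _)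

    -- The substitutions u ↦ 1 - u and u ↦ 1/u generate S₃; going around the
    -- orbit of the element of order 3 gives e ≡ - e.
    orbit : ∀ u → v u ≡ [ 0ℚ ] → v (1# - u) ≡ [ 0ℚ ] → 1ℚ ≺ 2 · 1# * e u
    orbit u vu v1-u = 2e-small
      where
      hu : 0ℚ ≼ u
      hu = ≼-val vu ℚ.≤-refl
      s t x₁ x₂ : Carrier
      s = (1# - u) ⁻¹
      t = u ⁻¹
      x₁ = s
      x₂ = (u - 1#) * t
      s-eq : (1# - u) * s ≈ 1#
      s-eq = ⁻¹-inv _ (nonzero v1-u)
      t-eq : u * t ≈ 1#
      t-eq = ⁻¹-inv _ (nonzero vu)
      vs = unit-⁻¹ v1-u
      vt = unit-⁻¹ vu
      h1-u = ≼-val v1-u ℚ.≤-refl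
      hs : 0ℚ ≼ s
      hs = ≼-val vs (ℚ.≤-reflexive refl)
      ht : 0ℚ ≼ t
      ht = ≼-val vt (ℚ.≤-reflexive refl)
      1-x₁ : 1# - x₁ ≈ - (u * s)
      1-x₁ = E.trans (+-congʳ (E.sym s-eq)) (solve 2 (λ u s → (:1 :- u) :* s :- s := :- (u :* s)) E.refl u s)
      1-x₂ : 1# - x₂ ≈ t
      1-x₂ = E.trans (+-congʳ (E.sym t-eq)) (solve 2 (λ u t → u :* t :- (u :- :1) :* t := t) E.refl u t)
      inv₁ : (1# - x₁) * x₂ ≈ 1#
      inv₁ = E.trans (*-congʳ 1-x₁) (E.trans (solve 3 (λ u s t → (:- (u :* s)) :* ((u :- :1) :* t) := ((:1 :- u) :* s) :* (u :* t)) E.refl u s t) (E.trans (*-cong s-eq t-eq) (*-identityˡ 1#)))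
      inv₂ : (1# - x₂) * u ≈ 1#
      inv₂ = E.trans (*-congʳ 1-x₂) (E.trans (*-comm t u) t-eq)
      h1-x₁ : 0ℚ ≼ 1# - x₁
      h1-x₁ = ≼-- 0≼1 hs
      hx₂ : 0ℚ ≼ x₂
      hx₂ = 0≼-* (≼-- hu 0≼1) ht
      A = (1# - u) ^ c₁
      B = (1# - x₁) ^ c₁
      G = (1# - x₂) ^ c₁
      r₀ : 1ℚ ≺ e u + A * e x₁
      r₀ = ≺-resp (+-congʳ (e-symmetric u)) (reciprocal (1# - u) x₁ h1-u hs s-eq)
      r₁ : 1ℚ ≺ e x₁ + B * e x₂
      r₁ = ≺-resp (+-congʳ (e-symmetric x₁)) (reciprocal (1# - x₁) x₂ h1-x₁ hx₂ inv₁)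
      r₂ : 1ℚ ≺ e x₂ + G * e u
      r₂ = ≺-resp (+-congʳ (e-symmetric x₂)) (reciprocal (1# - x₂) u (≼-- 0≼1 hx₂) hu inv₂)
      ABG : A * B * G ≈ 1#
      ABG = E.trans (E.sym (E.trans (^-* _ _ c₁) (*-congʳ (^-* _ _ c₁)))) (even-power _ (E.trans (*-cong -1≈ -1≈) (solve 0 ((:- :1) :* (:- :1) := :1) E.refl)))
        where
        -1≈ : (1# - u) * (1# - x₁) * (1# - x₂) ≈ - 1#
        -1≈ = E.trans (*-cong (*-congˡ 1-x₁) 1-x₂) (E.trans (solve 3 (λ u s t → (:1 :- u) :* (:- (u :* s)) :* t := :- (((:1 :- u) :* s) :* (u :* t))) E.refl u s t)
          (-‿cong (E.trans (*-cong s-eq t-eq) (*-identityˡ 1#))))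
      2e-small : 1ℚ ≺ 2 · 1# * e u
      2e-small = ≺-resp (E.trans (solve 6 (λ a b g e₀ e₁ e₂ → ((e₀ :+ a :* e₁) :- a :* (e₁ :+ b :* e₂)) :+ a :* b :* (e₂ :+ g :* e₀) := e₀ :+ a :* b :* g :* e₀) E.refl A B G (e u) (e x₁) (e x₂))
          (E.trans (+-congˡ (*-congʳ ABG)) (solve 1 (λ e → e :+ :1 :* e := # 2 :* e) E.refl (e u))))
        (≺-+ (≺-- r₀ (≺-*ˡ hA r₁)) (≺-*ˡ (0≼-* hA (0≼^ c₁ h1-x₁)) r₂))
        where
        hA : 0ℚ ≼ A
        hA = 0≼^ c₁ h1-u

  infinite-case : ∀ {z φ} M → Ẑ z → 1ℚ ≼ z → (∀ k → 0ℚ ≼ φ k) → φ 0 ≈ 0# → (∀ k → M ℕ.≤ k → 1ℚ ≺ φ k) → ∀ N₀ → v (φ N₀) ≡ [ 0ℚ ] →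
                  S.subst φ (S.t S.w₊) S.* S.pow z S.≈ S.- S.subst φ (S.t S.w₋) → ⊥
  infinite-case {z} {φ} M hz z-even hφ φ0 φ-tail N₀ vN₀ eq = ℚ.<-irrefl refl (val-≺ (≡.trans (v-*-val v-2 ve) (cong [_] (ℚ.+-identityʳ 1ℚ))) (orbit symmetric u vu v1-u))
    where
    α : ℕ → Carrier
    α = coefficients M φ
    N₀<M : N₀ ℕ.< M
    N₀<M = decide (N₀ ℕ.<? M) id λ h → contradiction (≺-weaken 0≤1 (φ-tail N₀ (ℕ.≮⇒≥ h))) (unit-not-small vN₀)
    point = good-point M hφ φ0 N₀ N₀<M vN₀
    u = proj₁ point
    vu = proj₁ (proj₂ point)
    v1-u = proj₁ (proj₂ (proj₂ point))
    ve : v (value (2 ℕ.* M) α u) ≡ [ 0ℚ ]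
    ve = ≡.trans (v-cong (evaluate-constant M φ u)) (proj₂ (proj₂ (proj₂ point)))
    unit-coefficient : ∃[ N ] N ℕ.< 2 ℕ.* M × ¬ 0ℚ ≺ α N
    unit-coefficient = Sum.[ (λ h → contradiction (≺-∑ (2 ℕ.* M) λ n n<D → ≺-*ʳ (h n n<D) (0≼^ n (≼-val vu ℚ.≤-refl))) (unit-not-small ve)) , id ]′ (small-or-not (2 ℕ.* M) α)
    congruences : Congruences
    congruences = record
      { z = z ; D = 2 ℕ.* M ; α = α ; ẑ = hz ; z-even = z-even ; 0≼α = integral-coefficients M hφ ; degree = degree-coefficients M φ
      ; sums = test M (2 ℕ.* M) hz hφ φ-tail ℕ.≤-refl eq
      ; N = proj₁ unit-coefficient ; N<D = proj₁ (proj₂ unit-coefficient) ; unit-αN = proj₂ (proj₂ unit-coefficient) }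
    symmetric : SymmetricPalindrome
    symmetric = record
      { D = 2 ℕ.* M ; α = α ; degree = degree-coefficients M φ ; c₁ = centre ; half = half ; c-even = centre-even ; pair = pair ; beyond = beyond
      ; e-symmetric = λ x → E.trans (evaluate-constant M φ (1# - x)) (E.trans (∑-cong′ M λ k → *-congˡ (^-cong k
          (solve 1 (λ x → (:1 :- x) :* (:1 :- x) :- (:1 :- x) := x :* x :- x) E.refl x))) (E.sym (evaluate-constant M φ x))) }
      where open Palindrome congruences

  -- 2-adic integers

  Ẑ-closed : ∀ {x} → (∀ K → ∃[ y ] Ẑ y × ι K ≼ x - y) → Ẑ x
  Ẑ-closed {x} h K with h K
  ... | y , hy , x-y with hy K
  ...   | n , y-n = n , ≼-resp (solve 3 (λ x y n → (x :- y) :+ (y :- n) := x :- n) E.refl x y (n · 1#)) (≼-+ x-y y-n)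

  Ẑ⇒∈ℤ₂ : ∀ {x} → Ẑ x → ∈ℤ₂ x
  Ẑ⇒∈ℤ₂ h N with ≤ι N
  ... | K , N≤K with h K
  ...   | n , e = ℤ.+ n , ≼-weaken N≤K e

  ∈ℤ₂⇒Ẑ : ∀ {x} → ∈ℤ₂ x → Ẑ x
  ∈ℤ₂⇒Ẑ {x} h = Ẑ-closed λ K → fromℤ (proj₁ (h (ι K))) , integer (proj₁ (h (ι K))) , proj₂ (h (ι K))
    where
    integer : ∀ n → Ẑ (fromℤ n)
    integer (ℤ.+ n)    = Ẑ-nat n
    integer ℤ.-[1+ n ] = Ẑ-neg (Ẑ-nat (suc n))

  -- For x ≡ 1 mod 2, 1/x is the geometric series in 1 - x.
  odd-unit : ∀ {x} → Ẑ x → 1ℚ ≼ 1# - x → v x ≡ [ 0ℚ ] × Ẑ (x ⁻¹)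
  odd-unit {x} hx hd = vx , Ẑ-closed λ K → geometric K , Ẑ-geometric K , ≼-resp (remainder K) (≼-*ˡ (≼-val (v-⁻¹ vx) (ℚ.≤-reflexive refl)) (ι≼d^ K))
    where
    d = 1# - x
    vx : v x ≡ [ 0ℚ ]
    vx = ≡.trans (v-cong (solve 1 (λ x → x := :1 :- (:1 :- x)) E.refl x)) (v-dominant v-1 (≺-neg (≼⇒≺ 0<1 hd)))
    geometric : ℕ → Carrier
    geometric zero    = 0#
    geometric (suc K) = 1# + d * geometric K
    Ẑ-d : Ẑ d
    Ẑ-d = Ẑ-+ (Ẑ-resp (+-identityʳ 1#) (Ẑ-nat 1)) (Ẑ-neg hx)
    Ẑ-geometric : ∀ K → Ẑ (geometric K)
    Ẑ-geometric zero    = Ẑ-nat 0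
    Ẑ-geometric (suc K) = Ẑ-+ (Ẑ-resp (+-identityʳ 1#) (Ẑ-nat 1)) (Ẑ-* Ẑ-d (Ẑ-geometric K))
    ι≼d^ : ∀ K → ι K ≼ d ^ K
    ι≼d^ zero    = ≼-val v-1 (ℚ.≤-reflexive ι-0)
    ι≼d^ (suc K) = ≡.subst (_≼ d ^ suc K) (≡.sym (ι-suc K)) (≼-* hd (ι≼d^ K))
    x*i : x * x ⁻¹ ≈ 1#
    x*i = ⁻¹-inv x (nonzero vx)
    sum-geometric : ∀ K → x * geometric K ≈ 1# - d ^ K
    sum-geometric zero    = E.trans (zeroʳ x) (E.sym (-‿inverseʳ 1#))
    sum-geometric (suc K) = E.trans (solve 2 (λ x g → x :* (:1 :+ (:1 :- x) :* g) := x :+ (:1 :- x) :* (x :* g)) E.refl x (geometric K))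
      (E.trans (+-congˡ (*-congˡ (sum-geometric K))) (solve 2 (λ x p → x :+ (:1 :- x) :* (:1 :- p) := :1 :- (:1 :- x) :* p) E.refl x (d ^ K)))
    remainder : ∀ K → x ⁻¹ * d ^ K ≈ x ⁻¹ - geometric K
    remainder K = E.trans (solve 2 (λ i p → i :* p := i :- i :* (:1 :- p)) E.refl (x ⁻¹) (d ^ K)) (+-congˡ (-‿cong
      (E.trans (*-congˡ (E.sym (sum-geometric K))) (E.trans (solve 3 (λ i x g → i :* (x :* g) := (x :* i) :* g) E.refl (x ⁻¹) x (geometric K))
        (E.trans (*-congʳ x*i) (*-identityˡ _))))))

  even-or-unit : ∀ {x} → Ẑ x → 1ℚ ≼ x ⊎ ∈ℤ₂ˣ x
  even-or-unit {x} hx with hx 1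
  ... | n , e with halve n
  ...   | inj₁ (m , refl) = inj₁ (≼-resp (solve 2 (λ x n → (x :- n) :+ n := x) E.refl x ((2 ℕ.* m) · 1#))
      (≼-+ (≡.subst (_≼ x - (2 ℕ.* m) · 1#) ι-1 e) (≼-resp (E.sym (×1-homo-* 2 m)) (≼-*ʳ (≼-val v-2 ℚ.≤-refl) (0≼nat m)))))
  ...   | inj₂ (m , refl) = inj₂ (Ẑ⇒∈ℤ₂ hx , x ⁻¹ , Ẑ⇒∈ℤ₂ (proj₂ odd) , ⁻¹-inv x (nonzero (proj₁ odd)))
    where
    odd : v x ≡ [ 0ℚ ] × Ẑ (x ⁻¹)
    odd = odd-unit hx (≼-resp (solve 2 (λ x m → :- ((x :- (:1 :+ m)) :+ m) := :1 :- x) E.refl x ((2 ℕ.* m) · 1#))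
      (≼-neg (≼-+ (≡.subst (_≼ x - suc (2 ℕ.* m) · 1#) ι-1 e) (≼-resp (E.sym (×1-homo-* 2 m)) (≼-*ʳ (≼-val v-2 ℚ.≤-refl) (0≼nat m))))))

  Ẑ-odd⁻¹ : ∀ m → Ẑ ((suc (2 ℕ.* m) · 1#) ⁻¹)
  Ẑ-odd⁻¹ m = proj₂ (odd-unit (Ẑ-nat (suc (2 ℕ.* m))) (≼-resp (solve 1 (λ m → :- m := :1 :- (:1 :+ m)) E.refl _)
    (≼-neg (≼-resp (E.sym (×1-homo-* 2 m)) (≼-*ʳ (≼-val v-2 ℚ.≤-refl) (0≼nat m))))))

  residue : ∀ R n → ∃[ m ] m ℕ.< 2 ℕ.^ R × ι R ≼ n · 1# - m · 1#
  residue R n = n ℕ.% 2 ℕ.^ R , ℕ.m%n<n n (2 ℕ.^ R) , ≼-resp difference (≼-*ˡ (0≼nat q) (≼-val (2^-val R) ℚ.≤-refl))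
    where
    instance _ = ℕ.m^n≢0 2 R
    q = n ℕ./ 2 ℕ.^ R
    difference : q · 1# * (2 ℕ.^ R) · 1# ≈ n · 1# - (n ℕ.% 2 ℕ.^ R) · 1#
    difference = E.trans (E.sym (×1-homo-* q (2 ℕ.^ R))) (E.trans (solve 2 (λ m p → p := (m :+ p) :- m) E.refl _ _)
      (+-congʳ (E.trans (E.sym (×-homo-+ 1# (n ℕ.% 2 ℕ.^ R) _)) (E.reflexive (cong (_· 1#) (≡.sym (ℕ.m≡m%n+[m/n]*n n (2 ℕ.^ R))))))))

  maximum : ∀ k (f : ℕ → Carrier) → ∃[ m ] ∀ i → i ℕ.< k → v (f i) ≤⁺ v (f m)
  maximum zero    f = 0 , λ _ ()
  maximum (suc k) f with maximum k f
  ... | m , h with NonStrict.≤⁺-total ℚ._≤_ ℚ.≤-total (v (f k)) (v (f m))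
  ...   | inj₁ k≤m = m , λ i i<1+k → aux i (ℕ.m<1+n⇒m<n∨m≡n i<1+k)
    where
    aux : ∀ i → i ℕ.< k ⊎ i ≡ k → v (f i) ≤⁺ v (f m)
    aux i (inj₁ i<k)  = h i i<k
    aux i (inj₂ refl) = k≤m
  ...   | inj₂ m≤k = k , λ i i<1+k → aux i (ℕ.m<1+n⇒m<n∨m≡n i<1+k)
    where
    aux : ∀ i → i ℕ.< k ⊎ i ≡ k → v (f i) ≤⁺ v (f k)
    aux i (inj₁ i<k)  = NonStrict.≤⁺-trans ℚ._≤_ ℚ.≤-trans (h i i<k) m≤k
    aux i (inj₂ refl) = NonStrict.≤⁺-reflexive-≡ ℚ._≤_ ℚ.≤-reflexive refl

  bounded-or : ∀ q x → v x ≤⁺ [ q ] ⊎ q ≺ x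
  bounded-or q x with q ≺? x
  ... | yes h = inj₂ h
  ... | no h with finite {x} (λ z → h (≺-0 z))
  ...   | p , e = inj₁ (≡.subst (_≤⁺ [ q ]) (≡.sym e) NonStrict.[ ≮⇒≥ (λ q<p → h (≺-val e q<p)) ])

  bounded-⊀ : ∀ {q x} → v x ≤⁺ [ q ] → ¬ q ≺ x
  bounded-⊀ {q} {x} h k with v x in e
  bounded-⊀ {q} {x} NonStrict.[ p≤q ] k | [ p ] = <⇒≱ (val-≺ e (≡.subst ([ q ] <⁺_) (≡.sym e) k)) p≤q

  approximate : ∀ x R → ∃[ m ] (ι R ≼ x - m · 1#
                  ⊎ (∃[ q ] v (x - m · 1#) ≡ [ q ] × q ℚ.< ι R × (∀ n → ∈ℤ₂ n → v (x - n) ≤⁺ [ q ])))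
  approximate x R with maximum (2 ℕ.^ R) (λ m → x - m · 1#)
  ... | m , max with ι R ≼? (x - m · 1#)
  ...   | yes h = m , inj₁ h
  ...   | no h with finite {x - m · 1#} (λ z → h (≼-0 z))
  ...     | q , e = m , inj₂ (q , e , q<R , optimal)
    where
    q<R : q ℚ.< ι R
    q<R = ℚ.≰⇒> λ R≤q → h (≼-val e R≤q)
    optimal : ∀ n → ∈ℤ₂ n → v (x - n) ≤⁺ [ q ]
    optimal n hn = Sum.[ id , (λ k → contradiction (x-m′ k) (bounded-⊀ (≡.subst (v (x - m′ · 1#) ≤⁺_) e (max m′ (proj₁ (proj₂ reduced)))))) ]′ (bounded-or q (x - n))
      where
      approximant : ∃[ k ] ι R ≼ n - k · 1#
      approximant = ∈ℤ₂⇒Ẑ hn R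
      n′ = proj₁ approximant
      reduced : ∃[ k ] k ℕ.< 2 ℕ.^ R × ι R ≼ n′ · 1# - k · 1#
      reduced = residue R n′
      m′ = proj₁ reduced
      x-m′ : q ≺ x - n → q ≺ x - m′ · 1#
      x-m′ k = ≺-resp (solve 4 (λ x n n′ m → (x :- n) :+ ((n :- n′) :+ (n′ :- m)) := x :- m) E.refl x n (n′ · 1#) (m′ · 1#))
        (≺-+ k (≼⇒≺ q<R (≼-+ (proj₂ approximant) (proj₂ (proj₂ reduced)))))

  β-finite : ∀ {x b} → Isβ x [ b ] → ∃[ m ] v (x - m · 1#) ≡ [ b ]
  β-finite {x} {b} (upper , least) with ≤ι b
  ... | R , b≤R with approximate x (suc R)
  ...   | m , inj₁ h = contradiction (≼⇒≺ (ℚ.≤-<-trans b≤R (ι-mono-< ℕ.≤-refl)) h) (bounded-⊀ (upper (m · 1#) (Ẑ⇒∈ℤ₂ (Ẑ-nat m))))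
  ...   | m , inj₂ (q , e , q<R , optimal) with least [ q ] optimal | ≡.subst (_≤⁺ [ b ]) e (upper (m · 1#) (Ẑ⇒∈ℤ₂ (Ẑ-nat m)))
  ...     | NonStrict.[ b≤q ] | NonStrict.[ q≤b ] = m , ≡.trans e (cong [_] (ℚ.≤-antisym q≤b b≤q))

  β-infinite : ∀ {x} → Isβ x ⊤⁺ → Ẑ x
  β-infinite {x} (upper , least) R with approximate x R
  ... | m , inj₁ h = m , h
  ... | m , inj₂ (q , _ , _ , optimal) with least [ q ] optimal
  ...   | ()

  -- Dividing by 3 shows that 3m + 3(x - m) is as badly approximable as x.
  β-weights : ∀ {x b m} → Isβ x [ b ] → v (x - m · 1#) ≡ [ b ] → ∀ k → v (3 · 1# * (x - m · 1#) - k · 1#) ≡ [ weights b k ]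
  β-weights {x} {b} {m} (upper , _) e = go
    where
    v-3 : v (3 · 1#) ≡ [ 0ℚ ]
    v-3 = v-odd 1
    ε = 3 · 1# * (x - m · 1#)
    vε : v ε ≡ [ b ]
    vε = ≡.trans (v-*-val v-3 e) (cong [_] (ℚ.+-identityˡ b))
    ⅓ = (3 · 1#) ⁻¹
    3*⅓ : 3 · 1# * ⅓ ≈ 1#
    3*⅓ = ⁻¹-inv _ (nonzero v-3)
    bounded : ∀ k → ¬ b ≺ ε - k · 1#
    bounded k h = bounded-⊀ (upper n (Ẑ⇒∈ℤ₂ (Ẑ-+ (Ẑ-nat m) (Ẑ-* (Ẑ-nat k) (Ẑ-odd⁻¹ 1))))) b≺
      where
      n = m · 1# + k · 1# * ⅓
      b≺ : b ≺ x - n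
      b≺ = ≺-resp (E.trans (solve 5 (λ t y m i k → (t :* (y :- m) :- k) :* i := (t :* i) :* (y :- m) :- k :* i) E.refl (3 · 1#) x (m · 1#) ⅓ (k · 1#))
          (E.trans (+-congʳ (E.trans (*-congʳ 3*⅓) (*-identityˡ _))) (solve 3 (λ x m j → x :- m :- j := x :- (m :+ j)) E.refl x (m · 1#) _)))
        (≺-*ʳ h (≼-val (v-⁻¹ v-3) (ℚ.≤-reflexive refl)))
    exactly : ∀ {y} → b ≼ y → ¬ b ≺ y → v y ≡ [ b ]
    exactly {y} h k = ≡.trans (proj₂ value-y) (cong [_] (ℚ.≤-antisym (≮⇒≥ λ b<q → k (≺-val (proj₂ value-y) b<q)) (val-≼ (proj₂ value-y) h)))
      where
      value-y : ∃[ q ] v y ≡ [ q ]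
      value-y = finite λ z → k (≺-0 z)
    go : ∀ k → v (ε - k · 1#) ≡ [ weights b k ]
    go zero    = ≡.trans (v-cong (solve 1 (λ e → e :- # 0 := e) E.refl ε)) vε
    go (suc k) = decide (o k ℚ.<? b)
      (λ o<b → ≡.trans (v-cong (solve 2 (λ e k → e :- k := (:- k) :+ e) E.refl ε (suc k · 1#)))
        (≡.trans (v-dominant (≡.trans (v-neg _) (v-o k)) (≺-val vε o<b)) (cong [_] (≡.sym (ℚ.p≤q⇒p⊓q≡p (ℚ.<⇒≤ o<b))))))
      (λ o≮b → ≡.trans (exactly (≼-- (≼-val vε ℚ.≤-refl) (≼-val (v-o k) (≮⇒≥ o≮b))) (bounded (suc k))) (cong [_] (≡.sym (ℚ.p≥q⇒p⊓q≡q (≮⇒≥ o≮b)))))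


  floor-bounds : ∀ {p} → 0ℚ ℚ.≤ p → ι ℤ.∣ floor p ∣ ℚ.≤ p × p ℚ.≤ ι (suc ℤ.∣ floor p ∣)
  floor-bounds {p@(ℚ.mkℚ n d _)} 0≤p = ≡.subst (ℚ._≤ p) (≡.sym (ι≡fromNat k)) (ℚ.toℚᵘ-cancel-≤ (ℚᵘ.≤-respˡ-≃ (ℚᵘ.≃-sym (ℚ.toℚᵘ-fromℚᵘ (ℤ.+ k ℚᵘ./ 1))) (ℚᵘ.*≤* below)))
      , ≡.subst (p ℚ.≤_) (≡.sym (ι≡fromNat (suc k))) (ℚ.toℚᵘ-cancel-≤ (ℚᵘ.≤-respʳ-≃ (ℚᵘ.≃-sym (ℚ.toℚᵘ-fromℚᵘ (ℤ.+ suc k ℚᵘ./ 1))) (ℚᵘ.*≤* above)))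
    where
    k = ℤ.∣ floor p ∣
    D = ℤ.+ suc d
    0≤n : ℤ.0ℤ ℤ.≤ n
    0≤n = ≡.subst (ℤ.0ℤ ℤ.≤_) (ℤ.*-identityʳ n) (ℚ.drop-*≤* 0≤p)
    k≡ : ℤ.+ k ≡ n ℤ./ D
    k≡ = ℤ.0≤i⇒+∣i∣≡i (ℤ.0≤n⇒0≤n/d n D 0≤n (ℤ.+≤+ z≤n))
    below : ℤ.+ k ℤ.* D ℤ.≤ n ℤ.* ℤ.1ℤ
    below = ℤ.≤-trans (ℤ.≤-reflexive (cong (ℤ._* D) k≡)) (ℤ.≤-trans (ℤ.[n/d]*d≤n n D) (ℤ.≤-reflexive (≡.sym (ℤ.*-identityʳ n))))
    above : n ℤ.* ℤ.1ℤ ℤ.≤ ℤ.+ suc k ℤ.* D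
    above = ℤ.≤-trans (ℤ.≤-reflexive (ℤ.*-identityʳ n)) (ℤ.<⇒≤ (≡.subst (λ z → n ℤ.< z ℤ.* D) (≡.trans (cong ℤ.suc (≡.sym (≡.trans k≡ (ℤ.div-pos-is-/ℕ n (suc d))))) refl) (ℤ.n<s[n/ℕd]*d n (suc d))))

  Σ½^≡ : ∀ n → Σ½^ n ≡ 1ℚ ℚ.- ½^ n
  Σ½^≡ zero    = ≡.sym (ℚ.+-inverseʳ 1ℚ)
  Σ½^≡ (suc n) = ≡.trans (cong (ℚ._+ ½ ℚ.* ½^ n) (≡.trans (Σ½^≡ n) (cong (λ x → 1ℚ ℚ.- x) (≡.sym (½+½ (½^ n))))))
    (solveℚ 2 (λ i p → i :- (p :+ p) :+ p := i :- p) same 1ℚ (½ ℚ.* ½^ n))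

  radius≡ : ∀ n β → radius n β ≡ ½^ n ℚ.* (1ℚ ℚ.+ ι n ℚ.- β)
  radius≡ zero    β = ≡.trans (solveℚ 1 (λ b → :1 :- b := :1 :* (:1 :+ # 0 :- b)) same β) (cong (λ z → 1ℚ ℚ.* (1ℚ ℚ.+ z ℚ.- β)) (≡.sym ι-0))
  radius≡ (suc n) β = ≡.trans (cong (½ ℚ.*_) (radius≡ n (β ℚ.- 1ℚ))) (≡.trans
    (solveℚ 4 (λ h p n b → h :* (p :* (:1 :+ n :- (b :- :1))) := h :* p :* (:1 :+ (:1 :+ n) :- b)) same ½ (½^ n) (ι n) β)
    (cong (λ z → ½ ℚ.* ½^ n ℚ.* (1ℚ ℚ.+ z ℚ.- β)) (≡.sym (ι-suc n))))

  1-ν : ∀ b → ∃[ n ] InPiece n b × 1ℚ ℚ.- ν [ b ] ≡ radius n b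
  1-ν b with b ℚ.≤ᵇ 0ℚ in e
  ... | true  = 0 , ℚ.≤ᵇ⇒≤ (≡.subst Bool.T (≡.sym e) tt) , refl
  ... | false = suc k , floor-bounds (ℚ.<⇒≤ (ℚ.≰⇒> λ h → ≡.subst Bool.T e (ℚ.≤⇒≤ᵇ h))) , formula
    where
    k = ℤ.∣ floor b ∣
    formula : 1ℚ ℚ.- (Σ½^ k ℚ.+ (b ℚ.- fromNat k) ℚ.* ½^ (suc k)) ≡ radius (suc k) b
    formula = ≡.trans (≡.cong₂ (λ x y → 1ℚ ℚ.- (x ℚ.+ (b ℚ.- y) ℚ.* ½^ (suc k))) (Σ½^≡ k) (≡.sym (ι≡fromNat k))) (≡.trans
      (solveℚ 4 (λ p h b k → :1 :- ((:1 :- p) :+ (b :- k) :* (h :* p)) := p :- (b :- k) :* (h :* p)) same (½^ k) ½ b (ι k)) (≡.trans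
      (cong (λ z → z ℚ.- (b ℚ.- ι k) ℚ.* (½ ℚ.* ½^ k)) (≡.sym (½+½ (½^ k)))) (≡.trans
      (solveℚ 4 (λ p h b k → (h :* p :+ h :* p) :- (b :- k) :* (h :* p) := h :* p :* (:1 :+ (:1 :+ k) :- b)) same (½^ k) ½ b (ι k)) (≡.trans
      (cong (λ z → ½ ℚ.* ½^ k ℚ.* (1ℚ ℚ.+ z ℚ.- b)) (≡.sym (ι-suc k))) (≡.sym (radius≡ (suc k) b))))))

  v-1/16 : v S.1/16 ≡ [ ℚ.- ι 4 ]
  v-1/16 = v-⁻¹ (2^-val 4)

  rescale-decays : ∀ {ν a} → Rigid ((fromNat 3 ℚ.+ ν) ℚ.* (ℤ.+ 1 ℚ./ 12)) a → Decays (1ℚ ℚ.- ν) (rescale a)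
  rescale-decays {ν} {a} rigid N with rigid N
  ... | m , h = m , λ n m≤n → ≡.subst (_≼ rescale a n) (eq n) (≼-* (h n m≤n) (≼-val (v-^ v-1/16 n) ℚ.≤-refl))
    where
    open ≡.≡-Reasoning
    12*r : fromNat 12 ℚ.* ((fromNat 3 ℚ.+ ν) ℚ.* (ℤ.+ 1 ℚ./ 12)) ≡ ι 3 ℚ.+ ν
    12*r = ≡.trans (solveℚ 3 (λ a b c → a :* (b :* c) := (a :* c) :* b) same (fromNat 12) (fromNat 3 ℚ.+ ν) (ℤ.+ 1 ℚ./ 12))
      (≡.trans (ℚ.*-identityˡ _) (cong (ℚ._+ ν) (≡.sym (ι≡fromNat 3))))
    eq : ∀ n → (N ℚ.+ fromNat 12 ℚ.* ((fromNat 3 ℚ.+ ν) ℚ.* (ℤ.+ 1 ℚ./ 12)) ℚ.* fromNat n) ℚ.+ ι n ℚ.* (ℚ.- ι 4) ≡ N ℚ.- (1ℚ ℚ.- ν) ℚ.* ι n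
    eq n = ≡.trans (≡.cong₂ (λ x y → (N ℚ.+ x ℚ.* fromNat n) ℚ.+ ι n ℚ.* (ℚ.- y)) 12*r (ι-suc 3)) (≡.trans
      (cong (λ x → (N ℚ.+ (ι 3 ℚ.+ ν) ℚ.* x) ℚ.+ ι n ℚ.* (ℚ.- (1ℚ ℚ.+ ι 3))) (≡.sym (ι≡fromNat n)))
      (solveℚ 4 (λ N t v n → (N :+ (t :+ v) :* n) :+ n :* (:- (:1 :+ t)) := N :- (:1 :- v) :* n) same N (ι 3) ν (ι n)))

  infinite-case′ : ∀ {z φ} → Ẑ z → 1ℚ ≼ z → Decays 0ℚ φ → φ 0 ≈ 0# → ¬ φ 1 ≈ 0# →
                   S.subst φ (S.t S.w₊) S.* S.pow z S.≈ S.- S.subst φ (S.t S.w₋) → ⊥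
  infinite-case′ {z} {φ} hz z-even φ-decays φ0 φ1 eq = by-minimum (minimum {0ℚ} {φ} φ-decays 1 φ1)
    where
    by-minimum : Minimum 0ℚ φ → ⊥
    by-minimum record { index = N ; weight = w ; attains = attains ; minimal = minimal } with φ-decays (w ℚ.+ 2ℚ)
    ... | M , tail-bound = infinite-case {z} {ψ} M hz z-even ψ-integral ψ0 ψ-tail N ψN ψ-eq
      where
      vφ : v (φ N) ≡ [ w ]
      vφ = ≡.trans attains (cong [_] (solveℚ 2 (λ w n → w :- # 0 :* n := w) same w (ι N)))
      x = φ N ⁻¹
      vx : v x ≡ [ ℚ.- w ]
      vx = v-⁻¹ vφ
      ψ : ℕ → Carrier
      ψ k = x * φ k
      ψ-integral : ∀ k → 0ℚ ≼ ψ k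
      ψ-integral k = ≡.subst (_≼ ψ k) (solveℚ 2 (λ w n → (:- w) :+ (w :- # 0 :* n) := # 0) same w (ι k)) (≼-* (≼-val vx ℚ.≤-refl) (minimal k))
      ψ0 : ψ 0 ≈ 0#
      ψ0 = E.trans (*-congˡ φ0) (zeroʳ x)
      ψ-tail : ∀ k → M ℕ.≤ k → 1ℚ ≺ ψ k
      ψ-tail k M≤k = ≼⇒≺ (<-by 1ℚ 0<1 refl) (≡.subst (_≼ ψ k) (solveℚ 3 (λ w t n → (:- w) :+ ((w :+ t) :- # 0 :* n) := t) same w 2ℚ (ι k))
        (≼-* (≼-val vx ℚ.≤-refl) (tail-bound k M≤k)))
      ψN : v (ψ N) ≡ [ 0ℚ ]
      ψN = ≡.trans (v-cong (⁻¹-invˡ (φ N) (nonzero vφ))) v-1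
      scale : ∀ u → S.subst ψ u S.≈ S.const x S.* S.subst φ u
      scale u = S.⟪ (λ n → E.trans (S.coeff-subst ψ u n) (E.trans (∑-cong′ (suc n) λ k → *-assoc x (φ k) _) (E.trans (E.sym (*-distribˡ-∑ (suc n) _))
        (E.trans (*-congˡ (E.sym (S.coeff-subst φ u n))) (E.sym (S.coeff-const-* x _ n)))))) ⟫
      ψ-eq : S.subst ψ (S.t S.w₊) S.* S.pow z S.≈ S.- S.subst ψ (S.t S.w₋)
      ψ-eq = S.trans (S.*-congʳ (scale t₊)) (S.trans (S.*-assoc (S.const x) (S.subst φ t₊) (S.pow z)) (S.trans (S.*-congˡ eq)
        (S.trans (S.solve 2 (λ x a → x :* (:- a) := :- (x :* a)) S.refl (S.const x) (S.subst φ t₋)) (S.-‿cong (S.sym (scale t₋))))))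
        where
        t₊ = S.t S.w₊
        t₋ = S.t S.w₋

  no-extension : ∀ {s β a} G → Isβ (2 · s) β → ¬ ∈ℤ₂ˣ (2 · s) → Rigid ((fromNat 3 ℚ.+ ν β) ℚ.* (ℤ.+ 1 ℚ./ 12)) a →
                 G 0 ≈ 0# → G 1 ≈ 1# → S.flip G S.≈ S.- G → h^ s S.* G S.≈ S.subst a j⁻¹ → ⊥
  no-extension {s} {β} {a} G isβ not-unit rigid G0 G1 G-odd F≈ = cases β isβ (rescale-decays {ν β} {a} rigid)
    where
    φ = rescale a
    F = h^ s S.* G
    h^-0 : h^ s 0 ≈ 1#
    h^-0 = E.trans (S.at (S.h^≈ s) 0) (S.power-0 _ {S.h} S.h-0)
    a0 : a 0 ≈ 0#
    a0 = E.trans (E.sym (E.trans (S.coeff-subst a j⁻¹ 0) (E.trans ∑-cons (E.trans (+-congˡ ∑-nil) (E.trans (+-identityʳ _) (E.trans (*-congˡ S.coeff-1-0) (*-identityʳ _)))))))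
      (E.trans (E.sym (S.at F≈ 0)) (E.trans (S.coeff-*-0 _ _) (E.trans (*-congˡ G0) (zeroʳ _))))
    a1 : ¬ a 1 ≈ 0#
    a1 h = 1≉0 (E.trans (E.sym F1) (E.trans (S.at F≈ 1) (E.trans (S.coeff-subst a j⁻¹ 1) (∑-zero 2 λ { zero _ → E.trans (*-congʳ a0) (zeroˡ _) ; (suc zero) _ → E.trans (*-congʳ h) (zeroˡ _) ; (suc (suc _)) (s≤s (s≤s ())) }))))
      where
      F1 : F 1 ≈ 1#
      F1 = E.trans (S.coeff-*-leading (h^ s) G 1 (S.mod-1 G0)) (E.trans (*-cong h^-0 G1) (*-identityˡ 1#))
    φ0 : φ 0 ≈ 0#
    φ0 = E.trans (*-congʳ a0) (zeroˡ _)
    φ1 : ¬ φ 1 ≈ 0#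
    φ1 h = a1 (cancel-0 (nonzero (v-^ v-1/16 1)) (E.trans (*-comm _ _) h))
    z = 6 · s
    eq : S.subst φ (S.t S.w₊) S.* S.pow z S.≈ S.- S.subst φ (S.t S.w₋)
    eq = S.trans (S.*-congʳ (S.sym (subst-rescale a (S.t S.w₊)))) (S.trans (S.core-equation s a G G-odd F≈) (S.-‿cong (subst-rescale a (S.t S.w₋))))
    z≈ : z ≈ 3 · 1# * 2 · s
    z≈ = solve 1 (λ s → 6 :× s := (3 :× :1) :* (2 :× s)) E.refl s
    infinite-β : Ẑ (2 · s) → Decays 0ℚ φ → ⊥
    infinite-β Ẑ-2s φ-decays = infinite-case′ {z} {φ} (Ẑ-resp (E.sym z≈) (Ẑ-* (Ẑ-nat 3) Ẑ-2s)) (≼-resp (E.sym z≈) (≼-*ˡ (0≼nat 3) 2s-even)) φ-decays φ0 φ1 eq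
      where
      2s-even : 1ℚ ≼ 2 · s
      2s-even with even-or-unit Ẑ-2s
      ... | inj₁ h = h
      ... | inj₂ h = contradiction h not-unit
    finite-β : ∀ {b n m} → Isβ (2 · s) [ b ] → InPiece n b → v (2 · s - m · 1#) ≡ [ b ] → Decays (radius n b) φ → ⊥
    finite-β {b} {n} {m} isβ piece e φ-decays =
        finite-case {z} {3 · 1# * (2 · s - m · 1#)} {3 ℕ.* m} {n} {b} {φ} decomposition piece (β-weights {2 · s} {b} {m} isβ e) φ-decays φ0 φ1 eq
      where
      decomposition : z ≈ (3 ℕ.* m) · 1# + 3 · 1# * (2 · s - m · 1#)
      decomposition = E.trans z≈ (E.trans (solve 3 (λ t x m → t :* x := t :* m :+ t :* (x :- m)) E.refl (3 · 1#) (2 · s) (m · 1#)) (+-congʳ (E.sym (×1-homo-* 3 m))))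
    cases : ∀ β → Isβ (2 · s) β → Decays (1ℚ ℚ.- ν β) φ → ⊥
    cases ⊤⁺    isβ φ-decays = infinite-β (β-infinite {2 · s} isβ) (≡.subst (λ δ → Decays δ φ) (ℚ.+-inverseʳ 1ℚ) φ-decays)
    cases [ b ] isβ φ-decays = finite-β {b} {proj₁ (1-ν b)} {proj₁ (β-finite {2 · s} isβ)} isβ (proj₁ (proj₂ (1-ν b))) (proj₂ (β-finite {2 · s} isβ))
      (≡.subst (λ δ → Decays δ φ) (proj₂ (proj₂ (1-ν b))) φ-decays)

  -- The weight parameter is determined by the character

  ∑-limit : ∀ {f x} → HasSum f x → ∀ (N : ℚ) → ∃[ m ] ∀ n → m ℕ.≤ n → N ≼ ∑ n f - x
  ∑-limit {f} h N with h N
  ... | m , k = m , λ n m≤n → ≼-resp (+-congʳ (E.reflexive (sum≡∑ n f))) (k n m≤n)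

  sum-unique : ∀ {f x y} → HasSum f x → HasSum f y → x ≈ y
  sum-unique {f} {x} {y} hx hy with (x - y) ≈0?
  ... | yes e = E.trans (solve 2 (λ x y → x := (x :- y) :+ y) E.refl x y) (E.trans (+-congʳ e) (+-identityˡ y))
  ... | no ne with finite ne
  ...   | q , e with ∑-limit {f} hx (q ℚ.+ 1ℚ) | ∑-limit {f} hy (q ℚ.+ 1ℚ)
  ...     | m , a | k , b = contradiction (val-≺ e (≼⇒≺ (<-by 1ℚ 0<1 refl) (≼-resp (solve 3 (λ s x y → (s :- y) :- (s :- x) := x :- y) E.refl (∑ (m ℕ.⊔ k) f) x y)
            (≼-- (b _ (ℕ.m≤n⊔m m k)) (a _ (ℕ.m≤m⊔n m k)))))) (ℚ.<-irrefl refl)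

  -- n - v(n!) is the sum of the binary digits of n.
  v-!-≤ : ∀ n → ∃[ q ] v ((suc n !) · 1#) ≡ [ q ] × q ℚ.≤ ι n
  v-!-≤ n = _ , v-!-digits (suc n) , ≤-by (digits (suc n) ℚ.- 1ℚ) (0≤- 1≤digits)
      (≡.trans (cong (λ x → x ℚ.- digits (suc n) ℚ.+ (digits (suc n) ℚ.- 1ℚ)) (ι-suc n)) (solveℚ 2 (λ n d → :1 :+ n :- d :+ (d :- :1) := n) same (ι n) (digits (suc n))))
    where
    digits : ℕ → ℚ
    digits = partial (weights 0ℚ) 1ℚ
    lacunary : LacunaryWeights digits
    lacunary = lacunary-base 0ℚ ℚ.≤-refl
    weights≡0 : ∀ k → weights 0ℚ k ≡ 0ℚ
    weights≡0 zero    = refl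
    weights≡0 (suc k) = ℚ.p≥q⇒p⊓q≡q (0≤o k)
    v-!-digits : ∀ k → v ((k !) · 1#) ≡ [ ι k ℚ.- digits k ]
    v-!-digits zero    = ≡.trans (v-cong (+-identityʳ 1#)) (≡.trans v-1 (cong [_] (≡.sym (≡.trans (cong (ℚ._- 0ℚ) ι-0) (ℚ.+-inverseʳ 0ℚ)))))
    v-!-digits (suc k) = ≡.trans (v-cong (×1-homo-* (suc k) (k !))) (≡.trans (v-*-val (v-o k) (v-!-digits k)) (cong [_] (≡.sym
      (≡.trans (≡.cong₂ (λ x y → x ℚ.- (digits k ℚ.+ (y ℚ.- o k) ℚ.+ 1ℚ)) (ι-suc k) (weights≡0 k))
        (solveℚ 3 (λ n d o → :1 :+ n :- (d :+ (# 0 :- o) :+ :1) := o :+ (n :- d)) same (ι k) (digits k) (o k))))))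
    1≤digits : 1ℚ ℚ.≤ digits (suc n)
    1≤digits with proj₂ (proj₂ (proj₂ lacunary)) (suc n) (s≤s z≤n)
    ... | inj₂ h = ℚ.<⇒≤ h
    ... | inj₁ (a , e) = ℚ.≤-reflexive (≡.sym (≡.trans (cong digits e) (proj₁ (proj₂ (proj₂ lacunary)) a z≤n)))

  homogeneous : Carrier → Carrier → ℕ → Carrier
  homogeneous x y zero    = 1#
  homogeneous x y (suc k) = x * homogeneous x y k + y ^ suc k

  homogeneous-difference : ∀ x y k → (x - y) * homogeneous x y k ≈ x ^ suc k - y ^ suc k
  homogeneous-difference x y zero    = solve 2 (λ x y → (x :- y) :* :1 := x :* :1 :- y :* :1) E.refl x y
  homogeneous-difference x y (suc k) = E.trans (solve 4 (λ x y h p → (x :- y) :* (x :* h :+ p) := x :* ((x :- y) :* h) :+ (x :- y) :* p) E.refl x y _ _)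
    (E.trans (+-congʳ (*-congˡ (homogeneous-difference x y k))) (solve 4 (λ x y p q → x :* (p :- q) :+ (x :- y) :* q := x :* p :- y :* q) E.refl x y (x ^ suc k) (y ^ suc k)))

  ι≼^ : ∀ {x} → 1ℚ ≺ x → ∀ k → ι k ≼ x ^ k
  ι≼^ h zero    = ≼-val v-1 (ℚ.≤-reflexive ι-0)
  ι≼^ {x} h (suc k) = ≡.subst (_≼ x ^ suc k) (≡.sym (ι-suc k)) (≼-* (≺⇒≼ h) (ι≼^ h k))

  homogeneous-≺ : ∀ {x y} → 1ℚ ≺ x → 1ℚ ≺ y → ∀ k → ι (suc k) ≺ homogeneous x y (suc k)
  homogeneous-≺ {x} {y} hx hy k = ≡.subst (_≺ homogeneous x y (suc k)) (≡.sym (ι-suc k)) (≺-+ (≺-* hx (bound k)) (≺-* hy (ι≼^ hy k)))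
    where
    bound : ∀ k → ι k ≼ homogeneous x y k
    bound zero    = ≼-val v-1 (ℚ.≤-reflexive ι-0)
    bound (suc k) = ≺⇒≼ (homogeneous-≺ hx hy k)

  exp-term : Carrier → ℕ → Carrier
  exp-term x n = x ^ n * ((n !) · 1#) ⁻¹

  exp-isometry : ∀ {x y q} → 1ℚ ≺ x → 1ℚ ≺ y → v (x - y) ≡ [ q ] → ∀ n → v (∑ (2 ℕ.+ n) (exp-term x) - ∑ (2 ℕ.+ n) (exp-term y)) ≡ [ q ]
  exp-isometry {x} {y} {q} hx hy e n = ≡.trans (v-cong difference) (≡.trans (v-*-val e (v-dominant v-1 small)) (cong [_] (ℚ.+-identityʳ q)))
    where
    i : ℕ → Carrier
    i k = ((k !) · 1#) ⁻¹
    i0 : i 0 ≈ 1#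
    i0 = E.trans (E.sym (*-identityˡ _)) (E.trans (*-congʳ (E.sym (+-identityʳ 1#))) (⁻¹-inv _ (nonzero (≡.trans (v-cong (+-identityʳ 1#)) v-1))))
    i1 : i 1 ≈ 1#
    i1 = i0
    quotient : ℕ → Carrier
    quotient k = homogeneous x y (suc k) * i (2 ℕ.+ k)
    small : 0ℚ ≺ ∑ n quotient
    small = ≺-∑ n λ k _ → term k
      where
      term : ∀ k → 0ℚ ≺ quotient k
      term k with v-!-≤ (suc k)
      ... | p , vp , p≤ = ≺-weaken (≤-by (ι (suc k) ℚ.- p) (0≤- p≤) (ℚ.+-identityˡ _)) (≺-* (homogeneous-≺ hx hy k) (≼-val (v-⁻¹ vp) ℚ.≤-refl))
    unfold : ∀ x → ∑ (2 ℕ.+ n) (exp-term x) ≈ 1# + (x + ∑ n (λ k → exp-term x (2 ℕ.+ k)))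
    unfold x = E.trans ∑-cons (+-cong (E.trans (*-identityˡ _) i0) (E.trans ∑-cons (+-congʳ (E.trans (*-congˡ i1) (E.trans (*-identityʳ _) (*-identityʳ x))))))
    difference : ∑ (2 ℕ.+ n) (exp-term x) - ∑ (2 ℕ.+ n) (exp-term y) ≈ (x - y) * (1# + ∑ n quotient)
    difference = E.trans (+-cong (unfold x) (-‿cong (unfold y))) (E.trans
      (solve 4 (λ x y s t → (:1 :+ (x :+ s)) :- (:1 :+ (y :+ t)) := (x :- y) :+ (s :- t)) E.refl x y (∑ n (λ k → exp-term x (2 ℕ.+ k))) (∑ n (λ k → exp-term y (2 ℕ.+ k))))
      (E.trans (+-congˡ (E.sym tail)) (solve 2 (λ d s → d :+ d :* s := d :* (:1 :+ s)) E.refl (x - y) (∑ n quotient))))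
      where
      tail : (x - y) * ∑ n quotient ≈ ∑ n (λ k → exp-term x (2 ℕ.+ k)) - ∑ n (λ k → exp-term y (2 ℕ.+ k))
      tail = E.trans (*-distribˡ-∑ n _) (E.trans (∑-cong′ n λ k → E.trans (E.sym (*-assoc _ _ _)) (E.trans (*-congʳ (homogeneous-difference x y (suc k)))
        (solve 3 (λ p q i → (p :- q) :* i := p :* i :+ (:- :1) :* (q :* i)) E.refl _ _ (i (2 ℕ.+ k))))) (E.trans (∑-distrib-+ n)
          (+-congˡ (E.trans (E.sym (*-distribˡ-∑ n _)) (-1*x≈-x _)))))

  exp-injective : ∀ {x y z} → 1ℚ ≺ x → 1ℚ ≺ y → IsExp x z → IsExp y z → x ≈ y
  exp-injective {x} {y} {z} hx hy ex ey with (x - y) ≈0?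
  ... | yes e = E.trans (solve 2 (λ x y → x := (x :- y) :+ y) E.refl x y) (E.trans (+-congʳ e) (+-identityˡ y))
  ... | no ne with finite ne
  ...   | q , e with ∑-limit {exp-term x} ex (q ℚ.+ 1ℚ) | ∑-limit {exp-term y} ey (q ℚ.+ 1ℚ)
  ...     | m , a | k , b = contradiction (val-≺ (exp-isometry {x} {y} hx hy e (m ℕ.⊔ k)) (≼⇒≺ (<-by 1ℚ 0<1 refl)
              (≼-resp (solve 3 (λ s t z → (s :- z) :- (t :- z) := s :- t) E.refl (∑ (2 ℕ.+ (m ℕ.⊔ k)) (exp-term x)) (∑ (2 ℕ.+ (m ℕ.⊔ k)) (exp-term y)) z)
                (≼-- (a _ (ℕ.≤-trans (ℕ.m≤m⊔n m k) (ℕ.m≤n+m _ 2))) (b _ (ℕ.≤-trans (ℕ.m≤n⊔m m k) (ℕ.m≤n+m _ 2))))))) (ℚ.<-irrefl refl)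

  v-4 : v (4 · 1#) ≡ [ ι 2 ]
  v-4 = 2^-val 2

  log-term : ℕ → Carrier
  log-term n = (- 1#) ^ n * (4 · 1#) ^ suc n * (suc n · 1#) ⁻¹

  v-log5 : ∀ {l} → IsLog1+ (4 · 1#) l → v l ≡ [ ι 2 ]
  v-log5 {l} hl with ∑-limit {log-term} hl (ι 3)
  ... | m , h = ≡.trans (v-cong (solve 2 (λ s l → l := s :+ (:- (s :- l))) E.refl (∑ (suc m) log-term) l))
      (v-dominant (≡.trans (v-cong ∑-cons) (v-dominant first (≺-∑ m λ k _ → rest k))) (≺-neg (≼⇒≺ (ι-mono-< ℕ.≤-refl) (h (suc m) (ℕ.n≤1+n m)))))
    where
    first : v (log-term 0) ≡ [ ι 2 ]
    first = ≡.trans (v-*-val (v-*-val v-1 (v-*-val v-4 v-1)) (v-⁻¹ (≡.trans (v-cong (+-identityʳ 1#)) v-1)))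
      (cong [_] (solveℚ 1 (λ t → # 0 :+ (t :+ # 0) :+ (:- # 0) := t) same (ι 2)))
    rest : ∀ k → ι 2 ≺ log-term (suc k)
    rest k with v-nat (suc (suc k)) (suc (suc k)) (s≤s z≤n) (n<2^n (suc (suc k)))
    ... | j , e , s≤s j≤1+k = ≺-weaken {ι 2} {0ℚ ℚ.+ ι (suc (suc k)) ℚ.* ι 2 ℚ.- ι j ℚ.- 1ℚ} bound
        (≼⇒≺ (<-by 1ℚ 0<1 (solveℚ 1 (λ t → t :- :1 :+ :1 := t) same _)) (≼-* (≼-* (0≼^ (suc k) (≼-neg 0≼1)) (≼-val (v-^ v-4 (suc (suc k))) ℚ.≤-refl)) (≼-val (v-⁻¹ e) ℚ.≤-refl)))
      where
      bound : ι 2 ℚ.≤ 0ℚ ℚ.+ ι (suc (suc k)) ℚ.* ι 2 ℚ.- ι j ℚ.- 1ℚ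
      bound = ≤-by (ι (suc k) ℚ.- ι j ℚ.+ ι k) (0≤+ (0≤- (ι-mono j≤1+k)) (0≤ι k)) eq
        where
        eq : ι 2 ℚ.+ (ι (suc k) ℚ.- ι j ℚ.+ ι k) ≡ 0ℚ ℚ.+ ι (suc (suc k)) ℚ.* ι 2 ℚ.- ι j ℚ.- 1ℚ
        eq rewrite ι2 | ι-suc (suc k) | ι-suc k = solveℚ 2 (λ k j → (:1 :+ :1) :+ ((:1 :+ k) :- j :+ k) := # 0 :+ (:1 :+ (:1 :+ k)) :* (:1 :+ :1) :- j :- :1) same (ι k) (ι j)

  five : ∃ ∈ℤ₂ˣ
  five = 5 · 1# , Ẑ⇒∈ℤ₂ (Ẑ-nat 5) , (5 · 1#) ⁻¹ , Ẑ⇒∈ℤ₂ (Ẑ-odd⁻¹ 2) , ⁻¹-inv _ (nonzero (v-odd 2))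

  weight-unique : ∀ {κ s s′} → [ fromInt ℤ.-[1+ 2 ] ] <⁺ v s → [ fromInt ℤ.-[1+ 2 ] ] <⁺ v s′ →
                  κ ≐⟨·⟩^ (- (12 · s)) → κ ≐⟨·⟩^ (- (12 · s′)) → s ≈ s′
  weight-unique {κ} {s} {s′} hs hs′ (_ , l , hl , he) (_ , l′ , hl′ , he′) = S.cancel-field (nonzero (v-l*12 vl))
      (E.trans (E.sym (expand s)) (E.trans (-‿cong exponents) (expand s′)))
    where
    vl = v-log5 {l} hl
    v-l*12 : ∀ {l} → v l ≡ [ ι 2 ] → v (l * (12 · 1#)) ≡ [ ι 2 ℚ.+ (1ℚ ℚ.+ (1ℚ ℚ.+ 0ℚ)) ]
    v-l*12 vl = v-*-val vl (v-even 6 (v-even 3 (v-odd 1)))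
    expand : ∀ s → - (- (12 · s) * l) ≈ l * (12 · 1#) * s
    expand s = solve 2 (λ s l → :- ((:- (12 :× s)) :* l) := l :* (12 :× :1) :* s) E.refl s l
    large : ∀ {s l} → v l ≡ [ ι 2 ] → [ fromInt ℤ.-[1+ 2 ] ] <⁺ v s → 1ℚ ≺ - (12 · s) * l
    large {s} {l} vl h = ≡.subst (_≺ - (12 · s) * l) (cong (λ x → fromInt ℤ.-[1+ 2 ] ℚ.+ (x ℚ.+ (1ℚ ℚ.+ (1ℚ ℚ.+ 0ℚ)))) (ι≡fromNat 2))
      (≺-resp (solve 2 (λ s l → :- (s :* (l :* (12 :× :1))) := (:- (12 :× s)) :* l) E.refl s l) (≺-neg (≺-* h (≼-val (v-l*12 vl) ℚ.≤-refl))))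
    exponents : - (12 · s) * l ≈ - (12 · s′) * l
    exponents = E.trans (exp-injective (large vl hs) (large (v-log5 {l′} hl′) hs′) (he five E.refl) (he′ five E.refl))
      (*-congˡ (sum-unique {log-term} hl′ hl))

  M⇒M₀ : ∀ {s κ r G} → [ fromInt -[1+ 1 ] ] <⁺ v s → κ ≐⟨·⟩^ (- (12 · s)) → M κ r G → M₀ r (h^ s *ˢ G)
  M⇒M₀ {s} {κ} {r} {G} s-bound κ≐s (t , (t-bound , κ≐t) , a , rigid , F≋) = a , rigid , S.at (S.trans (S.*ˢ≈* (h^ s) G) (S.trans (S.*-congʳ (h^-cong s≈t))
      (S.trans (S.*-comm (h^ t) G) (S.trans (S.sym (S.*ˢ≈* G (h^ t))) S.⟪ F≋ ⟫))))
    where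
    h^-cong : ∀ {s t} → s ≈ t → h^ s S.≈ h^ t
    h^-cong {s} {t} e = S.trans (S.h^≈ s) (S.trans (S.subst-cong (S.minus-1-0 {S.h} S.h-0) (S.pow-cong (×-congʳ 8 e))) (S.sym (S.h^≈ t)))
    s≈t : s ≈ t
    s≈t = weight-unique {κ} {s} {t} (≺-weaken (ℚ.≤ᵇ⇒≤ tt) s-bound) t-bound κ≐s κ≐t

  ∉M₀ : ∀ {s β G} → Isβ (2 · s) β → ¬ ∈ℤ₂ˣ (2 · s) → G 0 ≈ 0# → G 1 ≈ 1# → (∀ n → G (2 ℕ.* n) ≈ 0#) →
        ¬ M₀ ((fromNat 3 ℚ.+ ν β) ℚ.* (ℤ.+ 1 ℚ./ 12)) (h^ s *ˢ G)
  ∉M₀ {s} {β} {G} isβ not-unit G0 G1 UG≈0 (a , rigid , F≋) = no-extension {s} {β} {a} G isβ not-unit rigid G0 G1 (S.flip-odd G UG≈0)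
    (S.trans (S.sym (S.*ˢ≈* (h^ s) G)) (S.trans S.⟪ F≋ ⟫ (S.substitute≈subst a j⁻¹)))

theorem5p3 :
    ∀ {c ℓ} (C : ℂ₂ c ℓ) → let open OverconvergentForms C in
    (s : Carrier) → [ fromInt -[1+ 1 ] ] <⁺ v s → ¬ ∈ℤ₂ˣ (2 · s) →
    (κ : Character) → κ ≐⟨·⟩^ (- (12 · s)) →
    (β : ℚ∞) → Isβ (2 · s) β →
    let r = (fromNat 3 ℚ.+ ν β) ℚ.* (ℤ.+ 1 ℚ./ 12) in
    (G : Series) → G 0 ≈ 0# → G 1 ≈ 1# →
    (ρ : ℚ) → 𝒳 κ ρ → M κ ρ G →
    U G ≋ 0ˢ →
    let F = h^ s *ˢ G in
    M₀ ρ F × ¬ M₀ r F × ¬ M κ r G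
theorem5p3 C s s-bound not-unit κ κ≐ β isβ G G0 G1 ρ _ G∈M UG≈0 =
  M⇒M₀ C {s} {κ} {ρ} {G} s-bound κ≐ G∈M , G∉ , λ h → G∉ (M⇒M₀ C {s} {κ} {(fromNat 3 ℚ.+ ν β) ℚ.* (ℤ.+ 1 ℚ./ 12)} {G} s-bound κ≐ h)
  where
  open Overconvergence using (M⇒M₀; ∉M₀)
  G∉ = ∉M₀ C {s} {β} {G} isβ not-unit G0 G1 UG≈0
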